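{- Let $\mathcal{C}$ be a class of polytime computable functions from $\mathbb{R}^2$ to $\mathbb{R}$ that approximates the class of polytime computable integer functions. Let $f:\mathbb{R}\to\mathbb{R}$ be Lipschitz. Then $f$ is polytime computable if and only if $f$ is $\mathcal{C}$-definable.
   Context: Dyadic numbers: $\mathbb{D}=\{a/2^b : a\in\mathbb{Z}, b\in\mathbb{N}\}$. For $x\in\mathbb{R}$, $CF_x$ is the set of functions $\varphi:\mathbb{N}\to\mathbb{D}$ with $|x-\varphi(n)|\le 2^{ -n}$ for all $n\in\mathbb{N}$. A function $f:\mathbb{R}^d\to\mathbb{R}$ is computable if there is an oracle Turing machine $M$ (with $d$ oracles) such that for all $(x_1,\dots,x_d)\in\mathbb{R}^d$, all $\varphi_i\in CF_{x_i}$ and all $n\in\mathbb{N}$, $|M^{\varphi_1,\dots,\varphi_d}(n)-f(x_1,\dots,x_d)|\le 2^{ -n}$. It is polytime computable if moreover there is a polynomial $p$ such that the running time of $M^{\varphi_1,\dots,\varphi_d}(n)$ is at most $p(k,n)$, where $k=\min\{j\in\mathbb{N} : x_1,\dots,x_d\in[-2^j,2^j]\}$. An integer function $h:\mathbb{Z}^2\to\mathbb{Z}$ is polytime computable if it is computable by a Turing machine in time polynomial in the lengths of the binary representations of its arguments. $f$ is Lipschitz if there is a constant $K\ge 0$ with $|f(x_1)-f(x_2)|\le K|x_1-x_2|$ for all $x_1,x_2\in\mathbb{R}$. A class $\mathcal{C}$ of functions $\mathbb{R}^2\to\mathbb{R}$ approximates a class $\mathcal{D}$ of functions $\mathbb{Z}^2\to\mathbb{Z}$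 if for every $g\in\mathcal{D}$ there is $\tilde g\in\mathcal{C}$ with $|\tilde g(x,y)-g(x,y)|\le 1/4$ for all $x,y\in\mathbb{Z}$. Here $\mathcal{D}$ is the class of polytime computable functions $\mathbb{Z}^2\to\mathbb{Z}$. $f:\mathbb{R}\to\mathbb{R}$ is $\mathcal{C}$-definable if there is $\tilde g\in\mathcal{C}$ such that $|\tilde g(x,y)-y f(x/y)|\le 3$ for all $x\in\mathbb{Z}$ and all integers $y\ge 1$. -}

module Defs where

open import Data.Fin using (Fin; zero; suc)
open import Data.Integer using (ℤ; +_; -[1+_]; 1ℤ)
import Data.Integer as ℤ
open import Data.List using (List; []; _∷_; _++_; length; replicate)
open import Data.Maybe using (Maybe; just; nothing)
open import Data.Nat using (ℕ; zero; suc; NonZero)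
import Data.Nat as ℕ
import Data.Nat.DivMod as ℕ
import Data.Nat.Properties as ℕ
open import Data.Nat.Logarithm using (⌊log₂_⌋)
open import Data.Product using (Σ-syntax; ∃-syntax; _×_; _,_; proj₁; proj₂)
open import Data.Rational using (ℚ; 0ℚ; 1ℚ; ½; Positive; NonNegative)
import Data.Rational as ℚ
import Data.Rational.Properties as ℚ
open import Data.Rational.Solver using (module +-*-Solver)
open import Data.Sum using (inj₁; inj₂)
open import Data.Vec using (Vec; []; _∷_; lookup; _[_]%=_)
import Data.Vec as Vec
open import Data.Vec.Functional as Vector using (Vector)
import Data.Vec.Functional.Relation.Binary.Equality.Setoid as VectorEquality
open import Function.Bundles using (Func)
open import Level using (Level; 0ℓ; _⊔_)
open import Relation.Binary.Bundles using (Setoid)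
open import Relation.Binary.PropositionalEquality using (_≡_; refl; sym; trans; cong; subst)

private
  variable
    ℓ ℓ′ : Level

½-pos : ∀ ε .{{_ : Positive ε}} → Positive (ε ℚ.* ½)
½-pos ε = ℚ.pos*pos⇒pos ε ½

halves : ∀ ε → ε ℚ.* ½ ℚ.+ ε ℚ.* ½ ≡ ε
halves ε = trans (sym (ℚ.*-distribˡ-+ ε ½ ½)) (ℚ.*-identityʳ ε)

∣p-q∣≡∣q-p∣ : ∀ p q → ℚ.∣ p ℚ.- q ∣ ≡ ℚ.∣ q ℚ.- p ∣
∣p-q∣≡∣q-p∣ p q = trans (cong ℚ.∣_∣ lem) (ℚ.∣-p∣≡∣p∣ (q ℚ.- p))
  where
  open +-*-Solver
  lem : p ℚ.- q ≡ ℚ.- (q ℚ.- p)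
  lem = solve 2 (λ p q → p :+ (:- q) := :- (q :+ (:- p))) refl p q

∣p-p∣≤ε : ∀ p ε .{{_ : Positive ε}} → ℚ.∣ p ℚ.- p ∣ ℚ.≤ ε
∣p-p∣≤ε p ε = subst (ℚ._≤ ε) (sym (cong ℚ.∣_∣ (ℚ.+-inverseʳ p))) (ℚ.<⇒≤ (ℚ.positive⁻¹ ε))

triangle : ∀ p q r {δ ε} → ℚ.∣ p ℚ.- q ∣ ℚ.≤ δ → ℚ.∣ q ℚ.- r ∣ ℚ.≤ ε → ℚ.∣ p ℚ.- r ∣ ℚ.≤ δ ℚ.+ ε
triangle p q r a b =
  ℚ.≤-trans (ℚ.≤-reflexive (cong ℚ.∣_∣ lem))
    (ℚ.≤-trans (ℚ.∣p+q∣≤∣p∣+∣q∣ (p ℚ.- q) (q ℚ.- r)) (ℚ.+-mono-≤ a b))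
  where
  open +-*-Solver
  lem : p ℚ.- r ≡ (p ℚ.- q) ℚ.+ (q ℚ.- r)
  lem = solve 3 (λ p q r → p :+ (:- r) := (p :+ (:- q)) :+ (q :+ (:- r))) refl p q r

∣p∣-≤ : ∀ p q → ℚ.∣ p ∣ ℚ.≤ ℚ.∣ p ℚ.- q ∣ ℚ.+ ℚ.∣ q ∣
∣p∣-≤ p q =
  ℚ.≤-trans (ℚ.≤-reflexive (cong ℚ.∣_∣ lem)) (ℚ.∣p+q∣≤∣p∣+∣q∣ (p ℚ.- q) q)
  where
  open +-*-Solver
  lem : p ≡ (p ℚ.- q) ℚ.+ q
  lem = solve 2 (λ p q → p := (p :+ (:- q)) :+ q) refl p q

∣p∣-∣q∣≤ : ∀ p q → ℚ.∣ p ∣ ℚ.- ℚ.∣ q ∣ ℚ.≤ ℚ.∣ p ℚ.- q ∣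
∣p∣-∣q∣≤ p q =
  ℚ.≤-trans (ℚ.+-monoˡ-≤ (ℚ.- ℚ.∣ q ∣) (∣p∣-≤ p q)) (ℚ.≤-reflexive lem)
  where
  open +-*-Solver
  lem : (ℚ.∣ p ℚ.- q ∣ ℚ.+ ℚ.∣ q ∣) ℚ.- ℚ.∣ q ∣ ≡ ℚ.∣ p ℚ.- q ∣
  lem = solve 2 (λ a b → (a :+ b) :+ (:- b) := a) refl ℚ.∣ p ℚ.- q ∣ ℚ.∣ q ∣

reverse-triangle : ∀ p q → ℚ.∣ ℚ.∣ p ∣ ℚ.- ℚ.∣ q ∣ ∣ ℚ.≤ ℚ.∣ p ℚ.- q ∣
reverse-triangle p q with ℚ.∣p∣≡p∨∣p∣≡-p (ℚ.∣ p ∣ ℚ.- ℚ.∣ q ∣)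
... | inj₁ eq = ℚ.≤-trans (ℚ.≤-reflexive eq) (∣p∣-∣q∣≤ p q)
... | inj₂ eq =
  ℚ.≤-trans (ℚ.≤-reflexive (trans eq lem))
    (ℚ.≤-trans (∣p∣-∣q∣≤ q p) (ℚ.≤-reflexive (∣p-q∣≡∣q-p∣ q p)))
  where
  open +-*-Solver
  lem : ℚ.- (ℚ.∣ p ∣ ℚ.- ℚ.∣ q ∣) ≡ ℚ.∣ q ∣ ℚ.- ℚ.∣ p ∣
  lem = solve 2 (λ a b → :- (a :+ (:- b)) := b :+ (:- a)) refl ℚ.∣ p ∣ ℚ.∣ q ∣

*-mono-≤-∣∣ : ∀ p q {b δ} .{{_ : NonNegative b}} → ℚ.∣ p ∣ ℚ.≤ b → ℚ.∣ q ∣ ℚ.≤ δ → ℚ.∣ p ℚ.* q ∣ ℚ.≤ b ℚ.* δ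
*-mono-≤-∣∣ p q {b} {δ} pb qδ =
  ℚ.≤-trans (ℚ.≤-reflexive (ℚ.∣p*q∣≡∣p∣*∣q∣ p q))
    (ℚ.≤-trans (ℚ.*-monoʳ-≤-nonNeg ℚ.∣ q ∣ {{ℚ.∣-∣-nonNeg q}} pb) (ℚ.*-monoˡ-≤-nonNeg b qδ))

IsCauchy : (ℕ → ℚ) → Set
IsCauchy s = ∀ ε .{{_ : Positive ε}} →
  ∃[ N ] (∀ m n → N ℕ.≤ m → N ℕ.≤ n → ℚ.∣ s m ℚ.- s n ∣ ℚ.≤ ε)

-- Real numbers, as Cauchy sequences of rationals up to _≃_.
record ℝ : Set where
  constructor mkℝ
  field
    seq    : ℕ → ℚ
    cauchy : IsCauchy seq

open ℝ public

infix 4 _≃_ _≤_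
infixl 6 _+_ _-_
infixl 7 _*_
infix 8 -_

_≃_ : ℝ → ℝ → Set
x ≃ y = ∀ ε .{{_ : Positive ε}} →
  ∃[ N ] (∀ n → N ℕ.≤ n → ℚ.∣ seq x n ℚ.- seq y n ∣ ℚ.≤ ε)

_≤_ : ℝ → ℝ → Set
x ≤ y = ∀ ε .{{_ : Positive ε}} →
  ∃[ N ] (∀ n → N ℕ.≤ n → seq x n ℚ.≤ seq y n ℚ.+ ε)

≃-refl : ∀ {x} → x ≃ x
≃-refl {x} ε = 0 , λ n _ → ∣p-p∣≤ε (seq x n) ε

≃-sym : ∀ {x y} → x ≃ y → y ≃ x
≃-sym {x} {y} p ε with p ε
... | N , h = N , λ n N≤n → subst (ℚ._≤ ε) (∣p-q∣≡∣q-p∣ (seq x n) (seq y n)) (h n N≤n)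

≃-trans : ∀ {x y z} → x ≃ y → y ≃ z → x ≃ z
≃-trans {x} {y} {z} p q ε with p (ε ℚ.* ½) {{½-pos ε}} | q (ε ℚ.* ½) {{½-pos ε}}
... | N₁ , h₁ | N₂ , h₂ = N₁ ℕ.⊔ N₂ , λ n N≤n →
  subst (ℚ.∣ seq x n ℚ.- seq z n ∣ ℚ.≤_) (halves ε)
    (triangle (seq x n) (seq y n) (seq z n)
      (h₁ n (ℕ.≤-trans (ℕ.m≤m⊔n N₁ N₂) N≤n)) (h₂ n (ℕ.≤-trans (ℕ.m≤n⊔m N₁ N₂) N≤n)))

ℝ-setoid : Setoid 0ℓ 0ℓ
ℝ-setoid = record
  { Carrier       = ℝ
  ; _≈_           = _≃_
  ; isEquivalence = record
    { refl  = λ {x} → ≃-refl {x}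
    ; sym   = λ {x} {y} → ≃-sym {x} {y}
    ; trans = λ {x} {y} {z} → ≃-trans {x} {y} {z}
    }
  }

fromℚ : ℚ → ℝ
fromℚ q = mkℝ (λ _ → q) (λ ε → 0 , λ _ _ _ _ → ∣p-p∣≤ε q ε)

fromℤ : ℤ → ℝ
fromℤ z = fromℚ (z ℚ./ 1)

-_ : ℝ → ℝ
- x = mkℝ (λ n → ℚ.- seq x n) λ ε → let (N , h) = cauchy x ε in N , λ m n p q →
  ℚ.≤-trans (ℚ.≤-reflexive (trans (cong ℚ.∣_∣ (sym (ℚ.neg-distrib-+ (seq x m) (ℚ.- seq x n))))
                                  (ℚ.∣-p∣≡∣p∣ (seq x m ℚ.- seq x n))))
            (h m n p q)

_+_ : ℝ → ℝ → ℝ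
x + y = mkℝ (λ n → seq x n ℚ.+ seq y n) c
  where
  open +-*-Solver
  lem : ∀ a b c d → (a ℚ.+ b) ℚ.- (c ℚ.+ d) ≡ (a ℚ.- c) ℚ.+ (b ℚ.- d)
  lem = solve 4 (λ a b c d → (a :+ b) :+ (:- (c :+ d)) := (a :+ (:- c)) :+ (b :+ (:- d))) refl

  c : IsCauchy (λ n → seq x n ℚ.+ seq y n)
  c ε with cauchy x (ε ℚ.* ½) {{½-pos ε}} | cauchy y (ε ℚ.* ½) {{½-pos ε}}
  ... | N₁ , h₁ | N₂ , h₂ = N₁ ℕ.⊔ N₂ , λ m n p q →
    let l = ℕ.m≤m⊔n N₁ N₂ ; r = ℕ.m≤n⊔m N₁ N₂ in
    subst (ℚ._≤_ _) (halves ε)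
      (ℚ.≤-trans (ℚ.≤-reflexive (cong ℚ.∣_∣ (lem (seq x m) (seq y m) (seq x n) (seq y n))))
        (ℚ.≤-trans (ℚ.∣p+q∣≤∣p∣+∣q∣ (seq x m ℚ.- seq x n) (seq y m ℚ.- seq y n))
          (ℚ.+-mono-≤ (h₁ m n (ℕ.≤-trans l p) (ℕ.≤-trans l q))
                      (h₂ m n (ℕ.≤-trans r p) (ℕ.≤-trans r q)))))

_-_ : ℝ → ℝ → ℝ
x - y = x + (- y)

∣_∣ : ℝ → ℝ
∣ x ∣ = mkℝ (λ n → ℚ.∣ seq x n ∣) λ ε → let (N , h) = cauchy x ε in N , λ m n p q →
  ℚ.≤-trans (reverse-triangle (seq x m) (seq x n)) (h m n p q)

record EventualBound (s : ℕ → ℚ) : Set where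
  field
    bound     : ℚ
    bound-pos : Positive bound
    from      : ℕ
    bounded   : ∀ n → from ℕ.≤ n → ℚ.∣ s n ∣ ℚ.≤ bound

eventualBound : ∀ x → EventualBound (seq x)
eventualBound x with cauchy x 1ℚ
... | N , h = record
  { bound     = 1ℚ ℚ.+ ℚ.∣ seq x N ∣
  ; bound-pos = ℚ.pos+nonNeg⇒pos 1ℚ ℚ.∣ seq x N ∣ {{ℚ.∣-∣-nonNeg (seq x N)}}
  ; from      = N
  ; bounded   = λ n p → ℚ.≤-trans (∣p∣-≤ (seq x n) (seq x N))
                          (ℚ.+-monoˡ-≤ ℚ.∣ seq x N ∣ (h n N p ℕ.≤-refl))
  }

_*_ : ℝ → ℝ → ℝ
x * y = mkℝ (λ n → seq x n ℚ.* seq y n) c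
  where
  module X = EventualBound (eventualBound x)
  module Y = EventualBound (eventualBound y)
  open +-*-Solver

  B : ℚ
  B = X.bound ℚ.+ Y.bound

  B-pos : Positive B
  B-pos = ℚ.pos+pos⇒pos X.bound {{X.bound-pos}} Y.bound {{Y.bound-pos}}

  B⁻¹ : ℚ
  B⁻¹ = (ℚ.1/ B) {{ℚ.pos⇒nonZero B {{B-pos}}}}

  lem : ∀ a b c d → a ℚ.* b ℚ.- c ℚ.* d ≡ a ℚ.* (b ℚ.- d) ℚ.+ d ℚ.* (a ℚ.- c)
  lem = solve 4 (λ a b c d → a :* b :+ (:- (c :* d)) := a :* (b :+ (:- d)) :+ d :* (a :+ (:- c))) refl

  split : ∀ ε → X.bound ℚ.* (B⁻¹ ℚ.* ε) ℚ.+ Y.bound ℚ.* (B⁻¹ ℚ.* ε) ≡ ε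
  split ε =
    trans (sym (ℚ.*-distribʳ-+ (B⁻¹ ℚ.* ε) X.bound Y.bound))
      (trans (sym (ℚ.*-assoc B B⁻¹ ε))
        (trans (cong (ℚ._* ε) (ℚ.*-inverseʳ B {{ℚ.pos⇒nonZero B {{B-pos}}}})) (ℚ.*-identityˡ ε)))

  c : IsCauchy (λ n → seq x n ℚ.* seq y n)
  c ε = N , λ m n p q →
    subst (ℚ._≤_ _) (split ε)
      (ℚ.≤-trans (ℚ.≤-reflexive (cong ℚ.∣_∣ (lem (seq x m) (seq y m) (seq x n) (seq y n))))
        (ℚ.≤-trans (ℚ.∣p+q∣≤∣p∣+∣q∣ (seq x m ℚ.* (seq y m ℚ.- seq y n)) (seq y n ℚ.* (seq x m ℚ.- seq x n)))
          (ℚ.+-mono-≤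
            (*-mono-≤-∣∣ (seq x m) (seq y m ℚ.- seq y n) {{ℚ.pos⇒nonNeg X.bound {{X.bound-pos}}}}
              (X.bounded m (ℕ.≤-trans N₁≤N p)) (proj₂ cy m n (ℕ.≤-trans N₄≤N p) (ℕ.≤-trans N₄≤N q)))
            (*-mono-≤-∣∣ (seq y n) (seq x m ℚ.- seq x n) {{ℚ.pos⇒nonNeg Y.bound {{Y.bound-pos}}}}
              (Y.bounded n (ℕ.≤-trans N₂≤N q)) (proj₂ cx m n (ℕ.≤-trans N₃≤N p) (ℕ.≤-trans N₃≤N q))))))
    where
    δ-pos : Positive (B⁻¹ ℚ.* ε)
    δ-pos = ℚ.pos*pos⇒pos B⁻¹ {{ℚ.1/pos⇒pos B {{B-pos}}}} ε
    cx = cauchy x (B⁻¹ ℚ.* ε) {{δ-pos}}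
    cy = cauchy y (B⁻¹ ℚ.* ε) {{δ-pos}}
    N₁₂ = X.from ℕ.⊔ Y.from
    N₃₄ = proj₁ cx ℕ.⊔ proj₁ cy
    N = N₁₂ ℕ.⊔ N₃₄
    N₁≤N = ℕ.≤-trans (ℕ.m≤m⊔n X.from Y.from) (ℕ.m≤m⊔n N₁₂ N₃₄)
    N₂≤N = ℕ.≤-trans (ℕ.m≤n⊔m X.from Y.from) (ℕ.m≤m⊔n N₁₂ N₃₄)
    N₃≤N = ℕ.≤-trans (ℕ.m≤m⊔n (proj₁ cx) (proj₁ cy)) (ℕ.m≤n⊔m N₁₂ N₃₄)
    N₄≤N = ℕ.≤-trans (ℕ.m≤n⊔m (proj₁ cx) (proj₁ cy)) (ℕ.m≤n⊔m N₁₂ N₃₄)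

2^_ : ℕ → ℚ
2^ n = (+ (2 ℕ.^ n)) ℚ./ 1

2^-_ : ℕ → ℚ
2^- n = (1ℤ ℚ./ (2 ℕ.^ n)) {{ℕ.m^n≢0 2 n}}

-- ℝ^ d ⟶ℝ is the type of functions ℝᵈ → ℝ, i.e. of maps respecting equality of reals.
ℝ^_⟶ℝ : ℕ → Set
ℝ^ d ⟶ℝ = Func (VectorEquality.≋-setoid ℝ-setoid d) ℝ-setoid

ℝ⟶ℝ : Set
ℝ⟶ℝ = Func ℝ-setoid ℝ-setoid

unary : ℝ⟶ℝ → ℝ^ 1 ⟶ℝ
unary f = record
  { to   = λ x → Func.to f (x zero)
  ; cong = λ x≋y → Func.cong f (x≋y zero)
  }

apply : ℝ⟶ℝ → ℝ → ℝ
apply = Func.to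

apply₂ : ℝ^ 2 ⟶ℝ → ℝ → ℝ → ℝ
apply₂ g x y = Func.to g (x Vector.∷ y Vector.∷ Vector.[])

-- The number numerator / 2 ^ exponent; fractions need not be reduced.
record 𝔻 : Set where
  constructor _/2^_
  field
    numerator : ℤ
    exponent  : ℕ

𝔻→ℚ : 𝔻 → ℚ
𝔻→ℚ (a /2^ b) = (a ℚ./ (2 ℕ.^ b)) {{ℕ.m^n≢0 2 b}}

𝔻→ℝ : 𝔻 → ℝ
𝔻→ℝ r = fromℚ (𝔻→ℚ r)

CF : ℝ → (ℕ → 𝔻) → Set
CF x φ = ∀ n → ∣ x - 𝔻→ℝ (φ n) ∣ ≤ fromℚ (2^- n)

data Symbol (a : ℕ) : Set where
  blank b0 b1 minus point sep : Symbol a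
  aux                         : Fin a → Symbol a

Word : ℕ → Set
Word a = List (Symbol a)

module _ {a : ℕ} where

  bit : ℕ → Symbol a
  bit 0       = b0
  bit (suc _) = b1

  -- The w low-order binary digits of m, most significant first.
  digits : (w m : ℕ) → Word a
  digits zero    m = []
  digits (suc w) m = digits w (m ℕ./ 2) ++ bit (m ℕ.% 2) ∷ []

  -- ⌊log₂ 0 ⌋ is 0, so the encoding of 0 is the single digit 0.
  encodeℕ : ℕ → Word a
  encodeℕ m = digits (suc ⌊log₂ m ⌋) m

  encodeSign : ℤ → Word a
  encodeSign (+ _)    = []
  encodeSign -[1+ _ ] = minus ∷ []

  encodeℤ : ℤ → Word a
  encodeℤ z = encodeSign z ++ encodeℕ ℤ.∣ z ∣

  -- Fixed-point binary notation with exactly b digits after the point.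
  encode𝔻 : 𝔻 → Word a
  encode𝔻 (z /2^ b) =
    encodeSign z ++ encodeℕ ((ℤ.∣ z ∣ ℕ./ (2 ℕ.^ b)) {{ℕ.m^n≢0 2 b}}) ++ point ∷ digits b ℤ.∣ z ∣

  encodeUnary : ℕ → Word a
  encodeUnary n = replicate n b1

∣_∣₂ : ℤ → ℕ
∣ z ∣₂ = length (encodeℤ {0} z)

data Move : Set where
  left right stay : Move

-- A two-way infinite tape: `before` lists the cells to the left of the scanned
-- cell, nearest first; all cells not listed are blank.
record Tape (a : ℕ) : Set where
  constructor tape
  field
    before  : List (Symbol a)
    scanned : Symbol a
    after   : List (Symbol a)

module _ {a : ℕ} where

  load : Word a → Tape a
  load []      = tape [] blank []
  load (s ∷ w) = tape [] s w

  blankFreePrefix : Word a → Word a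
  blankFreePrefix []          = []
  blankFreePrefix (blank ∷ w) = []
  blankFreePrefix (s ∷ w)     = s ∷ blankFreePrefix w

  -- The word starting at the scanned cell and extending up to the first blank.
  contents : Tape a → Word a
  contents (tape _ s r) = blankFreePrefix (s ∷ r)

  write : Symbol a → Tape a → Tape a
  write s (tape l _ r) = tape l s r

  move : Move → Tape a → Tape a
  move left  (tape []      s r)       = tape [] blank (s ∷ r)
  move left  (tape (x ∷ l) s r)       = tape l x (s ∷ r)
  move right (tape l       s [])      = tape (s ∷ l) blank []
  move right (tape l       s (x ∷ r)) = tape (s ∷ l) x r
  move stay  t                        = t

  writeAndMove : Symbol a × Move → Tape a → Tape a
  writeAndMove (s , d) t = move d (write s t)

data Action (d states tapes a : ℕ) : Set where
  halt  : Action d states tapes a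
  step  : Fin states → Vec (Symbol a × Move) d → Vec (Symbol a × Move) tapes → Action d states tapes a
  query : Fin d → Fin states → Action d states tapes a

-- A deterministic multitape Turing machine with d oracles, each with its own
-- oracle tape, and 1 + extraTapes ordinary tapes. The first ordinary tape holds the
-- input at the start and the output at the end; state zero is the initial one.
-- With d = 0 this is an ordinary Turing machine.
record OTM (d : ℕ) : Set where
  field
    auxSymbols  : ℕ
    extraStates : ℕ
    extraTapes  : ℕ
    transition  : Fin (suc extraStates) →
                  Vec (Symbol auxSymbols) d → Vec (Symbol auxSymbols) (suc extraTapes) →
                  Action d (suc extraStates) (suc extraTapes) auxSymbols

  states tapes : ℕ
  states = suc extraStates
  tapes  = suc extraTapes

Oracles : ℕ → Set
Oracles d = Fin d → ℕ → 𝔻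

module _ {d : ℕ} (M : OTM d) where
  open OTM M

  record Config : Set where
    constructor config
    field
      state       : Fin states
      oracleTapes : Vec (Tape auxSymbols) d
      mainTapes   : Vec (Tape auxSymbols) tapes

  initial : Word auxSymbols → Config
  initial w = config zero (Vec.replicate d (load [])) (load w ∷ Vec.replicate extraTapes (load []))

module _ {d : ℕ} (M : OTM d) (φ : Oracles d) where
  open OTM M

  -- A query is posed in unary, as the length of the word on the oracle tape; in one
  -- step the tape is overwritten by the answer, with the head on its first symbol.
  answer : Fin d → Tape auxSymbols → Tape auxSymbols
  answer i t = load (encode𝔻 (φ i (length (contents t))))

  act : Config M → Action d states tapes auxSymbols → Maybe (Config M)
  act c                 halt         = nothing
  act (config _ os ts)  (step q u v) = just (config q (Vec.zipWith writeAndMove u os) (Vec.zipWith writeAndMove v ts))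
  act (config _ os ts)  (query i q)  = just (config q (os [ i ]%= answer i) ts)

  next : Config M → Maybe (Config M)
  next c@(config q os ts) = act c (transition q (Vec.map Tape.scanned os) (Vec.map Tape.scanned ts))

  data HaltsFrom : Config M → ℕ → Config M → Set where
    halted : ∀ {c} → next c ≡ nothing → HaltsFrom c 0 c
    steps  : ∀ {c c′ c″ t} → next c ≡ just c′ → HaltsFrom c′ t c″ → HaltsFrom c (suc t) c″

  -- Started on input w, the machine halts after exactly t steps with output v.
  Outputs : Word auxSymbols → ℕ → Word auxSymbols → Set
  Outputs w t v = ∃[ c ] (HaltsFrom (initial M w) t c × contents (Vec.head (Config.mainTapes c)) ≡ v)

-- Polynomials in m variables with coefficients in ℕ.
data Polynomial (m : ℕ) : Set where
  con     : ℕ → Polynomial m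
  var     : Fin m → Polynomial m
  _⊕_ _⊗_ : Polynomial m → Polynomial m → Polynomial m

⟦_⟧ : ∀ {m} → Polynomial m → Vec ℕ m → ℕ
⟦ con c ⟧ ρ = c
⟦ var i ⟧ ρ = lookup ρ i
⟦ p ⊕ q ⟧ ρ = ⟦ p ⟧ ρ ℕ.+ ⟦ q ⟧ ρ
⟦ p ⊗ q ⟧ ρ = ⟦ p ⟧ ρ ℕ.* ⟦ q ⟧ ρ

IsLeast : (ℕ → Set ℓ) → ℕ → Set ℓ
IsLeast P k = P k × (∀ j → P j → k ℕ.≤ j)

InBox : ∀ {d} → Vector ℝ d → ℕ → Set
InBox x j = ∀ i → (fromℚ (ℚ.- (2^ j)) ≤ x i) × (x i ≤ fromℚ (2^ j))

Computes : ∀ {d} → OTM d → ℝ^ d ⟶ℝ → Set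
Computes {d} M f =
  (x : Vector ℝ d) (φ : Oracles d) → (∀ i → CF (x i) (φ i)) → ∀ n →
  ∃[ t ] ∃[ r ] (Outputs M φ (encodeUnary n) t (encode𝔻 r) ×
                 ∣ 𝔻→ℝ r - Func.to f x ∣ ≤ fromℚ (2^- n))

RunsInTime : ∀ {d} → OTM d → Polynomial 2 → Set
RunsInTime {d} M p =
  (x : Vector ℝ d) (φ : Oracles d) → (∀ i → CF (x i) (φ i)) → ∀ n k → IsLeast (InBox x) k →
  ∀ t v → Outputs M φ (encodeUnary n) t v → t ℕ.≤ ⟦ p ⟧ (k ∷ n ∷ [])

PolytimeComputable : ∀ {d} → ℝ^ d ⟶ℝ → Set
PolytimeComputable {d} f = Σ[ M ∈ OTM d ] (Computes M f × ∃[ p ] RunsInTime M p)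

PolytimeComputableℤ : (ℤ → ℤ → ℤ) → Set
PolytimeComputableℤ h = Σ[ M ∈ OTM 0 ] Σ[ p ∈ Polynomial 2 ] (∀ x y →
  ∃[ t ] (Outputs M (λ ()) (encodeℤ x ++ sep ∷ encodeℤ y) t (encodeℤ (h x y)) ×
          t ℕ.≤ ⟦ p ⟧ (∣ x ∣₂ ∷ ∣ y ∣₂ ∷ [])))

Lipschitz : ℝ⟶ℝ → Set
Lipschitz f = Σ[ K ∈ ℝ ] (fromℚ 0ℚ ≤ K × (∀ x₁ x₂ → ∣ apply f x₁ - apply f x₂ ∣ ≤ K * ∣ x₁ - x₂ ∣))

Approximates : (ℝ^ 2 ⟶ℝ → Set ℓ) → ((ℤ → ℤ → ℤ) → Set ℓ′) → Set (ℓ ⊔ ℓ′)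
Approximates C D = ∀ g → D g → ∃[ g̃ ] (C g̃ × (∀ x y →
  ∣ apply₂ g̃ (fromℤ x) (fromℤ y) - fromℤ (g x y) ∣ ≤ fromℚ (1ℤ ℚ./ 4)))

Definable : (ℝ^ 2 ⟶ℝ → Set ℓ) → ℝ⟶ℝ → Set ℓ
Definable C f = ∃[ g̃ ] (C g̃ × (∀ (x : ℤ) (y : ℕ) .{{_ : NonZero y}} →
  ∣ apply₂ g̃ (fromℤ x) (fromℤ (+ y)) - fromℤ (+ y) * apply f (fromℚ (x ℚ./ y)) ∣ ≤ fromℤ (+ 3)))

{-# OPTIONS --safe #-}
-- Suppose that M computes f. For y ≥ 1, run M at the point x/y with a precision 2⁻ⁿ < 1/y, answering its queries by
-- long division, and round y times the result: this integer is within 2 of y f(x/y), and polynomially many steps suffice.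
-- Conversely, suppose that g̃ defines f and M computes g̃. Let y = 2^(N+1) and let x/y be a truncation of the argument,
-- read off the oracle. Running M at (x , y) with precision 1 and shifting the result by N+1 places gives f(x/y) to within
-- 4/y, and f(x/y) is close to f at the argument since f is Lipschitz; N = n + c with a constant c that depends on the
-- Lipschitz constant makes the total error at most 2⁻ⁿ.
--
-- In both directions M is simulated step by step. Its input and oracle tapes are kept as pairs of stacks, since they have
-- to be rewritten from outside; the other tapes are simulated in place. The arithmetic is done by programs on stacks, a
-- stack being the part of a tape to the right of the head.
module Submission where

open import Defs
open import Data.Bool using (Bool; true; false; if_then_else_; _∧_; _∨_; not; T; _xor_)
open import Data.Bool.Properties using (T-∧)
open import Data.Empty using (⊥-elim)
open import Data.Fin using (Fin; zero; suc; _↑ˡ_; _↑ʳ_; splitAt; combine; remQuot)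
import Data.Fin as Fin
open import Data.Fin.Patterns
import Data.Fin.Properties as Fin
open import Data.Integer using (ℤ; +_; -[1+_]; 1ℤ)
import Data.Integer as ℤ
import Data.Integer.Properties as ℤ
open import Data.List using (List; []; _∷_; _++_; length; _ʳ++_; reverse; map; replicate)
import Data.List.Properties as List
open import Data.List.Relation.Unary.All using (All; []; _∷_)
import Data.List.Relation.Unary.All.Properties as All
open import Data.Maybe using (Maybe; just; nothing)
open import Data.Nat using (ℕ; zero; suc; z≤n; s≤s; NonZero; ⌊_/2⌋)
import Data.Nat as ℕ
import Data.Nat.DivMod as ℕ
open import Data.Nat.Induction using (<-rec)
open import Data.Nat.Logarithm using (⌊log₂_⌋; ⌊log₂⌊n/2⌋⌋≡⌊log₂n⌋∸1; ⌊log₂⌋-mono-≤)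
import Data.Nat.Properties as ℕ
open import Data.Nat.Solver using (module +-*-Solver)
open import Data.Product using (∃-syntax; _×_; _,_; proj₁; proj₂)
open import Data.Rational using (ℚ; 0ℚ; 1ℚ; ½; Positive; toℚᵘ)
import Data.Rational as ℚ
import Data.Rational.Properties as ℚ
open import Data.Rational.Solver renaming (module +-*-Solver to ℚ-Solver)
open import Data.Rational.Unnormalised using (mkℚᵘ; *≡*; *≤*)
import Data.Rational.Unnormalised as ℚᵘ
import Data.Rational.Unnormalised.Properties as ℚᵘ
open import Data.Sum using (_⊎_; inj₁; inj₂; [_,_]′)
import Data.Sum.Properties as Sum
open import Data.Sum.Properties using (inj₂-injective)
open import Data.Unit using (⊤; tt)
open import Data.Vec using (Vec; []; _∷_; lookup; tabulate; _[_]≔_; _[_]%=_)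
import Data.Vec as Vec
open import Data.Vec.Functional as Vector using (Vector)
import Data.Vec.Properties as Vec
open import Function using (_∘_; id)
open import Function.Bundles using (Equivalence; _⇔_; mk⇔)
open import Level using (Level)
open import Relation.Binary.PropositionalEquality using (_≡_; _≢_; refl; sym; trans; cong; cong₂; subst; subst₂; module ≡-Reasoning)
open import Relation.Nullary using (Dec; yes; no; ¬_)
open import Relation.Nullary.Decidable using (False; toWitnessFalse; from-yes)

-- Time bounds depend on `k` and `n` only, while an oracle may answer with arbitrarily many digits
-- after the point. Hence the converse direction reads just `N` of them. An integer with `m` digits
-- lies in the box of index `m`, so M, run at the integers `x` and `y = 2^(N+1)`, stays polynomial
-- in `k` and `n`; and integers can be answered exactly, by the same word for every query. In the
-- other direction each query needs a fresh division, but queries are posed in unary: an answer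
-- exceeds its question by a bounded amount, so the tapes of M grow only linearly with the simulated
-- steps.
--
-- The error budgets are 1/4 + 1 + 1 ≤ 3 (approximation, rounding, precision of M) and (1 + 3)/y + 2
-- K 2^-N = 2 (1 + K) 2^-N, where the error 2 · 2^-N of the argument is due in equal parts to the
-- oracle and to truncation.
--
-- Every routine must produce exact words, so specifications give the final contents of the
-- registers exactly, and the time as an upper bound.

record Finite (S : Set) : Set where
  field
    size          : ℕ
    index         : S → Fin size
    element       : Fin size → S
    element-index : ∀ s → element (index s) ≡ s

open Finite

Bool-finite : Finite Bool
Bool-finite = record
  { size = 2 ; index = λ { false → zero ; true → suc zero }
  ; element = λ { zero → false ; (suc _) → true }
  ; element-index = λ { false → refl ; true → refl } }

Fin-finite : ∀ n → Finite (Fin n)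
Fin-finite n = record { size = n ; index = id ; element = id ; element-index = λ _ → refl }

⊎-finite : ∀ {A B} → Finite A → Finite B → Finite (A ⊎ B)
⊎-finite {A} {B} F G = record { size = size F ℕ.+ size G ; index = ix ; element = el ; element-index = ok }
  where
  ix : A ⊎ B → Fin (size F ℕ.+ size G)
  ix (inj₁ x) = index F x ↑ˡ size G
  ix (inj₂ y) = size F ↑ʳ index G y
  from : Fin (size F) ⊎ Fin (size G) → A ⊎ B
  from (inj₁ i) = inj₁ (element F i)
  from (inj₂ j) = inj₂ (element G j)
  el : Fin (size F ℕ.+ size G) → A ⊎ B
  el k = from (splitAt (size F) k)
  ok : ∀ s → el (ix s) ≡ s
  ok (inj₁ x) rewrite Fin.splitAt-↑ˡ (size F) (index F x) (size G) = cong inj₁ (element-index F x)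
  ok (inj₂ y) rewrite Fin.splitAt-↑ʳ (size F) (size G) (index G y) = cong inj₂ (element-index G y)

×-finite : ∀ {A B} → Finite A → Finite B → Finite (A × B)
×-finite {A} {B} F G = record { size = size F ℕ.* size G ; index = ix ; element = el ; element-index = ok }
  where
  ix : A × B → Fin (size F ℕ.* size G)
  ix (x , y) = combine (index F x) (index G y)
  el : Fin (size F ℕ.* size G) → A × B
  el k = element F (proj₁ (remQuot {size F} (size G) k)) , element G (proj₂ (remQuot {size F} (size G) k))
  ok : ∀ s → el (ix s) ≡ s
  ok (x , y) = trans (cong (λ p → element F (proj₁ p) , element G (proj₂ p)) (Fin.remQuot-combine {size F} (index F x) (index G y)))
                     (cong₂ _,_ (element-index F x) (element-index G y))

Maybe-finite : ∀ {A} → Finite A → Finite (Maybe A)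
Maybe-finite {A} F = record
  { size = suc (size F) ; index = λ { nothing → zero ; (just x) → suc (index F x) }
  ; element = λ { zero → nothing ; (suc i) → just (element F i) }
  ; element-index = λ { nothing → refl ; (just x) → cong just (element-index F x) } }

lookup-ext : ∀ {A : Set} {n} (v w : Vec A n) → (∀ i → lookup v i ≡ lookup w i) → v ≡ w
lookup-ext v w h = trans (sym (Vec.tabulate∘lookup v)) (trans (Vec.tabulate-cong h) (Vec.tabulate∘lookup w))

-- Tapes read as stacks, and stores of stacks

module Stack {a : ℕ} where

  hd : Word a → Symbol a
  hd []      = blank
  hd (s ∷ _) = s

  tl : Word a → Word a
  tl []      = []
  tl (_ ∷ w) = w

  cell : Word a → ℕ → Symbol a
  cell w zero    = hd w
  cell w (suc n) = cell (tl w) n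

  -- Read as a stack, a tape shows the cells from the head rightwards, padded with blanks.
  infix 4 _shows_
  record _shows_ (t : Tape a) (w : Word a) : Set where
    constructor showing
    field
      cells : ∀ n → cell (Tape.scanned t ∷ Tape.after t) n ≡ cell w n

  open _shows_ public

  shows-load : ∀ w → load w shows w
  shows-load []      = showing λ { zero → refl ; (suc n) → refl }
  shows-load (s ∷ w) = showing λ n → refl

  shows-top : ∀ {t w} → t shows w → Tape.scanned t ≡ hd w
  shows-top v = cells v 0

  shows-pop : ∀ {t w} → t shows w → move right t shows tl w
  shows-pop {tape l s []}      {w} v = showing λ { zero → cells v 1 ; (suc n) → cells v (suc (suc n)) }
  shows-pop {tape l s (x ∷ r)} {w} v = showing λ n → cells v (suc n)

  shows-write : ∀ {t w} s → t shows w → write s t shows (s ∷ tl w)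
  shows-write s v = showing λ { zero → refl ; (suc n) → cells v (suc n) }

  shows-push : ∀ {t w} s → t shows w → write s (move left t) shows (s ∷ w)
  shows-push {tape [] x r}      s v = showing λ { zero → refl ; (suc n) → cells v n }
  shows-push {tape (y ∷ l) x r} s v = showing λ { zero → refl ; (suc n) → cells v n }

  isBlank : Symbol a → Bool
  isBlank blank = true
  isBlank _     = false

  nonBlank : Symbol a → Bool
  nonBlank s = not (isBlank s)

  -- Cells that are not listed are blank, so a blank is the only end marker of a stack. A loop that
  -- runs to the first blank consumes all of a solid word.
  Solid : Word a → Set
  Solid = All (λ s → nonBlank s ≡ true)

  cells⇒prefix : ∀ u w → (∀ n → cell u n ≡ cell w n) → blankFreePrefix u ≡ blankFreePrefix w
  cells⇒prefix []      []      h = refl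
  cells⇒prefix []      (y ∷ w) h with h 0
  ... | refl = refl
  cells⇒prefix (x ∷ u) []      h with h 0
  ... | refl = refl
  cells⇒prefix (x ∷ u) (y ∷ w) h with h 0 | cells⇒prefix u w (h ∘ suc)
  cells⇒prefix (blank ∷ u) (y ∷ w) h | refl | ih = refl
  cells⇒prefix (b0 ∷ u)    (y ∷ w) h | refl | ih = cong (b0 ∷_) ih
  cells⇒prefix (b1 ∷ u)    (y ∷ w) h | refl | ih = cong (b1 ∷_) ih
  cells⇒prefix (minus ∷ u) (y ∷ w) h | refl | ih = cong (minus ∷_) ih
  cells⇒prefix (point ∷ u) (y ∷ w) h | refl | ih = cong (point ∷_) ih
  cells⇒prefix (sep ∷ u)   (y ∷ w) h | refl | ih = cong (sep ∷_) ih
  cells⇒prefix (aux k ∷ u) (y ∷ w) h | refl | ih = cong (aux k ∷_) ih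

  shows-contents : ∀ {t w} → t shows w → contents t ≡ blankFreePrefix w
  shows-contents {tape l s r} {w} v = cells⇒prefix (s ∷ r) w (cells v)

  solid-prefix : ∀ {w} → Solid w → blankFreePrefix w ≡ w
  solid-prefix []                    = refl
  solid-prefix (_∷_ {blank} () p)
  solid-prefix (_∷_ {b0} _ p)        = cong (b0 ∷_) (solid-prefix p)
  solid-prefix (_∷_ {b1} _ p)        = cong (b1 ∷_) (solid-prefix p)
  solid-prefix (_∷_ {minus} _ p)     = cong (minus ∷_) (solid-prefix p)
  solid-prefix (_∷_ {point} _ p)     = cong (point ∷_) (solid-prefix p)
  solid-prefix (_∷_ {sep} _ p)       = cong (sep ∷_) (solid-prefix p)
  solid-prefix (_∷_ {aux k} _ p)     = cong (aux k ∷_) (solid-prefix p)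

  -- As nested pairs rather than a Vec, so that the η-law of pairs makes get and set compute.
  Store : ℕ → Set
  Store zero    = ⊤
  Store (suc n) = Word a × Store n

  get : ∀ {n} → Fin n → Store n → Word a
  get zero    (w , _) = w
  get (suc i) (_ , σ) = get i σ

  set : ∀ {n} → Fin n → Word a → Store n → Store n
  set zero    w (_ , σ) = w , σ
  set (suc i) w (v , σ) = v , set i w σ

  get-set : ∀ {n} (i : Fin n) w σ → get i (set i w σ) ≡ w
  get-set zero    w σ       = refl
  get-set (suc i) w (_ , σ) = get-set i w σ

  get-set-≢ : ∀ {n} (i j : Fin n) w σ → i ≢ j → get j (set i w σ) ≡ get j σ
  get-set-≢ zero    zero    w σ       i≢j = ⊥-elim (i≢j refl)
  get-set-≢ zero    (suc j) w σ       i≢j = refl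
  get-set-≢ (suc i) zero    w σ       i≢j = refl
  get-set-≢ (suc i) (suc j) w (_ , σ) i≢j = get-set-≢ i j w σ (i≢j ∘ cong suc)

  -- Parameter passing. A routine written for `m` registers is called on the registers listed in
  -- `ι`; its results are scattered back into the larger store.
  gather : ∀ {n m} → Vec (Fin n) m → Store n → Store m
  gather []      σ = tt
  gather (i ∷ ι) σ = get i σ , gather ι σ

  scatter : ∀ {n m} → Vec (Fin n) m → Store m → Store n → Store n
  scatter []      _       σ = σ
  scatter (i ∷ ι) (w , ρ) σ = set i w (scatter ι ρ σ)

  get-gather : ∀ {n m} (ι : Vec (Fin n) m) σ r → get r (gather ι σ) ≡ get (lookup ι r) σ
  get-gather (i ∷ ι) σ zero    = refl
  get-gather (i ∷ ι) σ (suc r) = get-gather ι σ r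

  -- Without injectivity an earlier entry of `ι` would overwrite a later one that names the same
  -- register.
  get-scatter : ∀ {n m} (ι : Vec (Fin n) m) ρ σ → (∀ {r s} → lookup ι r ≡ lookup ι s → r ≡ s) →
                ∀ r → get (lookup ι r) (scatter ι ρ σ) ≡ get r ρ
  get-scatter (i ∷ ι) (w , ρ) σ inj zero    = get-set i w (scatter ι ρ σ)
  get-scatter (i ∷ ι) (w , ρ) σ inj (suc r) =
    trans (get-set-≢ i (lookup ι r) w (scatter ι ρ σ) (λ eq → Fin.0≢1+n (inj {zero} {suc r} eq)))
          (get-scatter ι ρ σ (Fin.suc-injective ∘ inj) r)

  get-scatter-∉ : ∀ {n m} (ι : Vec (Fin n) m) ρ σ j → (∀ r → lookup ι r ≢ j) → get j (scatter ι ρ σ) ≡ get j σ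
  get-scatter-∉ []      ρ       σ j ∉ = refl
  get-scatter-∉ (i ∷ ι) (w , ρ) σ j ∉ =
    trans (get-set-≢ i j w (scatter ι ρ σ) (∉ zero)) (get-scatter-∉ ι ρ σ j (∉ ∘ suc))

open Stack

-- Machine fragments, their composition and their runs

module Fragments (a o e : ℕ) where

  Act : Set
  Act = Symbol a × Move

  -- Unlike `halt`, `done` returns control to the surrounding fragment. States form an arbitrary
  -- finite type, so that combinators can use sums and products of state spaces; they are numbered
  -- only by `compile`.
  data Instr (S : Set) : Set where
    done : Instr S
    go   : S → Vec Act o → Vec Act (suc e) → Instr S
    ask  : Fin o → S → Instr S

  record Frag : Set₁ where
    field
      State  : Set
      finite : Finite State
      start  : State
      δ      : State → Vec (Symbol a) o → Vec (Symbol a) (suc e) → Instr State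

  Tapes : Set
  Tapes = Vec (Tape a) o × Vec (Tape a) (suc e)

  Address : Set
  Address = Fin o ⊎ Fin (suc e)

  _≟_ : (i j : Address) → Dec (i ≡ j)
  _≟_ = Sum.≡-dec Fin._≟_ Fin._≟_

  scan : Vec (Symbol a) o → Vec (Symbol a) (suc e) → Address → Symbol a
  scan os ts (inj₁ i) = lookup os i
  scan os ts (inj₂ i) = lookup ts i

  infix 9 _!_
  _!_ : Tapes → Address → Tape a
  (os , ts) ! inj₁ i = lookup os i
  (os , ts) ! inj₂ i = lookup ts i

  scanned! : Tapes → Address → Symbol a
  scanned! (os , ts) = scan (Vec.map Tape.scanned os) (Vec.map Tape.scanned ts)

  scanned!-! : ∀ τ i → scanned! τ i ≡ Tape.scanned (τ ! i)
  scanned!-! (os , ts) (inj₁ i) = Vec.lookup-map i Tape.scanned os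
  scanned!-! (os , ts) (inj₂ i) = Vec.lookup-map i Tape.scanned ts

  perform : (Address → Act) → Tapes → Tapes
  perform α (os , ts) = Vec.zipWith writeAndMove (tabulate (α ∘ inj₁)) os , Vec.zipWith writeAndMove (tabulate (α ∘ inj₂)) ts

  goBy : ∀ {S} → S → (Address → Act) → Instr S
  goBy s α = go s (tabulate (α ∘ inj₁)) (tabulate (α ∘ inj₂))

  perform-! : ∀ α τ i → perform α τ ! i ≡ writeAndMove (α i) (τ ! i)
  perform-! α (os , ts) (inj₁ i) =
    trans (Vec.lookup-zipWith writeAndMove i (tabulate (α ∘ inj₁)) os)
          (cong (λ x → writeAndMove x (lookup os i)) (Vec.lookup∘tabulate (α ∘ inj₁) i))
  perform-! α (os , ts) (inj₂ i) =
    trans (Vec.lookup-zipWith writeAndMove i (tabulate (α ∘ inj₂)) ts)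
          (cong (λ x → writeAndMove x (lookup ts i)) (Vec.lookup∘tabulate (α ∘ inj₂) i))

  tapes-ext : ∀ τ τ′ → (∀ i → τ ! i ≡ τ′ ! i) → τ ≡ τ′
  tapes-ext (os , ts) (os′ , ts′) h =
    cong₂ _,_ (lookup-ext os os′ (h ∘ inj₁)) (lookup-ext ts ts′ (h ∘ inj₂))

  -- A step of the model writes on every tape; writing back the scanned symbols gives the step
  -- without effect.
  idle : (Address → Symbol a) → Address → Act
  idle sc i = sc i , stay

  idle-perform : ∀ τ → perform (idle (scanned! τ)) τ ≡ τ
  idle-perform τ = tapes-ext _ τ λ i →
    trans (perform-! (idle (scanned! τ)) τ i) (cong (λ s → write s (τ ! i)) (scanned!-! τ i))

  only : Address → Act → (Address → Symbol a) → Address → Act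
  only t x sc i with t ≟ i
  ... | yes _ = x
  ... | no  _ = sc i , stay

  only-at : ∀ t x τ → perform (only t x (scanned! τ)) τ ! t ≡ writeAndMove x (τ ! t)
  only-at t x τ = trans (perform-! (only t x (scanned! τ)) τ t) (cong (λ y → writeAndMove y (τ ! t)) lem)
    where
    lem : only t x (scanned! τ) t ≡ x
    lem with t ≟ t
    ... | yes _ = refl
    ... | no ¬p = ⊥-elim (¬p refl)

  only-off : ∀ t x τ i → t ≢ i → perform (only t x (scanned! τ)) τ ! i ≡ τ ! i
  only-off t x τ i t≢i = trans (perform-! (only t x (scanned! τ)) τ i) (trans (cong (λ y → writeAndMove y (τ ! i)) lem) (cong (λ s → write s (τ ! i)) (scanned!-! τ i)))
    where
    lem : only t x (scanned! τ) i ≡ (scanned! τ i , stay)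
    lem with t ≟ i
    ... | yes p = ⊥-elim (t≢i p)
    ... | no  _ = refl

  open Frag

  mapI : ∀ {S S′} → (S → S′) → Instr S → Instr S′
  mapI f done       = done
  mapI f (go s u v) = go (f s) u v
  mapI f (ask i s)  = ask i (f s)

  -- `done` costs no time: where a fragment is done, the instruction `k` is issued in its place.
  -- Thus the time of a sequence is exactly the sum of the times.
  orElse : ∀ {S S′} → (S → S′) → Instr S → Instr S′ → Instr S′
  orElse f done       k = k
  orElse f (go s u v) k = go (f s) u v
  orElse f (ask i s)  k = ask i (f s)

  skipF : Frag
  skipF = record { State = Bool ; finite = Bool-finite ; start = false ; δ = λ _ _ _ → done }

  atomF : Address → ((Address → Symbol a) → Act) → Frag
  atomF t f = record { State = Bool ; finite = Bool-finite ; start = false ; δ = d }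
    where
    d : Bool → Vec (Symbol a) o → Vec (Symbol a) (suc e) → Instr Bool
    d false os ts = goBy true (only t (f (scan os ts)) (scan os ts))
    d true  os ts = done

  seqF : Frag → Frag → Frag
  seqF P Q = record { State = State P ⊎ State Q ; finite = ⊎-finite (finite P) (finite Q) ; start = inj₁ (start P) ; δ = d }
    where
    d : State P ⊎ State Q → Vec (Symbol a) o → Vec (Symbol a) (suc e) → Instr (State P ⊎ State Q)
    d (inj₁ s) os ts = orElse inj₁ (δ P s os ts) (mapI inj₂ (δ Q (start Q) os ts))
    d (inj₂ s) os ts = mapI inj₂ (δ Q s os ts)

  ifF : Address → (Symbol a → Bool) → Frag → Frag → Frag
  ifF i p P Q = record { State = Maybe (State P ⊎ State Q) ; finite = Maybe-finite (⊎-finite (finite P) (finite Q)) ; start = nothing ; δ = d }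
    where
    d : Maybe (State P ⊎ State Q) → Vec (Symbol a) o → Vec (Symbol a) (suc e) → Instr (Maybe (State P ⊎ State Q))
    -- The test takes no step, since the first instruction of the chosen branch is issued at once.
    d nothing os ts = if p (scan os ts i) then mapI (just ∘ inj₁) (δ P (start P) os ts) else mapI (just ∘ inj₂) (δ Q (start Q) os ts)
    d (just (inj₁ s)) os ts = mapI (just ∘ inj₁) (δ P s os ts)
    d (just (inj₂ s)) os ts = mapI (just ∘ inj₂) (δ Q s os ts)

  whileF : Address → Address → (Symbol a → Symbol a → Bool) → Frag → Frag
  whileF i j p P = record { State = Maybe (State P) ; finite = Maybe-finite (finite P) ; start = nothing ; δ = d }
    where
    d : Maybe (State P) → Vec (Symbol a) o → Vec (Symbol a) (suc e) → Instr (Maybe (State P))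
    -- Each round has two idle steps, one into the body and one back to the test. They keep the
    -- transition from unfolding into itself when the body is `done` at once.
    d nothing  os ts = if p (scan os ts i) (scan os ts j) then goBy (just (start P)) (idle (scan os ts)) else done
    d (just s) os ts = orElse just (δ P s os ts) (goBy nothing (idle (scan os ts)))

  askF : Fin o → Frag
  askF i = record { State = Bool ; finite = Bool-finite ; start = false ; δ = d }
    where
    d : Bool → Vec (Symbol a) o → Vec (Symbol a) (suc e) → Instr Bool
    d false os ts = ask i true
    d true  os ts = done

  -- A deep embedding, so that specifications mention programs and not the machines they denote.
  infixr 5 _⨟_
  data Cmd : Set₁ where
    skip   : Cmd
    atom   : Address → ((Address → Symbol a) → Act) → Cmd
    _⨟_    : Cmd → Cmd → Cmd
    ifTop  : Address → (Symbol a → Bool) → Cmd → Cmd → Cmd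
    while₂ : Address → Address → (Symbol a → Symbol a → Bool) → Cmd → Cmd
    query′ : Fin o → Cmd
    embed  : Frag → Cmd

  frag : Cmd → Frag
  frag skip             = skipF
  frag (atom t f)       = atomF t f
  frag (P ⨟ Q)          = seqF (frag P) (frag Q)
  frag (ifTop i p P Q)  = ifF i p (frag P) (frag Q)
  frag (while₂ i j p P) = whileF i j p (frag P)
  frag (query′ i)       = askF i
  frag (embed F)        = F

  module _ (φ : Oracles o) where

    reply : Fin o → Tape a → Tape a
    reply i t = load (encode𝔻 (φ i (length (contents t))))

    data Run (P : Frag) : State P → Tapes → ℕ → Tapes → Set where
      stop : ∀ {s os ts} → δ P s (Vec.map Tape.scanned os) (Vec.map Tape.scanned ts) ≡ done → Run P s (os , ts) 0 (os , ts)
      go   : ∀ {s s′ u v os ts t τ′} → δ P s (Vec.map Tape.scanned os) (Vec.map Tape.scanned ts) ≡ go s′ u v →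
             Run P s′ (Vec.zipWith writeAndMove u os , Vec.zipWith writeAndMove v ts) t τ′ → Run P s (os , ts) (suc t) τ′
      ask  : ∀ {s s′ i os ts t τ′} → δ P s (Vec.map Tape.scanned os) (Vec.map Tape.scanned ts) ≡ ask i s′ →
             Run P s′ (os Vec.[ i ]%= reply i , ts) t τ′ → Run P s (os , ts) (suc t) τ′

    Run-map : ∀ {P Q} (f : State P → State Q) → (∀ s os ts → δ Q (f s) os ts ≡ mapI f (δ P s os ts)) →
              ∀ {s τ t τ′} → Run P s τ t τ′ → Run Q (f s) τ t τ′
    Run-map f h (stop eq)  = stop (trans (h _ _ _) (cong (mapI f) eq))
    Run-map f h (go eq r)  = go (trans (h _ _ _) (cong (mapI f) eq)) (Run-map f h r)
    Run-map f h (ask eq r) = ask (trans (h _ _ _) (cong (mapI f) eq)) (Run-map f h r)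

    -- Run P from a state of Q that behaves like the start of P.
    Run-enter : ∀ {P Q} (f : State P → State Q) → (∀ s os ts → δ Q (f s) os ts ≡ mapI f (δ P s os ts)) →
                ∀ {q s os ts t τ′} → δ Q q (Vec.map Tape.scanned os) (Vec.map Tape.scanned ts) ≡ mapI f (δ P s (Vec.map Tape.scanned os) (Vec.map Tape.scanned ts)) →
                Run P s (os , ts) t τ′ → Run Q q (os , ts) t τ′
    Run-enter f h eq′ (stop eq)  = stop (trans eq′ (cong (mapI f) eq))
    Run-enter f h eq′ (go eq r)  = go (trans eq′ (cong (mapI f) eq)) (Run-map f h r)
    Run-enter f h eq′ (ask eq r) = ask (trans eq′ (cong (mapI f) eq)) (Run-map f h r)

    Run-⨟ : ∀ {P Q s τ t τ′ t′ τ″} → Run P s τ t τ′ → Run Q (start Q) τ′ t′ τ″ → Run (seqF P Q) (inj₁ s) τ (t ℕ.+ t′) τ″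
    Run-⨟ {P} {Q} (stop eq)  r = Run-enter inj₂ (λ _ _ _ → refl) (cong (λ x → orElse inj₁ x (mapI inj₂ (δ Q (start Q) _ _))) eq) r
    Run-⨟ {P} {Q} (go eq p)  r = go (cong (λ x → orElse inj₁ x (mapI inj₂ (δ Q (start Q) _ _))) eq) (Run-⨟ p r)
    Run-⨟ {P} {Q} (ask eq p) r = ask (cong (λ x → orElse inj₁ x (mapI inj₂ (δ Q (start Q) _ _))) eq) (Run-⨟ p r)

    Run-idle : ∀ {P s s′ τ t τ′} → δ P s (Vec.map Tape.scanned (proj₁ τ)) (Vec.map Tape.scanned (proj₂ τ)) ≡ goBy s′ (idle (scanned! τ)) →
               Run P s′ τ t τ′ → Run P s τ (suc t) τ′
    Run-idle {P} {s} {s′} {τ} {t} {τ′} eq r = go eq (subst (λ x → Run P s′ x t τ′) (sym (idle-perform τ)) r)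

    -- F runs P as a subroutine through f and then idles into s₀.
    Run-call : ∀ {P F} (f : State P → State F) s₀ →
               (∀ s os ts → δ F (f s) os ts ≡ orElse f (δ P s os ts) (goBy s₀ (idle (scan os ts)))) →
               ∀ {s τ t τ′ t′ τ″} → Run P s τ t τ′ → Run F s₀ τ′ t′ τ″ → Run F (f s) τ (t ℕ.+ suc t′) τ″
    Run-call f s₀ h {τ = τ} (stop eq)  r = Run-idle (trans (h _ _ _) (cong (λ x → orElse f x (goBy s₀ (idle (scanned! τ)))) eq)) r
    Run-call f s₀ h {τ = τ} (go eq q)  r = go (trans (h _ _ _) (cong (λ x → orElse f x (goBy s₀ (idle (scanned! τ)))) eq)) (Run-call f s₀ h q r)
    Run-call f s₀ h {τ = τ} (ask eq q) r = ask (trans (h _ _ _) (cong (λ x → orElse f x (goBy s₀ (idle (scanned! τ)))) eq)) (Run-call f s₀ h q r)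

    record Result (P : Cmd) (τ : Tapes) (T : ℕ) (Q : Tapes → Set) : Set where
      constructor result
      field
        {time}  : ℕ
        {final} : Tapes
        within  : time ℕ.≤ T
        run     : Run (frag P) (start (frag P)) τ time final
        holds   : Q final

    -- A record, because `frag` is not injective for unification: the command `P` could not be
    -- inferred from a `Run` of `frag P`.
    record Execution (P : Cmd) (τ : Tapes) (t : ℕ) (τ′ : Tapes) : Set where
      constructor execution
      field
        trace : Run (frag P) (start (frag P)) τ t τ′

    infixr 5 _then_
    _then_ : ∀ {P Q τ t τ′ t′ τ″} → Execution P τ t τ′ → Execution Q τ′ t′ τ″ → Execution (P ⨟ Q) τ (t ℕ.+ t′) τ″
    execution r then execution r′ = execution (Run-⨟ r r′)

    branch-true : ∀ {i p P Q τ t τ′} → p (scanned! τ i) ≡ true → Execution P τ t τ′ → Execution (ifTop i p P Q) τ t τ′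
    branch-true {P = P} {Q} eq (execution r) = execution (Run-enter (just ∘ inj₁) (λ _ _ _ → refl)
      (cong (λ b → if b then mapI (just ∘ inj₁) (δ (frag P) (start (frag P)) _ _) else mapI (just ∘ inj₂) (δ (frag Q) (start (frag Q)) _ _)) eq) r)

    branch-false : ∀ {i p P Q τ t τ′} → p (scanned! τ i) ≡ false → Execution Q τ t τ′ → Execution (ifTop i p P Q) τ t τ′
    branch-false {P = P} {Q} eq (execution r) = execution (Run-enter (just ∘ inj₂) (λ _ _ _ → refl)
      (cong (λ b → if b then mapI (just ∘ inj₁) (δ (frag P) (start (frag P)) _ _) else mapI (just ∘ inj₂) (δ (frag Q) (start (frag Q)) _ _)) eq) r)

    unpack : ∀ {P τ T Q} → Result P τ T Q → ∃[ t ] ∃[ τ′ ] (t ℕ.≤ T × Execution P τ t τ′ × Q τ′)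
    unpack (result w r h) = _ , _ , w , execution r , h

  -- Registers, and timed specifications of programs on them

  record Regs (n : ℕ) : Set where
    constructor regs
    field
      addr     : Fin n → Address
      addr-inj : ∀ {r s} → addr r ≡ addr s → r ≡ s

  open Regs public

  fresh : ∀ {n m} → Fin n → Vec (Fin n) m → Bool
  fresh i []      = true
  fresh i (j ∷ ι) = not (Fin.toℕ i ℕ.≡ᵇ Fin.toℕ j) ∧ fresh i ι

  -- A Boolean test, so that the injectivity of a concrete list of registers is proved by
  -- evaluation.
  distinct : ∀ {n m} → Vec (Fin n) m → Bool
  distinct []      = true
  distinct (i ∷ ι) = fresh i ι ∧ distinct ι

  fresh-sound : ∀ {n m} i (ι : Vec (Fin n) m) → T (fresh i ι) → ∀ r → lookup ι r ≢ i
  fresh-sound i (j ∷ ι) f zero refl with Fin.toℕ i ℕ.≡ᵇ Fin.toℕ i in eq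
  ... | false = subst T eq (ℕ.≡⇒≡ᵇ (Fin.toℕ i) (Fin.toℕ i) refl)
  fresh-sound i (j ∷ ι) f (suc r) = fresh-sound i ι (proj₂ (Equivalence.to T-∧ f)) r

  distinct-sound : ∀ {n m} (ι : Vec (Fin n) m) → T (distinct ι) → ∀ {r s} → lookup ι r ≡ lookup ι s → r ≡ s
  distinct-sound (i ∷ ι) d {zero}  {zero}  eq = refl
  distinct-sound (i ∷ ι) d {zero}  {suc s} eq = ⊥-elim (fresh-sound i ι (proj₁ (Equivalence.to T-∧ d)) s (sym eq))
  distinct-sound (i ∷ ι) d {suc r} {zero}  eq = ⊥-elim (fresh-sound i ι (proj₁ (Equivalence.to T-∧ d)) r eq)
  distinct-sound (i ∷ ι) d {suc r} {suc s} eq = cong suc (distinct-sound ι (proj₂ (Equivalence.to (T-∧ {fresh i ι}) d)) eq)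

  pick : ∀ {n m} → Regs n → (ι : Vec (Fin n) m) {d : T (distinct ι)} → Regs m
  pick ρ ι {d} = regs (λ r → addr ρ (lookup ι r)) (λ eq → distinct-sound ι d (addr-inj ρ eq))

  View : ∀ {n} → Regs n → Tapes → Store n → Set
  View ρ τ σ = ∀ r → τ ! addr ρ r shows get r σ

  -- Equality of tapes, not agreement in the sense of `shows`: the tapes simulated in place lie
  -- outside the registers, and their left halves count.
  Frame : ∀ {n} → Regs n → Tapes → Tapes → Set
  Frame ρ τ τ′ = ∀ i → (∀ r → addr ρ r ≢ i) → τ′ ! i ≡ τ ! i

  module _ {n} (ρ : Regs n) where

    pop : Fin n → Cmd
    pop r = atom (addr ρ r) (λ sc → sc (addr ρ r) , right)

    poke : (r i j k : Fin n) → (Symbol a → Symbol a → Symbol a → Symbol a) → Cmd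
    poke r i j k f = atom (addr ρ r) (λ sc → f (sc (addr ρ i)) (sc (addr ρ j)) (sc (addr ρ k)) , stay)

    -- Three sources are what a digit operation on two operands and a carry needs.
    pushF : (r i j k : Fin n) → (Symbol a → Symbol a → Symbol a → Symbol a) → Cmd
    pushF r i j k f = atom (addr ρ r) (λ sc → sc (addr ρ r) , left) ⨟ poke r i j k f

    push : Fin n → Symbol a → Cmd
    push r s = atom (addr ρ r) (λ sc → sc (addr ρ r) , left) ⨟ atom (addr ρ r) (λ sc → s , stay)

    copy : (r i : Fin n) → Cmd
    copy r i = pushF r i i i (λ x _ _ → x)

    when : Fin n → (Symbol a → Bool) → Cmd → Cmd → Cmd
    when r p P Q = ifTop (addr ρ r) p P Q

    while : Fin n → (Symbol a → Bool) → Cmd → Cmd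
    while r p P = while₂ (addr ρ r) (addr ρ r) (λ x _ → p x) P

  module Semantics (φ : Oracles o) where

    -- Total correctness with an upper bound on the time. Registers are known only up to `shows`, so
    -- whatever earlier pops left behind to the left of a head is irrelevant.
    record Spec {n} (ρ : Regs n) (P : Cmd) (σ : Store n) (T : ℕ) (σ′ : Store n) : Set where
      constructor spec
      field
        exec : ∀ τ → View ρ τ σ → Result φ P τ T (λ τ′ → View ρ τ′ σ′ × Frame ρ τ τ′)

    open Spec public

    module _ {n} {ρ : Regs n} where

      relax : ∀ {P σ T T′ σ′} → Spec ρ P σ T σ′ → T ℕ.≤ T′ → Spec ρ P σ T′ σ′
      relax S T≤T′ = spec λ τ v → let result w r h = exec S τ v in result (ℕ.≤-trans w T≤T′) r h

      infixl 6 _▸_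
      _▸_ : ∀ {P σ T σ′ σ″} → Spec ρ P σ T σ′ → σ′ ≡ σ″ → Spec ρ P σ T σ″
      S ▸ refl = S

      infixr 5 _⟫_
      _⟫_ : ∀ {P Q σ T T′ σ′ σ″} → Spec ρ P σ T σ′ → Spec ρ Q σ′ T′ σ″ → Spec ρ (P ⨟ Q) σ (T ℕ.+ T′) σ″
      _⟫_ S S′ = spec λ τ v →
        let result w r (v′ , f) = exec S τ v
            result w′ r′ (v″ , f′) = exec S′ _ v′
        in result (ℕ.+-mono-≤ w w′) (Run-⨟ φ r r′) (v″ , λ i ∉ → trans (f′ i ∉) (f i ∉))

      via : ∀ {P Q σ T T′ σ″} σ′ → Spec ρ P σ T σ′ → Spec ρ Q σ′ T′ σ″ → Spec ρ (P ⨟ Q) σ (T ℕ.+ T′) σ″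
      via σ′ = _⟫_

      skip-spec : ∀ {σ} → Spec ρ skip σ 0 σ
      skip-spec = spec λ τ v → result z≤n (stop refl) (v , λ _ _ → refl)

      view-top : ∀ {τ σ} → View ρ τ σ → ∀ r → scanned! τ (addr ρ r) ≡ hd (get r σ)
      view-top {τ} v r = trans (scanned!-! τ (addr ρ r)) (shows-top (v r))

      if-true : ∀ {σ T σ′ P Q} r {p} → p (hd (get r σ)) ≡ true → Spec ρ P σ T σ′ → Spec ρ (ifTop (addr ρ r) p P Q) σ T σ′
      if-true {P = P} {Q} r {p} eq S = spec λ τ v → let result w run h = exec S τ v in
        result w (Run-enter φ (just ∘ inj₁) (λ _ _ _ → refl)
          (cong (λ b → if b then mapI (just ∘ inj₁) (δ (frag P) (start (frag P)) _ _) else mapI (just ∘ inj₂) (δ (frag Q) (start (frag Q)) _ _))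
            (trans (cong p (view-top {τ} v r)) eq)) run) h

      if-false : ∀ {σ T σ′ P Q} r {p} → p (hd (get r σ)) ≡ false → Spec ρ Q σ T σ′ → Spec ρ (ifTop (addr ρ r) p P Q) σ T σ′
      if-false {P = P} {Q} r {p} eq S = spec λ τ v → let result w run h = exec S τ v in
        result w (Run-enter φ (just ∘ inj₂) (λ _ _ _ → refl)
          (cong (λ b → if b then mapI (just ∘ inj₁) (δ (frag P) (start (frag P)) _ _) else mapI (just ∘ inj₂) (δ (frag Q) (start (frag Q)) _ _))
            (trans (cong p (view-top {τ} v r)) eq)) run) h

      while-stop : ∀ {σ P} r s {p} → p (hd (get r σ)) (hd (get s σ)) ≡ false → Spec ρ (while₂ (addr ρ r) (addr ρ s) p P) σ 0 σ
      while-stop {P = P} r s {p} eq = spec λ τ v →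
        result z≤n (stop (cong (λ b → if b then goBy (just (start (frag P))) (idle (scanned! τ)) else done)
          (trans (cong₂ p (view-top {τ} v r) (view-top {τ} v s)) eq))) (v , λ _ _ → refl)

      while-step : ∀ {σ P T σ′ T′ σ″} r s {p} → p (hd (get r σ)) (hd (get s σ)) ≡ true → Spec ρ P σ T σ′ →
                   Spec ρ (while₂ (addr ρ r) (addr ρ s) p P) σ′ T′ σ″ →
                   Spec ρ (while₂ (addr ρ r) (addr ρ s) p P) σ (2 ℕ.+ T ℕ.+ T′) σ″
      while-step {P = P} {T} {T′ = T′} r s {p} eq S S′ = spec λ τ v →
        let result {t} w run (v′ , f) = exec S τ v
            result {t′} w′ run′ (v″ , f′) = exec S′ _ v′
        in result (subst (ℕ._≤ 2 ℕ.+ T ℕ.+ T′) (cong suc (sym (ℕ.+-suc t t′))) (s≤s (s≤s (ℕ.+-mono-≤ w w′))))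
             (Run-idle φ (cong (λ b → if b then goBy (just (start (frag P))) (idle (scanned! τ)) else done)
                 (trans (cong₂ p (view-top {τ} v r) (view-top {τ} v s)) eq))
               (Run-call φ just nothing (λ _ _ _ → refl) run run′))
             (v″ , λ i ∉ → trans (f′ i ∉) (f i ∉))

      View-set : ∀ {τ τ′ σ} r w → View ρ τ σ → (∀ i → addr ρ r ≢ i → τ′ ! i ≡ τ ! i) → τ′ ! addr ρ r shows w →
                 View ρ τ′ (set r w σ)
      View-set {τ} {τ′} {σ} r w v off at s with r Fin.≟ s
      ... | yes refl = subst (τ′ ! addr ρ r shows_) (sym (get-set r w σ)) at
      ... | no r≢s   = subst₂ _shows_ (sym (off (addr ρ s) (r≢s ∘ addr-inj ρ))) (sym (get-set-≢ r s w σ r≢s)) (v s)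

      pop-spec : ∀ {σ} r → Spec ρ (pop ρ r) σ 1 (set r (tl (get r σ)) σ)
      pop-spec {σ} r = spec λ τ v →
        let t = addr ρ r ; x = scanned! τ t , right in
        result ℕ.≤-refl (go refl (stop refl))
          (View-set {σ = σ} r (tl (get r σ)) v (only-off t x τ)
             (subst (_shows tl (get r σ))
               (sym (trans (only-at t x τ) (cong (λ s → move right (write s (τ ! t))) (scanned!-! τ t))))
               (shows-pop (v r)))
          , λ i ∉ → only-off t x τ i (∉ r))

      poke-spec : ∀ {σ} r i j k (f : Symbol a → Symbol a → Symbol a → Symbol a) →
        Spec ρ (poke ρ r i j k f) σ 1
          (set r (f (hd (get i σ)) (hd (get j σ)) (hd (get k σ)) ∷ tl (get r σ)) σ)
      poke-spec {σ} r i j k f = spec λ τ v →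
        let t = addr ρ r ; sc = scanned! τ ; y = f (sc (addr ρ i)) (sc (addr ρ j)) (sc (addr ρ k)) ; x = y , stay
            y≡ = trans (cong₂ (λ p q → f p q (sc (addr ρ k))) (view-top {τ} v i) (view-top {τ} v j)) (cong (f _ _) (view-top {τ} v k)) in
        result ℕ.≤-refl (go refl (stop refl))
          (View-set {σ = σ} r _ v (only-off t x τ)
             (subst₂ _shows_ (sym (only-at t x τ)) (cong (_∷ tl (get r σ)) y≡) (shows-write y (v r)))
          , λ i ∉ → only-off t x τ i (∉ r))

      -- The sources are read after the head of `r` has moved left, when `r` scans an unknown cell;
      -- they must therefore differ from `r`.
      pushF-spec : ∀ {σ} r i j k (f : Symbol a → Symbol a → Symbol a → Symbol a)
        {≢i : False (r Fin.≟ i)} {≢j : False (r Fin.≟ j)} {≢k : False (r Fin.≟ k)} →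
        Spec ρ (pushF ρ r i j k f) σ 2
          (set r (f (hd (get i σ)) (hd (get j σ)) (hd (get k σ)) ∷ get r σ) σ)
      pushF-spec {σ} r i j k f {≢i} {≢j} {≢k} = spec λ τ v →
        let r≢i = toWitnessFalse ≢i ; r≢j = toWitnessFalse ≢j ; r≢k = toWitnessFalse ≢k
            t = addr ρ r
            x = scanned! τ t , left
            τ₁ = perform (only t x (scanned! τ)) τ
            y = f (scanned! τ₁ (addr ρ i)) (scanned! τ₁ (addr ρ j)) (scanned! τ₁ (addr ρ k))
            x₁ = y , stay
            same : ∀ q → r ≢ q → scanned! τ₁ (addr ρ q) ≡ hd (get q σ)
            same q r≢q = trans (scanned!-! τ₁ (addr ρ q)) (trans (cong Tape.scanned (only-off t x τ (addr ρ q) (r≢q ∘ addr-inj ρ))) (shows-top (v q)))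
            y≡ = trans (cong₂ (λ p q → f p q (scanned! τ₁ (addr ρ k))) (same i r≢i) (same j r≢j)) (cong (f _ _) (same k r≢k))
            off = λ i t≢i → trans (only-off t x₁ τ₁ i t≢i) (only-off t x τ i t≢i)
        in result ℕ.≤-refl (go refl (go refl (stop refl)))
          (View-set {σ = σ} r _ v off
             (subst₂ _shows_ (sym (trans (only-at t x₁ τ₁) (cong (write y) (trans (only-at t x τ) (cong (λ s → move left (write s (τ ! t))) (scanned!-! τ t))))))
                (cong (_∷ get r σ) y≡) (shows-push y (v r)))
          , λ i ∉ → off i (∉ r))

      push-spec : ∀ {σ} r s →
        Spec ρ (push ρ r s) σ 2 (set r (s ∷ get r σ) σ)
      push-spec {σ} r s = spec λ τ v →
        let t = addr ρ r
            x = scanned! τ t , left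
            τ₁ = perform (only t x (scanned! τ)) τ
            x₁ = s , stay
            off = λ i t≢i → trans (only-off t x₁ τ₁ i t≢i) (only-off t x τ i t≢i)
        in result ℕ.≤-refl (go refl (go refl (stop refl)))
          (View-set {σ = σ} r _ v off
             (subst (_shows (s ∷ get r σ)) (sym (trans (only-at t x₁ τ₁) (cong (write s) (trans (only-at t x τ) (cong (λ s → move left (write s (τ ! t))) (scanned!-! τ t))))))
                (shows-push s (v r)))
          , λ i ∉ → off i (∉ r))

      copy-spec : ∀ {σ} r i {≢i : False (r Fin.≟ i)} → Spec ρ (copy ρ r i) σ 2 (set r (hd (get i σ) ∷ get r σ) σ)
      copy-spec r i {≢i} = pushF-spec r i i i (λ x _ _ → x) {≢i} {≢i} {≢i}

      query-spec : ∀ {σ} r i → addr ρ r ≡ inj₁ i →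
        Spec ρ (query′ i) σ 1 (set r (encode𝔻 (φ i (length (blankFreePrefix (get r σ))))) σ)
      query-spec {σ} r i eq = spec λ τ v →
        let τ′ = proj₁ τ Vec.[ i ]%= reply φ i , proj₂ τ
            hit : τ′ ! addr ρ r ≡ load (encode𝔻 (φ i (length (blankFreePrefix (get r σ)))))
            hit = trans (cong (τ′ !_) eq) (trans (Vec.lookup∘updateAt i (proj₁ τ))
                    (cong (λ w → load (encode𝔻 (φ i (length w))))
                      (trans (cong (λ j → contents (τ ! j)) (sym eq)) (shows-contents (v r)))))
            off : ∀ j → addr ρ r ≢ j → τ′ ! j ≡ τ ! j
            off = λ { (inj₁ j) ≢ → Vec.lookup∘updateAt′ j i (λ p → ≢ (trans eq (cong inj₁ (sym p)))) (proj₁ τ)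
                    ; (inj₂ j) ≢ → refl }
        in result ℕ.≤-refl (ask refl (stop refl))
             (View-set {τ} {τ′} {σ} r _ v off (subst (_shows _) (sym hit) (shows-load _)) , λ j ∉ → off j (∉ r))

      -- The frame rule: registers outside `ι` keep their contents because their tapes are outside
      -- the registers of the routine, where `Frame` preserves them.
      lift : ∀ {m P t} (ι : Vec (Fin n) m) {d : T (distinct ι)} {σ σ′} →
             Spec (pick ρ ι {d}) P (gather ι σ) t σ′ → Spec ρ P σ t (scatter ι σ′ σ)
      lift ι {d} {σ} {σ′} S = spec λ τ v →
        let result {final = τ′} w r (v′ , f) = exec S τ (λ s → subst (τ ! addr ρ (lookup ι s) shows_) (sym (get-gather ι σ s)) (v (lookup ι s)))
            view : View ρ τ′ (scatter ι σ′ σ)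
            view j = case-∈ j τ τ′ v v′ f (Fin.any? (λ s → lookup ι s Fin.≟ j))
        in result w r (view , λ i ∉ → f i (λ s → ∉ (lookup ι s)))
        where
        case-∈ : ∀ j τ τ′ → View ρ τ σ → View (pick ρ ι {d}) τ′ σ′ → Frame (pick ρ ι {d}) τ τ′ →
                 Dec (∃[ s ] lookup ι s ≡ j) → τ′ ! addr ρ j shows get j (scatter ι σ′ σ)
        case-∈ j τ τ′ v v′ f (yes (s , refl)) =
          subst (τ′ ! addr ρ (lookup ι s) shows_) (sym (get-scatter ι σ′ σ (distinct-sound ι d) s)) (v′ s)
        case-∈ j τ τ′ v v′ f (no ∉) =
          subst₂ _shows_ (sym (f (addr ρ j) (λ s eq → ∉ (s , addr-inj ρ eq)))) (sym (get-scatter-∉ ι σ′ σ j (λ s eq → ∉ (s , eq)))) (v j)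

  -- From fragments to oracle machines

  module _ (P : Frag) where

    -- State zero is a second copy of the start state.
    decode : Fin (suc (size (finite P))) → State P
    decode zero    = start P
    decode (suc i) = element (finite P) i

    translate : Instr (State P) → Action o (suc (size (finite P))) (suc e) a
    translate done       = halt
    translate (go s u v) = step (suc (index (finite P) s)) u v
    translate (ask i s)  = query i (suc (index (finite P) s))

    compile : OTM o
    compile = record
      { auxSymbols  = a
      ; extraStates = size (finite P)
      ; extraTapes  = e
      ; transition  = λ q os ts → translate (δ P (decode q) os ts)
      }

    compile-run : ∀ φ {s os ts t τ′} → Run φ P s (os , ts) t τ′ → ∀ q → decode q ≡ s →
                  ∃[ c ] (HaltsFrom compile φ (config q os ts) t c × Config.mainTapes c ≡ proj₂ τ′)
    compile-run φ (stop {os = os} {ts} eq) q refl =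
      config q os ts , halted (cong (λ x → act compile φ (config q os ts) (translate x)) eq) , refl
    compile-run φ (go {s′ = s′} {os = os} {ts} eq r) q refl =
      let c , h , m = compile-run φ r (suc (index (finite P) s′)) (element-index (finite P) s′) in
      c , steps (cong (λ x → act compile φ (config q os ts) (translate x)) eq) h , m
    compile-run φ (ask {s′ = s′} {os = os} {ts} eq r) q refl =
      let c , h , m = compile-run φ r (suc (index (finite P) s′)) (element-index (finite P) s′) in
      c , steps (cong (λ x → act compile φ (config q os ts) (translate x)) eq) h , m

  compile-outputs : ∀ P φ {w t τ′} → Execution φ P (Vec.replicate o (load []) , load w ∷ Vec.replicate e (load [])) t τ′ →
                    Outputs (compile (frag P)) φ w t (contents (τ′ ! inj₂ zero))
  compile-outputs P φ {w} {t} {τ′} (execution r) = finish (compile-run (frag P) φ r zero refl)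
    where
    head-lookup : ∀ {A : Set} {m} (v : Vec A (suc m)) → Vec.head v ≡ lookup v zero
    head-lookup (_ ∷ _) = refl
    finish : ∃[ c ] (HaltsFrom (compile (frag P)) φ (initial (compile (frag P)) w) t c × Config.mainTapes c ≡ proj₂ τ′) →
             Outputs (compile (frag P)) φ w t (contents (τ′ ! inj₂ zero))
    finish (c , h , m) = c , h , trans (cong (contents ∘ Vec.head) m) (cong contents (head-lookup (proj₂ τ′)))

-- `RunsInTime` speaks of every halting run. By determinism, a run that has been constructed and
-- bounded has the same length as any other.
HaltsFrom-deterministic : ∀ {d} {M : OTM d} {φ c t t′ c₁ c₂} → HaltsFrom M φ c t c₁ → HaltsFrom M φ c t′ c₂ → t ≡ t′
HaltsFrom-deterministic (halted _)   (halted _)   = refl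
HaltsFrom-deterministic (halted p)   (steps q _) with trans (sym p) q
... | ()
HaltsFrom-deterministic (steps p _)  (halted q) with trans (sym p) q
... | ()
HaltsFrom-deterministic (steps p h) (steps q k) with trans (sym p) q
... | refl = cong suc (HaltsFrom-deterministic h k)

-- Tapes kept as pairs of stacks

module Zippers {a : ℕ} where

  -- Each cell is preceded by a flag b1, so that cells holding blanks can be told from the end of the stack.
  code : List (Symbol a) → Word a
  code []      = []
  code (s ∷ w) = b1 ∷ s ∷ code w

  isLeft isRight isSep isMinus isPoint isOne isZero isDigit : Symbol a → Bool
  isLeft b0 = true
  isLeft _  = false
  isRight b1 = true
  isRight _  = false
  isSep sep = true
  isSep _   = false
  isMinus minus = true
  isMinus _     = false
  isPoint point = true
  isPoint _     = false
  isOne b1 = true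
  isOne _  = false
  isZero b0 = true
  isZero _  = false
  isDigit b0 = true
  isDigit b1 = true
  isDigit _  = false

  solid-ʳ++ : ∀ {u v : Word a} → Solid u → Solid v → Solid (u ʳ++ v)
  solid-ʳ++ []       q = q
  solid-ʳ++ (p ∷ ps) q = solid-ʳ++ ps (p ∷ q)

  -- The blank stands for `stay`, so a cleared direction cell means that nothing is pending; `sep`
  -- remains free to announce a query.
  direction : Move → Symbol a
  direction left  = b0
  direction right = b1
  direction stay  = blank

open Zippers

module Routines (a o e : ℕ) where
  open Fragments a o e public

  mv : Regs 2 → Cmd
  mv ρ = while ρ 0F nonBlank (copy ρ 1F 0F ⨟ pop ρ 0F)

  clear : Regs 1 → Cmd
  clear ρ = while ρ 0F nonBlank (pop ρ 0F)

  dup : Regs 3 → Cmd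
  dup ρ = mv (pick ρ (0F ∷ 2F ∷ [])) ⨟ while ρ 2F nonBlank (copy ρ 0F 2F ⨟ copy ρ 1F 2F ⨟ pop ρ 2F)

  clearCode : Regs 1 → Cmd
  clearCode ρ = while ρ 0F nonBlank (pop ρ 0F ⨟ pop ρ 0F)

  -- The scanned cell goes onto the side in register 2 and is replaced by the top cell of the side
  -- in register 0, or by a blank if that side is exhausted. Exchanging the sides gives the opposite
  -- move.
  shift : Regs 3 → Cmd
  shift ρ = copy ρ 2F 1F ⨟ push ρ 2F b1 ⨟
    when ρ 0F nonBlank (pop ρ 0F ⨟ poke ρ 1F 0F 0F 0F (λ x _ _ → x) ⨟ pop ρ 0F) (poke ρ 1F 0F 0F 0F (λ _ _ _ → blank))

  zmove : Regs 4 → Cmd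
  zmove ρ =
    when ρ 3F isLeft (shift (pick ρ (0F ∷ 1F ∷ 2F ∷ [])))
      (when ρ 3F isRight (shift (pick ρ (2F ∷ 1F ∷ 0F ∷ []))) skip)
    ⨟ poke ρ 3F 3F 3F 3F (λ _ _ _ → blank)

  readRest : Regs 2 → Cmd
  readRest ρ = while ρ 0F nonBlank (pop ρ 0F ⨟
    -- Cells beyond the first blank are not part of the contents. Discarding them empties the
    -- register, which also ends the loop.
    when ρ 0F nonBlank (copy ρ 1F 0F ⨟ pop ρ 0F) (pop ρ 0F ⨟ clearCode (pick ρ (0F ∷ []))))

  zread : Regs 3 → Cmd
  zread ρ = when ρ 0F nonBlank (copy ρ 2F 0F ⨟ readRest (pick ρ (1F ∷ 2F ∷ []))) (clearCode (pick ρ (1F ∷ [])))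

  fill : Regs 2 → Cmd
  fill ρ = while ρ 0F nonBlank (copy ρ 1F 0F ⨟ push ρ 1F b1 ⨟ pop ρ 0F)

  -- `fill` reverses, so the word to be loaded has to be supplied in reversed order.
  zload : Regs 3 → Cmd
  zload ρ = fill (pick ρ (0F ∷ 2F ∷ [])) ⨟ pop ρ 2F ⨟ poke ρ 1F 2F 2F 2F (λ x _ _ → x) ⨟ pop ρ 2F

  module Correct (φ : Oracles o) where
    open Semantics φ public

    mv-spec : ∀ ρ {u} v → Solid u → Spec ρ (mv ρ) (u , v , tt) (length u ℕ.* 5) ([] , u ʳ++ v , tt)
    mv-spec ρ v []      = while-stop 0F 0F refl
    mv-spec ρ v (_∷_ {s} p ps) =
      while-step 0F 0F p (copy-spec 1F 0F ⟫ pop-spec 0F) (mv-spec ρ (s ∷ v) ps)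

    clear-spec : ∀ ρ {u} → Solid u → Spec ρ (clear ρ) (u , tt) (length u ℕ.* 3) ([] , tt)
    clear-spec ρ []       = while-stop 0F 0F refl
    clear-spec ρ (p ∷ ps) = while-step 0F 0F p (pop-spec 0F) (clear-spec ρ ps)

    clearCode-spec : ∀ ρ u → Spec ρ (clearCode ρ) (code u , tt) (length u ℕ.* 4) ([] , tt)
    clearCode-spec ρ []       = while-stop 0F 0F refl
    clearCode-spec ρ (x ∷ u) = while-step 0F 0F refl (pop-spec 0F ⟫ pop-spec 0F) (clearCode-spec ρ u)

    dup-spec : ∀ ρ {u} → Solid u → Spec ρ (dup ρ) (u , [] , [] , tt) (length u ℕ.* 12) (u , u , [] , tt)
    dup-spec ρ {u} su = relax
        (lift (0F ∷ 2F ∷ []) (mv-spec _ [] su) ⟫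
         subst (λ x → Spec ρ _ ([] , [] , reverse u , tt) (length (reverse u) ℕ.* 7) (x , x , [] , tt))
           (List.reverse-involutive u) (back (reverse u) [] (solid-ʳ++ su [])))
        (ℕ.≤-reflexive (trans (cong (λ l → length u ℕ.* 5 ℕ.+ l ℕ.* 7) (List.length-reverse u)) (sym (ℕ.*-distribˡ-+ (length u) 5 7))))
      where
      back : ∀ w v {A} → Solid w → Spec ρ (while ρ 2F nonBlank (copy ρ 0F 2F ⨟ copy ρ 1F 2F ⨟ pop ρ 2F)) (v , A , w , tt) (length w ℕ.* 7) (w ʳ++ v , w ʳ++ A , [] , tt)
      back [] v []       = while-stop 2F 2F refl
      back (s ∷ w) v (p ∷ ps) = while-step 2F 2F p (copy-spec 0F 2F ⟫ copy-spec 1F 2F ⟫ pop-spec 2F) (back w (s ∷ v) ps)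

    shift-spec : ∀ ρ l s r → Spec ρ (shift ρ) (code l , s ∷ [] , code r , tt) 7 (code (tl l) , hd l ∷ [] , code (s ∷ r) , tt)
    shift-spec ρ []      s r =
      relax (copy-spec 2F 1F ⟫ push-spec 2F b1 ⟫ if-false 0F refl (poke-spec 1F 0F 0F 0F (λ _ _ _ → blank))) (ℕ.m≤m+n 5 2)
    shift-spec ρ (x ∷ l) s r =
      copy-spec 2F 1F ⟫ push-spec 2F b1 ⟫
      if-true 0F refl (pop-spec 0F ⟫ poke-spec 1F 0F 0F 0F (λ x _ _ → x) ⟫ pop-spec 0F)

    zip : Tape a → Symbol a → Store 4
    zip (tape l s r) d = code l , s ∷ [] , code r , d ∷ [] , tt

    zmove-spec : ∀ ρ t m → Spec ρ (zmove ρ) (zip t (direction m)) 8 (zip (move m t) blank)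
    zmove-spec ρ (tape []      s r) left =
      if-true 3F refl (lift (0F ∷ 1F ∷ 2F ∷ []) (shift-spec _ [] s r)) ⟫ poke-spec 3F 3F 3F 3F (λ _ _ _ → blank)
    zmove-spec ρ (tape (x ∷ l) s r) left =
      if-true 3F refl (lift (0F ∷ 1F ∷ 2F ∷ []) (shift-spec _ (x ∷ l) s r)) ⟫ poke-spec 3F 3F 3F 3F (λ _ _ _ → blank)
    zmove-spec ρ (tape l s [])      right =
      if-false 3F refl (if-true 3F refl (lift (2F ∷ 1F ∷ 0F ∷ []) (shift-spec _ [] s l))) ⟫ poke-spec 3F 3F 3F 3F (λ _ _ _ → blank)
    zmove-spec ρ (tape l s (x ∷ r)) right =
      if-false 3F refl (if-true 3F refl (lift (2F ∷ 1F ∷ 0F ∷ []) (shift-spec _ (x ∷ r) s l))) ⟫ poke-spec 3F 3F 3F 3F (λ _ _ _ → blank)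
    zmove-spec ρ (tape l s r) stay =
      relax (if-false 3F refl (if-false 3F refl skip-spec) ⟫ poke-spec 3F 3F 3F 3F (λ _ _ _ → blank)) (ℕ.m≤m+n 1 7)

    readRest-spec : ∀ ρ r A → Spec ρ (readRest ρ) (code r , A , tt) (length r ℕ.* 6) ([] , blankFreePrefix r ʳ++ A , tt)
    readRest-spec ρ [] A = while-stop 0F 0F refl
    readRest-spec ρ (blank ∷ r) A = relax
      (while-step 0F 0F refl (pop-spec 0F ⟫ if-false 0F refl (pop-spec 0F ⟫ lift (0F ∷ []) (clearCode-spec _ r))) (while-stop 0F 0F refl))
      (ℕ.≤-trans (ℕ.≤-reflexive (ℕ.+-identityʳ _)) (ℕ.+-mono-≤ {4} {6} (ℕ.m≤m+n 4 2) (ℕ.*-monoʳ-≤ (length r) (ℕ.m≤m+n 4 2))))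
    readRest-spec ρ (b0 ∷ r) A =
      while-step 0F 0F refl (pop-spec 0F ⟫ if-true 0F refl (copy-spec 1F 0F ⟫ pop-spec 0F)) (readRest-spec ρ r (b0 ∷ A))
    readRest-spec ρ (b1 ∷ r) A =
      while-step 0F 0F refl (pop-spec 0F ⟫ if-true 0F refl (copy-spec 1F 0F ⟫ pop-spec 0F)) (readRest-spec ρ r (b1 ∷ A))
    readRest-spec ρ (minus ∷ r) A =
      while-step 0F 0F refl (pop-spec 0F ⟫ if-true 0F refl (copy-spec 1F 0F ⟫ pop-spec 0F)) (readRest-spec ρ r (minus ∷ A))
    readRest-spec ρ (point ∷ r) A =
      while-step 0F 0F refl (pop-spec 0F ⟫ if-true 0F refl (copy-spec 1F 0F ⟫ pop-spec 0F)) (readRest-spec ρ r (point ∷ A))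
    readRest-spec ρ (sep ∷ r) A =
      while-step 0F 0F refl (pop-spec 0F ⟫ if-true 0F refl (copy-spec 1F 0F ⟫ pop-spec 0F)) (readRest-spec ρ r (sep ∷ A))
    readRest-spec ρ (aux k ∷ r) A =
      while-step 0F 0F refl (pop-spec 0F ⟫ if-true 0F refl (copy-spec 1F 0F ⟫ pop-spec 0F)) (readRest-spec ρ r (aux k ∷ A))

    zread-solid : ∀ ρ s r A → nonBlank s ≡ true →
      Spec ρ (zread ρ) (s ∷ [] , code r , A , tt) (2 ℕ.+ length r ℕ.* 6) (s ∷ [] , [] , blankFreePrefix r ʳ++ (s ∷ A) , tt)
    zread-solid ρ s r A eq = if-true 0F eq (copy-spec 2F 0F ⟫ lift (1F ∷ 2F ∷ []) (readRest-spec _ r (s ∷ A)))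

    zread-spec : ∀ ρ s r A → Spec ρ (zread ρ) (s ∷ [] , code r , A , tt) (2 ℕ.+ length r ℕ.* 6)
                               (s ∷ [] , [] , blankFreePrefix (s ∷ r) ʳ++ A , tt)
    zread-spec ρ blank r A = relax (if-false 0F refl (lift (1F ∷ []) (clearCode-spec _ r)))
      (ℕ.≤-trans (ℕ.*-monoʳ-≤ (length r) (ℕ.m≤m+n 4 2)) (ℕ.m≤n+m _ 2))
    zread-spec ρ b0      r A = zread-solid ρ b0 r A refl
    zread-spec ρ b1      r A = zread-solid ρ b1 r A refl
    zread-spec ρ minus   r A = zread-solid ρ minus r A refl
    zread-spec ρ point   r A = zread-solid ρ point r A refl
    zread-spec ρ sep     r A = zread-solid ρ sep r A refl
    zread-spec ρ (aux k) r A = zread-solid ρ (aux k) r A refl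

    fill-spec : ∀ ρ {u} v → Solid u → Spec ρ (fill ρ) (u , code v , tt) (length u ℕ.* 7) ([] , code (u ʳ++ v) , tt)
    fill-spec ρ v []      = while-stop 0F 0F refl
    fill-spec ρ v (_∷_ {s} p ps) =
      while-step 0F 0F p (copy-spec 1F 0F ⟫ push-spec 1F b1 ⟫ pop-spec 0F) (fill-spec ρ (s ∷ v) ps)

    zload-spec : ∀ ρ {u y} x w → Solid u → reverse u ≡ x ∷ w →
      Spec ρ (zload ρ) (u , y ∷ [] , [] , tt) (length u ℕ.* 7 ℕ.+ 3) ([] , x ∷ [] , code w , tt)
    zload-spec ρ {u} {y} x w su eq =
      subst (λ v → Spec ρ _ (u , y ∷ [] , [] , tt) (length u ℕ.* 7) ([] , y ∷ [] , code v , tt)) eq (lift (0F ∷ 2F ∷ []) (fill-spec _ [] su)) ⟫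
      (pop-spec 2F ⟫ poke-spec 1F 2F 2F 2F (λ x _ _ → x) ⟫ pop-spec 2F)

-- Simulation of an oracle machine, step by step

spread : ∀ {a} → Tape a → ℕ
spread (tape l _ r) = length l ℕ.+ length r

spreads : ∀ {a n} → Vec (Tape a) n → ℕ
spreads = Vec.sum ∘ Vec.map spread

-- The spread governs the cost of clearing and reading zippers, and thereby the time of the
-- handlers; this is what bounds its growth along a run.
spread-move : ∀ {a} m (t : Tape a) → spread (move m t) ℕ.≤ suc (spread t)
spread-move left  (tape []      s r)       = ℕ.≤-refl
spread-move left  (tape (x ∷ l) s r)       = ℕ.≤-trans (ℕ.≤-reflexive (ℕ.+-suc (length l) (length r))) (ℕ.n≤1+n _)
spread-move right (tape l       s [])      = ℕ.≤-refl
spread-move right (tape l       s (x ∷ r)) = ℕ.s≤s (ℕ.+-monoʳ-≤ (length l) (ℕ.n≤1+n _))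
spread-move stay  t                        = ℕ.n≤1+n _

spreads-step : ∀ {a n} (u : Vec (Symbol a × Move) n) zs → spreads (Vec.zipWith writeAndMove u zs) ℕ.≤ n ℕ.+ spreads zs
spreads-step []            []       = z≤n
spreads-step {n = suc n} ((s , m) ∷ u) (z ∷ zs) = ℕ.≤-trans
  (ℕ.+-mono-≤ (spread-move m (write s z)) (spreads-step u zs))
  (s≤s (ℕ.≤-reflexive (trans (sym (ℕ.+-assoc (spread z) n (spreads zs)))
    (trans (cong (ℕ._+ spreads zs) (ℕ.+-comm (spread z) n)) (ℕ.+-assoc n (spread z) (spreads zs))))))

module Simulation {d : ℕ} (M : OTM d) (o w : ℕ) where
  open OTM M renaming (auxSymbols to a; extraTapes to x)
  open Routines a o (w ℕ.+ x)
  open Frag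

  -- The extra tapes of M come last among the main tapes of the simulator and are used as they are.
  raw : Fin x → Address
  raw k = inj₂ (suc w ↑ʳ k)

  blanks : ∀ {n} → Vec (Symbol a) n
  blanks = Vec.replicate _ blank

  -- A step of M becomes one step of the simulator followed by a run of `H`. The step writes the new
  -- symbols into the registers `os` and the moves into the registers `dir`; `H` then carries the
  -- moves out on the zippers, or answers the query. Index zero belongs to the first main tape,
  -- index `suc i` to oracle tape `i`.
  module Machine {n} (ρ : Regs n) (os dir : Fin (suc d) → Fin n) (H : Cmd) where

    workAct : Vec Act (suc d) → (Address → Symbol a) → Address → Act
    workAct u sc i with Fin.any? (λ r → addr ρ (os r) ≟ i) | Fin.any? (λ r → addr ρ (dir r) ≟ i)
    ... | yes (r , _) | _           = proj₁ (lookup u r) , stay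
    ... | no _        | yes (r , _) = direction (proj₂ (lookup u r)) , stay
    ... | no _        | no _        = sc i , stay

    stepAct : Vec Act (suc d) → Vec Act x → (Address → Symbol a) → Address → Act
    stepAct u v sc (inj₁ j) = workAct u sc (inj₁ j)
    stepAct u v sc (inj₂ j) = [ (λ _ → workAct u sc (inj₂ j)) , lookup v ]′ (splitAt (suc w) j)

    instr : (Address → Symbol a) → Action d states tapes a → Instr (Fin states ⊎ (Fin states × State (frag H)))
    instr sc halt               = done
    instr sc (step q u (v ∷ vs)) = goBy (inj₂ (q , start (frag H))) (stepAct (v ∷ u) vs sc)
    instr sc (query i q)        = goBy (inj₂ (q , start (frag H))) (only (addr ρ (dir (suc i))) (sep , stay) sc)

    action : (Address → Symbol a) → Fin states → Action d states tapes a
    action sc q = transition q (tabulate (λ i → sc (addr ρ (os (suc i))))) (sc (addr ρ (os zero)) ∷ tabulate (sc ∘ raw))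

    simulate : Frag
    simulate = record
      -- `inj₁ q` is about to perform a step of M; `inj₂ (q , s)` runs the handler in its state `s`
      -- and will resume in `q`.
      { State  = Fin states ⊎ (Fin states × State (frag H))
      ; finite = ⊎-finite (Fin-finite states) (×-finite (Fin-finite states) (finite (frag H)))
      ; start  = inj₁ zero
      ; δ      = d′
      }
      where
      d′ : Fin states ⊎ (Fin states × State (frag H)) → Vec (Symbol a) o → Vec (Symbol a) (suc (w ℕ.+ x)) →
           Instr (Fin states ⊎ (Fin states × State (frag H)))
      d′ (inj₁ q)       osy tsy = instr (scan osy tsy) (action (scan osy tsy) q)
      d′ (inj₂ (q , s)) osy tsy = orElse (λ s → inj₂ (q , s)) (δ (frag H) s osy tsy) (goBy (inj₁ q) (idle (scan osy tsy)))

    module Proof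
      (apart : ∀ r k → addr ρ r ≢ raw k)
      (os-inj : ∀ {i j} → os i ≡ os j → i ≡ j) (dir-inj : ∀ {i j} → dir i ≡ dir j → i ≡ j) (os≢dir : ∀ i j → os i ≢ dir j)
      (φ : Oracles d) (ψ : Oracles o)
      (enc : Vec (Tape a) (suc d) → Vec (Symbol a) (suc d) → Store n)
      (enc-os : ∀ zs ds i → get (os i) (enc zs ds) ≡ Tape.scanned (lookup zs i) ∷ [])
      (enc-dir : ∀ zs ds i → get (dir i) (enc zs ds) ≡ lookup ds i ∷ [])
      -- The other registers depend neither on the scanned symbols nor on the directions, so writing
      -- both leads from one encoding to another.
      (enc-rest : ∀ r → (∀ i → os i ≢ r) → (∀ i → dir i ≢ r) → ∀ (u : Vec (Symbol a) (suc d)) zs ds ds′ →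
                  get r (enc (Vec.zipWith write u zs) ds′) ≡ get r (enc zs ds))
      -- `B` bounds the time of the handler in terms of the total spread, `D` the growth of the
      -- total spread in one step of M. The `suc d` heads that move in a step account for `d < D`.
      (B : ℕ → ℕ) (B-mono : ∀ {m k} → m ℕ.≤ k → B m ℕ.≤ B k) (D : ℕ) (d<D : d ℕ.< D)
      where
      open Correct ψ

      module Handled
        (H-move : ∀ zs ms → Spec ρ H (enc zs (Vec.map direction ms)) (B (spreads zs)) (enc (Vec.zipWith move ms zs) blanks))
        (H-query : ∀ zs i → Spec ρ H (enc zs (blanks [ suc i ]≔ sep)) (B (spreads zs)) (enc (zs [ suc i ]%= answer M φ i) blanks))
        (grow : ∀ zs i → spreads (zs [ suc i ]%= answer M φ i) ℕ.≤ D ℕ.+ spreads zs)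
        where

        RawOk : Tapes → Vec (Tape a) x → Set
        RawOk τ ms = ∀ k → τ ! raw k ≡ lookup ms k

        workAct-os : ∀ u sc r → workAct u sc (addr ρ (os r)) ≡ (proj₁ (lookup u r) , stay)
        workAct-os u sc r with Fin.any? (λ s → addr ρ (os s) ≟ addr ρ (os r)) | Fin.any? (λ s → addr ρ (dir s) ≟ addr ρ (os r))
        ... | yes (s , eq) | _ = cong (λ q → proj₁ (lookup u q) , stay) (os-inj (addr-inj ρ eq))
        ... | no ¬p        | _ = ⊥-elim (¬p (r , refl))

        workAct-dir : ∀ u sc r → workAct u sc (addr ρ (dir r)) ≡ (direction (proj₂ (lookup u r)) , stay)
        workAct-dir u sc r with Fin.any? (λ s → addr ρ (os s) ≟ addr ρ (dir r)) | Fin.any? (λ s → addr ρ (dir s) ≟ addr ρ (dir r))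
        ... | yes (s , eq) | _            = ⊥-elim (os≢dir s r (addr-inj ρ eq))
        ... | no _         | yes (s , eq) = cong (λ q → direction (proj₂ (lookup u q)) , stay) (dir-inj (addr-inj ρ eq))
        ... | no _         | no ¬p        = ⊥-elim (¬p (r , refl))

        workAct-rest : ∀ u sc r → (∀ i → os i ≢ r) → (∀ i → dir i ≢ r) → workAct u sc (addr ρ r) ≡ (sc (addr ρ r) , stay)
        workAct-rest u sc r ¬o ¬d with Fin.any? (λ s → addr ρ (os s) ≟ addr ρ r) | Fin.any? (λ s → addr ρ (dir s) ≟ addr ρ r)
        ... | yes (s , eq) | _            = ⊥-elim (¬o s (addr-inj ρ eq))
        ... | no _         | yes (s , eq) = ⊥-elim (¬d s (addr-inj ρ eq))
        ... | no _         | no _         = refl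

        stepAct-work : ∀ u v sc i → (∀ k → i ≢ raw k) → stepAct u v sc i ≡ workAct u sc i
        stepAct-work u v sc (inj₁ j) ≢raw = refl
        stepAct-work u v sc (inj₂ j) ≢raw with splitAt (suc w) j in eq
        ... | inj₁ _ = refl
        ... | inj₂ k = ⊥-elim (≢raw k (cong inj₂ (sym (Fin.splitAt⁻¹-↑ʳ {suc w} {x} {j} eq))))

        stepAct-raw : ∀ u v sc k → stepAct u v sc (raw k) ≡ lookup v k
        stepAct-raw u v sc k = cong [ (λ _ → workAct u sc (raw k)) , lookup v ]′ (Fin.splitAt-↑ʳ (suc w) x k)

        step-view : ∀ u v τ zs ds → View ρ τ (enc zs ds) →
          View ρ (perform (stepAct u v (scanned! τ)) τ) (enc (Vec.zipWith write (Vec.map proj₁ u) zs) (Vec.map (direction ∘ proj₂) u))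
        step-view u v τ zs ds vw r with Fin.any? (λ i → os i Fin.≟ r) | Fin.any? (λ i → dir i Fin.≟ r)
        ... | yes (i , refl) | _ = subst₂ _shows_
              (sym (trans (perform-! (stepAct u v (scanned! τ)) τ (addr ρ (os i)))
                (cong (λ y → writeAndMove y (τ ! addr ρ (os i))) (trans (stepAct-work u v (scanned! τ) _ (apart (os i))) (workAct-os u (scanned! τ) i)))))
              (trans (cong (λ y → proj₁ (lookup u i) ∷ tl y) (enc-os zs ds i))
                (sym (trans (enc-os _ _ i) (cong (λ y → Tape.scanned y ∷ []) (trans (Vec.lookup-zipWith write i (Vec.map proj₁ u) zs)
                  (cong (λ s → write s (lookup zs i)) (Vec.lookup-map i proj₁ u)))))))
              (shows-write (proj₁ (lookup u i)) (vw (os i)))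
        ... | no _ | yes (i , refl) = subst₂ _shows_
              (sym (trans (perform-! (stepAct u v (scanned! τ)) τ (addr ρ (dir i)))
                (cong (λ y → writeAndMove y (τ ! addr ρ (dir i))) (trans (stepAct-work u v (scanned! τ) _ (apart (dir i))) (workAct-dir u (scanned! τ) i)))))
              (trans (cong (λ y → direction (proj₂ (lookup u i)) ∷ tl y) (enc-dir zs ds i))
                (sym (trans (enc-dir _ _ i) (cong (_∷ []) (Vec.lookup-map i (direction ∘ proj₂) u)))))
              (shows-write (direction (proj₂ (lookup u i))) (vw (dir i)))
        ... | no ¬o | no ¬d = subst₂ _shows_
              (sym (trans (perform-! (stepAct u v (scanned! τ)) τ (addr ρ r))
                (trans (cong (λ y → writeAndMove y (τ ! addr ρ r)) (trans (stepAct-work u v (scanned! τ) _ (apart r))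
                  (workAct-rest u (scanned! τ) r (λ i p → ¬o (i , p)) (λ i p → ¬d (i , p)))))
                  (cong (λ s → write s (τ ! addr ρ r)) (scanned!-! τ (addr ρ r))))))
              (sym (enc-rest r (λ i p → ¬o (i , p)) (λ i p → ¬d (i , p)) (Vec.map proj₁ u) zs ds _))
              (vw r)

        step-raw : ∀ u v τ ms → RawOk τ ms → RawOk (perform (stepAct u v (scanned! τ)) τ) (Vec.zipWith writeAndMove v ms)
        step-raw u v τ ms ok k = trans (perform-! (stepAct u v (scanned! τ)) τ (raw k))
          (trans (cong₂ writeAndMove (stepAct-raw u v (scanned! τ) k) (ok k)) (sym (Vec.lookup-zipWith writeAndMove k v ms)))

        write-then-move : ∀ {m} (u : Vec Act m) (zs : Vec (Tape a) m) →
          Vec.zipWith move (Vec.map proj₂ u) (Vec.zipWith write (Vec.map proj₁ u) zs) ≡ Vec.zipWith writeAndMove u zs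
        write-then-move []      []       = refl
        write-then-move (_ ∷ u) (z ∷ zs) = cong (_ ∷_) (write-then-move u zs)

        spreads-write : ∀ {m} (u : Vec (Symbol a) m) (zs : Vec (Tape a) m) → spreads (Vec.zipWith write u zs) ≡ spreads zs
        spreads-write []      []       = refl
        spreads-write (_ ∷ u) (z ∷ zs) = cong (spread z ℕ.+_) (spreads-write u zs)

        query-view : ∀ i τ zs → View ρ τ (enc zs blanks) →
          View ρ (perform (only (addr ρ (dir (suc i))) (sep , stay) (scanned! τ)) τ) (enc zs (blanks [ suc i ]≔ sep))
        query-view i τ zs vw r with dir (suc i) Fin.≟ r
        ... | yes refl = subst₂ _shows_ (sym (only-at (addr ρ (dir (suc i))) (sep , stay) τ))
              (trans (cong (λ y → sep ∷ tl y) (enc-dir zs blanks (suc i)))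
                (sym (trans (enc-dir zs _ (suc i)) (cong (_∷ []) (Vec.lookup∘updateAt (suc i) blanks)))))
              (shows-write sep (vw r))
        ... | no ≢r = subst₂ _shows_ (sym (only-off (addr ρ (dir (suc i))) (sep , stay) τ (addr ρ r) (≢r ∘ addr-inj ρ))) (same (Fin.any? (λ j → os j Fin.≟ r)) (Fin.any? (λ j → dir j Fin.≟ r))) (vw r)
          where
          rewrite-id : ∀ {m} (zs : Vec (Tape a) m) → Vec.zipWith write (Vec.map Tape.scanned zs) zs ≡ zs
          rewrite-id []       = refl
          rewrite-id (z ∷ zs) = cong (z ∷_) (rewrite-id zs)
          same : Dec (∃[ j ] os j ≡ r) → Dec (∃[ j ] dir j ≡ r) → get r (enc zs blanks) ≡ get r (enc zs (blanks [ suc i ]≔ sep))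
          same (yes (j , refl)) _ = trans (enc-os zs _ j) (sym (enc-os zs _ j))
          same (no _) (yes (j , refl)) = trans (enc-dir zs _ j) (trans (cong (_∷ []) (sym (Vec.lookup∘updateAt′ j (suc i) (λ { refl → ≢r refl }) blanks))) (sym (enc-dir zs _ j)))
          -- Only a direction changes here; replacing every scanned symbol by itself makes
          -- `enc-rest` applicable.
          same (no ¬o) (no ¬d) = trans (sym (enc-rest r (λ j p → ¬o (j , p)) (λ j p → ¬d (j , p)) (Vec.map Tape.scanned zs) zs blanks (blanks [ suc i ]≔ sep)))
            (cong (λ y → get r (enc y (blanks [ suc i ]≔ sep))) (rewrite-id zs))

        action-faithful : ∀ q τ m ms mos → View ρ τ (enc (m ∷ mos) blanks) → RawOk τ ms →
          action (scanned! τ) q ≡ transition q (Vec.map Tape.scanned mos) (Vec.map Tape.scanned (m ∷ ms))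
        action-faithful q τ m ms mos vw ok = cong₂ (transition q)
          (lookup-ext _ _ λ i → trans (Vec.lookup∘tabulate _ i) (trans (trans (view-top {ρ = ρ} {τ} vw (os (suc i))) (cong hd (enc-os (m ∷ mos) blanks (suc i)))) (sym (Vec.lookup-map i Tape.scanned mos))))
          (cong₂ _∷_ (trans (view-top {ρ = ρ} {τ} vw (os zero)) (cong hd (enc-os (m ∷ mos) blanks zero)))
            (lookup-ext _ _ λ k → trans (Vec.lookup∘tabulate _ k) (trans (scanned!-! τ (raw k)) (trans (cong Tape.scanned (ok k)) (sym (Vec.lookup-map k Tape.scanned ms))))))

        -- Every step of M costs the writing step, the return to `inj₁` and one run of the handler.
        -- The latter is charged at `s + t D`, the largest spread that can occur, which turns the
        -- sum into a product.
        record Simulated (s t : ℕ) (q : Fin states) (τ : Tapes) (c : Config M) : Set where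
          constructor simulated
          field
            {time}  : ℕ
            {final} : Tapes
            within  : time ℕ.≤ t ℕ.* (2 ℕ.+ B (s ℕ.+ t ℕ.* D))
            run     : Run ψ simulate (inj₁ q) τ time final
            view    : View ρ final (enc (Vec.head (Config.mainTapes c) ∷ Config.oracleTapes c) blanks)
            spreads≤ : spreads (Vec.head (Config.mainTapes c) ∷ Config.oracleTapes c) ℕ.≤ s ℕ.+ t ℕ.* D

        shuffle : ∀ s t → (D ℕ.+ s) ℕ.+ t ℕ.* D ≡ s ℕ.+ suc t ℕ.* D
        shuffle s t = trans (cong (ℕ._+ t ℕ.* D) (ℕ.+-comm D s)) (ℕ.+-assoc s D (t ℕ.* D))

        budget : ∀ {s t h t′} → h ℕ.≤ B s → t′ ℕ.≤ t ℕ.* (2 ℕ.+ B ((D ℕ.+ s) ℕ.+ t ℕ.* D)) → suc (h ℕ.+ suc t′) ℕ.≤ suc t ℕ.* (2 ℕ.+ B (s ℕ.+ suc t ℕ.* D))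
        budget {s} {t} {h} {t′} h≤ t′≤ = ℕ.≤-trans (ℕ.≤-reflexive (cong suc (ℕ.+-suc h t′)))
          (ℕ.+-mono-≤ (s≤s (s≤s (ℕ.≤-trans h≤ (B-mono (ℕ.m≤m+n s (suc t ℕ.* D))))))
            (ℕ.≤-trans t′≤ (ℕ.≤-reflexive (cong (λ y → t ℕ.* (2 ℕ.+ B y)) (shuffle s t)))))

        -- The part common to steps and queries of M: one simulator step, the handler, and the rest
        -- of the run with the spread bound raised from `s` to `D + s`.
        continue : ∀ {s t q q′ α τ zs′ m ms mos c zs} → 
          δ simulate (inj₁ q) (Vec.map Tape.scanned (proj₁ τ)) (Vec.map Tape.scanned (proj₂ τ)) ≡ goBy (inj₂ (q′ , start (frag H))) α →
          View ρ (perform α τ) zs → Spec ρ H zs (B s) (enc zs′ blanks) → zs′ ≡ m ∷ mos → RawOk (perform α τ) ms →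
          (∀ τ′ → View ρ τ′ (enc (m ∷ mos) blanks) → RawOk τ′ ms → Simulated (D ℕ.+ s) t q′ τ′ c) →
          Simulated s (suc t) q τ c
        continue {s} {t} {q} {q′} {α} {τ} eq vw S refl ok next =
          let result {final = τ′} h≤ r (vw′ , fr) = exec S _ vw
              simulated t′≤ r′ v′ sp = next τ′ vw′ (λ k → trans (fr (raw k) (λ r → apart r k)) (ok k))
          in simulated (budget {s} {t} h≤ t′≤) (go eq (Run-call ψ (λ s → inj₂ (q′ , s)) (inj₁ q′) (λ _ _ _ → refl) r r′)) v′
               (ℕ.≤-trans sp (ℕ.≤-reflexive (shuffle s t)))

        simulate-halts : ∀ {q m ms mos t c} s τ → HaltsFrom M φ (config q mos (m ∷ ms)) t c →
          View ρ τ (enc (m ∷ mos) blanks) → RawOk τ ms → spreads (m ∷ mos) ℕ.≤ s → Simulated s t q τ c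
        simulate-act : ∀ {q m ms mos t c c′} s τ A → A ≡ transition q (Vec.map Tape.scanned mos) (Vec.map Tape.scanned (m ∷ ms)) →
          act M φ (config q mos (m ∷ ms)) A ≡ just c′ → HaltsFrom M φ c′ t c →
          View ρ τ (enc (m ∷ mos) blanks) → RawOk τ ms → spreads (m ∷ mos) ℕ.≤ s → Simulated s (suc t) q τ c

        simulate-halts {q} {m} {ms} {mos} s τ (halted eq) vw ok sp =
          simulated z≤n (stop (trans (cong (instr (scanned! τ)) (action-faithful q τ m ms mos vw ok)) (lem _ eq))) vw (ℕ.≤-trans sp (ℕ.m≤m+n s 0))
          where
          lem : ∀ A → act M φ (config q mos (m ∷ ms)) A ≡ nothing → instr (scanned! τ) A ≡ done
          lem halt         _ = refl
          lem (step _ _ _) ()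
          lem (query _ _)  ()
        simulate-halts s τ (steps eq h) vw ok sp = simulate-act s τ _ refl eq h vw ok sp

        simulate-act s τ halt A≡ () h vw ok sp
        simulate-act {q} {m} {ms} {mos} s τ (step q′ u (v ∷ vs)) A≡ refl h vw ok sp =
          continue {α = stepAct (v ∷ u) vs (scanned! τ)} {τ = τ} {ms = Vec.zipWith writeAndMove vs ms}
            (cong (instr (scanned! τ)) (trans (action-faithful q τ m ms mos vw ok) (sym A≡)))
            (subst (λ y → View ρ (perform (stepAct (v ∷ u) vs (scanned! τ)) τ) (enc (Vec.zipWith write (Vec.map proj₁ (v ∷ u)) (m ∷ mos)) y)) (Vec.map-∘ direction proj₂ (v ∷ u)) (step-view (v ∷ u) vs τ (m ∷ mos) blanks vw))
            (relax (H-move (Vec.zipWith write (Vec.map proj₁ (v ∷ u)) (m ∷ mos)) (Vec.map proj₂ (v ∷ u)))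
              (B-mono (ℕ.≤-trans (ℕ.≤-reflexive (spreads-write (Vec.map proj₁ (v ∷ u)) (m ∷ mos))) sp)))
            (write-then-move (v ∷ u) (m ∷ mos))
            (step-raw (v ∷ u) vs τ ms ok)
            (λ τ′ vw′ ok′ → simulate-halts (D ℕ.+ s) τ′ h vw′ ok′ (ℕ.≤-trans (spreads-step (v ∷ u) (m ∷ mos)) (ℕ.+-mono-≤ d<D sp)))
        simulate-act {q} {m} {ms} {mos} s τ (query i q′) A≡ refl h vw ok sp =
          continue {α = only (addr ρ (dir (suc i))) (sep , stay) (scanned! τ)} {τ = τ} {ms = ms}
            (cong (instr (scanned! τ)) (trans (action-faithful q τ m ms mos vw ok) (sym A≡)))
            (query-view i τ (m ∷ mos) vw)
            (relax (H-query (m ∷ mos) i) (B-mono sp))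
            refl
            (λ k → trans (only-off (addr ρ (dir (suc i))) (sep , stay) τ (raw k) (apart (dir (suc i)) k)) (ok k))
            (λ τ′ vw′ ok′ → simulate-halts (D ℕ.+ s) τ′ h vw′ ok′ (ℕ.≤-trans (grow (m ∷ mos) i) (ℕ.+-monoʳ-≤ D sp)))

-- Binary words, with the least significant bit first

b2n : Bool → ℕ
b2n false = 0
b2n true  = 1

val : List Bool → ℕ
val []      = 0
val (b ∷ u) = b2n b ℕ.+ 2 ℕ.* val u

odd : ℕ → Bool
odd m = 0 ℕ.<ᵇ m ℕ.% 2

low : ℕ → ℕ → List Bool
low zero    m = []
low (suc w) m = odd m ∷ low w (m ℕ./ 2)

module _ {a : ℕ} where

  bitS : Bool → Symbol a
  bitS false = b0
  bitS true  = b1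

  bits : List Bool → Word a
  bits = map bitS

  bits-solid : ∀ u → Solid (bits u)
  bits-solid []          = []
  bits-solid (false ∷ u) = refl ∷ bits-solid u
  bits-solid (true ∷ u)  = refl ∷ bits-solid u

  bit-odd : ∀ m → bit m ≡ bitS (0 ℕ.<ᵇ m)
  bit-odd zero    = refl
  bit-odd (suc m) = refl

  digits-low : ∀ w m → digits w m ≡ reverse (bits (low w m))
  digits-low zero    m = refl
  digits-low (suc w) m = trans (cong₂ (λ u s → u ++ s ∷ []) (digits-low w (m ℕ./ 2)) (bit-odd (m ℕ.% 2)))
    (sym (List.unfold-reverse (bitS (odd m)) (bits (low w (m ℕ./ 2)))))

length-low : ∀ w m → length (low w m) ≡ w
length-low zero    m = refl
length-low (suc w) m = cong suc (length-low w (m ℕ./ 2))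

b2n-%2 : ∀ b v → (b2n b ℕ.+ 2 ℕ.* v) ℕ.% 2 ≡ b2n b
b2n-%2 b v = trans (cong (λ x → (b2n b ℕ.+ x) ℕ.% 2) (ℕ.*-comm 2 v)) (trans (ℕ.[m+kn]%n≡m%n (b2n b) v 2) (small b))
  where
  small : ∀ b → b2n b ℕ.% 2 ≡ b2n b
  small false = refl
  small true  = refl

⌊b+2v/2⌋ : ∀ b v → ⌊ b2n b ℕ.+ 2 ℕ.* v /2⌋ ≡ v
⌊b+2v/2⌋ b zero = small b
  where
  small : ∀ b → ⌊ b2n b ℕ.+ 0 /2⌋ ≡ 0
  small false = refl
  small true  = refl
⌊b+2v/2⌋ b (suc v) = trans (cong ⌊_/2⌋ (lem b v)) (cong suc (⌊b+2v/2⌋ b v))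
  where
  lem : ∀ b v → b2n b ℕ.+ 2 ℕ.* suc v ≡ suc (suc (b2n b ℕ.+ 2 ℕ.* v))
  lem b v = let open +-*-Solver in
    solve 2 (λ b v → b :+ con 2 :* (con 1 :+ v) := con 2 :+ (b :+ con 2 :* v)) refl (b2n b) v

n/2≡⌊n/2⌋ : ∀ n → n ℕ./ 2 ≡ ⌊ n /2⌋
n/2≡⌊n/2⌋ 0             = refl
n/2≡⌊n/2⌋ 1             = refl
n/2≡⌊n/2⌋ (suc (suc n)) = trans (ℕ.m/n≡1+[m∸n]/n {suc (suc n)} {2} (s≤s (s≤s z≤n))) (cong suc (n/2≡⌊n/2⌋ n))

[b+2v]/2 : ∀ b v → (b2n b ℕ.+ 2 ℕ.* v) ℕ./ 2 ≡ v
[b+2v]/2 b v = trans (n/2≡⌊n/2⌋ _) (⌊b+2v/2⌋ b v)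

odd-b2n : ∀ b v → odd (b2n b ℕ.+ 2 ℕ.* v) ≡ b
odd-b2n b v = trans (cong (0 ℕ.<ᵇ_) (b2n-%2 b v)) (small b)
  where
  small : ∀ b → (0 ℕ.<ᵇ b2n b) ≡ b
  small false = refl
  small true  = refl

low-val : ∀ u v → low (length u) (val (u ++ v)) ≡ u
low-val []      v = refl
low-val (b ∷ u) v = cong₂ _∷_ (odd-b2n b (val (u ++ v)))
  (trans (cong (low (length u)) ([b+2v]/2 b (val (u ++ v)))) (low-val u v))

val-++ : ∀ u v → val (u ++ v) ≡ val u ℕ.+ 2 ℕ.^ length u ℕ.* val v
val-++ []      v = sym (ℕ.+-identityʳ (val v))
val-++ (b ∷ u) v = trans (cong (λ x → b2n b ℕ.+ 2 ℕ.* x) (val-++ u v))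
  (solve 4 (λ b u p v → b :+ con 2 :* (u :+ p :* v) := (b :+ con 2 :* u) :+ (con 2 :* p) :* v) refl
    (b2n b) (val u) (2 ℕ.^ length u) (val v))
  where open +-*-Solver

b2n≤1 : ∀ b → b2n b ℕ.≤ 1
b2n≤1 false = z≤n
b2n≤1 true  = s≤s z≤n

val<2^ : ∀ u → val u ℕ.< 2 ℕ.^ length u
val<2^ []      = s≤s z≤n
val<2^ (b ∷ u) = ℕ.≤-trans (s≤s (ℕ.+-monoˡ-≤ (2 ℕ.* val u) (b2n≤1 b)))
  (ℕ.≤-trans (ℕ.≤-reflexive (sym (ℕ.*-distribˡ-+ 2 1 (val u)))) (ℕ.*-monoʳ-≤ 2 (val<2^ u)))

/2^-suc : ∀ m k → (m ℕ./ 2 ℕ.^ suc k) {{ℕ.m^n≢0 2 (suc k)}} ≡ ((m ℕ./ 2) ℕ./ 2 ℕ.^ k) {{ℕ.m^n≢0 2 k}}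
/2^-suc m k = sym (ℕ.m/n/o≡m/[n*o] m 2 (2 ℕ.^ k) {{_}} {{ℕ.m^n≢0 2 k}} {{ℕ.m^n≢0 2 (suc k)}})

val-++-/ : ∀ u v → (val (u ++ v) ℕ./ 2 ℕ.^ length u) {{ℕ.m^n≢0 2 (length u)}} ≡ val v
val-++-/ []      v = ℕ.n/1≡n (val v)
val-++-/ (b ∷ u) v = trans (/2^-suc (val (b ∷ u ++ v)) (length u))
  (trans (cong (λ x → (x ℕ./ 2 ℕ.^ length u) {{ℕ.m^n≢0 2 (length u)}}) ([b+2v]/2 b (val (u ++ v)))) (val-++-/ u v))

digits-val : ∀ {a} u v → digits {a} (length u) (val (u ++ v)) ≡ reverse (bits u)
digits-val u v = trans (digits-low (length u) (val (u ++ v))) (cong (reverse ∘ bits) (low-val u v))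

m≡odd+2[m/2] : ∀ m → m ≡ b2n (odd m) ℕ.+ 2 ℕ.* (m ℕ./ 2)
m≡odd+2[m/2] m = trans (ℕ.m≡m%n+[m/n]*n m 2) (cong₂ ℕ._+_ (lem (m ℕ.% 2) (ℕ.m%n<n m 2)) (ℕ.*-comm (m ℕ./ 2) 2))
  where
  lem : ∀ r → r ℕ.< 2 → r ≡ b2n (0 ℕ.<ᵇ r)
  lem 0 _ = refl
  lem 1 _ = refl
  lem (suc (suc r)) (s≤s (s≤s ()))

m/2<2^ : ∀ w m → m ℕ.< 2 ℕ.^ suc w → m ℕ./ 2 ℕ.< 2 ℕ.^ w
m/2<2^ w m m< = ℕ.m<n*o⇒m/o<n (subst (m ℕ.<_) (ℕ.*-comm 2 (2 ℕ.^ w)) m<)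

val-low : ∀ w m → m ℕ.< 2 ℕ.^ w → val (low w m) ≡ m
val-low zero    zero    m< = refl
val-low zero    (suc m) (s≤s ())
val-low (suc w) m       m< = trans (cong (λ x → b2n (odd m) ℕ.+ 2 ℕ.* x) (val-low w (m ℕ./ 2) (m/2<2^ w m m<))) (sym (m≡odd+2[m/2] m))

log₂-double : ∀ m → 1 ℕ.≤ ⌊ m /2⌋ → ⌊log₂ m ⌋ ≡ suc ⌊log₂ ⌊ m /2⌋ ⌋
log₂-double m 1≤ = trans (sym (ℕ.m+[n∸m]≡n (⌊log₂⌋-mono-≤ {2} {m} 2≤m))) (cong suc (sym (⌊log₂⌊n/2⌋⌋≡⌊log₂n⌋∸1 m)))
  where
  2≤m : 2 ℕ.≤ m
  2≤m = ℕ.≤-trans (ℕ.+-mono-≤ 1≤ (ℕ.≤-trans 1≤ (ℕ.⌊n/2⌋≤⌈n/2⌉ m))) (ℕ.≤-reflexive (ℕ.⌊n/2⌋+⌈n/2⌉≡n m))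

1≤val : ∀ u → 1 ℕ.≤ val (u ++ true ∷ [])
1≤val []      = s≤s z≤n
1≤val (b ∷ u) = ℕ.≤-trans (1≤val u) (ℕ.≤-trans (ℕ.m≤m+n _ _) (ℕ.m≤n+m _ (b2n b)))

log₂-val : ∀ u → ⌊log₂ val (u ++ true ∷ []) ⌋ ≡ length u
log₂-val []      = refl
log₂-val (b ∷ u) = trans (log₂-double _ (subst (1 ℕ.≤_) (sym half) (1≤val u))) (cong suc (trans (cong ⌊log₂_⌋ half) (log₂-val u)))
  where
  half : ⌊ val (b ∷ u ++ true ∷ []) /2⌋ ≡ val (u ++ true ∷ [])
  half = ⌊b+2v/2⌋ b (val (u ++ true ∷ []))

-- A leading digit 1 makes a word of digits canonical: the logarithm is then the length of the rest.
encodeℕ-val : ∀ {a} u → encodeℕ {a} (val (u ++ true ∷ [])) ≡ reverse (bits (u ++ true ∷ []))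
encodeℕ-val {a} u = trans (cong (λ w → digits (suc w) (val (u ++ true ∷ []))) (log₂-val u))
  (trans (cong₂ (λ w v → digits {a} w (val v)) (trans (ℕ.+-comm 1 (length u)) (sym (List.length-++ u))) (sym (List.++-identityʳ (u ++ true ∷ []))))
    (digits-val (u ++ true ∷ []) []))

<2^-log₂ : ∀ m → m ℕ.< 2 ℕ.^ suc ⌊log₂ m ⌋
<2^-log₂ = <-rec _ go
  where
  go : ∀ m → (∀ {k} → k ℕ.< m → k ℕ.< 2 ℕ.^ suc ⌊log₂ k ⌋) → m ℕ.< 2 ℕ.^ suc ⌊log₂ m ⌋
  go 0 rec = s≤s z≤n
  go 1 rec = s≤s (s≤s z≤n)
  go (suc (suc m)) rec = ℕ.≤-trans
    (s≤s (ℕ.≤-trans (ℕ.≤-reflexive (trans (m≡odd+2[m/2] n) (cong (λ x → b2n (odd n) ℕ.+ 2 ℕ.* x) (n/2≡⌊n/2⌋ n)))) (ℕ.+-monoˡ-≤ (2 ℕ.* ⌊ n /2⌋) (b2n≤1 (odd n)))))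
    (ℕ.≤-trans (ℕ.≤-reflexive (sym (ℕ.*-distribˡ-+ 2 1 ⌊ n /2⌋)))
      (ℕ.*-monoʳ-≤ 2 (subst (λ w → ⌊ n /2⌋ ℕ.< 2 ℕ.^ w) (sym (log₂-double n (s≤s z≤n))) (rec (s≤s (s≤s (ℕ.⌊n/2⌋≤n m)))))))
    where n = suc (suc m)

strip : List Bool → List Bool
strip []          = []
strip (false ∷ w) = strip w
strip (true ∷ w)  = true ∷ w

val-snoc-false : ∀ u → val (u ++ false ∷ []) ≡ val u
val-snoc-false u = trans (val-++ u (false ∷ [])) (trans (cong (val u ℕ.+_) (ℕ.*-zeroʳ (2 ℕ.^ length u))) (ℕ.+-identityʳ (val u)))

-- Removing leading zeros yields the canonical encoding, with one exception: zero becomes the empty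
-- word, although it is encoded by a single digit. Programs have to test for this case.
data Stripped {a} (w : List Bool) : Set where
  zero    : strip w ≡ [] → val (reverse w) ≡ 0 → Stripped w
  nonzero : ∀ {u} → strip w ≡ true ∷ u → bits (strip w) ≡ encodeℕ {a} (val (reverse w)) → 1 ℕ.≤ val (reverse w) → Stripped w

stripped : ∀ {a} w → Stripped {a} w
stripped []          = zero refl refl
stripped {a} (false ∷ w) with stripped {a} w
... | zero p q = zero p (trans (cong val (List.unfold-reverse false w)) (trans (val-snoc-false (reverse w)) q))
... | nonzero p q r = nonzero p (trans q (cong encodeℕ (sym eq))) (subst (1 ℕ.≤_) (sym eq) r)
  where eq = trans (cong val (List.unfold-reverse false w)) (val-snoc-false (reverse w))
stripped {a} (true ∷ w)  = nonzero refl
  (sym (trans (cong (encodeℕ ∘ val) (List.unfold-reverse true w)) (trans (encodeℕ-val (reverse w))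
    (trans (cong (reverse ∘ bits) (sym (List.unfold-reverse true w))) (trans (sym (List.reverse-map bitS (reverse (true ∷ w)))) (cong bits (List.reverse-involutive (true ∷ w))))))))
  (subst (λ u → 1 ℕ.≤ val u) (sym (List.unfold-reverse true w)) (1≤val (reverse w)))

digits-split : ∀ {a} k b m → digits {a} (k ℕ.+ b) m ≡ digits k ((m ℕ./ 2 ℕ.^ b) {{ℕ.m^n≢0 2 b}}) ++ digits b m
digits-split k zero    m = trans (cong₂ digits (ℕ.+-identityʳ k) (sym (ℕ.n/1≡n m))) (sym (List.++-identityʳ _))
digits-split k (suc b) m = trans (cong (λ w → digits w m) (ℕ.+-suc k b))
  (trans (cong (_++ _) (digits-split k b (m ℕ./ 2)))
    (trans (List.++-assoc (digits k _) (digits b (m ℕ./ 2)) _)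
      (cong (λ x → digits k x ++ digits (suc b) m) (sym (/2^-suc m b)))))

-- Ripple-carry arithmetic; the shorter operand is padded with zeros

hdB : List Bool → Bool
hdB []      = false
hdB (b ∷ _) = b

tlB : List Bool → List Bool
tlB []      = []
tlB (_ ∷ u) = u

Digit : Set
Digit = Bool → Bool → Bool → Bool × Bool

ripple : Digit → List Bool → List Bool → Bool → List Bool
carry  : Digit → List Bool → List Bool → Bool → Bool
ripple f (a ∷ R) Y       c = proj₁ (f a (hdB Y) c) ∷ ripple f R (tlB Y) (proj₂ (f a (hdB Y) c))
ripple f []      (b ∷ Y) c = proj₁ (f false b c) ∷ ripple f [] Y (proj₂ (f false b c))
ripple f []      []      c = []
carry  f (a ∷ R) Y       c = carry f R (tlB Y) (proj₂ (f a (hdB Y) c))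
carry  f []      (b ∷ Y) c = carry f [] Y (proj₂ (f false b c))
carry  f []      []      c = c

-- The copy of the first operand that is made during a ripple, with the padding up to the length of
-- the longer operand. A failed trial subtraction is undone from it.
padTo : List Bool → List Bool → List Bool
padTo (a ∷ R) Y       = a ∷ padTo R (tlB Y)
padTo []      (b ∷ Y) = false ∷ padTo [] Y
padTo []      []      = []

-- Full adder and full subtractor; the third argument and the second result are the carry or the
-- borrow.
plus minus′ : Digit
plus a b c   = (a xor b) xor c , (a ∧ b) ∨ ((a xor b) ∧ c)
minus′ a b c = (a xor b) xor c , (not a ∧ (b ∨ c)) ∨ (b ∧ c)

plus-ok : ∀ a b c → b2n (proj₁ (plus a b c)) ℕ.+ 2 ℕ.* b2n (proj₂ (plus a b c)) ≡ b2n a ℕ.+ b2n b ℕ.+ b2n c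
plus-ok false false false = refl
plus-ok false false true  = refl
plus-ok false true  false = refl
plus-ok false true  true  = refl
plus-ok true  false false = refl
plus-ok true  false true  = refl
plus-ok true  true  false = refl
plus-ok true  true  true  = refl

minus-ok : ∀ a b c → b2n (proj₁ (minus′ a b c)) ℕ.+ (b2n b ℕ.+ b2n c) ≡ b2n a ℕ.+ 2 ℕ.* b2n (proj₂ (minus′ a b c))
minus-ok false false false = refl
minus-ok false false true  = refl
minus-ok false true  false = refl
minus-ok false true  true  = refl
minus-ok true  false false = refl
minus-ok true  false true  = refl
minus-ok true  true  false = refl
minus-ok true  true  true  = refl

val-hd-tl : ∀ u → val u ≡ b2n (hdB u) ℕ.+ 2 ℕ.* val (tlB u)
val-hd-tl []      = refl
val-hd-tl (b ∷ u) = refl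

private
  plus-step : ∀ s c′ a b c S p C R Y → s ℕ.+ 2 ℕ.* c′ ≡ a ℕ.+ b ℕ.+ c → S ℕ.+ p ℕ.* C ≡ R ℕ.+ Y ℕ.+ c′ →
    (s ℕ.+ 2 ℕ.* S) ℕ.+ (2 ℕ.* p) ℕ.* C ≡ (a ℕ.+ 2 ℕ.* R) ℕ.+ (b ℕ.+ 2 ℕ.* Y) ℕ.+ c
  plus-step s c′ a b c S p C R Y h ih = begin
    (s ℕ.+ 2 ℕ.* S) ℕ.+ (2 ℕ.* p) ℕ.* C   ≡⟨ solve 4 (λ s S p C → (s :+ con 2 :* S) :+ (con 2 :* p) :* C := s :+ con 2 :* (S :+ p :* C)) refl s S p C ⟩
    s ℕ.+ 2 ℕ.* (S ℕ.+ p ℕ.* C)           ≡⟨ cong (λ x → s ℕ.+ 2 ℕ.* x) ih ⟩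
    s ℕ.+ 2 ℕ.* (R ℕ.+ Y ℕ.+ c′)          ≡⟨ solve 4 (λ s R Y c → s :+ con 2 :* (R :+ Y :+ c) := (s :+ con 2 :* c) :+ con 2 :* (R :+ Y)) refl s R Y c′ ⟩
    (s ℕ.+ 2 ℕ.* c′) ℕ.+ 2 ℕ.* (R ℕ.+ Y)  ≡⟨ cong (ℕ._+ 2 ℕ.* (R ℕ.+ Y)) h ⟩
    (a ℕ.+ b ℕ.+ c) ℕ.+ 2 ℕ.* (R ℕ.+ Y)   ≡⟨ solve 5 (λ a b c R Y → (a :+ b :+ c) :+ con 2 :* (R :+ Y) := (a :+ con 2 :* R) :+ (b :+ con 2 :* Y) :+ c) refl a b c R Y ⟩
    (a ℕ.+ 2 ℕ.* R) ℕ.+ (b ℕ.+ 2 ℕ.* Y) ℕ.+ c ∎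
    where
    open ≡-Reasoning
    open +-*-Solver

  minus-step : ∀ s c′ a b c S p C R Y → s ℕ.+ (b ℕ.+ c) ≡ a ℕ.+ 2 ℕ.* c′ → S ℕ.+ (Y ℕ.+ c′) ≡ R ℕ.+ p ℕ.* C →
    (s ℕ.+ 2 ℕ.* S) ℕ.+ ((b ℕ.+ 2 ℕ.* Y) ℕ.+ c) ≡ (a ℕ.+ 2 ℕ.* R) ℕ.+ (2 ℕ.* p) ℕ.* C
  minus-step s c′ a b c S p C R Y h ih = begin
    (s ℕ.+ 2 ℕ.* S) ℕ.+ ((b ℕ.+ 2 ℕ.* Y) ℕ.+ c)  ≡⟨ solve 5 (λ s S b Y c → (s :+ con 2 :* S) :+ ((b :+ con 2 :* Y) :+ c) := (s :+ (b :+ c)) :+ con 2 :* (S :+ Y)) refl s S b Y c ⟩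
    (s ℕ.+ (b ℕ.+ c)) ℕ.+ 2 ℕ.* (S ℕ.+ Y)        ≡⟨ cong (ℕ._+ 2 ℕ.* (S ℕ.+ Y)) h ⟩
    (a ℕ.+ 2 ℕ.* c′) ℕ.+ 2 ℕ.* (S ℕ.+ Y)         ≡⟨ solve 4 (λ a c S Y → (a :+ con 2 :* c) :+ con 2 :* (S :+ Y) := a :+ con 2 :* (S :+ (Y :+ c))) refl a c′ S Y ⟩
    a ℕ.+ 2 ℕ.* (S ℕ.+ (Y ℕ.+ c′))               ≡⟨ cong (λ x → a ℕ.+ 2 ℕ.* x) ih ⟩
    a ℕ.+ 2 ℕ.* (R ℕ.+ p ℕ.* C)                  ≡⟨ solve 4 (λ a R p C → a :+ con 2 :* (R :+ p :* C) := (a :+ con 2 :* R) :+ (con 2 :* p) :* C) refl a R p C ⟩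
    (a ℕ.+ 2 ℕ.* R) ℕ.+ (2 ℕ.* p) ℕ.* C ∎
    where
    open ≡-Reasoning
    open +-*-Solver

plus-val : ∀ R Y c → val (ripple plus R Y c) ℕ.+ 2 ℕ.^ length (ripple plus R Y c) ℕ.* b2n (carry plus R Y c) ≡ val R ℕ.+ val Y ℕ.+ b2n c
plus-val (a ∷ R) Y c = trans
  (plus-step (b2n (proj₁ (plus a (hdB Y) c))) (b2n c′) (b2n a) (b2n (hdB Y)) (b2n c)
    (val (ripple plus R (tlB Y) c′)) (2 ℕ.^ length (ripple plus R (tlB Y) c′)) (b2n (carry plus R (tlB Y) c′)) (val R) (val (tlB Y))
    (plus-ok a (hdB Y) c) (plus-val R (tlB Y) c′))
  (cong (λ y → val (a ∷ R) ℕ.+ y ℕ.+ b2n c) (sym (val-hd-tl Y)))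
  where c′ = proj₂ (plus a (hdB Y) c)
plus-val [] (b ∷ Y) c =
  plus-step (b2n (proj₁ (plus false b c))) (b2n c′) 0 (b2n b) (b2n c)
    (val (ripple plus [] Y c′)) (2 ℕ.^ length (ripple plus [] Y c′)) (b2n (carry plus [] Y c′)) 0 (val Y)
    (plus-ok false b c) (plus-val [] Y c′)
  where c′ = proj₂ (plus false b c)
plus-val [] [] c = ℕ.+-identityʳ (b2n c)

-- Stated additively to remain within the natural numbers. As the difference is below `2 ^ length`,
-- without an initial borrow the final borrow is set exactly when `val R < val Y`; division uses it
-- as its comparison.
minus-val : ∀ R Y c → val (ripple minus′ R Y c) ℕ.+ (val Y ℕ.+ b2n c) ≡ val R ℕ.+ 2 ℕ.^ length (ripple minus′ R Y c) ℕ.* b2n (carry minus′ R Y c)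
minus-val (a ∷ R) Y c = trans
  (cong (λ y → val (ripple minus′ (a ∷ R) Y c) ℕ.+ (y ℕ.+ b2n c)) (val-hd-tl Y))
  (minus-step (b2n (proj₁ (minus′ a (hdB Y) c))) (b2n c′) (b2n a) (b2n (hdB Y)) (b2n c)
    (val (ripple minus′ R (tlB Y) c′)) (2 ℕ.^ length (ripple minus′ R (tlB Y) c′)) (b2n (carry minus′ R (tlB Y) c′)) (val R) (val (tlB Y))
    (minus-ok a (hdB Y) c) (minus-val R (tlB Y) c′))
  where c′ = proj₂ (minus′ a (hdB Y) c)
minus-val [] (b ∷ Y) c =
  minus-step (b2n (proj₁ (minus′ false b c))) (b2n c′) 0 (b2n b) (b2n c)
    (val (ripple minus′ [] Y c′)) (2 ℕ.^ length (ripple minus′ [] Y c′)) (b2n (carry minus′ [] Y c′)) 0 (val Y)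
    (minus-ok false b c) (minus-val [] Y c′)
  where c′ = proj₂ (minus′ false b c)
minus-val [] [] c = sym (ℕ.+-identityʳ (b2n c))

val-padTo : ∀ R Y → val (padTo R Y) ≡ val R
val-padTo (a ∷ R) Y       = cong (λ x → b2n a ℕ.+ 2 ℕ.* x) (val-padTo R (tlB Y))
val-padTo []      (b ∷ Y) = cong (2 ℕ.*_) (val-padTo [] Y)
val-padTo []      []      = refl

length-padTo : ∀ f R Y c → length (padTo R Y) ≡ length (ripple f R Y c)
length-padTo f (a ∷ R) Y       c = cong suc (length-padTo f R (tlB Y) _)
length-padTo f []      (b ∷ Y) c = cong suc (length-padTo f [] Y _)
length-padTo f []      []      c = refl

length-ripple≤ : ∀ f R Y c s → length R ℕ.≤ s → length Y ℕ.≤ s → length (ripple f R Y c) ℕ.≤ s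
length-ripple≤ f (a ∷ R) []      c (suc s) (s≤s p) q       = s≤s (length-ripple≤ f R [] _ s p z≤n)
length-ripple≤ f (a ∷ R) (b ∷ Y) c (suc s) (s≤s p) (s≤s q) = s≤s (length-ripple≤ f R Y _ s p q)
length-ripple≤ f []      (b ∷ Y) c (suc s) p       (s≤s q) = s≤s (length-ripple≤ f [] Y _ s z≤n q)
length-ripple≤ f []      []      c s       p       q       = z≤n

-- Cutting off a binary expansion, and programs that read stored words

msb : ℕ → ℕ → List Bool
msb w m = reverse (low w m)

digits-msb : ∀ {a} w m → digits {a} w m ≡ bits (msb w m)
digits-msb w m = trans (digits-low w m) (sym (List.reverse-map bitS (low w m)))

takePad : ℕ → List Bool → List Bool
takePad zero    G = []
takePad (suc n) G = hdB G ∷ takePad n (tlB G)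

private
  horner : ∀ A d p v → A ℕ.* (2 ℕ.* p) ℕ.+ (v ℕ.+ p ℕ.* (d ℕ.+ 2 ℕ.* 0)) ≡ (d ℕ.+ 2 ℕ.* A) ℕ.* p ℕ.+ v
  horner = solve 4 (λ A d p v → A :* (con 2 :* p) :+ (v :+ p :* (d :+ con 2 :* con 0)) := (d :+ con 2 :* A) :* p :+ v) refl
    where open +-*-Solver

horner-val : ∀ I d G → val I ℕ.* 2 ℕ.^ length (d ∷ G) ℕ.+ val (reverse (d ∷ G)) ≡ val (d ∷ I) ℕ.* 2 ℕ.^ length G ℕ.+ val (reverse G)
horner-val I d G = trans (cong (val I ℕ.* 2 ℕ.^ length (d ∷ G) ℕ.+_)
    (trans (cong val (List.unfold-reverse d G)) (trans (val-++ (reverse G) (d ∷ []))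
      (cong (λ l → val (reverse G) ℕ.+ 2 ℕ.^ l ℕ.* val (d ∷ [])) (List.length-reverse G)))))
  (horner (val I) (b2n d) (2 ℕ.^ length G) (val (reverse G)))

-- With `I` the integer part and `G` the fractional digits of `Z / 2 ^ length G`, the digits kept
-- form the floor of `Z 2 ^ n / 2 ^ length G`; both bounds are multiplied out. The induction moves
-- the leading digit of `G` over to `I`.
takePad-bounds : ∀ n G I Z → Z ≡ val I ℕ.* 2 ℕ.^ length G ℕ.+ val (reverse G) →
  val (takePad n G ʳ++ I) ℕ.* 2 ℕ.^ length G ℕ.≤ Z ℕ.* 2 ℕ.^ n ×
  Z ℕ.* 2 ℕ.^ n ℕ.< suc (val (takePad n G ʳ++ I)) ℕ.* 2 ℕ.^ length G
takePad-bounds zero G I Z eq rewrite eq | ℕ.*-identityʳ (val I ℕ.* 2 ℕ.^ length G ℕ.+ val (reverse G)) =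
  ℕ.m≤m+n _ _ ,
  ℕ.≤-trans (ℕ.+-monoʳ-< (val I ℕ.* 2 ℕ.^ length G) (subst (λ l → val (reverse G) ℕ.< 2 ℕ.^ l) (List.length-reverse G) (val<2^ (reverse G))))
    (ℕ.≤-reflexive (ℕ.+-comm (val I ℕ.* 2 ℕ.^ length G) (2 ℕ.^ length G)))
takePad-bounds (suc n) (d ∷ G) I Z eq =
  let lo , hi = takePad-bounds n G (d ∷ I) Z (trans eq (horner-val I d G)) in
  subst₂ ℕ._≤_ (swap A′ p) (swap Z q) (ℕ.*-monoʳ-≤ 2 lo) ,
  subst₂ ℕ._<_ (swap Z q) (swap (suc A′) p) (ℕ.*-monoʳ-< 2 hi)
  where
  A′ = val (takePad n G ʳ++ (d ∷ I))
  p = 2 ℕ.^ length G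
  q = 2 ℕ.^ n
  swap : ∀ x y → 2 ℕ.* (x ℕ.* y) ≡ x ℕ.* (2 ℕ.* y)
  swap = solve 2 (λ x y → con 2 :* (x :* y) := x :* (con 2 :* y)) refl
    where open +-*-Solver
takePad-bounds (suc n) [] I Z eq =
  -- With no digit left a zero is appended to the integer part, which doubles `Z` and takes one
  -- factor out of `2 ^ suc n`.
  let lo , hi = takePad-bounds n [] (false ∷ I) (2 ℕ.* Z) (trans (cong (2 ℕ.*_) eq) (lem (val I))) in
  subst (A′ ℕ.* 1 ℕ.≤_) (swap Z (2 ℕ.^ n)) lo , subst (ℕ._< suc A′ ℕ.* 1) (swap Z (2 ℕ.^ n)) hi
  where
  A′ = val (takePad n [] ʳ++ (false ∷ I))
  swap : ∀ x y → (2 ℕ.* x) ℕ.* y ≡ x ℕ.* (2 ℕ.* y)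
  swap = solve 2 (λ x y → (con 2 :* x) :* y := x :* (con 2 :* y)) refl
    where open +-*-Solver
  lem : ∀ x → 2 ℕ.* (x ℕ.* 1 ℕ.+ 0) ≡ (0 ℕ.+ 2 ℕ.* x) ℕ.* 1 ℕ.+ 0
  lem = solve 1 (λ x → con 2 :* (x :* con 1 :+ con 0) := (con 0 :+ con 2 :* x) :* con 1 :+ con 0) refl
    where open +-*-Solver

length-takePad : ∀ n G → length (takePad n G) ≡ n
length-takePad zero    G = refl
length-takePad (suc n) G = cong suc (length-takePad n (tlB G))

solid-replicate : ∀ {a} n {s : Symbol a} → nonBlank s ≡ true → Solid (replicate n s)
solid-replicate zero    p = []
solid-replicate (suc n) p = p ∷ solid-replicate n p

bits-ʳ++ : ∀ {a} u v → bits {a} (u ʳ++ v) ≡ bits u ʳ++ bits v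
bits-ʳ++ u v = List.map-ʳ++ bitS u

all-bits : ∀ {a} (p : Symbol a → Bool) → p b0 ≡ true → p b1 ≡ true → ∀ u → All (λ s → p s ≡ true) (bits u)
all-bits p p0 p1 []          = []
all-bits p p0 p1 (false ∷ u) = p0 ∷ all-bits p p0 p1 u
all-bits p p0 p1 (true ∷ u)  = p1 ∷ all-bits p p0 p1 u

-- The blank of an exhausted stack and a sign beneath the digits both read as 0; this supplies the
-- padding zeros.
toBit : ∀ {a} → Symbol a → Symbol a
toBit b1 = b1
toBit _  = b0

module Routines₂ (a o e : ℕ) where
  open Routines a o e public

  stripZeros : Regs 1 → Cmd
  stripZeros ρ = while ρ 0F isZero (pop ρ 0F)

  readTo : (Symbol a → Bool) → Regs 2 → Cmd
  readTo p ρ = while ρ 0F p (copy ρ 1F 0F ⨟ pop ρ 0F)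

  -- The arguments at which M runs are integers, so one exact answer serves every precision and the
  -- query word need not be read: the old oracle tape is discarded and a copy of the stored answer
  -- loaded.
  recall : Regs 7 → Cmd
  recall ρ = when ρ 3F isSep
    (dup (pick ρ (4F ∷ 6F ∷ 5F ∷ [])) ⨟ clearCode (pick ρ (0F ∷ [])) ⨟ clearCode (pick ρ (2F ∷ [])) ⨟
     zload (pick ρ (6F ∷ 1F ∷ 2F ∷ [])) ⨟ poke ρ 3F 3F 3F 3F (λ _ _ _ → blank))
    (zmove (pick ρ (0F ∷ 1F ∷ 2F ∷ 3F ∷ [])))

  module Correct₂ (φ : Oracles o) where
    open Correct φ public

    stripZeros-spec : ∀ ρ w → Spec ρ (stripZeros ρ) (bits w , tt) (length w ℕ.* 3) (bits (strip w) , tt)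
    stripZeros-spec ρ []          = while-stop 0F 0F refl
    stripZeros-spec ρ (true ∷ w)  = relax (while-stop 0F 0F refl) z≤n
    stripZeros-spec ρ (false ∷ w) = while-step 0F 0F refl (pop-spec 0F) (stripZeros-spec ρ w)

    readTo-spec : ∀ p ρ u {w} v → All (λ s → p s ≡ true) u → p (hd w) ≡ false →
      Spec ρ (readTo p ρ) (u ++ w , v , tt) (length u ℕ.* 5) (w , u ʳ++ v , tt)
    readTo-spec p ρ []      v []       q = while-stop 0F 0F q
    readTo-spec p ρ (x ∷ u) v (px ∷ ps) q =
      while-step 0F 0F px (copy-spec 1F 0F ⟫ pop-spec 0F) (readTo-spec p ρ u (x ∷ v) ps q)

    recall-query : ∀ ρ t {X x w} → Solid X → reverse X ≡ x ∷ w →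
      Spec ρ (recall ρ) (code (Tape.before t) , Tape.scanned t ∷ [] , code (Tape.after t) , sep ∷ [] , X , [] , [] , tt)
        (length X ℕ.* 19 ℕ.+ spread t ℕ.* 4 ℕ.+ 8)
        ([] , x ∷ [] , code w , blank ∷ [] , X , [] , [] , tt)
    recall-query ρ (tape l s r) {X} {x} {w} sX eq = relax
      (if-true 3F refl
        (lift (4F ∷ 6F ∷ 5F ∷ []) (dup-spec _ sX) ⟫
         lift (0F ∷ []) (clearCode-spec _ l) ⟫
         lift (2F ∷ []) (clearCode-spec _ r) ⟫
         lift (6F ∷ 1F ∷ 2F ∷ []) (zload-spec _ x w sX eq) ⟫
         poke-spec 3F 3F 3F 3F (λ _ _ _ → blank)))
      (ℕ.≤-trans (ℕ.≤-reflexive (solve 3 (λ n l r → n :* con 12 :+ (l :* con 4 :+ (r :* con 4 :+ (n :* con 7 :+ con 3 :+ con 1))) := n :* con 19 :+ (l :+ r) :* con 4 :+ con 4) refl (length X) (length l) (length r)))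
        (ℕ.+-monoʳ-≤ (length X ℕ.* 19 ℕ.+ (length l ℕ.+ length r) ℕ.* 4) (ℕ.m≤m+n 4 4)))
      where open +-*-Solver

    recall-move : ∀ ρ t {X} m →
      Spec ρ (recall ρ) (code (Tape.before t) , Tape.scanned t ∷ [] , code (Tape.after t) , direction m ∷ [] , X , [] , [] , tt)
        (length X ℕ.* 19 ℕ.+ spread t ℕ.* 4 ℕ.+ 8)
        (code (Tape.before (move m t)) , Tape.scanned (move m t) ∷ [] , code (Tape.after (move m t)) , blank ∷ [] , X , [] , [] , tt)
    recall-move ρ t {X} m = relax (if-false 3F (lem m) (lift (0F ∷ 1F ∷ 2F ∷ 3F ∷ []) (zmove-spec _ t m))) (ℕ.m≤n+m 8 (length X ℕ.* 19 ℕ.+ spread t ℕ.* 4))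
      where
      lem : ∀ m → isSep (direction {a} m) ≡ false
      lem left  = refl
      lem right = refl
      lem stay  = refl

-- Encodings of dyadic numbers, and division by a power of two

signW : ∀ {a} → Bool → Word a
signW false = []
signW true  = minus ∷ []

negative : ℤ → Bool
negative (+ _)    = false
negative -[1+ _ ] = true

signed : Bool → ℕ → ℤ
signed false n = + n
signed true  n = ℤ.- (+ n)

encodeSign-signW : ∀ {a} z → encodeSign {a} z ≡ signW (negative z)
encodeSign-signW (+ _)    = refl
encodeSign-signW -[1+ _ ] = refl

whole : ℤ → ℕ → ℕ
whole z b = (ℤ.∣ z ∣ ℕ./ 2 ℕ.^ b) {{ℕ.m^n≢0 2 b}}

width : ℕ → ℕ
width m = suc ⌊log₂ m ⌋

encode𝔻-bits : ∀ {a} z b → encode𝔻 {a} (z /2^ b) ≡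
  signW (negative z) ++ (bits (msb (width (whole z b)) (whole z b)) ++ point ∷ bits (msb b ℤ.∣ z ∣))
encode𝔻-bits z b = trans (cong (_++ (encodeℕ (whole z b) ++ point ∷ digits b ℤ.∣ z ∣)) (encodeSign-signW z))
  (cong₂ (λ u v → signW (negative z) ++ (u ++ point ∷ v)) (digits-msb (width (whole z b)) (whole z b)) (digits-msb b ℤ.∣ z ∣))

-- Moving a word onto a stack reverses it. In this form the least significant digit is on top and
-- the sign at the bottom, as the shift requires.
reverse-encode𝔻 : ∀ {a} z b → reverse (encode𝔻 {a} (z /2^ b)) ≡
  bits (low b ℤ.∣ z ∣) ++ point ∷ bits (low (width (whole z b)) (whole z b)) ++ signW (negative z)
reverse-encode𝔻 {a} z b = begin
  reverse (encode𝔻 (z /2^ b))                                      ≡⟨ cong reverse (encode𝔻-bits z b) ⟩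
  reverse (σ ++ (bits (reverse I) ++ point ∷ bits (reverse F)))    ≡⟨ List.reverse-++ σ (bits (reverse I) ++ point ∷ bits (reverse F)) ⟩
  reverse (bits (reverse I) ++ point ∷ bits (reverse F)) ++ reverse σ ≡⟨ cong₂ _++_ (List.reverse-++ (bits (reverse I)) (point ∷ bits (reverse F))) (palin (negative z)) ⟩
  (reverse (point ∷ bits (reverse F)) ++ reverse (bits (reverse I))) ++ σ ≡⟨ cong (λ x → (x ++ reverse (bits (reverse I))) ++ σ) (List.unfold-reverse point (bits (reverse F))) ⟩
  ((reverse (bits (reverse F)) ++ point ∷ []) ++ reverse (bits (reverse I))) ++ σ ≡⟨ cong₂ (λ u v → ((u ++ point ∷ []) ++ v) ++ σ) (twice F) (twice I) ⟩
  ((bits F ++ point ∷ []) ++ bits I) ++ σ                          ≡⟨ cong (_++ σ) (List.++-assoc (bits F) (point ∷ []) (bits I)) ⟩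
  (bits F ++ point ∷ bits I) ++ σ                                  ≡⟨ List.++-assoc (bits F) (point ∷ bits I) σ ⟩
  bits F ++ point ∷ bits I ++ σ ∎
  where
  open ≡-Reasoning
  F = low b ℤ.∣ z ∣
  I = low (width (whole z b)) (whole z b)
  σ = signW {a} (negative z)
  palin : ∀ n → reverse (signW {a} n) ≡ signW n
  palin false = refl
  palin true  = refl
  twice : ∀ u → reverse (bits {a} (reverse u)) ≡ bits u
  twice u = trans (sym (List.reverse-map bitS (reverse u))) (cong bits (List.reverse-involutive u))

solid-encode𝔻 : ∀ {a} z b → Solid (encode𝔻 {a} (z /2^ b))
solid-encode𝔻 {a} z b = subst Solid (sym (encode𝔻-bits z b))
  (All.++⁺ (lem (negative z)) (All.++⁺ (bits-solid (msb (width (whole z b)) (whole z b))) (refl ∷ bits-solid (msb b ℤ.∣ z ∣))))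
  where
  lem : ∀ n → Solid (signW {a} n)
  lem false = []
  lem true  = refl ∷ []

encode𝔻-nonempty : ∀ {a} z b → ∃[ x ] ∃[ w ] (encode𝔻 {a} (z /2^ b) ≡ x ∷ w)
encode𝔻-nonempty {a} z b = lem (signW (negative z)) (bits (msb (width (whole z b)) (whole z b))) (encode𝔻-bits z b)
  where
  lem : ∀ (u : Word a) (v : Word a) {w w′} → w ≡ u ++ (v ++ point ∷ w′) → ∃[ x ] ∃[ w″ ] (w ≡ x ∷ w″)
  lem []      []      refl = _ , _ , refl
  lem []      (_ ∷ _) refl = _ , _ , refl
  lem (_ ∷ _) v       refl = _ , _ , refl

-- Bounds the digits of an output of M, before and after the point, by the length of the word on its
-- tape and so by the spread of that tape.
length-encode𝔻 : ∀ {a} z b → b ℕ.+ width (whole z b) ℕ.+ 1 ℕ.≤ length (encode𝔻 {a} (z /2^ b))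
length-encode𝔻 {a} z b = ℕ.≤-trans (ℕ.≤-reflexive lem) (ℕ.≤-trans (ℕ.m≤m+n _ (length σ))
  (ℕ.≤-reflexive (trans (sym (List.length-++ (bits F ++ point ∷ bits I))) (trans (cong length (List.++-assoc (bits F) (point ∷ bits I) σ))
    (trans (sym (cong length (reverse-encode𝔻 z b))) (List.length-reverse (encode𝔻 {a} (z /2^ b))))))))
  where
  F = low b ℤ.∣ z ∣
  I = low (width (whole z b)) (whole z b)
  σ = signW {a} (negative z)
  lem : b ℕ.+ width (whole z b) ℕ.+ 1 ≡ length (bits {a} F ++ point ∷ bits I)
  lem = sym (trans (List.length-++ (bits F)) (trans (cong₂ (λ x y → x ℕ.+ suc y)
    (trans (List.length-map bitS F) (length-low b ℤ.∣ z ∣)) (trans (List.length-map bitS I) (length-low (width (whole z b)) (whole z b))))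
    (trans (cong (b ℕ.+_) (ℕ.+-comm 1 (width (whole z b)))) (sym (ℕ.+-assoc b (width (whole z b)) 1)))))

-- w is the width of m, or m has been shifted out entirely.
data Shifted (w m : ℕ) : Set where
  gone : w ≡ 0 → m ≡ 0 → Shifted w m
  left : w ≡ width m → Shifted w m

shifted-half : ∀ {w m} → Shifted (suc w) m → Shifted w (m ℕ./ 2)
shifted-half {m = m} (left eq) with m
... | 0 = gone (ℕ.suc-injective eq) refl
... | 1 = gone (ℕ.suc-injective eq) refl
... | m′@(suc (suc k)) = left (trans (ℕ.suc-injective eq) (trans (log₂-double m′ (s≤s z≤n)) (cong (suc ∘ ⌊log₂_⌋) (sym (n/2≡⌊n/2⌋ m′)))))

module Shifting (a o e : ℕ) where
  open Routines₂ a o e public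

  -- Division by a power of two moves digits across the point. When the integer digits are used up
  -- zeros follow, while the sign beneath them has to stay; so a symbol is removed only if it is a
  -- digit.
  shiftBit shiftLoop : Regs 3 → Cmd
  shiftBit ρ = pop ρ 2F ⨟ pushF ρ 0F 1F 1F 1F (λ x _ _ → toBit x) ⨟ when ρ 1F isDigit (pop ρ 1F) skip
  shiftLoop ρ = while ρ 2F nonBlank (shiftBit ρ)

  -- Registers: output, scanned cell and right part of the zipper, buffer, unary shift.
  shiftOut : Regs 5 → Cmd
  shiftOut ρ =
    zread (pick ρ (1F ∷ 2F ∷ 3F ∷ [])) ⨟
    readTo (not ∘ isPoint) (pick ρ (3F ∷ 0F ∷ [])) ⨟
    pop ρ 3F ⨟
    shiftLoop (pick ρ (0F ∷ 3F ∷ 4F ∷ [])) ⨟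
    push ρ 0F point ⨟
    -- If the shift has used up all integer digits, the integer part must still be written as the
    -- digit 0.
    when ρ 3F isDigit (readTo isDigit (pick ρ (3F ∷ 0F ∷ []))) (push ρ 0F b0) ⨟
    when ρ 3F isMinus (push ρ 0F minus ⨟ pop ρ 3F) skip

  module Correct₃ (φ : Oracles o) where
    open Correct₂ φ public

    shiftLoop-spec : ∀ ρ k {w m} n v → Shifted w m →
      ∃[ w′ ] (Shifted w′ ((m ℕ./ 2 ℕ.^ k) {{ℕ.m^n≢0 2 k}}) × w′ ℕ.≤ w ×
        Spec ρ (shiftLoop ρ) (v , bits (low w m) ++ signW n , replicate k b1 , tt) (k ℕ.* 6)
          (digits k m ++ v , bits (low w′ ((m ℕ./ 2 ℕ.^ k) {{ℕ.m^n≢0 2 k}})) ++ signW n , [] , tt))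
    shiftLoop-spec ρ zero {w} {m} n v sh =
      w , subst (Shifted w) (sym (ℕ.n/1≡n m)) sh , ℕ.≤-refl ,
      (while-stop 2F 2F refl ▸ cong (λ x → v , bits (low w x) ++ signW n , [] , tt) (sym (ℕ.n/1≡n m)))
    shiftLoop-spec ρ (suc k) {zero} {m} n v (gone eq refl) =
      let w′ , sh , w′≤ , S = shiftLoop-spec ρ k {zero} {0} n (b0 ∷ v) (gone refl refl) in
      w′ , subst (Shifted w′) (sym (/2^-suc 0 k)) sh , w′≤ ,
      subst₂ (λ x y → Spec ρ (shiftLoop ρ) (v , signW n , replicate (suc k) b1 , tt) (6 ℕ.+ k ℕ.* 6) (x , bits (low w′ y) ++ signW n , [] , tt))
        (sym (List.++-assoc (digits k 0) (b0 ∷ []) v)) (sym (/2^-suc 0 k))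
        (while-step 2F 2F refl (relax (first n) (ℕ.m≤m+n 3 1)) S)
      where
      first : ∀ n → Spec ρ (shiftBit ρ) (v , signW n , replicate (suc k) b1 , tt) 3 (b0 ∷ v , signW n , replicate k b1 , tt)
      first false = pop-spec 2F ⟫ pushF-spec 0F 1F 1F 1F (λ x _ _ → toBit x) ⟫ if-false 1F refl skip-spec
      first true  = pop-spec 2F ⟫ pushF-spec 0F 1F 1F 1F (λ x _ _ → toBit x) ⟫ if-false 1F refl skip-spec
    shiftLoop-spec ρ (suc k) {zero} n v (left ())
    shiftLoop-spec ρ (suc k) {suc w} {m} n v sh =
      let w′ , sh′ , w′≤ , S = shiftLoop-spec ρ k {w} {m ℕ./ 2} n (bit (m ℕ.% 2) ∷ v) (shifted-half sh) in
      w′ , subst (Shifted w′) (sym (/2^-suc m k)) sh′ , ℕ.m≤n⇒m≤1+n w′≤ ,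
      subst₂ (λ x y → Spec ρ (shiftLoop ρ) (v , bitS (odd m) ∷ bits (low w (m ℕ./ 2)) ++ signW n , replicate (suc k) b1 , tt) (6 ℕ.+ k ℕ.* 6) (x , bits (low w′ y) ++ signW n , [] , tt))
        (sym (List.++-assoc (digits k (m ℕ./ 2)) (bit (m ℕ.% 2) ∷ []) v)) (sym (/2^-suc m k))
        (while-step 2F 2F refl (first (odd m) ▸ cong (λ s → s ∷ v , bits (low w (m ℕ./ 2)) ++ signW n , replicate k b1 , tt) (sym (bit-odd (m ℕ.% 2)))) S)
      where
      first : ∀ d → Spec ρ (shiftBit ρ) (v , bitS d ∷ bits (low w (m ℕ./ 2)) ++ signW n , replicate (suc k) b1 , tt) 4 (bitS d ∷ v , bits (low w (m ℕ./ 2)) ++ signW n , replicate k b1 , tt)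
      first false = pop-spec 2F ⟫ pushF-spec 0F 1F 1F 1F (λ x _ _ → toBit x) ⟫ if-true 1F refl (pop-spec 1F)
      first true  = pop-spec 2F ⟫ pushF-spec 0F 1F 1F 1F (λ x _ _ → toBit x) ⟫ if-true 1F refl (pop-spec 1F)

    hd-sign : ∀ n → isDigit (hd (signW {a} n)) ≡ false
    hd-sign false = refl
    hd-sign true  = refl

    shiftOut-spec : ∀ ρ s r z b k → blankFreePrefix (s ∷ r) ≡ encode𝔻 (z /2^ b) →
      Spec ρ (shiftOut ρ) ([] , s ∷ [] , code r , [] , replicate k b1 , tt)
        ((2 ℕ.+ length r ℕ.* 6) ℕ.+ (b ℕ.* 5 ℕ.+ (1 ℕ.+ (k ℕ.* 6 ℕ.+ (2 ℕ.+ ((width (whole z b) ℕ.* 5 ℕ.+ 2) ℕ.+ 3))))))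
        (encode𝔻 (z /2^ (k ℕ.+ b)) , s ∷ [] , [] , [] , [] , tt)
    shiftOut-spec ρ s r z b k eq =
      let w′ , sh , w′≤ , S = shiftLoop-spec (pick ρ (0F ∷ 3F ∷ 4F ∷ [])) k {width m} {m} n (bits F ʳ++ []) (left refl) in
      (lift (1F ∷ 2F ∷ 3F ∷ []) (zread-spec _ s r []) ▸
        cong (λ x → [] , s ∷ [] , [] , x , replicate k b1 , tt) (trans (cong reverse eq) (reverse-encode𝔻 z b))) ⟫
      relax (lift (3F ∷ 0F ∷ []) (readTo-spec (not ∘ isPoint) _ (bits F) [] (all-bits (not ∘ isPoint) refl refl F) refl))
        (ℕ.≤-reflexive (cong (ℕ._* 5) (trans (List.length-map bitS F) (length-low b ℤ.∣ z ∣)))) ⟫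
      pop-spec 3F ⟫
      lift (0F ∷ 3F ∷ 4F ∷ []) S ⟫
      push-spec 0F point ⟫
      integral w′ w′≤ sh ⟫
      sign
      where
      m = whole z b
      F = low b ℤ.∣ z ∣
      I = low (width m) m
      n = negative z
      q = (m ℕ./ 2 ℕ.^ k) {{ℕ.m^n≢0 2 k}}
      v = point ∷ digits k m ++ (bits F ʳ++ [])

      integral : ∀ w′ → w′ ℕ.≤ width m → Shifted w′ q →
        Spec ρ (when ρ 3F isDigit (readTo isDigit (pick ρ (3F ∷ 0F ∷ []))) (push ρ 0F b0))
          (v , s ∷ [] , [] , bits (low w′ q) ++ signW n , [] , tt) (width m ℕ.* 5 ℕ.+ 2) (encodeℕ q ++ v , s ∷ [] , [] , signW n , [] , tt)
      integral zero w≤ (gone _ q≡0) = relax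
        (if-false 3F (hd-sign n) (push-spec 0F b0) ▸ cong (λ x → encodeℕ x ++ v , s ∷ [] , [] , signW n , [] , tt) (sym q≡0))
        (ℕ.m≤n+m 2 (width m ℕ.* 5))
      integral (suc w) w≤ (left w≡) = relax
        (if-true 3F (head (odd q))
          (lift (3F ∷ 0F ∷ []) (readTo-spec isDigit _ (bits (low (suc w) q)) v (all-bits isDigit refl refl (low (suc w) q)) (hd-sign n))) ▸
          cong (λ x → x , s ∷ [] , [] , signW n , [] , tt)
            (trans (List.ʳ++-defn (bits (low (suc w) q))) (cong (_++ v) (trans (sym (digits-low (suc w) q)) (cong (λ x → digits x q) w≡)))))
        (ℕ.≤-trans (ℕ.≤-reflexive (cong (ℕ._* 5) (trans (List.length-map bitS (low (suc w) q)) (length-low (suc w) q))))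
          (ℕ.≤-trans (ℕ.*-monoˡ-≤ 5 w≤) (ℕ.m≤m+n (width m ℕ.* 5) 2)))
        where
        head : ∀ d → isDigit (bitS {a} d) ≡ true
        head false = refl
        head true  = refl
      integral zero w≤ (left ())

      body : encodeℕ q ++ v ≡ encodeℕ (whole z (k ℕ.+ b)) ++ point ∷ digits (k ℕ.+ b) ℤ.∣ z ∣
      body = cong₂ (λ x y → encodeℕ x ++ point ∷ y)
        (trans (ℕ.m/n/o≡m/[n*o] ℤ.∣ z ∣ (2 ℕ.^ b) (2 ℕ.^ k) {{ℕ.m^n≢0 2 b}} {{ℕ.m^n≢0 2 k}} {{nz}})
          (ℕ./-congʳ {{nz}} {{ℕ.m^n≢0 2 (k ℕ.+ b)}} (trans (sym (ℕ.^-distribˡ-+-* 2 b k)) (cong (2 ℕ.^_) (ℕ.+-comm b k)))))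
        (trans (cong (digits k m ++_) (sym (digits-low b ℤ.∣ z ∣))) (sym (digits-split k b ℤ.∣ z ∣)))
        where
        nz : NonZero (2 ℕ.^ b ℕ.* 2 ℕ.^ k)
        nz = ℕ.m*n≢0 (2 ℕ.^ b) (2 ℕ.^ k) {{ℕ.m^n≢0 2 b}} {{ℕ.m^n≢0 2 k}}

      sign : Spec ρ (when ρ 3F isMinus (push ρ 0F minus ⨟ pop ρ 3F) skip) (encodeℕ q ++ v , s ∷ [] , [] , signW n , [] , tt) 3
               (encode𝔻 (z /2^ (k ℕ.+ b)) , s ∷ [] , [] , [] , [] , tt)
      sign = prefix n ▸ cong (λ x → x , s ∷ [] , [] , [] , [] , tt)
        (trans (cong (signW n ++_) body) (cong (_++ (encodeℕ (whole z (k ℕ.+ b)) ++ point ∷ digits (k ℕ.+ b) ℤ.∣ z ∣)) (sym (encodeSign-signW z))))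
        where
        prefix : ∀ n → Spec ρ (when ρ 3F isMinus (push ρ 0F minus ⨟ pop ρ 3F) skip) (encodeℕ q ++ v , s ∷ [] , [] , signW n , [] , tt) 3
               (signW n ++ (encodeℕ q ++ v) , s ∷ [] , [] , [] , [] , tt)
        prefix false = relax (if-false 3F refl skip-spec) z≤n
        prefix true  = if-true 3F refl (push-spec 0F minus ⟫ pop-spec 3F)

pattern 10F = suc 9F
pattern 11F = suc 10F
pattern 12F = suc 11F
pattern 13F = suc 12F
pattern 14F = suc 13F
pattern 15F = suc 14F
pattern 16F = suc 15F
pattern 17F = suc 16F
pattern 18F = suc 17F
pattern 19F = suc 18F
pattern 20F = suc 19F
pattern 21F = suc 20F

-- Truncating the argument that the oracle supplies

replicate-∷ : ∀ {A : Set} n (x : A) w → replicate n x ++ x ∷ w ≡ x ∷ replicate n x ++ w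
replicate-∷ zero    x w = refl
replicate-∷ (suc n) x w = cong (x ∷_) (replicate-∷ n x w)

replicate-ʳ++ : ∀ {A : Set} n (x : A) w → replicate n x ʳ++ w ≡ replicate n x ++ w
replicate-ʳ++ zero    x w = refl
replicate-ʳ++ (suc n) x w = trans (replicate-ʳ++ n x (x ∷ w)) (replicate-∷ n x w)

replicate-++ : ∀ {A : Set} m n (x : A) → replicate m x ++ replicate n x ≡ replicate (m ℕ.+ n) x
replicate-++ zero    n x = refl
replicate-++ (suc m) n x = cong (x ∷_) (replicate-++ m n x)

-- The odd numerator over 2^(n+1) obtained by truncating z/2^b after n binary places and appending a 1;
-- the final 1 keeps it nonzero, so that its sign is that of z.
truncation : ℤ → ℕ → ℕ → List Bool
truncation z b n = true ∷ (takePad n (msb b ℤ.∣ z ∣) ʳ++ low (width (whole z b)) (whole z b))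

oddNumerator : ℤ → ℕ → ℕ → ℤ
oddNumerator z b n = signed (negative z) (val (truncation z b n))

length-truncation : ∀ z b n → length (truncation z b n) ≡ suc (n ℕ.+ width (whole z b))
length-truncation z b n = cong suc (trans (List.length-ʳ++ (takePad n (msb b ℤ.∣ z ∣)))
  (cong₂ ℕ._+_ (length-takePad n (msb b ℤ.∣ z ∣)) (length-low (width (whole z b)) (whole z b))))

∣signed∣ : ∀ s n → ℤ.∣ signed s n ∣ ≡ n
∣signed∣ false n       = refl
∣signed∣ true  zero    = refl
∣signed∣ true  (suc n) = refl

encodeSign-signed : ∀ {a} s n → encodeSign {a} (signed s (suc n)) ≡ signW s
encodeSign-signed false n = refl
encodeSign-signed true  n = refl

reverse-encode-integer : ∀ {a} z → reverse (encode𝔻 {a} (z /2^ 0)) ≡ point ∷ (encodeℕ ℤ.∣ z ∣ ʳ++ encodeSign z)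
reverse-encode-integer {a} z = trans (List.++-ʳ++ (encodeSign z) {encodeℕ (whole z 0) ++ point ∷ []} {[]})
  (trans (List.++-ʳ++ (encodeℕ (whole z 0)) {point ∷ []}) (cong₂ (λ x y → point ∷ (encodeℕ x ʳ++ y)) (ℕ.n/1≡n ℤ.∣ z ∣) (palin z)))
  where
  palin : ∀ z → encodeSign {a} z ʳ++ [] ≡ encodeSign z
  palin (+ _)    = refl
  palin -[1+ _ ] = refl

-- Abstract, because unfolding an encoding unfolds the accessibility proofs inside ⌊log₂_⌋.
abstract
  reversed : ∀ {a} → ℤ → Word a
  reversed z = reverse (encode𝔻 (z /2^ 0))

  reversed-def : ∀ {a} z → reversed {a} z ≡ reverse (encode𝔻 (z /2^ 0))
  reversed-def z = refl

val-zeros : ∀ n u → val (replicate n false ++ u) ≡ 2 ℕ.^ n ℕ.* val u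
val-zeros zero    u = sym (ℕ.+-identityʳ (val u))
val-zeros (suc n) u = trans (cong (2 ℕ.*_) (val-zeros n u)) (sym (ℕ.*-assoc 2 (2 ℕ.^ n) (val u)))

encodeℕ-2^ : ∀ {a} n → encodeℕ {a} (2 ℕ.^ n) ≡ reverse (replicate n b0 ++ b1 ∷ [])
encodeℕ-2^ {a} n = trans (cong encodeℕ (sym (trans (val-zeros n (true ∷ [])) (ℕ.*-identityʳ (2 ℕ.^ n)))))
  (trans (encodeℕ-val (replicate n false)) (cong reverse (trans (List.map-++ bitS (replicate n false) (true ∷ [])) (cong (_++ b1 ∷ []) (List.map-replicate bitS n false)))))

length-strip : ∀ w → length (strip w) ℕ.≤ length w
length-strip []          = z≤n
length-strip (false ∷ w) = ℕ.m≤n⇒m≤1+n (length-strip w)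
length-strip (true ∷ w)  = ℕ.≤-refl

-- An odd number is not zero, so the exceptional case of `Stripped` cannot occur.
strip-odd : ∀ {a} u → bits {a} (strip (reverse (true ∷ u))) ≡ encodeℕ (val (true ∷ u))
strip-odd {a} u with stripped {a} (reverse (true ∷ u))
... | zero _ v≡0 = ⊥-elim (ℕ.1+n≢0 (trans (cong val (sym (List.reverse-involutive (true ∷ u)))) v≡0))
... | nonzero _ eq _ = trans eq (cong (encodeℕ ∘ val) (List.reverse-involutive (true ∷ u)))

dropB : ℕ → List Bool → List Bool
dropB zero    G = G
dropB (suc n) G = dropB n (tlB G)

module Preparing (a e : ℕ) where
  open Shifting a 1 e public

  count : Regs 3 → Cmd
  count ρ = while ρ 0F nonBlank (pop ρ 0F ⨟ push ρ 1F b1 ⨟ push ρ 2F b1)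

  ones : ℕ → Regs 2 → Cmd
  ones zero    ρ = skip
  ones (suc c) ρ = push ρ 0F b1 ⨟ push ρ 1F b1 ⨟ ones c ρ

  -- Registers: oracle answer, digits, precision, copy of the precision, power of two.
  fraction : Regs 5 → Cmd
  -- The precision governs the loop, not the answer: a long answer is cut off, a short one padded
  -- with zeros by `toBit`.
  fraction ρ = while ρ 2F nonBlank
    (pushF ρ 1F 0F 0F 0F (λ x _ _ → toBit x) ⨟ pop ρ 0F ⨟ pop ρ 2F ⨟ push ρ 3F b1 ⨟ push ρ 4F b0)

  -- Registers: input, oracle tape, reversed numerator, reversed power of two, precision, shift, two buffers.
  prepare : ℕ → Regs 8 → Cmd
  prepare c ρ =
    count (pick ρ (0F ∷ 1F ∷ 4F ∷ [])) ⨟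
    -- The oracle is asked for precision `c + n`; the additional `c` absorbs the constants of the
    -- error estimate.
    ones c (pick ρ (1F ∷ 4F ∷ [])) ⨟
    query′ 0F ⨟
    when ρ 1F isMinus (push ρ 2F minus ⨟ pop ρ 1F) skip ⨟
    readTo (not ∘ isPoint) (pick ρ (1F ∷ 6F ∷ [])) ⨟
    pop ρ 1F ⨟
    push ρ 3F b1 ⨟
    fraction (pick ρ (1F ∷ 6F ∷ 4F ∷ 5F ∷ 3F ∷ [])) ⨟
    -- The appended digit 1 occupies one further binary place, hence one more shift and one more
    -- factor 2 in the denominator.
    push ρ 6F b1 ⨟ push ρ 5F b1 ⨟ push ρ 3F b0 ⨟ push ρ 3F point ⨟
    -- The numerator is reversed twice; in between its most significant digit is on top and leading
    -- zeros can be removed.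
    mv (pick ρ (6F ∷ 7F ∷ [])) ⨟
    stripZeros (pick ρ (7F ∷ [])) ⨟
    mv (pick ρ (7F ∷ 2F ∷ [])) ⨟
    push ρ 2F point

  prepareTime : ℕ → ℕ → ℕ → ℕ
  prepareTime c n ℓ =
    n ℕ.* 7 ℕ.+ (c ℕ.* 4 ℕ.+ (1 ℕ.+ (3 ℕ.+ (ℓ ℕ.* 5 ℕ.+ (1 ℕ.+ (2 ℕ.+ ((c ℕ.+ n) ℕ.* 10 ℕ.+ (2 ℕ.+ (2 ℕ.+ (2 ℕ.+ (2 ℕ.+
    (suc ((c ℕ.+ n) ℕ.+ ℓ) ℕ.* 5 ℕ.+ (suc ((c ℕ.+ n) ℕ.+ ℓ) ℕ.* 3 ℕ.+ (suc ((c ℕ.+ n) ℕ.+ ℓ) ℕ.* 5 ℕ.+ 2))))))))))))))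

  module Correct₄ (φ : Oracles 1) where
    open Correct₃ φ public

    count-spec : ∀ ρ n u v → Spec ρ (count ρ) (replicate n b1 , u , v , tt) (n ℕ.* 7) ([] , replicate n b1 ʳ++ u , replicate n b1 ʳ++ v , tt)
    count-spec ρ zero    u v = while-stop 0F 0F refl
    count-spec ρ (suc n) u v = while-step 0F 0F refl (pop-spec 0F ⟫ push-spec 1F b1 ⟫ push-spec 2F b1) (count-spec ρ n (b1 ∷ u) (b1 ∷ v))

    ones-spec : ∀ c ρ u v → Spec ρ (ones c ρ) (u , v , tt) (c ℕ.* 4) (replicate c b1 ʳ++ u , replicate c b1 ʳ++ v , tt)
    ones-spec zero    ρ u v = skip-spec
    ones-spec (suc c) ρ u v = push-spec 0F b1 ⟫ push-spec 1F b1 ⟫ ones-spec c ρ (b1 ∷ u) (b1 ∷ v)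

    fraction-spec : ∀ ρ k G u v y → Spec ρ (fraction ρ) (bits G , u , replicate k b1 , v , y , tt) (k ℕ.* 10)
      (bits (dropB k G) , bits (takePad k G) ʳ++ u , [] , replicate k b1 ʳ++ v , replicate k b0 ʳ++ y , tt)
    fraction-spec ρ zero    G           u v y = while-stop 2F 2F refl
    fraction-spec ρ (suc k) []          u v y = while-step 2F 2F refl
      (pushF-spec 1F 0F 0F 0F (λ x _ _ → toBit x) ⟫ pop-spec 0F ⟫ pop-spec 2F ⟫ push-spec 3F b1 ⟫ push-spec 4F b0) (fraction-spec ρ k [] (b0 ∷ u) (b1 ∷ v) (b0 ∷ y))
    fraction-spec ρ (suc k) (false ∷ G) u v y = while-step 2F 2F refl
      (pushF-spec 1F 0F 0F 0F (λ x _ _ → toBit x) ⟫ pop-spec 0F ⟫ pop-spec 2F ⟫ push-spec 3F b1 ⟫ push-spec 4F b0) (fraction-spec ρ k G (b0 ∷ u) (b1 ∷ v) (b0 ∷ y))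
    fraction-spec ρ (suc k) (true ∷ G)  u v y = while-step 2F 2F refl
      (pushF-spec 1F 0F 0F 0F (λ x _ _ → toBit x) ⟫ pop-spec 0F ⟫ pop-spec 2F ⟫ push-spec 3F b1 ⟫ push-spec 4F b0) (fraction-spec ρ k G (b1 ∷ u) (b1 ∷ v) (b0 ∷ y))

    -- `rest` consists of the digits of the answer beyond the precision. They stay on the oracle
    -- tape, since removing them would take time that no polynomial in `k` and `n` bounds.
    prepare-spec : ∀ c ρ n z b → addr ρ 1F ≡ inj₁ 0F → φ 0F (c ℕ.+ n) ≡ (z /2^ b) →
      ∃[ rest ] Spec ρ (prepare c ρ) (replicate n b1 , [] , [] , [] , [] , [] , [] , [] , tt) (prepareTime c n (width (whole z b)))
        ([] , rest , reversed (oddNumerator z b (c ℕ.+ n)) , reversed (+ (2 ℕ.^ suc (c ℕ.+ n))) , [] , replicate (suc (c ℕ.+ n)) b1 , [] , [] , tt)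
    prepare-spec c ρ n z b orc φ≡ = bits (dropB N G) ,
      (lift (0F ∷ 1F ∷ 4F ∷ []) (count-spec _ n [] []) ⟫
      (lift (1F ∷ 4F ∷ []) (ones-spec c _ (replicate n b1 ʳ++ []) (replicate n b1 ʳ++ [])) ▸
        cong (λ x → [] , x , [] , [] , x , [] , [] , [] , tt) ones≡) ⟫
      (query-spec 1F 0F orc ▸ cong (λ x → [] , x , [] , [] , replicate N b1 , [] , [] , [] , tt) answer≡) ⟫
      sign s ⟫
      relax (lift (1F ∷ 6F ∷ []) (readTo-spec (not ∘ isPoint) _ (bits (reverse I)) [] (all-bits (not ∘ isPoint) refl refl (reverse I)) refl) ▸
          cong (λ x → [] , point ∷ bits G , signW s , [] , replicate N b1 , [] , x , [] , tt) (back I))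
        (ℕ.≤-reflexive (cong (ℕ._* 5) (trans (List.length-map bitS (reverse I)) (trans (List.length-reverse I) (length-low ℓ q))))) ⟫
      pop-spec 1F ⟫
      push-spec 3F b1 ⟫
      lift (1F ∷ 6F ∷ 4F ∷ 5F ∷ 3F ∷ []) (fraction-spec _ N G (bits I) [] (b1 ∷ [])) ⟫
      push-spec 6F b1 ⟫ push-spec 5F b1 ⟫ push-spec 3F b0 ⟫
      (push-spec 3F point ▸
        cong (λ x → [] , bits (dropB N G) , signW s , point ∷ b0 ∷ (replicate N b0 ʳ++ b1 ∷ []) , [] , b1 ∷ (replicate N b1 ʳ++ []) , b1 ∷ x , [] , tt) (sym (bits-ʳ++ (takePad N G) I))) ⟫
      relax (lift (6F ∷ 7F ∷ []) (mv-spec _ [] (bits-solid U)) ▸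
          cong (λ x → [] , bits (dropB N G) , signW s , point ∷ b0 ∷ (replicate N b0 ʳ++ b1 ∷ []) , [] , b1 ∷ (replicate N b1 ʳ++ []) , [] , x , tt) (sym (List.reverse-map bitS U)))
        (ℕ.≤-reflexive (cong (ℕ._* 5) lenU)) ⟫
      relax (lift (7F ∷ []) (stripZeros-spec _ (reverse U))) (ℕ.≤-reflexive (cong (ℕ._* 3) (trans (List.length-reverse U) (length-truncation z b N)))) ⟫
      relax (lift (7F ∷ 2F ∷ []) (mv-spec _ (signW s) (bits-solid (strip (reverse U)))))
        (ℕ.*-monoˡ-≤ 5 (ℕ.≤-trans (ℕ.≤-reflexive (List.length-map bitS (strip (reverse U)))) (ℕ.≤-trans (length-strip (reverse U)) (ℕ.≤-reflexive (trans (List.length-reverse U) (length-truncation z b N)))))) ⟫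
      push-spec 2F point) ▸
      trans (cong₂ (λ x y → [] , bits (dropB N G) , x , y , [] , b1 ∷ (replicate N b1 ʳ++ []) , [] , [] , tt) XA≡ YA≡)
            (cong (λ x → [] , bits (dropB N G) , reversed (oddNumerator z b N) , reversed (+ (2 ℕ.^ suc N)) , [] , b1 ∷ x , [] , [] , tt)
              (trans (replicate-ʳ++ N b1 []) (List.++-identityʳ (replicate N b1))))
      where
      N = c ℕ.+ n
      q = whole z b
      ℓ = width q
      I = low ℓ q
      G = msb b ℤ.∣ z ∣
      s = negative z
      U = truncation z b N

      lenU : length (bits {a} U) ≡ suc (N ℕ.+ ℓ)
      lenU = trans (List.length-map bitS U) (length-truncation z b N)

      ones≡ : replicate c b1 ʳ++ (replicate n b1 ʳ++ []) ≡ replicate N b1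
      ones≡ = trans (replicate-ʳ++ c b1 _) (trans (cong (replicate c b1 ++_) (trans (replicate-ʳ++ n b1 []) (List.++-identityʳ (replicate n b1)))) (replicate-++ c n b1))

      answer≡ : encode𝔻 (φ 0F (length (blankFreePrefix {a} (replicate N b1)))) ≡ signW s ++ (bits (reverse I) ++ point ∷ bits G)
      answer≡ = trans (cong (λ k → encode𝔻 (φ 0F k)) (trans (cong length (solid-prefix (solid-replicate N refl))) (List.length-replicate N)))
        (trans (cong encode𝔻 φ≡) (encode𝔻-bits z b))

      back : ∀ u → bits {a} (reverse u) ʳ++ [] ≡ bits u
      back u = trans (sym (List.reverse-map bitS (reverse u))) (cong bits (List.reverse-involutive u))

      sign : ∀ s → Spec ρ (when ρ 1F isMinus (push ρ 2F minus ⨟ pop ρ 1F) skip)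
        ([] , signW s ++ (bits (reverse I) ++ point ∷ bits G) , [] , [] , replicate N b1 , [] , [] , [] , tt) 3
        ([] , bits (reverse I) ++ point ∷ bits G , signW s , [] , replicate N b1 , [] , [] , [] , tt)
      sign true  = if-true 1F refl (push-spec 2F minus ⟫ pop-spec 1F)
      sign false = relax (if-false 1F (plain (reverse I)) skip-spec) z≤n
        where
        plain : ∀ u → isMinus (hd (bits {a} u ++ point ∷ bits G)) ≡ false
        plain []          = refl
        plain (false ∷ u) = refl
        plain (true ∷ u)  = refl

      XA≡ : point ∷ (bits {a} (strip (reverse U)) ʳ++ signW s) ≡ reversed (oddNumerator z b N)
      XA≡ = trans (cong₂ (λ x y → point ∷ (x ʳ++ y))
          (trans (strip-odd (takePad N G ʳ++ I)) (cong encodeℕ (sym (∣signed∣ s (val U)))))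
          (sym (encodeSign-signed s (2 ℕ.* val (takePad N G ʳ++ I)))))
        (sym (trans (reversed-def (oddNumerator z b N)) (reverse-encode-integer (oddNumerator z b N))))

      YA≡ : point ∷ b0 ∷ (replicate N b0 ʳ++ b1 ∷ []) ≡ reversed (+ (2 ℕ.^ suc N))
      YA≡ = sym (trans (trans (reversed-def (+ (2 ℕ.^ suc N))) (reverse-encode-integer (+ (2 ℕ.^ suc N)))) (cong (point ∷_)
        (trans (cong reverse (encodeℕ-2^ (suc N))) (trans (List.reverse-involutive (replicate (suc N) b0 ++ b1 ∷ [])) (cong (b0 ∷_) (sym (replicate-ʳ++ N b0 (b1 ∷ []))))))))

-- A fresh tape can serve as the scanned cell of an empty zipper, or as a cleared direction cell,
-- without initialisation.
shows-blank : ∀ {a} → load {a} [] shows (blank ∷ [])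
shows-blank = showing λ { zero → refl ; (suc zero) → refl ; (suc (suc n)) → refl }

↑ˡ≢↑ʳ : ∀ {m n} (i : Fin m) (j : Fin n) → i ↑ˡ n ≢ m ↑ʳ j
↑ˡ≢↑ʳ {m} {n} i j eq with trans (sym (Fin.splitAt-↑ˡ m i n)) (trans (cong (splitAt m) eq) (Fin.splitAt-↑ʳ m n j))
... | ()

prefix-length : ∀ {a} (u : Word a) → length (blankFreePrefix u) ℕ.≤ length u
prefix-length []          = z≤n
prefix-length (blank ∷ u) = z≤n
prefix-length (b0 ∷ u)    = s≤s (prefix-length u)
prefix-length (b1 ∷ u)    = s≤s (prefix-length u)
prefix-length (minus ∷ u) = s≤s (prefix-length u)
prefix-length (point ∷ u) = s≤s (prefix-length u)
prefix-length (sep ∷ u)   = s≤s (prefix-length u)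
prefix-length (aux _ ∷ u) = s≤s (prefix-length u)

spread-load : ∀ {a} (w : Word a) → spread (load w) ℕ.≤ length w
spread-load []      = z≤n
spread-load (s ∷ w) = ℕ.n≤1+n (length w)

-- The machine that computes `f` from a machine for `g̃`

module Backward (M : OTM 2) (c : ℕ) where
  open OTM M using (extraTapes) renaming (auxSymbols to a)
  private
    x = extraTapes
  open Preparing a (20 ℕ.+ x)
  open Simulation M 1 20
  open Frag

  -- 0 input/output; 1 oracle; 2-5, 6-9, 10-13 zippers for the input tape and the two oracle tapes of M;
  -- 14, 15 reversed oracle answers; 16, 17 buffers; 18 precision; 19 shift; 20, 21 buffers.
  ρ : Regs 22
  ρ = regs at at-inj
    where
    at : Fin 22 → Address
    at 0F            = inj₂ 0F
    at 1F            = inj₁ 0F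
    at (suc (suc k)) = inj₂ (suc (k ↑ˡ x))
    at-inj : ∀ {r s} → at r ≡ at s → r ≡ s
    at-inj {0F}          {0F}          eq = refl
    at-inj {1F}          {1F}          eq = refl
    at-inj {suc (suc k)} {suc (suc l)} eq = cong (λ i → suc (suc i)) (Fin.↑ˡ-injective x k l (Fin.suc-injective (inj₂-injective eq)))
    at-inj {0F}          {1F}          ()
    at-inj {1F}          {0F}          ()
    at-inj {0F}          {suc (suc _)} ()
    at-inj {1F}          {suc (suc _)} ()
    at-inj {suc (suc _)} {0F}          ()
    at-inj {suc (suc _)} {1F}          ()

  apart : ∀ r k → addr ρ r ≢ raw k
  apart 0F            k eq with inj₂-injective eq
  ... | ()
  apart 1F            k ()
  apart (suc (suc j)) k eq = ↑ˡ≢↑ʳ (suc j) k (inj₂-injective eq)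

  os dir : Fin 3 → Fin 22
  os  = lookup (3F ∷ 7F ∷ 11F ∷ [])
  dir = lookup (5F ∷ 9F ∷ 13F ∷ [])

  os≢dir : ∀ i j → os i ≢ dir j
  os≢dir 0F 0F ()
  os≢dir 0F 1F ()
  os≢dir 0F 2F ()
  os≢dir 1F 0F ()
  os≢dir 1F 1F ()
  os≢dir 1F 2F ()
  os≢dir 2F 0F ()
  os≢dir 2F 1F ()
  os≢dir 2F 2F ()

  handler : Cmd
  handler =
    zmove (pick ρ (2F ∷ 3F ∷ 4F ∷ 5F ∷ [])) ⨟
    recall (pick ρ (6F ∷ 7F ∷ 8F ∷ 9F ∷ 14F ∷ 16F ∷ 17F ∷ [])) ⨟
    recall (pick ρ (10F ∷ 11F ∷ 12F ∷ 13F ∷ 15F ∷ 16F ∷ 17F ∷ []))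

  open Machine ρ os dir handler

  prologue epilogue program : Cmd
  prologue = prepare c (pick ρ (0F ∷ 1F ∷ 14F ∷ 15F ∷ 18F ∷ 19F ∷ 20F ∷ 21F ∷ []))
  epilogue = shiftOut (pick ρ (0F ∷ 3F ∷ 4F ∷ 17F ∷ 19F ∷ []))
  program  = prologue ⨟ embed simulate ⨟ epilogue

  machine : OTM 1
  machine = compile (frag program)

  module Encoding (orc X Y N : Word a) where

    enc : Vec (Tape a) 3 → Vec (Symbol a) 3 → Store 22
    enc (t₀ ∷ t₁ ∷ t₂ ∷ []) (d₀ ∷ d₁ ∷ d₂ ∷ []) =
      [] , orc ,
      code (Tape.before t₀) , Tape.scanned t₀ ∷ [] , code (Tape.after t₀) , d₀ ∷ [] ,
      code (Tape.before t₁) , Tape.scanned t₁ ∷ [] , code (Tape.after t₁) , d₁ ∷ [] ,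
      code (Tape.before t₂) , Tape.scanned t₂ ∷ [] , code (Tape.after t₂) , d₂ ∷ [] ,
      X , Y , [] , [] , [] , N , [] , [] , tt

    enc-os : ∀ zs ds i → get (os i) (enc zs ds) ≡ Tape.scanned (lookup zs i) ∷ []
    enc-os (_ ∷ _ ∷ _ ∷ []) (_ ∷ _ ∷ _ ∷ []) 0F = refl
    enc-os (_ ∷ _ ∷ _ ∷ []) (_ ∷ _ ∷ _ ∷ []) 1F = refl
    enc-os (_ ∷ _ ∷ _ ∷ []) (_ ∷ _ ∷ _ ∷ []) 2F = refl

    enc-dir : ∀ zs ds i → get (dir i) (enc zs ds) ≡ lookup ds i ∷ []
    enc-dir (_ ∷ _ ∷ _ ∷ []) (_ ∷ _ ∷ _ ∷ []) 0F = refl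
    enc-dir (_ ∷ _ ∷ _ ∷ []) (_ ∷ _ ∷ _ ∷ []) 1F = refl
    enc-dir (_ ∷ _ ∷ _ ∷ []) (_ ∷ _ ∷ _ ∷ []) 2F = refl

    enc-rest : ∀ r → (∀ i → os i ≢ r) → (∀ i → dir i ≢ r) → ∀ (u : Vec (Symbol a) 3) zs ds ds′ →
               get r (enc (Vec.zipWith write u zs) ds′) ≡ get r (enc zs ds)
    enc-rest 0F ¬o ¬d (_ ∷ _ ∷ _ ∷ []) (_ ∷ _ ∷ _ ∷ []) (_ ∷ _ ∷ _ ∷ []) (_ ∷ _ ∷ _ ∷ []) = refl
    enc-rest 1F ¬o ¬d (_ ∷ _ ∷ _ ∷ []) (_ ∷ _ ∷ _ ∷ []) (_ ∷ _ ∷ _ ∷ []) (_ ∷ _ ∷ _ ∷ []) = refl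
    enc-rest 2F ¬o ¬d (_ ∷ _ ∷ _ ∷ []) (_ ∷ _ ∷ _ ∷ []) (_ ∷ _ ∷ _ ∷ []) (_ ∷ _ ∷ _ ∷ []) = refl
    enc-rest 3F ¬o ¬d _ _ _ _ = ⊥-elim (¬o 0F refl)
    enc-rest 4F ¬o ¬d (_ ∷ _ ∷ _ ∷ []) (_ ∷ _ ∷ _ ∷ []) (_ ∷ _ ∷ _ ∷ []) (_ ∷ _ ∷ _ ∷ []) = refl
    enc-rest 5F ¬o ¬d _ _ _ _ = ⊥-elim (¬d 0F refl)
    enc-rest 6F ¬o ¬d (_ ∷ _ ∷ _ ∷ []) (_ ∷ _ ∷ _ ∷ []) (_ ∷ _ ∷ _ ∷ []) (_ ∷ _ ∷ _ ∷ []) = refl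
    enc-rest 7F ¬o ¬d _ _ _ _ = ⊥-elim (¬o 1F refl)
    enc-rest 8F ¬o ¬d (_ ∷ _ ∷ _ ∷ []) (_ ∷ _ ∷ _ ∷ []) (_ ∷ _ ∷ _ ∷ []) (_ ∷ _ ∷ _ ∷ []) = refl
    enc-rest 9F ¬o ¬d _ _ _ _ = ⊥-elim (¬d 1F refl)
    enc-rest 10F ¬o ¬d (_ ∷ _ ∷ _ ∷ []) (_ ∷ _ ∷ _ ∷ []) (_ ∷ _ ∷ _ ∷ []) (_ ∷ _ ∷ _ ∷ []) = refl
    enc-rest 11F ¬o ¬d _ _ _ _ = ⊥-elim (¬o 2F refl)
    enc-rest 12F ¬o ¬d (_ ∷ _ ∷ _ ∷ []) (_ ∷ _ ∷ _ ∷ []) (_ ∷ _ ∷ _ ∷ []) (_ ∷ _ ∷ _ ∷ []) = refl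
    enc-rest 13F ¬o ¬d _ _ _ _ = ⊥-elim (¬d 2F refl)
    enc-rest 14F ¬o ¬d (_ ∷ _ ∷ _ ∷ []) (_ ∷ _ ∷ _ ∷ []) (_ ∷ _ ∷ _ ∷ []) (_ ∷ _ ∷ _ ∷ []) = refl
    enc-rest 15F ¬o ¬d (_ ∷ _ ∷ _ ∷ []) (_ ∷ _ ∷ _ ∷ []) (_ ∷ _ ∷ _ ∷ []) (_ ∷ _ ∷ _ ∷ []) = refl
    enc-rest 16F ¬o ¬d (_ ∷ _ ∷ _ ∷ []) (_ ∷ _ ∷ _ ∷ []) (_ ∷ _ ∷ _ ∷ []) (_ ∷ _ ∷ _ ∷ []) = refl
    enc-rest 17F ¬o ¬d (_ ∷ _ ∷ _ ∷ []) (_ ∷ _ ∷ _ ∷ []) (_ ∷ _ ∷ _ ∷ []) (_ ∷ _ ∷ _ ∷ []) = refl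
    enc-rest 18F ¬o ¬d (_ ∷ _ ∷ _ ∷ []) (_ ∷ _ ∷ _ ∷ []) (_ ∷ _ ∷ _ ∷ []) (_ ∷ _ ∷ _ ∷ []) = refl
    enc-rest 19F ¬o ¬d (_ ∷ _ ∷ _ ∷ []) (_ ∷ _ ∷ _ ∷ []) (_ ∷ _ ∷ _ ∷ []) (_ ∷ _ ∷ _ ∷ []) = refl
    enc-rest 20F ¬o ¬d (_ ∷ _ ∷ _ ∷ []) (_ ∷ _ ∷ _ ∷ []) (_ ∷ _ ∷ _ ∷ []) (_ ∷ _ ∷ _ ∷ []) = refl
    enc-rest 21F ¬o ¬d (_ ∷ _ ∷ _ ∷ []) (_ ∷ _ ∷ _ ∷ []) (_ ∷ _ ∷ _ ∷ []) (_ ∷ _ ∷ _ ∷ []) = refl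

  module _ (n : ℕ) (φ : Oracles 1) (z : ℤ) (b : ℕ) (φ≡ : φ 0F (c ℕ.+ n) ≡ (z /2^ b)) where
    open Correct₄ φ

    N ℓ Q D : ℕ
    N = c ℕ.+ n
    ℓ = width (whole z b)
    -- Room for a stored answer: at most `suc (N + ℓ)` digits, the sign and the point.
    Q = 3 ℕ.+ (N ℕ.+ ℓ)
    D = 3 ℕ.+ (Q ℕ.+ Q)

    numerators : Fin 2 → ℤ
    numerators 0F = oddNumerator z b N
    numerators 1F = + (2 ℕ.^ suc N)

    ψ : Oracles 2
    ψ i _ = numerators i /2^ 0

    B : ℕ → ℕ
    B s = 8 ℕ.+ ((Q ℕ.* 19 ℕ.+ s ℕ.* 4 ℕ.+ 8) ℕ.+ (Q ℕ.* 19 ℕ.+ s ℕ.* 4 ℕ.+ 8))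

    B-mono : ∀ {m k} → m ℕ.≤ k → B m ℕ.≤ B k
    B-mono m≤k = ℕ.+-monoʳ-≤ 8 (ℕ.+-mono-≤ lem lem)
      where lem = ℕ.+-monoˡ-≤ 8 (ℕ.+-monoʳ-≤ (Q ℕ.* 19) (ℕ.*-monoˡ-≤ 4 m≤k))

    stored : Fin 2 → Word a
    stored i = reversed (numerators i)

    stored-solid : ∀ i → Solid (stored i)
    stored-solid i = subst Solid (sym (reversed-def (numerators i))) (solid-ʳ++ (solid-encode𝔻 (numerators i) 0) [])

    reverse-stored : ∀ i → reverse (stored i) ≡ encode𝔻 (numerators i /2^ 0)
    reverse-stored i = trans (cong reverse (reversed-def (numerators i))) (List.reverse-involutive (encode𝔻 (numerators i /2^ 0)))

    length-numerator : ∀ i → length (encode𝔻 {a} (numerators i /2^ 0)) ℕ.≤ Q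
    length-numerator i = ℕ.≤-trans (ℕ.≤-reflexive (trans (sym (List.length-reverse (encode𝔻 {a} (numerators i /2^ 0)))) (cong length (reverse-encode-integer (numerators i)))))
      (s≤s (ℕ.≤-trans (ℕ.≤-reflexive (List.length-ʳ++ (encodeℕ {a} ℤ.∣ numerators i ∣)))
        (ℕ.≤-trans (ℕ.+-mono-≤ (lem i) (short (numerators i))) (ℕ.≤-reflexive (ℕ.+-comm (suc (N ℕ.+ ℓ)) 1)))))
      where
      short : ∀ z → length (encodeSign {a} z) ℕ.≤ 1
      short (+ _)    = z≤n
      short -[1+ _ ] = ℕ.≤-refl
      lem : ∀ i → length (encodeℕ {a} ℤ.∣ numerators i ∣) ℕ.≤ suc (N ℕ.+ ℓ)
      lem 0F = ℕ.≤-trans (ℕ.≤-reflexive (trans (cong (length ∘ encodeℕ {a}) (∣signed∣ (negative z) (val U))) (trans (cong length (sym (strip-odd {a} (takePad N (msb b ℤ.∣ z ∣) ʳ++ low ℓ (whole z b)))))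
          (List.length-map bitS (strip (reverse U))))))
        (ℕ.≤-trans (length-strip (reverse U)) (ℕ.≤-reflexive (trans (List.length-reverse U) (length-truncation z b N))))
        where U = truncation z b N
      lem 1F = ℕ.≤-trans (ℕ.≤-reflexive (trans (cong length (encodeℕ-2^ {a} (suc N))) (trans (List.length-reverse (replicate (suc N) b0 ++ b1 ∷ []))
          (trans (List.length-++ (replicate (suc N) b0)) (trans (cong (ℕ._+ 1) (List.length-replicate (suc N))) (cong suc (ℕ.+-comm N 1)))))))
        (s≤s (ℕ.≤-trans (ℕ.≤-reflexive (ℕ.+-comm 1 N)) (ℕ.+-monoʳ-≤ N (s≤s z≤n))))

    length-stored : ∀ i → length (stored i) ℕ.≤ Q
    length-stored i = ℕ.≤-trans (ℕ.≤-reflexive (trans (cong length (reversed-def {a} (numerators i))) (List.length-reverse (encode𝔻 {a} (numerators i /2^ 0))))) (length-numerator i)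

    module Handler (orc N′ : Word a) where
      open Encoding orc (stored 0F) (stored 1F) N′

      spread₁ : ∀ (t₀ t₁ t₂ : Tape a) → spread t₁ ℕ.≤ spreads (t₀ ∷ t₁ ∷ t₂ ∷ [])
      spread₁ t₀ t₁ t₂ = ℕ.≤-trans (ℕ.m≤m+n (spread t₁) (spread t₂ ℕ.+ 0)) (ℕ.m≤n+m _ (spread t₀))
      spread₂ : ∀ (t₀ t₁ t₂ : Tape a) → spread t₂ ℕ.≤ spreads (t₀ ∷ t₁ ∷ t₂ ∷ [])
      spread₂ t₀ t₁ t₂ = ℕ.≤-trans (ℕ.m≤m+n (spread t₂) 0) (ℕ.≤-trans (ℕ.m≤n+m _ (spread t₁)) (ℕ.m≤n+m _ (spread t₀)))

      cost : ∀ i (t : Tape a) s → spread t ℕ.≤ s → length (stored i) ℕ.* 19 ℕ.+ spread t ℕ.* 4 ℕ.+ 8 ℕ.≤ Q ℕ.* 19 ℕ.+ s ℕ.* 4 ℕ.+ 8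
      cost i t s sp = ℕ.+-monoˡ-≤ 8 (ℕ.+-mono-≤ {length (stored i) ℕ.* 19} {Q ℕ.* 19} {spread t ℕ.* 4} {s ℕ.* 4} (ℕ.*-monoˡ-≤ 19 (length-stored i)) (ℕ.*-monoˡ-≤ 4 sp))

      H-move : ∀ zs ms → Spec ρ handler (enc zs (Vec.map direction ms)) (B (spreads zs)) (enc (Vec.zipWith move ms zs) blanks)
      H-move (t₀ ∷ t₁ ∷ t₂ ∷ []) (m₀ ∷ m₁ ∷ m₂ ∷ []) = relax
        (lift (2F ∷ 3F ∷ 4F ∷ 5F ∷ []) (zmove-spec _ t₀ m₀) ⟫
         lift (6F ∷ 7F ∷ 8F ∷ 9F ∷ 14F ∷ 16F ∷ 17F ∷ []) (recall-move _ t₁ m₁) ⟫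
         lift (10F ∷ 11F ∷ 12F ∷ 13F ∷ 15F ∷ 16F ∷ 17F ∷ []) (recall-move _ t₂ m₂))
        (ℕ.+-monoʳ-≤ 8 (ℕ.+-mono-≤ (cost 0F t₁ (spreads (t₀ ∷ t₁ ∷ t₂ ∷ [])) (spread₁ t₀ t₁ t₂)) (cost 1F t₂ (spreads (t₀ ∷ t₁ ∷ t₂ ∷ [])) (spread₂ t₀ t₁ t₂))))

      H-query : ∀ zs i → Spec ρ handler (enc zs (blanks [ suc i ]≔ sep)) (B (spreads zs)) (enc (zs [ suc i ]%= answer M ψ i) blanks)
      H-query (t₀ ∷ t₁ ∷ t₂ ∷ []) 0F = let y , w , eq = encode𝔻-nonempty {a} (numerators 0F) 0 in relax
        (lift (2F ∷ 3F ∷ 4F ∷ 5F ∷ []) (zmove-spec _ t₀ stay) ⟫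
         lift (6F ∷ 7F ∷ 8F ∷ 9F ∷ 14F ∷ 16F ∷ 17F ∷ []) (recall-query _ t₁ (stored-solid 0F) (trans (reverse-stored 0F) eq)) ⟫
         (lift (10F ∷ 11F ∷ 12F ∷ 13F ∷ 15F ∷ 16F ∷ 17F ∷ []) (recall-move _ t₂ stay) ▸
           cong (λ v → enc (t₀ ∷ load v ∷ t₂ ∷ []) blanks) (sym eq)))
        (ℕ.+-monoʳ-≤ 8 (ℕ.+-mono-≤ (cost 0F t₁ (spreads (t₀ ∷ t₁ ∷ t₂ ∷ [])) (spread₁ t₀ t₁ t₂)) (cost 1F t₂ (spreads (t₀ ∷ t₁ ∷ t₂ ∷ [])) (spread₂ t₀ t₁ t₂))))
      H-query (t₀ ∷ t₁ ∷ t₂ ∷ []) 1F = let y , w , eq = encode𝔻-nonempty {a} (numerators 1F) 0 in relax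
        (lift (2F ∷ 3F ∷ 4F ∷ 5F ∷ []) (zmove-spec _ t₀ stay) ⟫
         lift (6F ∷ 7F ∷ 8F ∷ 9F ∷ 14F ∷ 16F ∷ 17F ∷ []) (recall-move _ t₁ stay) ⟫
         (lift (10F ∷ 11F ∷ 12F ∷ 13F ∷ 15F ∷ 16F ∷ 17F ∷ []) (recall-query _ t₂ (stored-solid 1F) (trans (reverse-stored 1F) eq)) ▸
           cong (λ v → enc (t₀ ∷ t₁ ∷ load v ∷ []) blanks) (sym eq)))
        (ℕ.+-monoʳ-≤ 8 (ℕ.+-mono-≤ (cost 0F t₁ (spreads (t₀ ∷ t₁ ∷ t₂ ∷ [])) (spread₁ t₀ t₁ t₂)) (cost 1F t₂ (spreads (t₀ ∷ t₁ ∷ t₂ ∷ [])) (spread₂ t₀ t₁ t₂))))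

      answer≤ : ∀ i → spread (load {a} (encode𝔻 (numerators i /2^ 0))) ℕ.≤ D
      answer≤ i = ℕ.≤-trans (spread-load (encode𝔻 (numerators i /2^ 0))) (ℕ.≤-trans (length-numerator i) (ℕ.≤-trans (ℕ.m≤m+n Q Q) (ℕ.m≤n+m (Q ℕ.+ Q) 3)))

      grow-arith₁ : ∀ A p q r → A ℕ.≤ D → p ℕ.+ (A ℕ.+ (r ℕ.+ 0)) ℕ.≤ D ℕ.+ (p ℕ.+ (q ℕ.+ (r ℕ.+ 0)))
      grow-arith₁ A p q r A≤ = ℕ.≤-trans (ℕ.+-monoʳ-≤ p (ℕ.+-mono-≤ A≤ (ℕ.m≤n+m (r ℕ.+ 0) q)))
        (ℕ.≤-reflexive (solve 3 (λ p d r → p :+ (d :+ r) := d :+ (p :+ r)) refl p D (q ℕ.+ (r ℕ.+ 0))))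
        where open +-*-Solver

      grow-arith₂ : ∀ A p q r → A ℕ.≤ D → p ℕ.+ (q ℕ.+ (A ℕ.+ 0)) ℕ.≤ D ℕ.+ (p ℕ.+ (q ℕ.+ (r ℕ.+ 0)))
      grow-arith₂ A p q r A≤ = ℕ.≤-trans (ℕ.+-monoʳ-≤ p (ℕ.+-monoʳ-≤ q (ℕ.+-mono-≤ A≤ (z≤n {r ℕ.+ 0}))))
        (ℕ.≤-reflexive (solve 4 (λ p q d r → p :+ (q :+ (d :+ r)) := d :+ (p :+ (q :+ r))) refl p q D (r ℕ.+ 0)))
        where open +-*-Solver

      grow : ∀ zs i → spreads (zs [ suc i ]%= answer M ψ i) ℕ.≤ D ℕ.+ spreads zs
      grow (t₀ ∷ t₁ ∷ t₂ ∷ []) 0F = grow-arith₁ (spread (load (encode𝔻 (numerators 0F /2^ 0)))) (spread t₀) (spread t₁) (spread t₂) (answer≤ 0F)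
      grow (t₀ ∷ t₁ ∷ t₂ ∷ []) 1F = grow-arith₂ (spread (load (encode𝔻 (numerators 1F /2^ 0)))) (spread t₀) (spread t₁) (spread t₂) (answer≤ 1F)

      simulation : ∀ {t m₀ m₁ m₂ ms q} τ → HaltsFrom M ψ (initial M []) t (config q (m₁ ∷ m₂ ∷ []) (m₀ ∷ ms)) →
        View ρ τ (enc (load [] ∷ load [] ∷ load [] ∷ []) blanks) → (∀ k → τ ! raw k ≡ load []) →
        ∃[ t′ ] ∃[ τ′ ] (t′ ℕ.≤ t ℕ.* (2 ℕ.+ B (t ℕ.* D)) × Execution φ (embed simulate) τ t′ τ′ ×
          View ρ τ′ (enc (m₀ ∷ m₁ ∷ m₂ ∷ []) blanks) × spreads (m₀ ∷ m₁ ∷ m₂ ∷ []) ℕ.≤ t ℕ.* D)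
      simulation τ h v ok = packed
        (Proof.Handled.simulate-halts apart (λ {i} {j} → distinct-sound (3F ∷ 7F ∷ 11F ∷ []) tt {i} {j}) (λ {i} {j} → distinct-sound (5F ∷ 9F ∷ 13F ∷ []) tt {i} {j})
          os≢dir ψ φ enc enc-os enc-dir enc-rest B B-mono D (s≤s (s≤s (s≤s z≤n))) H-move H-query grow 0 τ h v
          (λ k → trans (ok k) (sym (Vec.lookup-replicate k (load [])))) z≤n)
        where
        packed : ∀ {t c} → Proof.Handled.Simulated apart (λ {i} {j} → distinct-sound (3F ∷ 7F ∷ 11F ∷ []) tt {i} {j}) (λ {i} {j} → distinct-sound (5F ∷ 9F ∷ 13F ∷ []) tt {i} {j})
          os≢dir ψ φ enc enc-os enc-dir enc-rest B B-mono D (s≤s (s≤s (s≤s z≤n))) H-move H-query grow 0 t zero τ c →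
          ∃[ t′ ] ∃[ τ′ ] (t′ ℕ.≤ t ℕ.* (2 ℕ.+ B (t ℕ.* D)) × Execution φ (embed simulate) τ t′ τ′ ×
            View ρ τ′ (enc (Vec.head (Config.mainTapes c) ∷ Config.oracleTapes c) blanks) × spreads (Vec.head (Config.mainTapes c) ∷ Config.oracleTapes c) ℕ.≤ t ℕ.* D)
        packed (Proof.Handled.simulated w r v sp) = _ , _ , w , execution r , v , sp

    initialStore : Store 22
    initialStore = set 0F (replicate n b1) (Encoding.enc [] [] [] [] (Vec.replicate 3 (load [])) (Vec.replicate 3 blank))

    initialTapes : Tapes
    initialTapes = Vec.replicate 1 (load []) , load (replicate n b1) ∷ Vec.replicate (20 ℕ.+ x) (load [])

    fresh-view : ∀ k → load [] shows get (suc (suc k)) initialStore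
    fresh-view 0F = shows-load []
    fresh-view 1F = shows-blank
    fresh-view 2F = shows-load []
    fresh-view 3F = shows-blank
    fresh-view 4F = shows-load []
    fresh-view 5F = shows-blank
    fresh-view 6F = shows-load []
    fresh-view 7F = shows-blank
    fresh-view 8F = shows-load []
    fresh-view 9F = shows-blank
    fresh-view 10F = shows-load []
    fresh-view 11F = shows-blank
    fresh-view 12F = shows-load []
    fresh-view 13F = shows-load []
    fresh-view 14F = shows-load []
    fresh-view 15F = shows-load []
    fresh-view 16F = shows-load []
    fresh-view 17F = shows-load []
    fresh-view 18F = shows-load []
    fresh-view 19F = shows-load []

    initial-view : View ρ initialTapes initialStore
    initial-view 0F            = shows-load (replicate n b1)
    initial-view 1F            = shows-load []
    initial-view (suc (suc k)) = subst (_shows get (suc (suc k)) initialStore) (sym (Vec.lookup-replicate (k ↑ˡ x) (load []))) (fresh-view k)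

    runTime : ℕ → ℕ
    runTime t = prepareTime c n ℓ ℕ.+ (t ℕ.* (2 ℕ.+ B (t ℕ.* D)) ℕ.+ (19 ℕ.+ (t ℕ.* D) ℕ.* 11 ℕ.+ suc N ℕ.* 6))

    Ready : Word a → Tapes → Set
    Ready rest τ = View ρ τ (Encoding.enc rest (stored 0F) (stored 1F) (replicate (suc N) b1) (load [] ∷ load [] ∷ load [] ∷ []) blanks)

    prologue-spec : ∃[ rest ] Spec ρ prologue initialStore (prepareTime c n ℓ)
      (Encoding.enc rest (stored 0F) (stored 1F) (replicate (suc N) b1) (load [] ∷ load [] ∷ load [] ∷ []) blanks)
    prologue-spec = embedded (prepare-spec c (pick ρ (0F ∷ 1F ∷ 14F ∷ 15F ∷ 18F ∷ 19F ∷ 20F ∷ 21F ∷ [])) n z b refl φ≡)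
      where
      embedded : ∃[ rest ] Spec (pick ρ (0F ∷ 1F ∷ 14F ∷ 15F ∷ 18F ∷ 19F ∷ 20F ∷ 21F ∷ [])) prologue (gather (0F ∷ 1F ∷ 14F ∷ 15F ∷ 18F ∷ 19F ∷ 20F ∷ 21F ∷ []) initialStore) (prepareTime c n ℓ) ([] , rest , stored 0F , stored 1F , [] , replicate (suc N) b1 , [] , [] , tt) →
        ∃[ rest ] Spec ρ prologue initialStore (prepareTime c n ℓ)
          (Encoding.enc rest (stored 0F) (stored 1F) (replicate (suc N) b1) (load [] ∷ load [] ∷ load [] ∷ []) blanks)
      embedded (rest , P) = rest , lift {ρ = ρ} (0F ∷ 1F ∷ 14F ∷ 15F ∷ 18F ∷ 19F ∷ 20F ∷ 21F ∷ []) P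

    prepared : ∃[ rest ] ∃[ t ] ∃[ τ ] (t ℕ.≤ prepareTime c n ℓ × Execution φ prologue initialTapes t τ × Ready rest τ × (∀ k → τ ! raw k ≡ load []))
    prepared = go₁ prologue-spec
      where
      go₂ : ∀ rest → ∃[ t ] ∃[ τ ] (t ℕ.≤ prepareTime c n ℓ × Execution φ prologue initialTapes t τ × (Ready rest τ × Frame ρ initialTapes τ)) →
        ∃[ rest ] ∃[ t ] ∃[ τ ] (t ℕ.≤ prepareTime c n ℓ × Execution φ prologue initialTapes t τ × Ready rest τ × (∀ k → τ ! raw k ≡ load []))
      go₂ rest (t , τ , w , r , v , f) = rest , t , τ , w , r , v , λ k → trans (f (raw k) (λ r → apart r k)) (Vec.lookup-replicate (20 ↑ʳ k) (load []))
      go₁ : ∃[ rest ] Spec ρ prologue initialStore (prepareTime c n ℓ)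
        (Encoding.enc rest (stored 0F) (stored 1F) (replicate (suc N) b1) (load [] ∷ load [] ∷ load [] ∷ []) blanks) →
        ∃[ rest ] ∃[ t ] ∃[ τ ] (t ℕ.≤ prepareTime c n ℓ × Execution φ prologue initialTapes t τ × Ready rest τ × (∀ k → τ ! raw k ≡ load []))
      go₁ (rest , S) = go₂ rest (unpack φ (exec S initialTapes initial-view))

    shiftTime≤ : ∀ z′ b′ s₀ r {s} → blankFreePrefix {a} (s₀ ∷ r) ≡ encode𝔻 (z′ /2^ b′) → length r ℕ.≤ s →
      (2 ℕ.+ length r ℕ.* 6) ℕ.+ (b′ ℕ.* 5 ℕ.+ (1 ℕ.+ (suc N ℕ.* 6 ℕ.+ (2 ℕ.+ ((width (whole z′ b′) ℕ.* 5 ℕ.+ 2) ℕ.+ 3)))))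
      ℕ.≤ 19 ℕ.+ s ℕ.* 11 ℕ.+ suc N ℕ.* 6
    shiftTime≤ z′ b′ s₀ r {s} eq r≤ = ℕ.≤-trans
      (ℕ.≤-reflexive (solve 4 (λ r b k w → (con 2 :+ r :* con 6) :+ (b :* con 5 :+ (con 1 :+ (k :* con 6 :+ (con 2 :+ ((w :* con 5 :+ con 2) :+ con 3))))) := (con 10 :+ r :* con 6 :+ (b :+ w) :* con 5) :+ k :* con 6) refl (length r) b′ (suc N) (width (whole z′ b′))))
      (ℕ.+-monoˡ-≤ (suc N ℕ.* 6) (ℕ.≤-trans
        (ℕ.+-mono-≤ (ℕ.+-monoʳ-≤ 10 (ℕ.*-monoˡ-≤ 6 r≤)) (ℕ.*-monoˡ-≤ 5 (ℕ.≤-trans bw (ℕ.≤-trans r≤ (ℕ.n≤1+n s)))))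
        (ℕ.≤-trans (ℕ.≤-reflexive (solve 1 (λ s → con 10 :+ s :* con 6 :+ (con 1 :+ s) :* con 5 := con 15 :+ s :* con 11) refl s)) (ℕ.+-monoˡ-≤ (s ℕ.* 11) (ℕ.m≤m+n 15 4)))))
      where
      open +-*-Solver
      bw : b′ ℕ.+ width (whole z′ b′) ℕ.≤ length r
      bw = ℕ.s≤s⁻¹ (ℕ.≤-trans (ℕ.≤-reflexive (ℕ.+-comm 1 (b′ ℕ.+ width (whole z′ b′)))) (ℕ.≤-trans (length-encode𝔻 {a} z′ b′)
        (ℕ.≤-trans (ℕ.≤-reflexive (cong length (sym eq))) (prefix-length (s₀ ∷ r)))))

    finished : ∀ {orc z′ b′} m₀ m₁ m₂ τ s → contents m₀ ≡ encode𝔻 (z′ /2^ b′) → spreads (m₀ ∷ m₁ ∷ m₂ ∷ []) ℕ.≤ s →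
      View ρ τ (Encoding.enc orc (stored 0F) (stored 1F) (replicate (suc N) b1) (m₀ ∷ m₁ ∷ m₂ ∷ []) blanks) →
      ∃[ t ] ∃[ τ′ ] (t ℕ.≤ 19 ℕ.+ s ℕ.* 11 ℕ.+ suc N ℕ.* 6 × Execution φ epilogue τ t τ′ ×
        contents (τ′ ! inj₂ 0F) ≡ encode𝔻 (z′ /2^ (suc N ℕ.+ b′)))
    finished {orc} {z′} {b′} m₀ m₁ m₂ τ s out sp v = go₁
      (lift {ρ = ρ} (0F ∷ 3F ∷ 4F ∷ 17F ∷ 19F ∷ []) {σ = Encoding.enc orc (stored 0F) (stored 1F) (replicate (suc N) b1) (m₀ ∷ m₁ ∷ m₂ ∷ []) blanks}
        (relax (shiftOut-spec (pick ρ (0F ∷ 3F ∷ 4F ∷ 17F ∷ 19F ∷ [])) (Tape.scanned m₀) (Tape.after m₀) z′ b′ (suc N) out)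
          (shiftTime≤ z′ b′ (Tape.scanned m₀) (Tape.after m₀) out (ℕ.≤-trans (ℕ.≤-trans (ℕ.m≤n+m _ (length (Tape.before m₀))) (ℕ.m≤m+n (spread m₀) _)) sp))))
      where
      go₂ : ∀ {σ} → get 0F σ ≡ encode𝔻 (z′ /2^ (suc N ℕ.+ b′)) →
        ∃[ t ] ∃[ τ′ ] (t ℕ.≤ 19 ℕ.+ s ℕ.* 11 ℕ.+ suc N ℕ.* 6 × Execution φ epilogue τ t τ′ × (View ρ τ′ σ × Frame ρ τ τ′)) →
        ∃[ t ] ∃[ τ′ ] (t ℕ.≤ 19 ℕ.+ s ℕ.* 11 ℕ.+ suc N ℕ.* 6 × Execution φ epilogue τ t τ′ × contents (τ′ ! inj₂ 0F) ≡ encode𝔻 (z′ /2^ (suc N ℕ.+ b′)))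
      go₂ eq (t , τ′ , w , r , v′ , _) = t , τ′ , w , r , trans (shows-contents (v′ 0F)) (trans (cong blankFreePrefix eq) (solid-prefix (solid-encode𝔻 z′ (suc N ℕ.+ b′))))
      go₁ : ∀ {σ} → Spec ρ epilogue (Encoding.enc orc (stored 0F) (stored 1F) (replicate (suc N) b1) (m₀ ∷ m₁ ∷ m₂ ∷ []) blanks) (19 ℕ.+ s ℕ.* 11 ℕ.+ suc N ℕ.* 6) (encode𝔻 (z′ /2^ (suc N ℕ.+ b′)) , σ) →
        ∃[ t ] ∃[ τ′ ] (t ℕ.≤ 19 ℕ.+ s ℕ.* 11 ℕ.+ suc N ℕ.* 6 × Execution φ epilogue τ t τ′ × contents (τ′ ! inj₂ 0F) ≡ encode𝔻 (z′ /2^ (suc N ℕ.+ b′)))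
      go₁ S = go₂ refl (unpack φ (exec S τ v))

    outputs : ∀ {t cM z′ b′} → HaltsFrom M ψ (initial M []) t cM → contents (Vec.head (Config.mainTapes cM)) ≡ encode𝔻 (z′ /2^ b′) →
      ∃[ T ] (T ℕ.≤ runTime t × Outputs machine φ (encodeUnary n) T (encode𝔻 (z′ /2^ (suc N ℕ.+ b′))))
    outputs {t} {config _ (m₁ ∷ m₂ ∷ []) (m₀ ∷ _)} {z′} {b′} h out = go₁ prepared
      where
      Goal : Set
      Goal = ∃[ T ] (T ℕ.≤ runTime t × Outputs machine φ (encodeUnary n) T (encode𝔻 (z′ /2^ (suc N ℕ.+ b′))))
      go₃ : ∀ {t₁ t₂ τ₁ τ₂} → t₁ ℕ.≤ prepareTime c n ℓ → t₂ ℕ.≤ t ℕ.* (2 ℕ.+ B (t ℕ.* D)) →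
        Execution φ prologue initialTapes t₁ τ₁ → Execution φ (embed simulate) τ₁ t₂ τ₂ →
        ∃[ t₃ ] ∃[ τ₃ ] (t₃ ℕ.≤ 19 ℕ.+ (t ℕ.* D) ℕ.* 11 ℕ.+ suc N ℕ.* 6 × Execution φ epilogue τ₂ t₃ τ₃ × contents (τ₃ ! inj₂ 0F) ≡ encode𝔻 (z′ /2^ (suc N ℕ.+ b′))) →
        Goal
      go₃ {t₁} {t₂} w₁ w₂ r₁ r₂ (t₃ , τ₃ , w₃ , r₃ , eq) =
        t₁ ℕ.+ (t₂ ℕ.+ t₃) , ℕ.+-mono-≤ w₁ (ℕ.+-mono-≤ w₂ w₃) ,
        subst (Outputs machine φ (encodeUnary n) (t₁ ℕ.+ (t₂ ℕ.+ t₃))) eq (compile-outputs program φ (_then_ φ r₁ (_then_ φ r₂ r₃)))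
      go₂ : ∀ {rest t₁ τ₁} → t₁ ℕ.≤ prepareTime c n ℓ → Execution φ prologue initialTapes t₁ τ₁ →
        ∃[ t₂ ] ∃[ τ₂ ] (t₂ ℕ.≤ t ℕ.* (2 ℕ.+ B (t ℕ.* D)) × Execution φ (embed simulate) τ₁ t₂ τ₂ ×
          View ρ τ₂ (Encoding.enc rest (stored 0F) (stored 1F) (replicate (suc N) b1) (m₀ ∷ m₁ ∷ m₂ ∷ []) blanks) × spreads (m₀ ∷ m₁ ∷ m₂ ∷ []) ℕ.≤ t ℕ.* D) → Goal
      go₂ w₁ r₁ (t₂ , τ₂ , w₂ , r₂ , v₂ , sp) = go₃ w₁ w₂ r₁ r₂ (finished {z′ = z′} {b′} m₀ m₁ m₂ τ₂ (t ℕ.* D) out sp v₂)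
      go₁ : ∃[ rest ] ∃[ t ] ∃[ τ ] (t ℕ.≤ prepareTime c n ℓ × Execution φ prologue initialTapes t τ × Ready rest τ × (∀ k → τ ! raw k ≡ load [])) → Goal
      go₁ (rest , t₁ , τ₁ , w₁ , r₁ , v₁ , ok) = go₂ w₁ r₁ (Handler.simulation rest (replicate (suc N) b1) τ₁ h v₁ ok)

-- Long division and multiplication of binary words, and programs for them

cong₃ : ∀ {A B C D : Set} (f : A → B → C → D) {x x′ y y′ z z′} → x ≡ x′ → y ≡ y′ → z ≡ z′ → f x y z ≡ f x′ y′ z′
cong₃ f refl refl refl = refl

isOne-bitS : ∀ {a} d → isOne (bitS {a} d) ≡ d
isOne-bitS false = refl
isOne-bitS true  = refl

nonBlank-bitS : ∀ {a} d → nonBlank (bitS {a} d) ≡ true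
nonBlank-bitS false = refl
nonBlank-bitS true  = refl

-- Trial subtraction: a final borrow shows that the divisor exceeds the partial remainder, which is
-- then restored, and the quotient digit is 0.
divStep : List Bool → List Bool → List Bool × Bool
divStep Y R = if carry minus′ R Y false then (padTo R Y , false) else (ripple minus′ R Y false , true)

-- Long division: the quotient digits are pushed onto Q, the digits of the dividend arrive most significant first.
divide : List Bool → List Bool → List Bool → List Bool → List Bool × List Bool
divide Y []       R Q = R , Q
divide Y (x ∷ xs) R Q = divide Y xs (proj₁ (divStep Y (x ∷ R))) (proj₂ (divStep Y (x ∷ R)) ∷ Q)

divStep-length : ∀ Y R {k} → length Y ℕ.≤ k → length R ℕ.≤ k → length (proj₁ (divStep Y R)) ℕ.≤ k
divStep-length Y R Y≤ R≤ with carry minus′ R Y false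
... | true  = ℕ.≤-trans (ℕ.≤-reflexive (length-padTo minus′ R Y false)) (length-ripple≤ minus′ R Y false _ R≤ Y≤)
... | false = length-ripple≤ minus′ R Y false _ R≤ Y≤

divStep-val : ∀ Y R → val (proj₁ (divStep Y R)) ℕ.+ b2n (proj₂ (divStep Y R)) ℕ.* val Y ≡ val R
divStep-val Y R with carry minus′ R Y false | minus-val R Y false
... | true  | _  = trans (ℕ.+-identityʳ _) (val-padTo R Y)
... | false | eq = trans (cong (val (ripple minus′ R Y false) ℕ.+_) (trans (ℕ.*-identityˡ (val Y)) (sym (ℕ.+-identityʳ (val Y)))))
                     (trans eq (trans (cong (val R ℕ.+_) (ℕ.*-zeroʳ (2 ℕ.^ length (ripple minus′ R Y false)))) (ℕ.+-identityʳ (val R))))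

-- A remainder below twice the divisor needs at most one subtraction. With a borrow the claim is
-- that `val R` was below `val Y` already: the difference `S` satisfies `S + Y = R + p` and `S < p`.
divStep-bound : ∀ Y R → val R ℕ.< 2 ℕ.* val Y → val (proj₁ (divStep Y R)) ℕ.< val Y
divStep-bound Y R R< with carry minus′ R Y false | minus-val R Y false
... | true  | eq = subst (ℕ._< val Y) (sym (val-padTo R Y))
  (ℕ.+-cancelʳ-< p (val R) (val Y) (subst₂ ℕ._<_ (trans (cong (val S ℕ.+_) (sym (ℕ.+-identityʳ (val Y)))) (trans eq (cong (val R ℕ.+_) (ℕ.*-identityʳ p))))
    (ℕ.+-comm p (val Y)) (ℕ.+-monoˡ-< (val Y) (val<2^ S))))
  where
  S = ripple minus′ R Y false
  p = 2 ℕ.^ length S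
... | false | eq = ℕ.+-cancelʳ-< (val Y) (val S) (val Y)
  (subst₂ ℕ._<_ (sym (trans (cong (val S ℕ.+_) (sym (ℕ.+-identityʳ (val Y)))) (trans eq (trans (cong (val R ℕ.+_) (ℕ.*-zeroʳ (2 ℕ.^ length S))) (ℕ.+-identityʳ (val R))))))
    (cong (val Y ℕ.+_) (ℕ.+-identityʳ (val Y))) R<)
  where
  S = ripple minus′ R Y false

-- The invariant is that `Q Y + R` is the part of the dividend read so far; a further digit doubles
-- this number and is added to it.
divide-val : ∀ Y xs R Q → val R ℕ.< val Y →
  val (proj₂ (divide Y xs R Q)) ℕ.* val Y ℕ.+ val (proj₁ (divide Y xs R Q)) ≡ (val Q ℕ.* val Y ℕ.+ val R) ℕ.* 2 ℕ.^ length xs ℕ.+ val (reverse xs)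
  × val (proj₁ (divide Y xs R Q)) ℕ.< val Y
divide-val Y [] R Q R< = sym (trans (ℕ.+-identityʳ _) (ℕ.*-identityʳ _)) , R<
divide-val Y (x ∷ xs) R Q R< =
  let eq , lt = divide-val Y xs R′ (q ∷ Q) (divStep-bound Y (x ∷ R) xR<) in
  trans eq (trans (cong (λ v → v ℕ.* 2 ℕ.^ length xs ℕ.+ val (reverse xs)) step-val) (sym rev)) , lt
  where
  R′ = proj₁ (divStep Y (x ∷ R))
  q = proj₂ (divStep Y (x ∷ R))
  v₀ = val Q ℕ.* val Y ℕ.+ val R
  xR< : val (x ∷ R) ℕ.< 2 ℕ.* val Y
  xR< = ℕ.≤-trans (s≤s (ℕ.+-monoˡ-≤ (2 ℕ.* val R) (b2n≤1 x))) (ℕ.≤-trans (ℕ.≤-reflexive (sym (ℕ.*-distribˡ-+ 2 1 (val R)))) (ℕ.*-monoʳ-≤ 2 R<))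
  step-val : val (q ∷ Q) ℕ.* val Y ℕ.+ val R′ ≡ b2n x ℕ.+ 2 ℕ.* v₀
  step-val = trans (solve 4 (λ q Q y r → (q :+ con 2 :* Q) :* y :+ r := con 2 :* (Q :* y) :+ (r :+ q :* y)) refl (b2n q) (val Q) (val Y) (val R′))
    (trans (cong (2 ℕ.* (val Q ℕ.* val Y) ℕ.+_) (divStep-val Y (x ∷ R)))
      (solve 3 (λ p x r → con 2 :* p :+ (x :+ con 2 :* r) := x :+ con 2 :* (p :+ r)) refl (val Q ℕ.* val Y) (b2n x) (val R)))
    where open +-*-Solver
  rev : v₀ ℕ.* 2 ℕ.^ length (x ∷ xs) ℕ.+ val (reverse (x ∷ xs)) ≡ (b2n x ℕ.+ 2 ℕ.* v₀) ℕ.* 2 ℕ.^ length xs ℕ.+ val (reverse xs)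
  rev = trans (cong (v₀ ℕ.* 2 ℕ.^ length (x ∷ xs) ℕ.+_) (trans (cong val (List.unfold-reverse x xs)) (trans (val-++ (reverse xs) (x ∷ []))
      (cong (λ l → val (reverse xs) ℕ.+ 2 ℕ.^ l ℕ.* val (x ∷ [])) (List.length-reverse xs)))))
    (solve 4 (λ v x p r → v :* (con 2 :* p) :+ (r :+ p :* (x :+ con 2 :* con 0)) := (x :+ con 2 :* v) :* p :+ r) refl v₀ (b2n x) (2 ℕ.^ length xs) (val (reverse xs)))
    where open +-*-Solver

-- Earlier quotient digits do not influence later ones. Hence the fractional digits can be produced
-- on an empty stack, and the two divisions still be analysed as a single one.
divide-++ : ∀ Y xs R Q P → divide Y xs R (Q ++ P) ≡ (proj₁ (divide Y xs R Q) , proj₂ (divide Y xs R Q) ++ P)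
divide-++ Y []       R Q P = refl
divide-++ Y (x ∷ xs) R Q P = divide-++ Y xs (proj₁ (divStep Y (x ∷ R))) (proj₂ (divStep Y (x ∷ R)) ∷ Q) P

divide-length : ∀ Y xs R Q → length (proj₂ (divide Y xs R Q)) ≡ length xs ℕ.+ length Q
divide-length Y []       R Q = refl
divide-length Y (x ∷ xs) R Q = trans (divide-length Y xs (proj₁ (divStep Y (x ∷ R))) (proj₂ (divStep Y (x ∷ R)) ∷ Q)) (ℕ.+-suc (length xs) (length Q))

-- Leading zeros of the remainder are never removed, so its length may grow with every digit
-- although its value remains below the divisor.
divide-length₁ : ∀ Y xs R Q {k} → length Y ℕ.≤ k → length R ℕ.≤ k → length (proj₁ (divide Y xs R Q)) ℕ.≤ k ℕ.+ length xs
divide-length₁ Y []       R Q {k} Y≤ R≤ = ℕ.≤-trans R≤ (ℕ.m≤m+n k 0)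
divide-length₁ Y (x ∷ xs) R Q {k} Y≤ R≤ = ℕ.≤-trans
  (divide-length₁ Y xs (proj₁ (divStep Y (x ∷ R))) (proj₂ (divStep Y (x ∷ R)) ∷ Q) {suc k} (ℕ.m≤n⇒m≤1+n Y≤) (divStep-length Y (x ∷ R) (ℕ.m≤n⇒m≤1+n Y≤) (s≤s R≤)))
  (ℕ.≤-reflexive (sym (ℕ.+-suc k (length xs))))

addShifted : List Bool → List Bool → List Bool
addShifted Y R = ripple plus (false ∷ R) Y false ++ carry plus (false ∷ R) Y false ∷ []

-- Horner's scheme over the digits of the multiplier, which come most significant first.
multiply : List Bool → List Bool → List Bool → List Bool
multiply Y []           R = R
multiply Y (false ∷ ds) R = multiply Y ds (false ∷ R)
multiply Y (true ∷ ds)  R = multiply Y ds (addShifted Y R)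

-- Lets the digits before and after the point be processed by two separate loops.
multiply-++ : ∀ Y ds es R → multiply Y (ds ++ es) R ≡ multiply Y es (multiply Y ds R)
multiply-++ Y []           es R = refl
multiply-++ Y (false ∷ ds) es R = multiply-++ Y ds es (false ∷ R)
multiply-++ Y (true ∷ ds)  es R = multiply-++ Y ds es (addShifted Y R)

addShifted-val : ∀ Y R → val (addShifted Y R) ≡ 2 ℕ.* val R ℕ.+ val Y
addShifted-val Y R = trans (val-++ S (C ∷ [])) (trans (cong (λ x → val S ℕ.+ 2 ℕ.^ length S ℕ.* x) (ℕ.+-identityʳ (b2n C))) (trans (plus-val (false ∷ R) Y false) (ℕ.+-identityʳ _)))
  where
  S = ripple plus (false ∷ R) Y false
  C = carry plus (false ∷ R) Y false

addShifted-length : ∀ Y R {k} → length Y ℕ.≤ k → length R ℕ.≤ k → length (addShifted Y R) ℕ.≤ 2 ℕ.+ k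
addShifted-length Y R {k} Y≤ R≤ = ℕ.≤-trans (ℕ.≤-reflexive (trans (List.length-++ (ripple plus (false ∷ R) Y false)) (ℕ.+-comm _ 1)))
  (s≤s (length-ripple≤ plus (false ∷ R) Y false (suc k) (s≤s R≤) (ℕ.m≤n⇒m≤1+n Y≤)))

multiply-val : ∀ Y ds R → val (multiply Y ds R) ≡ val R ℕ.* 2 ℕ.^ length ds ℕ.+ val (reverse ds) ℕ.* val Y
multiply-val Y [] R = sym (trans (ℕ.+-identityʳ _) (ℕ.*-identityʳ (val R)))
multiply-val Y (d ∷ ds) R = lem d
  where
  open +-*-Solver
  rev : ∀ d → val (reverse (d ∷ ds)) ≡ val (reverse ds) ℕ.+ 2 ℕ.^ length ds ℕ.* b2n d
  rev d = trans (cong val (List.unfold-reverse d ds)) (trans (val-++ (reverse ds) (d ∷ [])) (cong₂ (λ l v → val (reverse ds) ℕ.+ 2 ℕ.^ l ℕ.* v) (List.length-reverse ds) (ℕ.+-identityʳ (b2n d))))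
  lem : ∀ d → val (multiply Y (d ∷ ds) R) ≡ val R ℕ.* 2 ℕ.^ length (d ∷ ds) ℕ.+ val (reverse (d ∷ ds)) ℕ.* val Y
  lem false = trans (multiply-val Y ds (false ∷ R)) (trans
    (solve 4 (λ r p v y → (con 2 :* r) :* p :+ v :* y := r :* (con 2 :* p) :+ (v :+ p :* con 0) :* y) refl (val R) (2 ℕ.^ length ds) (val (reverse ds)) (val Y))
    (cong (λ v → val R ℕ.* 2 ℕ.^ length (false ∷ ds) ℕ.+ v ℕ.* val Y) (sym (rev false))))
  lem true = trans (multiply-val Y ds (addShifted Y R)) (trans (cong (λ v → v ℕ.* 2 ℕ.^ length ds ℕ.+ val (reverse ds) ℕ.* val Y) (addShifted-val Y R)) (trans
    (solve 4 (λ r p v y → (con 2 :* r :+ y) :* p :+ v :* y := r :* (con 2 :* p) :+ (v :+ p :* con 1) :* y) refl (val R) (2 ℕ.^ length ds) (val (reverse ds)) (val Y))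
    (cong (λ v → val R ℕ.* 2 ℕ.^ length (true ∷ ds) ℕ.+ v ℕ.* val Y) (sym (rev true)))))

multiply-length : ∀ Y ds R {k} → length Y ℕ.≤ k → length R ℕ.≤ k → length (multiply Y ds R) ℕ.≤ k ℕ.+ length ds ℕ.* 2
multiply-length Y []           R {k} Y≤ R≤ = ℕ.≤-trans R≤ (ℕ.m≤m+n k 0)
multiply-length Y (false ∷ ds) R {k} Y≤ R≤ = ℕ.≤-trans (multiply-length Y ds (false ∷ R) {suc (suc k)} (ℕ.m≤n⇒m≤1+n (ℕ.m≤n⇒m≤1+n Y≤)) (ℕ.m≤n⇒m≤1+n (s≤s R≤)))
  (ℕ.≤-reflexive (sym (trans (ℕ.+-suc k _) (cong suc (ℕ.+-suc k _)))))
multiply-length Y (true ∷ ds)  R {k} Y≤ R≤ = ℕ.≤-trans (multiply-length Y ds (addShifted Y R) {suc (suc k)} (ℕ.m≤n⇒m≤1+n (ℕ.m≤n⇒m≤1+n Y≤)) (addShifted-length Y R Y≤ R≤))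
  (ℕ.≤-reflexive (sym (trans (ℕ.+-suc k _) (cong suc (ℕ.+-suc k _)))))

module Arithmetic (a o e : ℕ) where
  open Routines₂ a o e public

  sumS carryS : Digit → Symbol a → Symbol a → Symbol a → Symbol a
  sumS   f x y c = bitS (proj₁ (f (isOne x) (isOne y) (isOne c)))
  carryS f x y c = bitS (proj₂ (f (isOne x) (isOne y) (isOne c)))

  firstBit : Symbol a → Symbol a → Symbol a → Symbol a
  firstBit x _ _ = bitS (isOne x)

  -- Registers: two operands, carry, reversed result, reversed copies of the operands.
  rippleBody rippleLoop : Digit → Regs 6 → Cmd
  rippleBody f ρ =
    pushF ρ 3F 0F 1F 2F (sumS f) ⨟
    pushF ρ 4F 0F 0F 0F firstBit ⨟
    poke ρ 2F 0F 1F 2F (carryS f) ⨟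
    pop ρ 0F ⨟
    -- The second operand is copied only while it lasts. It comes back without padding, so the
    -- divisor keeps its length through all steps of a division.
    when ρ 1F nonBlank (copy ρ 5F 1F ⨟ pop ρ 1F) skip
  rippleLoop f ρ = while₂ (addr ρ 0F) (addr ρ 1F) (λ x y → nonBlank x ∨ nonBlank y) (rippleBody f ρ)

  -- Remainder, divisor, carry, three buffers, quotient.
  dstep : Regs 7 → Cmd
  dstep ρ =
    push ρ 2F b0 ⨟
    rippleLoop minus′ (pick ρ (0F ∷ 1F ∷ 2F ∷ 3F ∷ 4F ∷ 5F ∷ [])) ⨟
    mv (pick ρ (5F ∷ 1F ∷ [])) ⨟
    when ρ 2F isOne
      (clear (pick ρ (3F ∷ [])) ⨟ mv (pick ρ (4F ∷ 0F ∷ [])) ⨟ push ρ 6F b0)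
      (clear (pick ρ (4F ∷ [])) ⨟ mv (pick ρ (3F ∷ 0F ∷ [])) ⨟ push ρ 6F b1) ⨟
    pop ρ 2F

  -- The dividend is copied back while it is consumed, since later queries need it again.
  divInteger : Regs 9 → Cmd
  divInteger ρ = while ρ 0F nonBlank
    (copy ρ 2F 0F ⨟ copy ρ 1F 0F ⨟ pop ρ 0F ⨟ dstep (pick ρ (2F ∷ 3F ∷ 4F ∷ 5F ∷ 6F ∷ 7F ∷ 8F ∷ [])))

  -- Register 0 holds the query word, which serves as loop counter: one binary place per symbol,
  -- whatever the symbols are.
  divFraction : Regs 8 → Cmd
  divFraction ρ = while ρ 0F nonBlank
    (pop ρ 0F ⨟ push ρ 1F b0 ⨟ dstep (pick ρ (1F ∷ 2F ∷ 3F ∷ 4F ∷ 5F ∷ 6F ∷ 7F ∷ [])))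

  add : Regs 6 → Cmd
  add ρ =
    push ρ 2F b0 ⨟ rippleLoop plus ρ ⨟ mv (pick ρ (5F ∷ 1F ∷ [])) ⨟ clear (pick ρ (4F ∷ [])) ⨟
    -- The final carry becomes the most significant digit of the sum.
    copy ρ 3F 2F ⨟ pop ρ 2F ⨟ mv (pick ρ (3F ∷ 0F ∷ []))

  hstep : Regs 7 → Cmd
  hstep ρ = push ρ 1F b0 ⨟ when ρ 0F isOne (add (pick ρ (1F ∷ 2F ∷ 3F ∷ 4F ∷ 5F ∷ 6F ∷ []))) skip ⨟ pop ρ 0F

  mulInteger : Regs 7 → Cmd
  mulInteger ρ = while ρ 0F (not ∘ isPoint) (hstep ρ)

  -- The fractional digits of the multiplier are counted in unary; that many bits are dropped from
  -- the product afterwards.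
  mulFraction : Regs 8 → Cmd
  mulFraction ρ = while ρ 0F nonBlank (hstep (pick ρ (0F ∷ 1F ∷ 2F ∷ 3F ∷ 4F ∷ 5F ∷ 6F ∷ [])) ⨟ push ρ 7F b1)

  canonical : Regs 1 → Cmd
  canonical ρ = stripZeros ρ ⨟ when ρ 0F nonBlank skip (push ρ 0F b0)

  module CorrectA (φ : Oracles o) where
    open Correct₂ φ public

    twice : ∀ u → (bits {a} u ʳ++ []) ʳ++ [] ≡ bits u
    twice u = List.reverse-involutive (bits u)

    length-bits : ∀ u → length (bits {a} u) ≡ length u
    length-bits = List.length-map bitS

    length-rev : ∀ u → length (bits {a} u ʳ++ []) ≡ length u
    length-rev u = trans (List.length-reverse (bits u)) (length-bits u)

    -- The conditional copy enters as a hypothesis, since it alone depends on whether the second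
    -- operand is exhausted.
    rippleBody-spec : ∀ f ρ x y c t r w v →
      Spec ρ (when ρ 1F nonBlank (copy ρ 5F 1F ⨟ pop ρ 1F) skip)
        (tl x , y , carryS f (hd x) (hd y) c ∷ [] , sumS f (hd x) (hd y) c ∷ t , firstBit (hd x) b0 b0 ∷ r , w , tt) 3
        (tl x , tl y , carryS f (hd x) (hd y) c ∷ [] , sumS f (hd x) (hd y) c ∷ t , firstBit (hd x) b0 b0 ∷ r , v , tt) →
      Spec ρ (rippleBody f ρ) (x , y , c ∷ [] , t , r , w , tt) 9
        (tl x , tl y , carryS f (hd x) (hd y) c ∷ [] , sumS f (hd x) (hd y) c ∷ t , firstBit (hd x) b0 b0 ∷ r , v , tt)
    rippleBody-spec f ρ x y c t r w v S =
      via (x , y , c ∷ [] , s ∷ t , r , w , tt) (pushF-spec 3F 0F 1F 2F (sumS f))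
        (via (x , y , c ∷ [] , s ∷ t , p ∷ r , w , tt) (pushF-spec 4F 0F 0F 0F firstBit)
          (via (x , y , c′ ∷ [] , s ∷ t , p ∷ r , w , tt) (poke-spec 2F 0F 1F 2F (carryS f))
            (via (tl x , y , c′ ∷ [] , s ∷ t , p ∷ r , w , tt) (pop-spec 0F) S)))
      where
      s = sumS f (hd x) (hd y) c
      p = firstBit (hd x) b0 b0
      c′ = carryS f (hd x) (hd y) c

    keep : ∀ ρ {x c t r w} q y → Spec ρ (when ρ 1F nonBlank (copy ρ 5F 1F ⨟ pop ρ 1F) skip)
      (x , bitS q ∷ y , c , t , r , w , tt) 3 (x , y , c , t , r , bitS q ∷ w , tt)
    keep ρ q y = if-true 1F (nonBlank-bitS q) (copy-spec 5F 1F ⟫ pop-spec 1F)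

    ignore : ∀ ρ {x c t r w} → Spec ρ (when ρ 1F nonBlank (copy ρ 5F 1F ⨟ pop ρ 1F) skip)
      (x , [] , c , t , r , w , tt) 3 (x , [] , c , t , r , w , tt)
    ignore ρ = relax (if-false 1F refl skip-spec) z≤n

    rippleLoop-spec : ∀ f ρ R Y c t r y →
      Spec ρ (rippleLoop f ρ) (bits R , bits Y , bitS c ∷ [] , t , r , y , tt) (length (ripple f R Y c) ℕ.* 11)
        ([] , [] , bitS (carry f R Y c) ∷ [] , bits (ripple f R Y c) ʳ++ t , bits (padTo R Y) ʳ++ r , bits Y ʳ++ y , tt)
    rippleLoop-spec f ρ [] [] c t r y = while-stop 0F 1F refl
    rippleLoop-spec f ρ (p ∷ R) (q ∷ Y) c t r y = while-step 0F 1F (cong (_∨ nonBlank (bitS {a} q)) (nonBlank-bitS p))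
      (rippleBody-spec f ρ (bits (p ∷ R)) (bits (q ∷ Y)) (bitS c) t r y (bitS q ∷ y) (keep ρ q (bits Y)) ▸
        cong₃ (λ p′ q′ c′ → bits R , bits Y , bitS (proj₂ (f p′ q′ c′)) ∷ [] , bitS (proj₁ (f p′ q′ c′)) ∷ t , bitS p′ ∷ r , bitS q ∷ y , tt) (isOne-bitS p) (isOne-bitS q) (isOne-bitS c))
      (rippleLoop-spec f ρ R Y (proj₂ (f p q c)) (bitS (proj₁ (f p q c)) ∷ t) (bitS p ∷ r) (bitS q ∷ y))
    rippleLoop-spec f ρ (p ∷ R) [] c t r y = while-step 0F 1F (cong (_∨ false) (nonBlank-bitS p))
      (rippleBody-spec f ρ (bits (p ∷ R)) [] (bitS c) t r y y (ignore ρ) ▸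
        cong₂ (λ p′ c′ → bits R , [] , bitS (proj₂ (f p′ false c′)) ∷ [] , bitS (proj₁ (f p′ false c′)) ∷ t , bitS p′ ∷ r , y , tt) (isOne-bitS p) (isOne-bitS c))
      (rippleLoop-spec f ρ R [] (proj₂ (f p false c)) (bitS (proj₁ (f p false c)) ∷ t) (bitS p ∷ r) y)
    rippleLoop-spec f ρ [] (q ∷ Y) c t r y = while-step 0F 1F (nonBlank-bitS q)
      (rippleBody-spec f ρ [] (bits (q ∷ Y)) (bitS c) t r y (bitS q ∷ y) (keep ρ q (bits Y)) ▸
        cong₂ (λ q′ c′ → [] , bits Y , bitS (proj₂ (f false q′ c′)) ∷ [] , bitS (proj₁ (f false q′ c′)) ∷ t , b0 ∷ r , bitS q ∷ y , tt) (isOne-bitS q) (isOne-bitS c))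
      (rippleLoop-spec f ρ [] Y (proj₂ (f false q c)) (bitS (proj₁ (f false q c)) ∷ t) (b0 ∷ r) (bitS q ∷ y))

    mvBits : ∀ ρ u → Spec ρ (mv ρ) (bits u ʳ++ [] , [] , tt) (length u ℕ.* 5) ([] , bits u , tt)
    mvBits ρ u = relax (mv-spec ρ [] (solid-ʳ++ (bits-solid u) []) ▸ cong (λ x → [] , x , tt) (twice u)) (ℕ.≤-reflexive (cong (ℕ._* 5) (length-rev u)))

    clearBits : ∀ ρ u → Spec ρ (clear ρ) (bits u ʳ++ [] , tt) (length u ℕ.* 3) ([] , tt)
    clearBits ρ u = relax (clear-spec ρ (solid-ʳ++ (bits-solid u) [])) (ℕ.≤-reflexive (cong (ℕ._* 3) (length-rev u)))

    dstep-spec : ∀ ρ R Y Q s → length R ℕ.≤ s → length Y ℕ.≤ s →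
      Spec ρ (dstep ρ) (bits R , bits Y , [] , [] , [] , [] , Q , tt) (s ℕ.* 24 ℕ.+ 5)
        (bits (proj₁ (divStep Y R)) , bits Y , [] , [] , [] , [] , bitS (proj₂ (divStep Y R)) ∷ Q , tt)
    dstep-spec ρ R Y Q s R≤ Y≤ = relax
      (push-spec 2F b0 ⟫
       relax (lift (0F ∷ 1F ∷ 2F ∷ 3F ∷ 4F ∷ 5F ∷ []) (rippleLoop-spec minus′ _ R Y false [] [] [])) (ℕ.*-monoˡ-≤ 11 L≤) ⟫
       relax (lift (5F ∷ 1F ∷ []) (mvBits _ Y)) (ℕ.*-monoˡ-≤ 5 Y≤) ⟫
       choose (carry minus′ R Y false) ⟫
       pop-spec 2F)
      (ℕ.≤-reflexive (solve 1 (λ s → con 2 :+ (s :* con 11 :+ (s :* con 5 :+ ((s :* con 3 :+ (s :* con 5 :+ con 2)) :+ con 1))) := s :* con 24 :+ con 5) refl s))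
      where
      open +-*-Solver
      S = ripple minus′ R Y false
      L≤ : length S ℕ.≤ s
      L≤ = length-ripple≤ minus′ R Y false s R≤ Y≤
      P≤ : length (padTo R Y) ℕ.≤ s
      P≤ = ℕ.≤-trans (ℕ.≤-reflexive (length-padTo minus′ R Y false)) L≤
      choose : ∀ c → Spec ρ
        (when ρ 2F isOne
          (clear (pick ρ (3F ∷ [])) ⨟ mv (pick ρ (4F ∷ 0F ∷ [])) ⨟ push ρ 6F b0)
          (clear (pick ρ (4F ∷ [])) ⨟ mv (pick ρ (3F ∷ 0F ∷ [])) ⨟ push ρ 6F b1))
        ([] , bits Y , bitS c ∷ [] , bits S ʳ++ [] , bits (padTo R Y) ʳ++ [] , [] , Q , tt)
        (s ℕ.* 3 ℕ.+ (s ℕ.* 5 ℕ.+ 2))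
        (bits (proj₁ (if c then (padTo R Y , false) else (S , true))) , bits Y , bitS c ∷ [] , [] , [] , [] , bitS (proj₂ (if c then (padTo R Y , false) else (S , true))) ∷ Q , tt)
      choose true  = if-true 2F refl
        (relax (lift (3F ∷ []) (clearBits _ S)) (ℕ.*-monoˡ-≤ 3 L≤) ⟫ relax (lift (4F ∷ 0F ∷ []) (mvBits _ (padTo R Y))) (ℕ.*-monoˡ-≤ 5 P≤) ⟫ push-spec 6F b0)
      choose false = if-false 2F refl
        (relax (lift (4F ∷ []) (clearBits _ (padTo R Y))) (ℕ.*-monoˡ-≤ 3 P≤) ⟫ relax (lift (3F ∷ 0F ∷ []) (mvBits _ S)) (ℕ.*-monoˡ-≤ 5 L≤) ⟫ push-spec 6F b1)

    -- `k` bounds the current lengths and rises by one per digit; `s` bounds the value it finally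
    -- reaches, and so the cost of each single step.
    divInteger-spec : ∀ ρ xs X R Y Q k s → length Y ℕ.≤ k → length R ℕ.≤ k → k ℕ.+ length xs ℕ.≤ s →
      Spec ρ (divInteger ρ) (bits xs , X , bits R , bits Y , [] , [] , [] , [] , bits Q , tt) (length xs ℕ.* (s ℕ.* 24 ℕ.+ 12))
        ([] , bits xs ʳ++ X , bits (proj₁ (divide Y xs R Q)) , bits Y , [] , [] , [] , [] , bits (proj₂ (divide Y xs R Q)) , tt)
    divInteger-spec ρ []       X R Y Q k s Y≤ R≤ k≤ = while-stop 0F 0F refl
    divInteger-spec ρ (x ∷ xs) X R Y Q k s Y≤ R≤ k≤ = relax
      (while-step 0F 0F (nonBlank-bitS x)
        (copy-spec 2F 0F ⟫ copy-spec 1F 0F ⟫ pop-spec 0F ⟫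
         lift (2F ∷ 3F ∷ 4F ∷ 5F ∷ 6F ∷ 7F ∷ 8F ∷ []) (dstep-spec _ (x ∷ R) Y (bits Q) s (ℕ.≤-trans (s≤s R≤) k′≤) (ℕ.≤-trans Y≤′ k′≤)))
        (divInteger-spec ρ xs (bitS x ∷ X) (proj₁ (divStep Y (x ∷ R))) Y (proj₂ (divStep Y (x ∷ R)) ∷ Q) (suc k) s Y≤′
          (divStep-length Y (x ∷ R) Y≤′ (s≤s R≤)) k+≤))
      (ℕ.≤-reflexive (cong (ℕ._+ length xs ℕ.* (s ℕ.* 24 ℕ.+ 12)) (trans (cong (7 ℕ.+_) (ℕ.+-comm (s ℕ.* 24) 5)) (ℕ.+-comm 12 (s ℕ.* 24)))))
      where
      Y≤′ = ℕ.m≤n⇒m≤1+n Y≤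
      k+≤ : suc k ℕ.+ length xs ℕ.≤ s
      k+≤ = ℕ.≤-trans (ℕ.≤-reflexive (sym (ℕ.+-suc k (length xs)))) k≤
      k′≤ : suc k ℕ.≤ s
      k′≤ = ℕ.≤-trans (ℕ.m≤m+n (suc k) (length xs)) k+≤

    divFraction-spec : ∀ ρ A R Y Q {w} k s → Solid A → length Y ℕ.≤ k → length R ℕ.≤ k → k ℕ.+ length A ℕ.≤ s →
      Spec ρ (divFraction ρ) (A , bits R , bits Y , [] , [] , [] , [] , bits Q ++ w , tt) (length A ℕ.* (s ℕ.* 24 ℕ.+ 12))
        ([] , bits (proj₁ (divide Y (replicate (length A) false) R Q)) , bits Y , [] , [] , [] , [] , bits (proj₂ (divide Y (replicate (length A) false) R Q)) ++ w , tt)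
    divFraction-spec ρ []      R Y Q k s []       Y≤ R≤ k≤ = while-stop 0F 0F refl
    divFraction-spec ρ (x ∷ A) R Y Q {w} k s (p ∷ ps) Y≤ R≤ k≤ = relax
      (while-step 0F 0F p
        (pop-spec 0F ⟫ push-spec 1F b0 ⟫
         lift (1F ∷ 2F ∷ 3F ∷ 4F ∷ 5F ∷ 6F ∷ 7F ∷ []) (dstep-spec _ (false ∷ R) Y (bits Q ++ w) s (ℕ.≤-trans (s≤s R≤) k′≤) (ℕ.≤-trans Y≤′ k′≤)))
        (divFraction-spec ρ A (proj₁ (divStep Y (false ∷ R))) Y (proj₂ (divStep Y (false ∷ R)) ∷ Q) (suc k) s ps Y≤′
          (divStep-length Y (false ∷ R) Y≤′ (s≤s R≤)) k+≤))
      (ℕ.+-monoˡ-≤ (length A ℕ.* (s ℕ.* 24 ℕ.+ 12)) (ℕ.≤-trans (ℕ.≤-reflexive (trans (cong (5 ℕ.+_) (ℕ.+-comm (s ℕ.* 24) 5)) (ℕ.+-comm 10 (s ℕ.* 24)))) (ℕ.+-monoʳ-≤ (s ℕ.* 24) (ℕ.m≤m+n 10 2))))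
      where
      Y≤′ = ℕ.m≤n⇒m≤1+n Y≤
      k+≤ : suc k ℕ.+ length A ℕ.≤ s
      k+≤ = ℕ.≤-trans (ℕ.≤-reflexive (sym (ℕ.+-suc k (length A)))) k≤
      k′≤ : suc k ℕ.≤ s
      k′≤ = ℕ.≤-trans (ℕ.m≤m+n (suc k) (length A)) k+≤

    add-spec : ∀ ρ R Y s → suc (length R) ℕ.≤ s → length Y ℕ.≤ s →
      Spec ρ (add ρ) (bits (false ∷ R) , bits Y , [] , [] , [] , [] , tt) (s ℕ.* 24 ℕ.+ 10) (bits (addShifted Y R) , bits Y , [] , [] , [] , [] , tt)
    add-spec ρ R Y s R≤ Y≤ = relax
      (push-spec 2F b0 ⟫
       relax (rippleLoop-spec plus _ (false ∷ R) Y false [] [] []) (ℕ.*-monoˡ-≤ 11 L≤) ⟫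
       relax (lift (5F ∷ 1F ∷ []) (mvBits _ Y)) (ℕ.*-monoˡ-≤ 5 Y≤) ⟫
       relax (lift (4F ∷ []) (clearBits _ (padTo (false ∷ R) Y))) (ℕ.*-monoˡ-≤ 3 P≤) ⟫
       copy-spec 3F 2F ⟫ (pop-spec 2F ▸ cong (λ x → [] , bits Y , [] , x , [] , [] , tt) snoc) ⟫
       relax (lift (3F ∷ 0F ∷ []) (mvBits _ (addShifted Y R))) (ℕ.*-monoˡ-≤ 5 (ℕ.≤-trans (ℕ.≤-reflexive (trans (List.length-++ S) (ℕ.+-comm _ 1))) (s≤s L≤))))
      (ℕ.≤-reflexive (solve 1 (λ s → con 2 :+ (s :* con 11 :+ (s :* con 5 :+ (s :* con 3 :+ (con 2 :+ (con 1 :+ (con 1 :+ s) :* con 5))))) := s :* con 24 :+ con 10) refl s))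
      where
      open +-*-Solver
      S = ripple plus (false ∷ R) Y false
      C = carry plus (false ∷ R) Y false
      L≤ : length S ℕ.≤ s
      L≤ = length-ripple≤ plus (false ∷ R) Y false s R≤ Y≤
      P≤ : length (padTo (false ∷ R) Y) ℕ.≤ s
      P≤ = ℕ.≤-trans (ℕ.≤-reflexive (length-padTo plus (false ∷ R) Y false)) L≤
      snoc : bitS {a} C ∷ (bits S ʳ++ []) ≡ bits (S ++ C ∷ []) ʳ++ []
      snoc = sym (trans (cong (_ʳ++ []) (List.map-++ bitS S (C ∷ []))) (List.++-ʳ++ (bits S) {bitS C ∷ []} {[]}))

    hstep-spec : ∀ ρ d w R Y s → suc (length R) ℕ.≤ s → length Y ℕ.≤ s →
      Spec ρ (hstep ρ) (bitS d ∷ w , bits R , bits Y , [] , [] , [] , [] , tt) (s ℕ.* 24 ℕ.+ 13)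
        (w , bits (if d then addShifted Y R else (false ∷ R)) , bits Y , [] , [] , [] , [] , tt)
    hstep-spec ρ true w R Y s R≤ Y≤ = relax
      (push-spec 1F b0 ⟫ if-true 0F refl (lift (1F ∷ 2F ∷ 3F ∷ 4F ∷ 5F ∷ 6F ∷ []) (add-spec _ R Y s R≤ Y≤)) ⟫ pop-spec 0F)
      (ℕ.≤-reflexive (trans (cong (2 ℕ.+_) (ℕ.+-assoc (s ℕ.* 24) 10 1)) (trans (ℕ.+-comm 2 (s ℕ.* 24 ℕ.+ 11)) (ℕ.+-assoc (s ℕ.* 24) 11 2))))
    hstep-spec ρ false w R Y s R≤ Y≤ = relax (push-spec 1F b0 ⟫ if-false 0F refl skip-spec ⟫ pop-spec 0F) (ℕ.≤-trans (ℕ.m≤m+n 3 10) (ℕ.m≤n+m 13 (s ℕ.* 24)))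

    multiply-∷ : ∀ Y d ds R → multiply Y ds (if d then addShifted Y R else (false ∷ R)) ≡ multiply Y (d ∷ ds) R
    multiply-∷ Y false ds R = refl
    multiply-∷ Y true  ds R = refl

    step-length : ∀ Y d R {k} → length Y ℕ.≤ k → length R ℕ.≤ k → length (if d then addShifted Y R else (false ∷ R)) ℕ.≤ 2 ℕ.+ k
    step-length Y false R Y≤ R≤ = ℕ.m≤n⇒m≤1+n (s≤s R≤)
    step-length Y true  R Y≤ R≤ = addShifted-length Y R Y≤ R≤

    -- Here the bound on the lengths rises by two per digit, one for the doubling and one for the
    -- carry.
    mulInteger-spec : ∀ ρ ds {w} R Y k s → length Y ℕ.≤ k → length R ℕ.≤ k → k ℕ.+ length ds ℕ.* 2 ℕ.≤ s →
      Spec ρ (mulInteger ρ) (bits ds ++ point ∷ w , bits R , bits Y , [] , [] , [] , [] , tt) (length ds ℕ.* (s ℕ.* 24 ℕ.+ 17))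
        (point ∷ w , bits (multiply Y ds R) , bits Y , [] , [] , [] , [] , tt)
    mulInteger-spec ρ []       R Y k s Y≤ R≤ k≤ = while-stop 0F 0F refl
    mulInteger-spec ρ (d ∷ ds) {w} R Y k s Y≤ R≤ k≤ = relax
      (while-step 0F 0F (lem d) (hstep-spec ρ d (bits ds ++ point ∷ w) R Y s (ℕ.≤-trans (s≤s R≤) (ℕ.≤-trans (ℕ.n≤1+n _) k′≤)) (ℕ.≤-trans (ℕ.m≤n⇒m≤1+n (ℕ.m≤n⇒m≤1+n Y≤)) k′≤))
        (mulInteger-spec ρ ds (if d then addShifted Y R else (false ∷ R)) Y (2 ℕ.+ k) s (ℕ.m≤n⇒m≤1+n (ℕ.m≤n⇒m≤1+n Y≤)) (step-length Y d R Y≤ R≤) k+≤ ▸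
          cong (λ x → point ∷ w , bits x , bits Y , [] , [] , [] , [] , tt) (multiply-∷ Y d ds R)))
      (ℕ.+-monoˡ-≤ (length ds ℕ.* (s ℕ.* 24 ℕ.+ 17)) (ℕ.≤-trans (ℕ.≤-reflexive (trans (ℕ.+-comm 2 (s ℕ.* 24 ℕ.+ 13)) (ℕ.+-assoc (s ℕ.* 24) 13 2))) (ℕ.+-monoʳ-≤ (s ℕ.* 24) (ℕ.m≤m+n 15 2))))
      where
      lem : ∀ d → not (isPoint (bitS {a} d)) ≡ true
      lem false = refl
      lem true  = refl
      k+≤ : 2 ℕ.+ k ℕ.+ length ds ℕ.* 2 ℕ.≤ s
      k+≤ = ℕ.≤-trans (ℕ.≤-reflexive (sym (trans (ℕ.+-suc k _) (cong suc (ℕ.+-suc k _))))) k≤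
      k′≤ : 2 ℕ.+ k ℕ.≤ s
      k′≤ = ℕ.≤-trans (ℕ.m≤m+n (2 ℕ.+ k) (length ds ℕ.* 2)) k+≤

    mulFraction-spec : ∀ ρ ds R Y u k s → length Y ℕ.≤ k → length R ℕ.≤ k → k ℕ.+ length ds ℕ.* 2 ℕ.≤ s →
      Spec ρ (mulFraction ρ) (bits ds , bits R , bits Y , [] , [] , [] , [] , u , tt) (length ds ℕ.* (s ℕ.* 24 ℕ.+ 17))
        ([] , bits (multiply Y ds R) , bits Y , [] , [] , [] , [] , replicate (length ds) b1 ʳ++ u , tt)
    mulFraction-spec ρ []       R Y u k s Y≤ R≤ k≤ = while-stop 0F 0F refl
    mulFraction-spec ρ (d ∷ ds) R Y u k s Y≤ R≤ k≤ = relax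
      (while-step 0F 0F (nonBlank-bitS d)
        (lift (0F ∷ 1F ∷ 2F ∷ 3F ∷ 4F ∷ 5F ∷ 6F ∷ []) (hstep-spec _ d (bits ds) R Y s (ℕ.≤-trans (s≤s R≤) (ℕ.≤-trans (ℕ.n≤1+n _) k′≤)) (ℕ.≤-trans (ℕ.m≤n⇒m≤1+n (ℕ.m≤n⇒m≤1+n Y≤)) k′≤)) ⟫ push-spec 7F b1)
        (mulFraction-spec ρ ds (if d then addShifted Y R else (false ∷ R)) Y (b1 ∷ u) (2 ℕ.+ k) s (ℕ.m≤n⇒m≤1+n (ℕ.m≤n⇒m≤1+n Y≤)) (step-length Y d R Y≤ R≤) k+≤ ▸
          cong (λ x → [] , bits x , bits Y , [] , [] , [] , [] , replicate (length ds) b1 ʳ++ (b1 ∷ u) , tt) (multiply-∷ Y d ds R)))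
      (ℕ.+-monoˡ-≤ (length ds ℕ.* (s ℕ.* 24 ℕ.+ 17)) (ℕ.≤-reflexive (trans (cong (2 ℕ.+_) (ℕ.+-assoc (s ℕ.* 24) 13 2)) (trans (ℕ.+-comm 2 (s ℕ.* 24 ℕ.+ 15)) (ℕ.+-assoc (s ℕ.* 24) 15 2)))))
      where
      k+≤ : 2 ℕ.+ k ℕ.+ length ds ℕ.* 2 ℕ.≤ s
      k+≤ = ℕ.≤-trans (ℕ.≤-reflexive (sym (trans (ℕ.+-suc k _) (cong suc (ℕ.+-suc k _))))) k≤
      k′≤ : 2 ℕ.+ k ℕ.≤ s
      k′≤ = ℕ.≤-trans (ℕ.m≤m+n (2 ℕ.+ k) (length ds ℕ.* 2)) k+≤

    canonical-spec : ∀ ρ w → Spec ρ (canonical ρ) (bits w , tt) (length w ℕ.* 3 ℕ.+ 2) (encodeℕ (val (reverse w)) , tt)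
    canonical-spec ρ w = stripZeros-spec ρ w ⟫ pad (stripped {a} w)
      where
      pad : Stripped {a} w → Spec ρ (when ρ 0F nonBlank skip (push ρ 0F b0)) (bits (strip w) , tt) 2 (encodeℕ (val (reverse w)) , tt)
      pad (zero s≡ v≡) = subst₂ (λ x y → Spec ρ _ (bits x , tt) 2 (encodeℕ y , tt)) (sym s≡) (sym v≡) (if-false 0F refl (push-spec 0F b0))
      pad (nonzero s≡ e≡ _) = relax (if-true 0F (trans (cong (nonBlank ∘ hd ∘ bits) s≡) refl) skip-spec ▸ cong (λ x → x , tt) e≡) z≤n

-- Dyadic approximations of a fraction, rounding, and programs for both

prefix-solid : ∀ {a} (u : Word a) → Solid (blankFreePrefix u)
prefix-solid []          = []
prefix-solid (blank ∷ u) = []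
prefix-solid (b0 ∷ u)    = refl ∷ prefix-solid u
prefix-solid (b1 ∷ u)    = refl ∷ prefix-solid u
prefix-solid (minus ∷ u) = refl ∷ prefix-solid u
prefix-solid (point ∷ u) = refl ∷ prefix-solid u
prefix-solid (sep ∷ u)   = refl ∷ prefix-solid u
prefix-solid (aux _ ∷ u) = refl ∷ prefix-solid u

encodeℕ-bits : ∀ {a} m → encodeℕ {a} m ≡ bits (msb (width m) m)
encodeℕ-bits m = digits-msb (width m) m

encodeℕ-solid : ∀ {a} m → Solid (encodeℕ {a} m)
encodeℕ-solid m = subst Solid (sym (encodeℕ-bits m)) (bits-solid (msb (width m) m))

length-encodeℕ : ∀ {a} m → length (encodeℕ {a} m) ≡ width m
length-encodeℕ m = trans (cong length (encodeℕ-bits m)) (trans (List.length-map bitS (msb (width m) m)) (trans (List.length-reverse (low (width m) m)) (length-low (width m) m)))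

-- The canonical encoding is the stripped word and thus no longer than `u`; the extra 1 is for zero,
-- whose encoding is not empty.
width-val : ∀ u → width (val u) ℕ.≤ suc (length u)
width-val u = lem (stripped {0} (reverse u))
  where
  rr = List.reverse-involutive u
  lem : Stripped {0} (reverse u) → width (val u) ℕ.≤ suc (length u)
  lem (zero _ v≡) = subst (λ v → width v ℕ.≤ suc (length u)) (trans (sym v≡) (cong val rr)) (s≤s z≤n)
  lem (nonzero _ e≡ _) = ℕ.m≤n⇒m≤1+n (ℕ.≤-trans (ℕ.≤-reflexive (trans (sym (length-encodeℕ {0} (val u))) (trans (cong (length ∘ encodeℕ ∘ val) (sym rr)) (trans (cong length (sym e≡)) (List.length-map bitS (strip (reverse u)))))))
    (ℕ.≤-trans (length-strip (reverse u)) (ℕ.≤-reflexive (List.length-reverse u))))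

val-split : ∀ b m → val (low b m ++ low (width ((m ℕ./ 2 ℕ.^ b) {{ℕ.m^n≢0 2 b}})) ((m ℕ./ 2 ℕ.^ b) {{ℕ.m^n≢0 2 b}})) ≡ m
val-split zero m = trans (cong (λ x → val (low (width x) x)) (ℕ.n/1≡n m)) (val-low (width m) m (<2^-log₂ m))
val-split (suc b) m = trans (cong (λ x → b2n (odd m) ℕ.+ 2 ℕ.* x) (trans (cong (λ x → val (low b (m ℕ./ 2) ++ low (width x) x)) (/2^-suc m b)) (val-split b (m ℕ./ 2)))) (sym (m≡odd+2[m/2] m))

val-dropB : ∀ b P → val (dropB b P) ≡ (val P ℕ./ 2 ℕ.^ b) {{ℕ.m^n≢0 2 b}}
val-dropB zero    P = sym (ℕ.n/1≡n (val P))
val-dropB (suc b) P = trans (val-dropB b (tlB P)) (trans (cong (λ x → (x ℕ./ 2 ℕ.^ b) {{ℕ.m^n≢0 2 b}}) (sym (trans (cong (ℕ._/ 2) (val-hd-tl P)) ([b+2v]/2 (hdB P) (val (tlB P)))))) (sym (/2^-suc (val P) b)))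

length-dropB : ∀ b P → length (dropB b P) ℕ.≤ length P
length-dropB zero    P       = ℕ.≤-refl
length-dropB (suc b) []      = length-dropB b []
length-dropB (suc b) (_ ∷ P) = ℕ.m≤n⇒m≤1+n (length-dropB b P)

-- The dyadic approximations of ±X/Y: the quotient to m binary places followed by a digit 1, which keeps them nonzero.
integerPart fractionPart : List Bool → List Bool → List Bool
integerPart X Y = proj₂ (divide Y (reverse X) [] [])
fractionPart X Y = proj₁ (divide Y (reverse X) [] [])

fractionDigits : List Bool → List Bool → ℕ → List Bool
fractionDigits X Y m = proj₂ (divide Y (replicate m false) (fractionPart X Y) [])

quotient : Bool → List Bool → List Bool → ℕ → 𝔻
quotient n X Y m = signed n (val (true ∷ fractionDigits X Y m ++ integerPart X Y)) /2^ suc m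

length-fractionDigits : ∀ X Y m → length (fractionDigits X Y m) ≡ m
length-fractionDigits X Y m = trans (divide-length Y (replicate m false) (fractionPart X Y) []) (trans (ℕ.+-identityʳ _) (List.length-replicate m))

length-integerPart : ∀ X Y → length (integerPart X Y) ≡ length X
length-integerPart X Y = trans (divide-length Y (reverse X) [] []) (trans (ℕ.+-identityʳ _) (List.length-reverse X))

-- From bottom to top, this is the order in which long division delivers the answer: sign, integer
-- digits, point, fractional digits, and the final 1.
reverse-quotient : ∀ {a} n X Y m → reverse (encode𝔻 {a} (quotient n X Y m)) ≡
  b1 ∷ bits (fractionDigits X Y m) ++ point ∷ (encodeℕ (val (integerPart X Y)) ʳ++ signW n)
reverse-quotient {a} n X Y m = begin
  reverse (encode𝔻 (z /2^ suc m))
    ≡⟨ cong₂ (λ σ w → reverse (σ ++ w)) (encodeSign-signed n (2 ℕ.* val (F ++ I)))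
         (cong₂ (λ u v → encodeℕ u ++ point ∷ v) whole≡ digits≡) ⟩
  (signW n ++ (E ++ point ∷ reverse B)) ʳ++ []   ≡⟨ List.++-ʳ++ (signW n) {E ++ point ∷ reverse B} ⟩
  (E ++ point ∷ reverse B) ʳ++ (signW n ʳ++ [])  ≡⟨ List.++-ʳ++ E {point ∷ reverse B} ⟩
  reverse B ʳ++ (point ∷ (E ʳ++ (signW n ʳ++ []))) ≡⟨ trans (List.ʳ++-defn (reverse B)) (cong₂ (λ u v → u ++ point ∷ (E ʳ++ v)) (List.reverse-involutive B) (palin n)) ⟩
  B ++ point ∷ (E ʳ++ signW n) ∎
  where
  open ≡-Reasoning
  F = fractionDigits X Y m
  I = integerPart X Y
  E = encodeℕ {a} (val I)
  B = bits {a} (true ∷ F)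
  z = signed n (val (true ∷ F ++ I))
  len : length (true ∷ F) ≡ suc m
  len = cong suc (length-fractionDigits X Y m)
  whole≡ : whole z (suc m) ≡ val I
  whole≡ = trans (cong (λ v → (v ℕ./ 2 ℕ.^ suc m) {{ℕ.m^n≢0 2 (suc m)}}) (∣signed∣ n (val (true ∷ F ++ I))))
    (trans (ℕ./-congʳ {{ℕ.m^n≢0 2 (suc m)}} {{ℕ.m^n≢0 2 (length (true ∷ F))}} (cong (2 ℕ.^_) (sym len))) (val-++-/ (true ∷ F) I))
  digits≡ : digits (suc m) ℤ.∣ z ∣ ≡ reverse B
  digits≡ = trans (cong₂ digits (sym len) (∣signed∣ n (val (true ∷ F ++ I)))) (digits-val (true ∷ F) I)
  palin : ∀ n → signW {a} n ʳ++ [] ≡ signW n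
  palin false = refl
  palin true  = refl

-- An answer is longer than the query by at most `length X + 4`. As the query word already stood on
-- the tape, an answer raises the spread by a bounded amount, however often M asks.
length-quotient : ∀ {a} n X Y m → length (encode𝔻 {a} (quotient n X Y m)) ℕ.≤ length X ℕ.+ m ℕ.+ 4
length-quotient {a} n X Y m = ℕ.≤-trans
  (ℕ.≤-reflexive (trans (sym (List.length-reverse (encode𝔻 {a} (quotient n X Y m)))) (trans (cong length (reverse-quotient {a} n X Y m))
    (cong suc (trans (List.length-++ (bits {a} F)) (cong₂ (λ x y → x ℕ.+ suc y) (trans (List.length-map bitS F) (length-fractionDigits X Y m))
      (trans (List.length-ʳ++ (encodeℕ {a} (val I))) (cong (ℕ._+ length (signW {a} n)) (length-encodeℕ {a} (val I)))))))))) 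
  (ℕ.≤-trans (s≤s (ℕ.+-monoʳ-≤ m (s≤s (ℕ.+-mono-≤ (ℕ.≤-trans (width-val I) (s≤s (ℕ.≤-reflexive (length-integerPart X Y)))) (short n)))))
    (ℕ.≤-reflexive (solve 2 (λ m x → con 1 :+ (m :+ (con 1 :+ ((con 1 :+ x) :+ con 1))) := x :+ m :+ con 4) refl m (length X))))
  where
  open +-*-Solver
  F = fractionDigits X Y m
  I = integerPart X Y
  short : ∀ n → length (signW {a} n) ℕ.≤ 1
  short false = z≤n
  short true  = ℕ.≤-refl

respondTime : ℕ → ℕ
respondTime s = s ℕ.* (s ℕ.* 24 ℕ.+ 12) ℕ.+ s ℕ.* (s ℕ.* 24 ℕ.+ 12) ℕ.+ s ℕ.* 38 ℕ.+ 50

respondTime-mono : ∀ {s s′} → s ℕ.≤ s′ → respondTime s ℕ.≤ respondTime s′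
respondTime-mono {s} {s′} s≤ = ℕ.+-monoˡ-≤ 50 (ℕ.+-mono-≤ (ℕ.+-mono-≤ sq sq) (ℕ.*-monoˡ-≤ 38 s≤))
  where
  sq : s ℕ.* (s ℕ.* 24 ℕ.+ 12) ℕ.≤ s′ ℕ.* (s′ ℕ.* 24 ℕ.+ 12)
  sq = ℕ.*-mono-≤ s≤ (ℕ.+-monoˡ-≤ 12 (ℕ.*-monoˡ-≤ 24 s≤))

finishTime : ℕ → ℕ → ℕ
finishTime y u = u ℕ.* ((y ℕ.+ u ℕ.* 2) ℕ.* 24 ℕ.+ 17) ℕ.+ u ℕ.* 15 ℕ.+ (y ℕ.+ u ℕ.* 2) ℕ.* 8 ℕ.+ 20

-- The magnitude of `z val Y / 2 ^ b`, rounded down; the sign is attached afterwards, so the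
-- rounding is toward zero.
product : ℤ → ℕ → List Bool → ℕ
product z b Y = ((ℤ.∣ z ∣ ℕ.* val Y) ℕ./ 2 ℕ.^ b) {{ℕ.m^n≢0 2 b}}

module Forwarding (a o e : ℕ) where
  open Arithmetic a o e public

  -- 0-3 zipper; 4 query length; 5 reversed answer; 6 sign; 7, 8 dividend and its reversal;
  -- 9-14 remainder, divisor and buffers; 15, 16 quotient.
  answerQuery respond : Regs 17 → Cmd
  answerQuery ρ =
    zread (pick ρ (1F ∷ 2F ∷ 4F ∷ [])) ⨟
    clearCode (pick ρ (0F ∷ [])) ⨟
    when ρ 6F isMinus (push ρ 5F minus) skip ⨟
    mv (pick ρ (7F ∷ 8F ∷ [])) ⨟
    divInteger (pick ρ (8F ∷ 7F ∷ 9F ∷ 10F ∷ 11F ∷ 12F ∷ 13F ∷ 14F ∷ 15F ∷ [])) ⨟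
    mv (pick ρ (15F ∷ 16F ∷ [])) ⨟
    -- The integer quotient has as many digits as the dividend, so leading zeros must be removed.
    canonical (pick ρ (16F ∷ [])) ⨟
    mv (pick ρ (16F ∷ 5F ∷ [])) ⨟
    push ρ 5F point ⨟
    divFraction (pick ρ (4F ∷ 9F ∷ 10F ∷ 11F ∷ 12F ∷ 13F ∷ 14F ∷ 5F ∷ [])) ⨟
    push ρ 5F b1 ⨟
    clear (pick ρ (9F ∷ [])) ⨟
    zload (pick ρ (5F ∷ 1F ∷ 2F ∷ [])) ⨟
    poke ρ 3F 3F 3F 3F (λ _ _ _ → blank)
  respond ρ = when ρ 3F isSep (answerQuery ρ) (zmove (pick ρ (0F ∷ 1F ∷ 2F ∷ 3F ∷ [])))

  dropBits : Regs 2 → Cmd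
  dropBits ρ = while ρ 0F nonBlank (pop ρ 0F ⨟ pop ρ 1F)

  -- 0, 1 zipper; 2, 3 buffers; 4 sign; 5-10 accumulator, multiplier and buffers; 11 number of binary places; 12 output.
  finish : Regs 13 → Cmd
  finish ρ =
    zread (pick ρ (0F ∷ 1F ∷ 2F ∷ [])) ⨟
    mv (pick ρ (2F ∷ 3F ∷ [])) ⨟
    when ρ 3F isMinus (push ρ 4F minus ⨟ pop ρ 3F) skip ⨟
    mulInteger (pick ρ (3F ∷ 5F ∷ 6F ∷ 7F ∷ 8F ∷ 9F ∷ 10F ∷ [])) ⨟
    pop ρ 3F ⨟
    mulFraction (pick ρ (3F ∷ 5F ∷ 6F ∷ 7F ∷ 8F ∷ 9F ∷ 10F ∷ 11F ∷ [])) ⨟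
    dropBits (pick ρ (11F ∷ 5F ∷ [])) ⨟
    mv (pick ρ (5F ∷ 12F ∷ [])) ⨟
    stripZeros (pick ρ (12F ∷ [])) ⨟
    -- A result that was rounded to zero is written without the sign of `z`.
    when ρ 12F nonBlank (when ρ 4F isMinus (push ρ 12F minus) skip) (push ρ 12F b0)

  parse : Regs 3 → Cmd
  parse ρ = when ρ 0F isMinus (push ρ 1F minus ⨟ pop ρ 0F) skip ⨟ readTo (not ∘ isSep) (pick ρ (0F ∷ 2F ∷ [])) ⨟ pop ρ 0F

  measure : Regs 3 → Cmd
  measure ρ = while ρ 0F nonBlank (copy ρ 1F 0F ⨟ push ρ 2F b1 ⨟ pop ρ 0F)

  -- The number of binary digits of `y` is itself a sufficient precision, because `y < 2 ^ width y`;
  -- counting the digits yields the unary input of M.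
  launch : Regs 5 → Cmd
  launch ρ = measure (pick ρ (0F ∷ 1F ∷ 2F ∷ [])) ⨟ zload (pick ρ (2F ∷ 3F ∷ 4F ∷ []))

  zeroOut : Regs 1 → Cmd
  zeroOut ρ = clear ρ ⨟ push ρ 0F b0

  module CorrectF (φ : Oracles o) where
    open CorrectA φ public

    answerQuery-spec : ∀ ρ l s₀ r n X Y s {x w} →
      length X ℕ.+ length Y ℕ.+ suc (length r) ℕ.≤ s → length l ℕ.≤ s → encode𝔻 (quotient n X Y (length (blankFreePrefix (s₀ ∷ r)))) ≡ x ∷ w →
      Spec ρ (answerQuery ρ)
        (code l , s₀ ∷ [] , code r , sep ∷ [] , [] , [] , signW n , bits X , [] , [] , bits Y , [] , [] , [] , [] , [] , [] , tt) (respondTime s)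
        ([] , x ∷ [] , code w , blank ∷ [] , [] , [] , signW n , bits X , [] , [] , bits Y , [] , [] , [] , [] , [] , [] , tt)
    answerQuery-spec ρ l s₀ r n X Y s {x} {w} s≥ l≤ enc≡ = relax
      (relax (lift (1F ∷ 2F ∷ 4F ∷ []) (zread-spec _ s₀ r [])) (ℕ.+-monoʳ-≤ 2 (ℕ.*-monoˡ-≤ 6 r≤)) ⟫
       relax (lift (0F ∷ []) (clearCode-spec _ l)) (ℕ.*-monoˡ-≤ 4 l≤) ⟫
       sign n ⟫
       relax (lift (7F ∷ 8F ∷ []) (mv-spec _ [] (bits-solid X)) ▸
         cong (λ v → [] , s₀ ∷ [] , [] , sep ∷ [] , A , signW n , signW n , [] , v , [] , bits Y , [] , [] , [] , [] , [] , [] , tt) (sym (List.reverse-map bitS X)))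
         (ℕ.*-monoˡ-≤ 5 (ℕ.≤-trans (ℕ.≤-reflexive (length-bits X)) X≤)) ⟫
       relax (lift (8F ∷ 7F ∷ 9F ∷ 10F ∷ 11F ∷ 12F ∷ 13F ∷ 14F ∷ 15F ∷ []) (divInteger-spec _ (reverse X) [] [] Y [] (length Y) s ℕ.≤-refl z≤n Y+X≤) ▸
         cong (λ v → [] , s₀ ∷ [] , [] , sep ∷ [] , A , signW n , signW n , v , [] , bits R₁ , bits Y , [] , [] , [] , [] , bits I , [] , tt)
           (trans (sym (List.reverse-map bitS (reverse X))) (cong bits (List.reverse-involutive X))))
         (ℕ.*-monoˡ-≤ (s ℕ.* 24 ℕ.+ 12) (ℕ.≤-trans (ℕ.≤-reflexive (List.length-reverse X)) X≤)) ⟫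
       relax (lift (15F ∷ 16F ∷ []) (mv-spec _ [] (bits-solid I)) ▸
         cong (λ v → [] , s₀ ∷ [] , [] , sep ∷ [] , A , signW n , signW n , bits X , [] , bits R₁ , bits Y , [] , [] , [] , [] , [] , v , tt) (sym (List.reverse-map bitS I)))
         (ℕ.*-monoˡ-≤ 5 (ℕ.≤-trans (ℕ.≤-reflexive (length-bits I)) I≤)) ⟫
       relax (lift (16F ∷ []) (canonical-spec _ (reverse I)) ▸
         cong (λ v → [] , s₀ ∷ [] , [] , sep ∷ [] , A , signW n , signW n , bits X , [] , bits R₁ , bits Y , [] , [] , [] , [] , [] , encodeℕ (val v) , tt) (List.reverse-involutive I))
         (ℕ.+-monoˡ-≤ 2 (ℕ.*-monoˡ-≤ 3 (ℕ.≤-trans (ℕ.≤-reflexive (List.length-reverse I)) I≤))) ⟫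
       relax (lift (16F ∷ 5F ∷ []) (mv-spec _ (signW n) (encodeℕ-solid (val I))))
         (ℕ.*-monoˡ-≤ 5 (ℕ.≤-trans (ℕ.≤-reflexive (length-encodeℕ {a} (val I))) (ℕ.≤-trans (width-val I) (s≤s I≤)))) ⟫
       push-spec 5F point ⟫
       relax (lift (4F ∷ 9F ∷ 10F ∷ 11F ∷ 12F ∷ 13F ∷ 14F ∷ 5F ∷ [])
           (divFraction-spec _ A R₁ Y [] {point ∷ (encodeℕ (val I) ʳ++ signW n)} (length X ℕ.+ length Y) s (solid-ʳ++ (prefix-solid (s₀ ∷ r)) []) (ℕ.m≤n+m (length Y) (length X)) R₁≤ k+A≤) ▸
         cong (λ m → [] , s₀ ∷ [] , [] , sep ∷ [] , [] , bits (fractionDigits X Y m) ++ point ∷ (encodeℕ (val I) ʳ++ signW n) , signW n , bits X , [] , bits (proj₁ (divide Y (replicate m false) R₁ [])) , bits Y , [] , [] , [] , [] , [] , [] , tt) lenA)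
         (ℕ.*-monoˡ-≤ (s ℕ.* 24 ℕ.+ 12) A≤) ⟫
       (push-spec 5F b1 ▸
         cong (λ v → [] , s₀ ∷ [] , [] , sep ∷ [] , [] , v , signW n , bits X , [] , bits R₂ , bits Y , [] , [] , [] , [] , [] , [] , tt) (sym (reverse-quotient {a} n X Y m))) ⟫
       relax (lift (9F ∷ []) (clear-spec _ (bits-solid R₂))) (ℕ.*-monoˡ-≤ 3 (ℕ.≤-trans (ℕ.≤-reflexive (length-bits R₂)) R₂≤)) ⟫
       relax (lift (5F ∷ 1F ∷ 2F ∷ []) (zload-spec _ x w (solid-ʳ++ (solid-encode𝔻 (𝔻.numerator (quotient n X Y m)) (suc m)) []) (trans (List.reverse-involutive (encode𝔻 (quotient n X Y m))) enc≡)))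
         (ℕ.+-monoˡ-≤ 3 (ℕ.*-monoˡ-≤ 7 (ℕ.≤-trans (ℕ.≤-reflexive (List.length-reverse (encode𝔻 {a} (quotient n X Y m)))) (ℕ.≤-trans (length-quotient {a} n X Y m) (ℕ.+-monoˡ-≤ 4 X+m≤))))) ⟫
       poke-spec 3F 3F 3F 3F (λ _ _ _ → blank))
      (ℕ.≤-trans (ℕ.≤-reflexive (solve 2 (λ s q → (con 2 :+ s :* con 6) :+ (s :* con 4 :+ (con 2 :+ (s :* con 5 :+ (q :+ (s :* con 5 :+ ((s :* con 3 :+ con 2) :+ ((con 1 :+ s) :* con 5 :+ (con 2 :+ (q :+ (con 2 :+ (s :* con 3 :+ (((s :+ con 4) :* con 7 :+ con 3) :+ con 1))))))))))))
           := q :+ q :+ s :* con 38 :+ con 47) refl s (s ℕ.* (s ℕ.* 24 ℕ.+ 12))))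
        (ℕ.+-monoʳ-≤ (s ℕ.* (s ℕ.* 24 ℕ.+ 12) ℕ.+ s ℕ.* (s ℕ.* 24 ℕ.+ 12) ℕ.+ s ℕ.* 38) (ℕ.m≤m+n 47 3)))
      where
      open +-*-Solver
      m = length (blankFreePrefix (s₀ ∷ r))
      A = blankFreePrefix (s₀ ∷ r) ʳ++ []
      R₁ = fractionPart X Y
      I = integerPart X Y
      R₂ = proj₁ (divide Y (replicate m false) R₁ [])
      lenA : length A ≡ m
      lenA = List.length-reverse (blankFreePrefix (s₀ ∷ r))
      m≤ : m ℕ.≤ suc (length r)
      m≤ = prefix-length (s₀ ∷ r)
      sr≤ : suc (length r) ℕ.≤ s
      sr≤ = ℕ.≤-trans (ℕ.m≤n+m _ (length X ℕ.+ length Y)) s≥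
      r≤ : length r ℕ.≤ s
      r≤ = ℕ.≤-trans (ℕ.n≤1+n _) sr≤
      A≤ : length A ℕ.≤ s
      A≤ = ℕ.≤-trans (ℕ.≤-reflexive lenA) (ℕ.≤-trans m≤ sr≤)
      X+Y≤ : length X ℕ.+ length Y ℕ.≤ s
      X+Y≤ = ℕ.≤-trans (ℕ.m≤m+n _ (suc (length r))) s≥
      X≤ : length X ℕ.≤ s
      X≤ = ℕ.≤-trans (ℕ.m≤m+n _ (length Y)) X+Y≤
      I≤ : length I ℕ.≤ s
      I≤ = ℕ.≤-trans (ℕ.≤-reflexive (length-integerPart X Y)) X≤
      Y+X≤ : length Y ℕ.+ length (reverse X) ℕ.≤ s
      Y+X≤ = ℕ.≤-trans (ℕ.≤-reflexive (trans (cong (length Y ℕ.+_) (List.length-reverse X)) (ℕ.+-comm (length Y) (length X)))) X+Y≤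
      R₁≤ : length R₁ ℕ.≤ length X ℕ.+ length Y
      R₁≤ = ℕ.≤-trans (divide-length₁ Y (reverse X) [] [] {length Y} ℕ.≤-refl z≤n) (ℕ.≤-reflexive (trans (cong (length Y ℕ.+_) (List.length-reverse X)) (ℕ.+-comm (length Y) (length X))))
      k+A≤ : length X ℕ.+ length Y ℕ.+ length A ℕ.≤ s
      k+A≤ = ℕ.≤-trans (ℕ.+-monoʳ-≤ (length X ℕ.+ length Y) (ℕ.≤-trans (ℕ.≤-reflexive lenA) m≤)) s≥
      R₂≤ : length R₂ ℕ.≤ s
      R₂≤ = ℕ.≤-trans (divide-length₁ Y (replicate m false) R₁ [] (ℕ.m≤n+m (length Y) (length X)) R₁≤)
        (ℕ.≤-trans (ℕ.+-monoʳ-≤ (length X ℕ.+ length Y) (ℕ.≤-trans (ℕ.≤-reflexive (List.length-replicate m)) m≤)) s≥)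
      X+m≤ : length X ℕ.+ m ℕ.≤ s
      X+m≤ = ℕ.≤-trans (ℕ.+-mono-≤ (ℕ.m≤m+n (length X) (length Y)) m≤) s≥
      sign : ∀ n → Spec ρ (when ρ 6F isMinus (push ρ 5F minus) skip)
        ([] , s₀ ∷ [] , [] , sep ∷ [] , A , [] , signW n , bits X , [] , [] , bits Y , [] , [] , [] , [] , [] , [] , tt) 2
        ([] , s₀ ∷ [] , [] , sep ∷ [] , A , signW n , signW n , bits X , [] , [] , bits Y , [] , [] , [] , [] , [] , [] , tt)
      sign true  = if-true 6F refl (push-spec 5F minus)
      sign false = relax (if-false 6F refl skip-spec) z≤n

    respond-query : ∀ ρ (t : Tape a) n X Y s {x w} →
      length X ℕ.+ length Y ℕ.+ suc (length (Tape.after t)) ℕ.≤ s → length (Tape.before t) ℕ.≤ s → encode𝔻 (quotient n X Y (length (contents t))) ≡ x ∷ w →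
      Spec ρ (respond ρ)
        (code (Tape.before t) , Tape.scanned t ∷ [] , code (Tape.after t) , sep ∷ [] , [] , [] , signW n , bits X , [] , [] , bits Y , [] , [] , [] , [] , [] , [] , tt) (respondTime s)
        ([] , x ∷ [] , code w , blank ∷ [] , [] , [] , signW n , bits X , [] , [] , bits Y , [] , [] , [] , [] , [] , [] , tt)
    respond-query ρ (tape l s₀ r) n X Y s s≥ l≤ eq = if-true 3F refl (answerQuery-spec ρ l s₀ r n X Y s s≥ l≤ eq)

    respond-move : ∀ ρ (t : Tape a) n X Y s m →
      Spec ρ (respond ρ)
        (code (Tape.before t) , Tape.scanned t ∷ [] , code (Tape.after t) , direction m ∷ [] , [] , [] , signW n , bits X , [] , [] , bits Y , [] , [] , [] , [] , [] , [] , tt) (respondTime s)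
        (code (Tape.before (move m t)) , Tape.scanned (move m t) ∷ [] , code (Tape.after (move m t)) , blank ∷ [] , [] , [] , signW n , bits X , [] , [] , bits Y , [] , [] , [] , [] , [] , [] , tt)
    respond-move ρ t n X Y s m = relax (if-false 3F (lem m) (lift (0F ∷ 1F ∷ 2F ∷ 3F ∷ []) (zmove-spec _ t m)))
      (ℕ.≤-trans (ℕ.m≤m+n 8 42) (ℕ.m≤n+m 50 (s ℕ.* (s ℕ.* 24 ℕ.+ 12) ℕ.+ s ℕ.* (s ℕ.* 24 ℕ.+ 12) ℕ.+ s ℕ.* 38)))
      where
      lem : ∀ m → isSep (direction {a} m) ≡ false
      lem left  = refl
      lem right = refl
      lem stay  = refl

    dropBits-spec : ∀ ρ b P → Spec ρ (dropBits ρ) (replicate b b1 , bits P , tt) (b ℕ.* 4) ([] , bits (dropB b P) , tt)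
    dropBits-spec ρ zero    P       = while-stop 0F 0F refl
    dropBits-spec ρ (suc b) []      = while-step 0F 0F refl (pop-spec 0F ⟫ pop-spec 1F) (dropBits-spec ρ b [])
    dropBits-spec ρ (suc b) (_ ∷ P) = while-step 0F 0F refl (pop-spec 0F ⟫ pop-spec 1F) (dropBits-spec ρ b P)

    finish-spec : ∀ ρ s₀ r z b Y u → blankFreePrefix (s₀ ∷ r) ≡ encode𝔻 (z /2^ b) → length r ℕ.≤ u →
      Spec ρ (finish ρ) (s₀ ∷ [] , code r , [] , [] , [] , [] , bits Y , [] , [] , [] , [] , [] , [] , tt) (finishTime (length Y) u)
        (s₀ ∷ [] , [] , [] , [] , signW (negative z) , [] , bits Y , [] , [] , [] , [] , [] , encodeℤ (signed (negative z) (product z b Y)) , tt)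
    finish-spec ρ s₀ r z b Y u eq r≤ = relax
      (relax (lift (0F ∷ 1F ∷ 2F ∷ []) (zread-spec _ s₀ r [])) (ℕ.+-monoʳ-≤ 2 (ℕ.*-monoˡ-≤ 6 r≤)) ⟫
       relax (lift (2F ∷ 3F ∷ []) (mv-spec _ [] (solid-ʳ++ (prefix-solid (s₀ ∷ r)) [])) ▸
         cong (λ v → s₀ ∷ [] , [] , [] , v , [] , [] , bits Y , [] , [] , [] , [] , [] , [] , tt)
           (trans (List.reverse-involutive (blankFreePrefix (s₀ ∷ r))) (trans eq (encode𝔻-bits z b))))
         (ℕ.*-monoˡ-≤ 5 (ℕ.≤-trans (ℕ.≤-reflexive (List.length-reverse (blankFreePrefix (s₀ ∷ r)))) (ℕ.≤-trans (prefix-length (s₀ ∷ r)) (s≤s r≤)))) ⟫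
       sign n ⟫
       relax (lift (3F ∷ 5F ∷ 6F ∷ 7F ∷ 8F ∷ 9F ∷ 10F ∷ []) (mulInteger-spec _ I [] Y (length Y) s ℕ.≤-refl z≤n Y+w≤))
         (ℕ.≤-reflexive (cong (ℕ._* (s ℕ.* 24 ℕ.+ 17)) lenI)) ⟫
       pop-spec 3F ⟫
       relax (lift (3F ∷ 5F ∷ 6F ∷ 7F ∷ 8F ∷ 9F ∷ 10F ∷ 11F ∷ []) (mulFraction-spec _ F (multiply Y I []) Y [] (length Y ℕ.+ length I ℕ.* 2) s (ℕ.m≤m+n _ _) (multiply-length Y I [] ℕ.≤-refl z≤n) YIF≤) ▸
         cong₂ (λ p c → s₀ ∷ [] , [] , [] , [] , signW n , bits p , bits Y , [] , [] , [] , [] , c , [] , tt) (sym (multiply-++ Y I F []))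
           (trans (replicate-ʳ++ (length F) b1 []) (trans (List.++-identityʳ _) (cong (λ k → replicate k b1) lenF))))
         (ℕ.≤-reflexive (cong (ℕ._* (s ℕ.* 24 ℕ.+ 17)) lenF)) ⟫
       relax (lift (11F ∷ 5F ∷ []) (dropBits-spec _ b P)) (ℕ.*-monoˡ-≤ 4 b≤) ⟫
       relax (lift (5F ∷ 12F ∷ []) (mv-spec _ [] (bits-solid P′)) ▸
         cong (λ v → s₀ ∷ [] , [] , [] , [] , signW n , [] , bits Y , [] , [] , [] , [] , [] , v , tt) (sym (List.reverse-map bitS P′)))
         (ℕ.*-monoˡ-≤ 5 (ℕ.≤-trans (ℕ.≤-reflexive (length-bits P′)) P′≤)) ⟫
       relax (lift (12F ∷ []) (stripZeros-spec _ (reverse P′))) (ℕ.*-monoˡ-≤ 3 (ℕ.≤-trans (ℕ.≤-reflexive (List.length-reverse P′)) P′≤)) ⟫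
       output (stripped {a} (reverse P′)))
      (ℕ.≤-trans (ℕ.≤-reflexive (solve 5 (λ u w b c s → (con 2 :+ u :* con 6) :+ ((con 1 :+ u) :* con 5 :+ (con 3 :+ (w :* c :+ (con 1 :+ (b :* c :+ (u :* con 4 :+ (s :* con 5 :+ (s :* con 3 :+ con 2))))))))
            := (b :+ w) :* c :+ u :* con 15 :+ s :* con 8 :+ con 13) refl u (width q) b (s ℕ.* 24 ℕ.+ 17) s))
        (ℕ.+-mono-≤ (ℕ.+-monoˡ-≤ (s ℕ.* 8) (ℕ.+-monoˡ-≤ (u ℕ.* 15) (ℕ.*-monoˡ-≤ (s ℕ.* 24 ℕ.+ 17) bw≤))) (ℕ.m≤m+n 13 7)))
      where
      open +-*-Solver
      n = negative z
      q = whole z b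
      I = msb (width q) q
      F = msb b ℤ.∣ z ∣
      s = length Y ℕ.+ u ℕ.* 2
      P = multiply Y (I ++ F) []
      P′ = dropB b P
      lenI : length I ≡ width q
      lenI = trans (List.length-reverse (low (width q) q)) (length-low (width q) q)
      lenF : length F ≡ b
      lenF = trans (List.length-reverse (low b ℤ.∣ z ∣)) (length-low b ℤ.∣ z ∣)
      bw≤ : b ℕ.+ width q ℕ.≤ u
      bw≤ = ℕ.≤-trans (ℕ.s≤s⁻¹ (ℕ.≤-trans (ℕ.≤-reflexive (ℕ.+-comm 1 (b ℕ.+ width q))) (ℕ.≤-trans (length-encode𝔻 {a} z b)
        (ℕ.≤-trans (ℕ.≤-reflexive (cong length (sym eq))) (prefix-length (s₀ ∷ r)))))) r≤
      b≤ : b ℕ.≤ u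
      b≤ = ℕ.≤-trans (ℕ.m≤m+n b (width q)) bw≤
      Y+w≤ : length Y ℕ.+ length I ℕ.* 2 ℕ.≤ s
      Y+w≤ = ℕ.+-monoʳ-≤ (length Y) (ℕ.*-monoˡ-≤ 2 (ℕ.≤-trans (ℕ.≤-reflexive lenI) (ℕ.≤-trans (ℕ.m≤n+m (width q) b) bw≤)))
      YIF≤ : length Y ℕ.+ length I ℕ.* 2 ℕ.+ length F ℕ.* 2 ℕ.≤ s
      YIF≤ = ℕ.≤-trans (ℕ.≤-reflexive (trans (cong₂ (λ i f → length Y ℕ.+ i ℕ.* 2 ℕ.+ f ℕ.* 2) lenI lenF)
          (solve 3 (λ y w b → y :+ w :* con 2 :+ b :* con 2 := y :+ (b :+ w) :* con 2) refl (length Y) (width q) b)))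
        (ℕ.+-monoʳ-≤ (length Y) (ℕ.*-monoˡ-≤ 2 bw≤))
      P≤ : length P ℕ.≤ s
      P≤ = ℕ.≤-trans (multiply-length Y (I ++ F) [] ℕ.≤-refl z≤n)
        (ℕ.+-monoʳ-≤ (length Y) (ℕ.*-monoˡ-≤ 2 (ℕ.≤-trans (ℕ.≤-reflexive (trans (List.length-++ I) (trans (cong₂ ℕ._+_ lenI lenF) (ℕ.+-comm (width q) b)))) bw≤)))
      P′≤ : length P′ ℕ.≤ s
      P′≤ = ℕ.≤-trans (length-dropB b P) P≤
      rev≡ : reverse (I ++ F) ≡ low b ℤ.∣ z ∣ ++ low (width q) q
      rev≡ = trans (List.reverse-++ I F) (cong₂ _++_ (List.reverse-involutive (low b ℤ.∣ z ∣)) (List.reverse-involutive (low (width q) q)))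
      val≡ : val (reverse (reverse P′)) ≡ product z b Y
      val≡ = trans (cong val (List.reverse-involutive P′)) (trans (val-dropB b P)
        (cong (λ v → (v ℕ./ 2 ℕ.^ b) {{ℕ.m^n≢0 2 b}}) (trans (multiply-val Y (I ++ F) []) (cong (ℕ._* val Y) (trans (cong val rev≡) (val-split b ℤ.∣ z ∣))))))

      sign : ∀ n → Spec ρ (when ρ 3F isMinus (push ρ 4F minus ⨟ pop ρ 3F) skip)
        (s₀ ∷ [] , [] , [] , signW n ++ (bits I ++ point ∷ bits F) , [] , [] , bits Y , [] , [] , [] , [] , [] , [] , tt) 3
        (s₀ ∷ [] , [] , [] , bits I ++ point ∷ bits F , signW n , [] , bits Y , [] , [] , [] , [] , [] , [] , tt)
      sign true  = if-true 3F refl (push-spec 4F minus ⟫ pop-spec 3F)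
      sign false = relax (if-false 3F (plain I) skip-spec) z≤n
        where
        plain : ∀ v → isMinus (hd (bits {a} v ++ point ∷ bits F)) ≡ false
        plain []          = refl
        plain (false ∷ v) = refl
        plain (true ∷ v)  = refl

      encodeℤ-signed : ∀ n h → 1 ℕ.≤ h → signW {a} n ++ encodeℕ h ≡ encodeℤ (signed n h)
      encodeℤ-signed false h       _ = refl
      encodeℤ-signed true  (suc h) _ = refl

      encodeℤ-zero : ∀ n → b0 ∷ [] ≡ encodeℤ {a} (signed n 0)
      encodeℤ-zero false = refl
      encodeℤ-zero true  = refl

      output : Stripped {a} (reverse P′) → Spec ρ (when ρ 12F nonBlank (when ρ 4F isMinus (push ρ 12F minus) skip) (push ρ 12F b0))
        (s₀ ∷ [] , [] , [] , [] , signW n , [] , bits Y , [] , [] , [] , [] , [] , bits (strip (reverse P′)) , tt) 2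
        (s₀ ∷ [] , [] , [] , [] , signW n , [] , bits Y , [] , [] , [] , [] , [] , encodeℤ (signed n (product z b Y)) , tt)
      output (zero s≡ v≡) = if-false 12F (cong (nonBlank ∘ hd ∘ bits) s≡)
        (push-spec 12F b0 ▸ cong (λ v → s₀ ∷ [] , [] , [] , [] , signW n , [] , bits Y , [] , [] , [] , [] , [] , v , tt)
          (trans (cong (λ v → b0 ∷ bits v) s≡) (trans (encodeℤ-zero n) (cong (encodeℤ ∘ signed n) (trans (sym v≡) val≡)))))
      output (nonzero s≡ e≡ 1≤) = if-true 12F (cong (nonBlank ∘ hd ∘ bits) s≡)
        (minusSign n ▸ cong (λ v → s₀ ∷ [] , [] , [] , [] , signW n , [] , bits Y , [] , [] , [] , [] , [] , v , tt)
          (trans (cong (signW n ++_) (trans e≡ (cong encodeℕ val≡))) (encodeℤ-signed n (product z b Y) (subst (1 ℕ.≤_) val≡ 1≤))))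
        where
        minusSign : ∀ n → Spec ρ (when ρ 4F isMinus (push ρ 12F minus) skip)
          (s₀ ∷ [] , [] , [] , [] , signW n , [] , bits Y , [] , [] , [] , [] , [] , bits (strip (reverse P′)) , tt) 2
          (s₀ ∷ [] , [] , [] , [] , signW n , [] , bits Y , [] , [] , [] , [] , [] , signW n ++ bits (strip (reverse P′)) , tt)
        minusSign true  = if-true 4F refl (push-spec 12F minus)
        minusSign false = relax (if-false 4F refl skip-spec) z≤n

    parse-spec : ∀ ρ x w → Spec ρ (parse ρ) (encodeℤ x ++ sep ∷ w , [] , [] , tt) (3 ℕ.+ (width ℤ.∣ x ∣ ℕ.* 5 ℕ.+ 1))
      (w , signW (negative x) , bits (low (width ℤ.∣ x ∣) ℤ.∣ x ∣) , tt)
    parse-spec ρ x w = subst (λ v → Spec ρ (parse ρ) (v , [] , [] , tt) (3 ℕ.+ (width ℤ.∣ x ∣ ℕ.* 5 ℕ.+ 1)) (w , signW (negative x) , bits (low (width ℤ.∣ x ∣) ℤ.∣ x ∣) , tt)) (sym split)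
      (sign (negative x) ⟫
       relax (lift (0F ∷ 2F ∷ []) (readTo-spec (not ∘ isSep) _ (bits G) [] (all-bits (not ∘ isSep) refl refl G) refl) ▸
         cong (λ v → sep ∷ w , signW (negative x) , v , tt) (trans (sym (List.reverse-map bitS G)) (cong bits (List.reverse-involutive (low (width ℤ.∣ x ∣) ℤ.∣ x ∣)))))
         (ℕ.≤-reflexive (cong (ℕ._* 5) (trans (length-bits G) (trans (List.length-reverse (low (width ℤ.∣ x ∣) ℤ.∣ x ∣)) (length-low (width ℤ.∣ x ∣) ℤ.∣ x ∣))))) ⟫
       pop-spec 0F)
      where
      G = msb (width ℤ.∣ x ∣) ℤ.∣ x ∣
      split : encodeℤ x ++ sep ∷ w ≡ signW (negative x) ++ (bits G ++ sep ∷ w)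
      split = trans (cong₂ (λ u v → (u ++ v) ++ sep ∷ w) (encodeSign-signW x) (encodeℕ-bits ℤ.∣ x ∣)) (List.++-assoc (signW (negative x)) (bits G) (sep ∷ w))
      sign : ∀ n → Spec ρ (when ρ 0F isMinus (push ρ 1F minus ⨟ pop ρ 0F) skip) (signW n ++ (bits G ++ sep ∷ w) , [] , [] , tt) 3 (bits G ++ sep ∷ w , signW n , [] , tt)
      sign true  = if-true 0F refl (push-spec 1F minus ⟫ pop-spec 0F)
      sign false = relax (if-false 0F (plain G) skip-spec) z≤n
        where
        plain : ∀ v → isMinus (hd (bits {a} v ++ sep ∷ w)) ≡ false
        plain []          = refl
        plain (false ∷ v) = refl
        plain (true ∷ v)  = refl

    measure-spec : ∀ ρ u v w → Spec ρ (measure ρ) (bits u , v , w , tt) (length u ℕ.* 7) ([] , bits u ʳ++ v , replicate (length u) b1 ʳ++ w , tt)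
    measure-spec ρ []      v w = while-stop 0F 0F refl
    measure-spec ρ (x ∷ u) v w = while-step 0F 0F (nonBlank-bitS x) (copy-spec 1F 0F ⟫ push-spec 2F b1 ⟫ pop-spec 0F) (measure-spec ρ u (bitS x ∷ v) (b1 ∷ w))

    launch-spec : ∀ ρ y → Spec ρ (launch ρ) (encodeℕ y , [] , [] , blank ∷ [] , [] , tt) (width y ℕ.* 7 ℕ.+ (width y ℕ.* 7 ℕ.+ 3))
      ([] , bits (low (width y) y) , [] , b1 ∷ [] , code (replicate ⌊log₂ y ⌋ b1) , tt)
    launch-spec ρ y = subst (λ v → Spec ρ (launch ρ) (v , [] , [] , blank ∷ [] , [] , tt) (width y ℕ.* 7 ℕ.+ (width y ℕ.* 7 ℕ.+ 3)) ([] , bits (low (width y) y) , [] , b1 ∷ [] , code (replicate ⌊log₂ y ⌋ b1) , tt)) (sym (encodeℕ-bits y))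
      (relax (lift (0F ∷ 1F ∷ 2F ∷ []) (measure-spec _ G [] []) ▸
          cong₂ (λ u v → [] , u , v , blank ∷ [] , [] , tt) (trans (sym (List.reverse-map bitS G)) (cong bits (List.reverse-involutive (low (width y) y))))
            (trans (replicate-ʳ++ (length G) b1 []) (trans (List.++-identityʳ _) (cong (λ k → replicate k b1) lenG))))
          (ℕ.≤-reflexive (cong (ℕ._* 7) lenG)) ⟫
       relax (lift (2F ∷ 3F ∷ 4F ∷ []) (zload-spec _ b1 (replicate ⌊log₂ y ⌋ b1) (solid-replicate (width y) refl) (trans (replicate-ʳ++ (width y) b1 []) (List.++-identityʳ _))))
         (ℕ.≤-reflexive (cong (λ k → k ℕ.* 7 ℕ.+ 3) (List.length-replicate (width y)))))
      where
      G = msb (width y) y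
      lenG : length G ≡ width y
      lenG = trans (List.length-reverse (low (width y) y)) (length-low (width y) y)

    zeroOut-spec : ∀ ρ {u} → Solid u → Spec ρ (zeroOut ρ) (u , tt) (length u ℕ.* 3 ℕ.+ 2) (b0 ∷ [] , tt)
    zeroOut-spec ρ su = clear-spec ρ su ⟫ push-spec 0F b0

-- The machine that computes an integer near `y f(x/y)`

pattern 22F = suc 21F
pattern 23F = suc 22F
pattern 24F = suc 23F

-- The machine branches on the first symbol of `y`: only encodings of positive integers begin with
-- `b1`.
encodeℕ-head : ∀ {a} m → hd (encodeℕ {a} (suc m)) ≡ b1
encodeℕ-head {a} m = lem (stripped {a} w)
  where
  w = msb (width (suc m)) (suc m)
  v≡ : val (reverse w) ≡ suc m
  v≡ = trans (cong val (List.reverse-involutive (low (width (suc m)) (suc m)))) (val-low (width (suc m)) (suc m) (<2^-log₂ (suc m)))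
  lem : Stripped {a} w → hd (encodeℕ {a} (suc m)) ≡ b1
  lem (zero _ v≡0) = ⊥-elim (ℕ.0≢1+n (trans (sym v≡0) v≡))
  lem (nonzero s≡ e≡ _) = trans (cong hd (trans (cong encodeℕ (sym v≡)) (sym e≡))) (cong (hd ∘ bits) s≡)

module Forward (M : OTM 1) where
  open OTM M using (extraTapes) renaming (auxSymbols to a)
  private
    x = extraTapes
  open Forwarding a 0 (24 ℕ.+ x)
  open Simulation M 0 24

  -- 0 input/output; 1-4, 5-8 zippers for the input and oracle tape of M; 9 sign, 10 numerator, 13 denominator of the argument;
  -- 11, 12, 14-24 work space.
  ρ : Regs 25
  ρ = regs (λ r → inj₂ (r ↑ˡ x)) (λ {r} {s} eq → Fin.↑ˡ-injective x r s (inj₂-injective eq))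

  apart : ∀ r k → addr ρ r ≢ raw k
  apart r k eq = ↑ˡ≢↑ʳ r k (inj₂-injective eq)

  os dir : Fin 2 → Fin 25
  os  = lookup (2F ∷ 6F ∷ [])
  dir = lookup (4F ∷ 8F ∷ [])

  os≢dir : ∀ i j → os i ≢ dir j
  os≢dir 0F 0F ()
  os≢dir 0F 1F ()
  os≢dir 1F 0F ()
  os≢dir 1F 1F ()

  handler : Cmd
  handler = zmove (pick ρ (1F ∷ 2F ∷ 3F ∷ 4F ∷ [])) ⨟ respond (pick ρ (5F ∷ 6F ∷ 7F ∷ 8F ∷ 20F ∷ 21F ∷ 9F ∷ 10F ∷ 11F ∷ 12F ∷ 13F ∷ 14F ∷ 15F ∷ 16F ∷ 17F ∷ 18F ∷ 19F ∷ []))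

  open Machine ρ os dir handler

  start′ main epilogue nil program : Cmd
  start′   = parse (pick ρ (0F ∷ 9F ∷ 10F ∷ []))
  main     = launch (pick ρ (0F ∷ 13F ∷ 22F ∷ 2F ∷ 3F ∷ []))
  epilogue = finish (pick ρ (2F ∷ 3F ∷ 20F ∷ 23F ∷ 24F ∷ 12F ∷ 13F ∷ 14F ∷ 15F ∷ 16F ∷ 17F ∷ 22F ∷ 0F ∷ []))
  nil      = zeroOut (pick ρ (0F ∷ []))
  program  = start′ ⨟ when ρ 0F isOne (main ⨟ embed simulate ⨟ epilogue) nil

  machine : OTM 0
  machine = compile (frag program)

  ψ : Oracles 0
  ψ ()

  open CorrectF ψ

  module Encoding (sg X Y : Word a) where

    enc : Vec (Tape a) 2 → Vec (Symbol a) 2 → Store 25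
    enc (t₀ ∷ t₁ ∷ []) (d₀ ∷ d₁ ∷ []) =
      [] ,
      code (Tape.before t₀) , Tape.scanned t₀ ∷ [] , code (Tape.after t₀) , d₀ ∷ [] ,
      code (Tape.before t₁) , Tape.scanned t₁ ∷ [] , code (Tape.after t₁) , d₁ ∷ [] ,
      sg , X , [] , [] , Y , [] , [] , [] , [] , [] , [] , [] , [] , [] , [] , [] , tt

    enc-os : ∀ zs ds i → get (os i) (enc zs ds) ≡ Tape.scanned (lookup zs i) ∷ []
    enc-os (_ ∷ _ ∷ []) (_ ∷ _ ∷ []) 0F = refl
    enc-os (_ ∷ _ ∷ []) (_ ∷ _ ∷ []) 1F = refl

    enc-dir : ∀ zs ds i → get (dir i) (enc zs ds) ≡ lookup ds i ∷ []
    enc-dir (_ ∷ _ ∷ []) (_ ∷ _ ∷ []) 0F = refl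
    enc-dir (_ ∷ _ ∷ []) (_ ∷ _ ∷ []) 1F = refl

    enc-rest : ∀ r → (∀ i → os i ≢ r) → (∀ i → dir i ≢ r) → ∀ (u : Vec (Symbol a) 2) zs ds ds′ →
               get r (enc (Vec.zipWith write u zs) ds′) ≡ get r (enc zs ds)
    enc-rest 0F ¬o ¬d (_ ∷ _ ∷ []) (_ ∷ _ ∷ []) (_ ∷ _ ∷ []) (_ ∷ _ ∷ []) = refl
    enc-rest 1F ¬o ¬d (_ ∷ _ ∷ []) (_ ∷ _ ∷ []) (_ ∷ _ ∷ []) (_ ∷ _ ∷ []) = refl
    enc-rest 2F ¬o ¬d _ _ _ _ = ⊥-elim (¬o 0F refl)
    enc-rest 3F ¬o ¬d (_ ∷ _ ∷ []) (_ ∷ _ ∷ []) (_ ∷ _ ∷ []) (_ ∷ _ ∷ []) = refl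
    enc-rest 4F ¬o ¬d _ _ _ _ = ⊥-elim (¬d 0F refl)
    enc-rest 5F ¬o ¬d (_ ∷ _ ∷ []) (_ ∷ _ ∷ []) (_ ∷ _ ∷ []) (_ ∷ _ ∷ []) = refl
    enc-rest 6F ¬o ¬d _ _ _ _ = ⊥-elim (¬o 1F refl)
    enc-rest 7F ¬o ¬d (_ ∷ _ ∷ []) (_ ∷ _ ∷ []) (_ ∷ _ ∷ []) (_ ∷ _ ∷ []) = refl
    enc-rest 8F ¬o ¬d _ _ _ _ = ⊥-elim (¬d 1F refl)
    enc-rest 9F ¬o ¬d (_ ∷ _ ∷ []) (_ ∷ _ ∷ []) (_ ∷ _ ∷ []) (_ ∷ _ ∷ []) = refl
    enc-rest 10F ¬o ¬d (_ ∷ _ ∷ []) (_ ∷ _ ∷ []) (_ ∷ _ ∷ []) (_ ∷ _ ∷ []) = refl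
    enc-rest 11F ¬o ¬d (_ ∷ _ ∷ []) (_ ∷ _ ∷ []) (_ ∷ _ ∷ []) (_ ∷ _ ∷ []) = refl
    enc-rest 12F ¬o ¬d (_ ∷ _ ∷ []) (_ ∷ _ ∷ []) (_ ∷ _ ∷ []) (_ ∷ _ ∷ []) = refl
    enc-rest 13F ¬o ¬d (_ ∷ _ ∷ []) (_ ∷ _ ∷ []) (_ ∷ _ ∷ []) (_ ∷ _ ∷ []) = refl
    enc-rest 14F ¬o ¬d (_ ∷ _ ∷ []) (_ ∷ _ ∷ []) (_ ∷ _ ∷ []) (_ ∷ _ ∷ []) = refl
    enc-rest 15F ¬o ¬d (_ ∷ _ ∷ []) (_ ∷ _ ∷ []) (_ ∷ _ ∷ []) (_ ∷ _ ∷ []) = refl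
    enc-rest 16F ¬o ¬d (_ ∷ _ ∷ []) (_ ∷ _ ∷ []) (_ ∷ _ ∷ []) (_ ∷ _ ∷ []) = refl
    enc-rest 17F ¬o ¬d (_ ∷ _ ∷ []) (_ ∷ _ ∷ []) (_ ∷ _ ∷ []) (_ ∷ _ ∷ []) = refl
    enc-rest 18F ¬o ¬d (_ ∷ _ ∷ []) (_ ∷ _ ∷ []) (_ ∷ _ ∷ []) (_ ∷ _ ∷ []) = refl
    enc-rest 19F ¬o ¬d (_ ∷ _ ∷ []) (_ ∷ _ ∷ []) (_ ∷ _ ∷ []) (_ ∷ _ ∷ []) = refl
    enc-rest 20F ¬o ¬d (_ ∷ _ ∷ []) (_ ∷ _ ∷ []) (_ ∷ _ ∷ []) (_ ∷ _ ∷ []) = refl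
    enc-rest 21F ¬o ¬d (_ ∷ _ ∷ []) (_ ∷ _ ∷ []) (_ ∷ _ ∷ []) (_ ∷ _ ∷ []) = refl
    enc-rest 22F ¬o ¬d (_ ∷ _ ∷ []) (_ ∷ _ ∷ []) (_ ∷ _ ∷ []) (_ ∷ _ ∷ []) = refl
    enc-rest 23F ¬o ¬d (_ ∷ _ ∷ []) (_ ∷ _ ∷ []) (_ ∷ _ ∷ []) (_ ∷ _ ∷ []) = refl
    enc-rest 24F ¬o ¬d (_ ∷ _ ∷ []) (_ ∷ _ ∷ []) (_ ∷ _ ∷ []) (_ ∷ _ ∷ []) = refl

  module Handler (n : Bool) (X Y : List Bool) where
    open Encoding (signW n) (bits X) (bits Y)

    φ : Oracles 1
    φ _ = quotient n X Y

    D : ℕ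
    -- The contents have at most one symbol more than the spread of the tape, and an answer at most
    -- `length X + 4` more than the contents.
    D = 5 ℕ.+ length X

    B : ℕ → ℕ
    B s = 8 ℕ.+ respondTime (length X ℕ.+ length Y ℕ.+ suc s)

    B-mono : ∀ {m k} → m ℕ.≤ k → B m ℕ.≤ B k
    B-mono m≤k = ℕ.+-monoʳ-≤ 8 (respondTime-mono (ℕ.+-monoʳ-≤ (length X ℕ.+ length Y) (s≤s m≤k)))

    after≤ : ∀ (t₀ t₁ : Tape a) → length (Tape.after t₁) ℕ.≤ spreads (t₀ ∷ t₁ ∷ [])
    after≤ t₀ t₁ = ℕ.≤-trans (ℕ.m≤n+m (length (Tape.after t₁)) (length (Tape.before t₁))) (ℕ.≤-trans (ℕ.m≤m+n (spread t₁) 0) (ℕ.m≤n+m _ (spread t₀)))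

    before≤ : ∀ (t₀ t₁ : Tape a) → length (Tape.before t₁) ℕ.≤ spreads (t₀ ∷ t₁ ∷ [])
    before≤ t₀ t₁ = ℕ.≤-trans (ℕ.m≤m+n (length (Tape.before t₁)) (length (Tape.after t₁))) (ℕ.≤-trans (ℕ.m≤m+n (spread t₁) 0) (ℕ.m≤n+m _ (spread t₀)))

    H-move : ∀ zs ms → Spec ρ handler (enc zs (Vec.map direction ms)) (B (spreads zs)) (enc (Vec.zipWith move ms zs) blanks)
    H-move (t₀ ∷ t₁ ∷ []) (m₀ ∷ m₁ ∷ []) =
      lift (1F ∷ 2F ∷ 3F ∷ 4F ∷ []) (zmove-spec _ t₀ m₀) ⟫
      lift (5F ∷ 6F ∷ 7F ∷ 8F ∷ 20F ∷ 21F ∷ 9F ∷ 10F ∷ 11F ∷ 12F ∷ 13F ∷ 14F ∷ 15F ∷ 16F ∷ 17F ∷ 18F ∷ 19F ∷ []) (respond-move _ t₁ n X Y (length X ℕ.+ length Y ℕ.+ suc (spreads (t₀ ∷ t₁ ∷ []))) m₁)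

    H-query : ∀ zs i → Spec ρ handler (enc zs (blanks [ suc i ]≔ sep)) (B (spreads zs)) (enc (zs [ suc i ]%= answer M φ i) blanks)
    H-query (t₀ ∷ t₁ ∷ []) 0F = go₁ (encode𝔻-nonempty {a} (𝔻.numerator (quotient n X Y m)) (suc m))
      where
      m = length (contents t₁)
      go₁ : ∃[ y ] ∃[ w ] (encode𝔻 {a} (quotient n X Y m) ≡ y ∷ w) →
        Spec ρ handler (enc (t₀ ∷ t₁ ∷ []) (blank ∷ sep ∷ [])) (B (spreads (t₀ ∷ t₁ ∷ []))) (enc (t₀ ∷ load (encode𝔻 (quotient n X Y m)) ∷ []) blanks)
      go₁ (y , w , eq) =
        lift (1F ∷ 2F ∷ 3F ∷ 4F ∷ []) (zmove-spec _ t₀ stay) ⟫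
        (lift (5F ∷ 6F ∷ 7F ∷ 8F ∷ 20F ∷ 21F ∷ 9F ∷ 10F ∷ 11F ∷ 12F ∷ 13F ∷ 14F ∷ 15F ∷ 16F ∷ 17F ∷ 18F ∷ 19F ∷ []) (respond-query _ t₁ n X Y (length X ℕ.+ length Y ℕ.+ suc (spreads (t₀ ∷ t₁ ∷ [])))
          (ℕ.+-monoʳ-≤ (length X ℕ.+ length Y) (s≤s (after≤ t₀ t₁))) (ℕ.≤-trans (before≤ t₀ t₁) (ℕ.≤-trans (ℕ.n≤1+n _) (ℕ.m≤n+m _ (length X ℕ.+ length Y)))) eq) ▸
          cong (λ v → enc (t₀ ∷ load v ∷ []) blanks) (sym eq))

    grow-arith : ∀ A p q → A ℕ.≤ D ℕ.+ q → p ℕ.+ (A ℕ.+ 0) ℕ.≤ D ℕ.+ (p ℕ.+ (q ℕ.+ 0))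
    grow-arith A p q A≤ = ℕ.≤-trans (ℕ.+-monoʳ-≤ p (ℕ.+-monoˡ-≤ 0 A≤))
      (ℕ.≤-reflexive (solve 3 (λ p d q → p :+ ((d :+ q) :+ con 0) := d :+ (p :+ (q :+ con 0))) refl p D q))
      where open +-*-Solver

    grow : ∀ zs i → spreads (zs [ suc i ]%= answer M φ i) ℕ.≤ D ℕ.+ spreads zs
    grow (t₀ ∷ t₁ ∷ []) 0F = grow-arith (spread (load (encode𝔻 (quotient n X Y m)))) (spread t₀) (spread t₁)
      (ℕ.≤-trans (spread-load (encode𝔻 (quotient n X Y m))) (ℕ.≤-trans (length-quotient {a} n X Y m) (bound t₁)))
      where
      m = length (contents t₁)
      bound : ∀ (t : Tape a) → length X ℕ.+ length (contents t) ℕ.+ 4 ℕ.≤ D ℕ.+ spread t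
      bound (tape l s r) = ℕ.≤-trans (ℕ.+-monoˡ-≤ 4 (ℕ.+-monoʳ-≤ (length X) (ℕ.≤-trans (prefix-length (s ∷ r)) (s≤s (ℕ.m≤n+m (length r) (length l))))))
        (ℕ.≤-reflexive (solve 2 (λ x u → x :+ (con 1 :+ u) :+ con 4 := con 5 :+ x :+ u) refl (length X) (length l ℕ.+ length r)))
        where open +-*-Solver

    simulation : ∀ {t m₀ m₁ ms q} τ k → HaltsFrom M φ (initial M (encodeUnary (suc k))) t (config q (m₁ ∷ []) (m₀ ∷ ms)) →
      View ρ τ (enc (load (encodeUnary (suc k)) ∷ load [] ∷ []) blanks) → (∀ k → τ ! raw k ≡ load []) →
      ∃[ t′ ] ∃[ τ′ ] (t′ ℕ.≤ t ℕ.* (2 ℕ.+ B (suc k ℕ.+ t ℕ.* D)) × Execution ψ (embed simulate) τ t′ τ′ ×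
        View ρ τ′ (enc (m₀ ∷ m₁ ∷ []) blanks) × spreads (m₀ ∷ m₁ ∷ []) ℕ.≤ suc k ℕ.+ t ℕ.* D)
    simulation τ k h v ok = packed
      (Proof.Handled.simulate-halts apart (λ {i} {j} → distinct-sound (2F ∷ 6F ∷ []) tt {i} {j}) (λ {i} {j} → distinct-sound (4F ∷ 8F ∷ []) tt {i} {j})
        os≢dir φ ψ enc enc-os enc-dir enc-rest B B-mono D (s≤s (s≤s z≤n)) H-move H-query grow (suc k) τ h v
        (λ k → trans (ok k) (sym (Vec.lookup-replicate k (load []))))
        (ℕ.≤-trans (ℕ.≤-reflexive (trans (ℕ.+-identityʳ _) (List.length-replicate k))) (ℕ.n≤1+n k)))
      where
      packed : ∀ {t c} → Proof.Handled.Simulated apart (λ {i} {j} → distinct-sound (2F ∷ 6F ∷ []) tt {i} {j}) (λ {i} {j} → distinct-sound (4F ∷ 8F ∷ []) tt {i} {j})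
        os≢dir φ ψ enc enc-os enc-dir enc-rest B B-mono D (s≤s (s≤s z≤n)) H-move H-query grow (suc k) t zero τ c →
        ∃[ t′ ] ∃[ τ′ ] (t′ ℕ.≤ t ℕ.* (2 ℕ.+ B (suc k ℕ.+ t ℕ.* D)) × Execution ψ (embed simulate) τ t′ τ′ ×
          View ρ τ′ (enc (Vec.head (Config.mainTapes c) ∷ Config.oracleTapes c) blanks) × spreads (Vec.head (Config.mainTapes c) ∷ Config.oracleTapes c) ℕ.≤ suc k ℕ.+ t ℕ.* D)
      packed (Proof.Handled.simulated w r v sp) = _ , _ , w , execution r , v , sp

  module _ (input : Word a) where

    initialStore : Store 25
    initialStore = set 0F input (Encoding.enc [] [] [] (load [] ∷ load [] ∷ []) (blank ∷ blank ∷ []))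

    initialTapes : Tapes
    initialTapes = [] , load input ∷ Vec.replicate (24 ℕ.+ x) (load [])

    fresh-view : ∀ k → load [] shows get (suc k) initialStore
    fresh-view 0F = shows-load []
    fresh-view 1F = shows-blank
    fresh-view 2F = shows-load []
    fresh-view 3F = shows-blank
    fresh-view 4F = shows-load []
    fresh-view 5F = shows-blank
    fresh-view 6F = shows-load []
    fresh-view 7F = shows-blank
    fresh-view 8F = shows-load []
    fresh-view 9F = shows-load []
    fresh-view 10F = shows-load []
    fresh-view 11F = shows-load []
    fresh-view 12F = shows-load []
    fresh-view 13F = shows-load []
    fresh-view 14F = shows-load []
    fresh-view 15F = shows-load []
    fresh-view 16F = shows-load []
    fresh-view 17F = shows-load []
    fresh-view 18F = shows-load []
    fresh-view 19F = shows-load []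
    fresh-view 20F = shows-load []
    fresh-view 21F = shows-load []
    fresh-view 22F = shows-load []
    fresh-view 23F = shows-load []

    initial-view : View ρ initialTapes initialStore
    initial-view 0F      = shows-load input
    initial-view (suc k) = subst (_shows get (suc k) initialStore) (sym (Vec.lookup-replicate (k ↑ˡ x) (load []))) (fresh-view k)

  parsedStore : ℤ → Word a → Store 25
  parsedStore x w = set 0F w (Encoding.enc (signW (negative x)) (bits (low (width ℤ.∣ x ∣) ℤ.∣ x ∣)) [] (load [] ∷ load [] ∷ []) (blank ∷ blank ∷ []))

  parseTime : ℤ → ℕ
  parseTime x = 3 ℕ.+ (width ℤ.∣ x ∣ ℕ.* 5 ℕ.+ 1)

  parsed : ∀ x w → ∃[ t ] ∃[ τ ] (t ℕ.≤ parseTime x × Execution ψ start′ (initialTapes (encodeℤ x ++ sep ∷ w)) t τ × View ρ τ (parsedStore x w) × (∀ k → τ ! raw k ≡ load []))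
  parsed x w = go₁ (lift {ρ = ρ} (0F ∷ 9F ∷ 10F ∷ []) {σ = initialStore (encodeℤ x ++ sep ∷ w)} (parse-spec (pick ρ (0F ∷ 9F ∷ 10F ∷ [])) x w))
    where
    τ₀ = initialTapes (encodeℤ x ++ sep ∷ w)
    go₂ : ∃[ t ] ∃[ τ ] (t ℕ.≤ parseTime x × Execution ψ start′ τ₀ t τ × (View ρ τ (parsedStore x w) × Frame ρ τ₀ τ)) →
      ∃[ t ] ∃[ τ ] (t ℕ.≤ parseTime x × Execution ψ start′ τ₀ t τ × View ρ τ (parsedStore x w) × (∀ k → τ ! raw k ≡ load []))
    go₂ (t , τ , le , r , v , f) = t , τ , le , r , v , λ k → trans (f (raw k) (λ r → apart r k)) (Vec.lookup-replicate (24 ↑ʳ k) (load []))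
    go₁ : Spec ρ start′ (initialStore (encodeℤ x ++ sep ∷ w)) (parseTime x) (parsedStore x w) →
      ∃[ t ] ∃[ τ ] (t ℕ.≤ parseTime x × Execution ψ start′ τ₀ t τ × View ρ τ (parsedStore x w) × (∀ k → τ ! raw k ≡ load []))
    go₁ S = go₂ (unpack ψ (exec S τ₀ (initial-view (encodeℤ x ++ sep ∷ w))))

  -- Covers zero and negative `y`, whose encodings begin with `b0` and `minus`.
  outputs-nil : ∀ x y → isOne (hd (encodeℤ {a} y)) ≡ false → Solid (encodeℤ {a} y) →
    ∃[ T ] (T ℕ.≤ parseTime x ℕ.+ (length (encodeℤ {a} y) ℕ.* 3 ℕ.+ 2) × Outputs machine ψ (encodeℤ x ++ sep ∷ encodeℤ y) T (encodeℤ (+ 0)))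
  outputs-nil x y not-one solid = go₁ (parsed x w)
    where
    w = encodeℤ y
    T₂ = length w ℕ.* 3 ℕ.+ 2
    Goal : Set
    Goal = ∃[ T ] (T ℕ.≤ parseTime x ℕ.+ T₂ × Outputs machine ψ (encodeℤ x ++ sep ∷ w) T (b0 ∷ []))
    S : Spec ρ nil (parsedStore x w) T₂ (set 0F (b0 ∷ []) (parsedStore x w))
    S = lift {ρ = ρ} (0F ∷ []) {σ = parsedStore x w} (zeroOut-spec (pick ρ (0F ∷ [])) solid)
    go₂ : ∀ {t₁ τ₁} → t₁ ℕ.≤ parseTime x → Execution ψ start′ (initialTapes (encodeℤ x ++ sep ∷ w)) t₁ τ₁ → View ρ τ₁ (parsedStore x w) →
      ∃[ t ] ∃[ τ ] (t ℕ.≤ T₂ × Execution ψ nil τ₁ t τ × (View ρ τ (set 0F (b0 ∷ []) (parsedStore x w)) × Frame ρ τ₁ τ)) → Goal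
    go₂ {t₁} {τ₁} le₁ r₁ v₁ (t₂ , τ₂ , le₂ , r₂ , v₂ , _) = t₁ ℕ.+ t₂ , ℕ.+-mono-≤ le₁ le₂ ,
      subst (Outputs machine ψ (encodeℤ x ++ sep ∷ w) (t₁ ℕ.+ t₂)) (shows-contents (v₂ 0F))
        (compile-outputs program ψ (_then_ ψ r₁ (branch-false ψ (trans (cong isOne (view-top {ρ = ρ} {τ₁} {parsedStore x w} v₁ 0F)) not-one) r₂)))
    go₁ : ∃[ t ] ∃[ τ ] (t ℕ.≤ parseTime x × Execution ψ start′ (initialTapes (encodeℤ x ++ sep ∷ w)) t τ × View ρ τ (parsedStore x w) × (∀ k → τ ! raw k ≡ load [])) → Goal
    go₁ (t₁ , τ₁ , le₁ , r₁ , v₁ , _) = go₂ le₁ r₁ v₁ (unpack ψ (exec S τ₁ v₁))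

  module _ (x : ℤ) (y : ℕ) where

    n : Bool
    n = negative x

    X Y : List Bool
    X = low (width ℤ.∣ x ∣) ℤ.∣ x ∣
    Y = low (width (suc y)) (suc y)

    k : ℕ
    k = ⌊log₂ suc y ⌋

    open Handler n X Y
    open Encoding (signW n) (bits X) (bits Y)

    launchTime : ℕ
    launchTime = width (suc y) ℕ.* 7 ℕ.+ (width (suc y) ℕ.* 7 ℕ.+ 3)

    Ready : Tapes → Set
    Ready τ = View ρ τ (enc (load (encodeUnary (suc k)) ∷ load [] ∷ []) blanks) × (∀ k → τ ! raw k ≡ load [])

    launched : ∀ τ → View ρ τ (parsedStore x (encodeℕ (suc y))) → (∀ k → τ ! raw k ≡ load []) →
      ∃[ t ] ∃[ τ′ ] (t ℕ.≤ launchTime × Execution ψ main τ t τ′ × Ready τ′)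
    launched τ v ok = go₁ (lift {ρ = ρ} (0F ∷ 13F ∷ 22F ∷ 2F ∷ 3F ∷ []) {σ = parsedStore x (encodeℕ (suc y))} (launch-spec (pick ρ (0F ∷ 13F ∷ 22F ∷ 2F ∷ 3F ∷ [])) (suc y)))
      where
      go₂ : ∃[ t ] ∃[ τ′ ] (t ℕ.≤ launchTime × Execution ψ main τ t τ′ × (View ρ τ′ (enc (load (encodeUnary (suc k)) ∷ load [] ∷ []) blanks) × Frame ρ τ τ′)) →
        ∃[ t ] ∃[ τ′ ] (t ℕ.≤ launchTime × Execution ψ main τ t τ′ × Ready τ′)
      go₂ (t , τ′ , le , r , v′ , f) = t , τ′ , le , r , v′ , λ k → trans (f (raw k) (λ r → apart r k)) (ok k)
      go₁ : Spec ρ main (parsedStore x (encodeℕ (suc y))) launchTime (enc (load (encodeUnary (suc k)) ∷ load [] ∷ []) blanks) →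
        ∃[ t ] ∃[ τ′ ] (t ℕ.≤ launchTime × Execution ψ main τ t τ′ × Ready τ′)
      go₁ S = go₂ (unpack ψ (exec S τ v))

    finished : ∀ {z b} m₀ m₁ τ u → contents m₀ ≡ encode𝔻 (z /2^ b) → spreads (m₀ ∷ m₁ ∷ []) ℕ.≤ u → View ρ τ (enc (m₀ ∷ m₁ ∷ []) blanks) →
      ∃[ t ] ∃[ τ′ ] (t ℕ.≤ finishTime (length Y) u × Execution ψ epilogue τ t τ′ × τ′ ! inj₂ 0F shows encodeℤ (signed (negative z) (product z b Y)))
    finished {z} {b} m₀ m₁ τ u out sp v = go₁ (lift {ρ = ρ} (2F ∷ 3F ∷ 20F ∷ 23F ∷ 24F ∷ 12F ∷ 13F ∷ 14F ∷ 15F ∷ 16F ∷ 17F ∷ 22F ∷ 0F ∷ []) {σ = enc (m₀ ∷ m₁ ∷ []) blanks}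
        (finish-spec (pick ρ (2F ∷ 3F ∷ 20F ∷ 23F ∷ 24F ∷ 12F ∷ 13F ∷ 14F ∷ 15F ∷ 16F ∷ 17F ∷ 22F ∷ 0F ∷ [])) (Tape.scanned m₀) (Tape.after m₀) z b Y u out
          (ℕ.≤-trans (ℕ.≤-trans (ℕ.m≤n+m (length (Tape.after m₀)) (length (Tape.before m₀))) (ℕ.m≤m+n (spread m₀) _)) sp)))
      where
      w = encodeℤ (signed (negative z) (product z b Y))
      go₂ : ∀ {σ} → ∃[ t ] ∃[ τ′ ] (t ℕ.≤ finishTime (length Y) u × Execution ψ epilogue τ t τ′ × (View ρ τ′ (w , σ) × Frame ρ τ τ′)) →
        ∃[ t ] ∃[ τ′ ] (t ℕ.≤ finishTime (length Y) u × Execution ψ epilogue τ t τ′ × τ′ ! inj₂ 0F shows w)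
      go₂ (t , τ′ , le , r , v′ , _) = t , τ′ , le , r , v′ 0F
      go₁ : ∀ {σ} → Spec ρ epilogue (enc (m₀ ∷ m₁ ∷ []) blanks) (finishTime (length Y) u) (w , σ) →
        ∃[ t ] ∃[ τ′ ] (t ℕ.≤ finishTime (length Y) u × Execution ψ epilogue τ t τ′ × τ′ ! inj₂ 0F shows w)
      go₁ S = go₂ (unpack ψ (exec S τ v))

    runTime : ℕ → ℕ
    runTime t = parseTime x ℕ.+ (launchTime ℕ.+ (t ℕ.* (2 ℕ.+ B (suc k ℕ.+ t ℕ.* D)) ℕ.+ finishTime (length Y) (suc k ℕ.+ t ℕ.* D)))

    outputs : ∀ {t cM z b} → HaltsFrom M φ (initial M (encodeUnary (suc k))) t cM → contents (Vec.head (Config.mainTapes cM)) ≡ encode𝔻 (z /2^ b) →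
      Solid (encodeℤ {a} (signed (negative z) (product z b Y))) →
      ∃[ T ] (T ℕ.≤ runTime t × Outputs machine ψ (encodeℤ x ++ sep ∷ encodeℤ (+ suc y)) T (encodeℤ (signed (negative z) (product z b Y))))
    outputs {t} {config _ (m₁ ∷ []) (m₀ ∷ _)} {z} {b} h out solid = go₁ (parsed x (encodeℕ (suc y)))
      where
      u = suc k ℕ.+ t ℕ.* D
      T₃ = t ℕ.* (2 ℕ.+ B u)
      w = encodeℤ {a} (signed (negative z) (product z b Y))
      τ₀ = initialTapes (encodeℤ x ++ sep ∷ encodeℕ (suc y))
      Goal : Set
      Goal = ∃[ T ] (T ℕ.≤ runTime t × Outputs machine ψ (encodeℤ x ++ sep ∷ encodeℤ (+ suc y)) T w)
      go₄ : ∀ {t₁ t₂ t₃ τ₁ τ₂ τ₃} → t₁ ℕ.≤ parseTime x → t₂ ℕ.≤ launchTime → t₃ ℕ.≤ T₃ → isOne (scanned! τ₁ (inj₂ 0F)) ≡ true →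
        Execution ψ start′ τ₀ t₁ τ₁ → Execution ψ main τ₁ t₂ τ₂ → Execution ψ (embed simulate) τ₂ t₃ τ₃ →
        ∃[ t₄ ] ∃[ τ₄ ] (t₄ ℕ.≤ finishTime (length Y) u × Execution ψ epilogue τ₃ t₄ τ₄ × τ₄ ! inj₂ 0F shows w) → Goal
      go₄ {t₁} {t₂} {t₃} le₁ le₂ le₃ top r₁ r₂ r₃ (t₄ , τ₄ , le₄ , r₄ , v₄) =
        t₁ ℕ.+ (t₂ ℕ.+ (t₃ ℕ.+ t₄)) , ℕ.+-mono-≤ le₁ (ℕ.+-mono-≤ le₂ (ℕ.+-mono-≤ le₃ le₄)) ,
        subst (Outputs machine ψ (encodeℤ x ++ sep ∷ encodeℤ (+ suc y)) (t₁ ℕ.+ (t₂ ℕ.+ (t₃ ℕ.+ t₄)))) (trans (shows-contents v₄) (solid-prefix solid))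
          (compile-outputs program ψ (_then_ ψ r₁ (branch-true ψ top (_then_ ψ r₂ (_then_ ψ r₃ r₄)))))
      go₃ : ∀ {t₁ t₂ τ₁ τ₂} → t₁ ℕ.≤ parseTime x → t₂ ℕ.≤ launchTime → isOne (scanned! τ₁ (inj₂ 0F)) ≡ true →
        Execution ψ start′ τ₀ t₁ τ₁ → Execution ψ main τ₁ t₂ τ₂ →
        ∃[ t₃ ] ∃[ τ₃ ] (t₃ ℕ.≤ T₃ × Execution ψ (embed simulate) τ₂ t₃ τ₃ × View ρ τ₃ (enc (m₀ ∷ m₁ ∷ []) blanks) × spreads (m₀ ∷ m₁ ∷ []) ℕ.≤ u) → Goal
      go₃ le₁ le₂ top r₁ r₂ (t₃ , τ₃ , le₃ , r₃ , v₃ , sp) = go₄ le₁ le₂ le₃ top r₁ r₂ r₃ (finished {z} {b} m₀ m₁ τ₃ u out sp v₃)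
      go₂ : ∀ {t₁ τ₁} → t₁ ℕ.≤ parseTime x → isOne (scanned! τ₁ (inj₂ 0F)) ≡ true → Execution ψ start′ τ₀ t₁ τ₁ →
        ∃[ t₂ ] ∃[ τ₂ ] (t₂ ℕ.≤ launchTime × Execution ψ main τ₁ t₂ τ₂ × Ready τ₂) → Goal
      go₂ le₁ top r₁ (t₂ , τ₂ , le₂ , r₂ , v₂ , ok₂) = go₃ le₁ le₂ top r₁ r₂ (simulation τ₂ k h v₂ ok₂)
      go₁ : ∃[ t ] ∃[ τ ] (t ℕ.≤ parseTime x × Execution ψ start′ τ₀ t τ × View ρ τ (parsedStore x (encodeℕ (suc y))) × (∀ k → τ ! raw k ≡ load [])) → Goal
      go₁ (t₁ , τ₁ , le₁ , r₁ , v₁ , ok₁) = go₂ le₁ (trans (cong isOne (view-top {ρ = ρ} {τ₁} {parsedStore x (encodeℕ (suc y))} v₁ 0F)) (cong isOne (encodeℕ-head {a} y))) r₁ (launched τ₁ v₁ ok₁)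

-- Fractions, compared by cross-multiplication

toℚᵘ-/ : ∀ i n → toℚᵘ (i ℚ./ suc n) ℚᵘ.≃ mkℚᵘ i n
toℚᵘ-/ i n = ℚ.toℚᵘ-fromℚᵘ (mkℚᵘ i n)

/-≤ : ∀ i n j m .{{_ : NonZero n}} .{{_ : NonZero m}} → i ℤ.* + m ℤ.≤ j ℤ.* + n → i ℚ./ n ℚ.≤ j ℚ./ m
/-≤ i (suc n) j (suc m) h = ℚ.toℚᵘ-cancel-≤ (ℚᵘ.≤-respˡ-≃ (ℚᵘ.≃-sym (toℚᵘ-/ i n)) (ℚᵘ.≤-respʳ-≃ (ℚᵘ.≃-sym (toℚᵘ-/ j m)) (*≤* h)))

/-≤⁻¹ : ∀ i n j m .{{_ : NonZero n}} .{{_ : NonZero m}} → i ℚ./ n ℚ.≤ j ℚ./ m → i ℤ.* + m ℤ.≤ j ℤ.* + n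
/-≤⁻¹ i (suc n) j (suc m) h = ℚᵘ.drop-*≤* (ℚᵘ.≤-respˡ-≃ (toℚᵘ-/ i n) (ℚᵘ.≤-respʳ-≃ (toℚᵘ-/ j m) (ℚ.toℚᵘ-mono-≤ h)))

/-distance : ∀ i n j m r s .{{_ : NonZero n}} .{{_ : NonZero m}} .{{_ : NonZero s}} →
  ℤ.∣ i ℤ.* + m ℤ.- j ℤ.* + n ∣ ℕ.* s ℕ.≤ r ℕ.* (n ℕ.* m) → ℚ.∣ i ℚ./ n ℚ.- j ℚ./ m ∣ ℚ.≤ + r ℚ./ s
/-distance i (suc n) j (suc m) r (suc s) h = ℚ.toℚᵘ-cancel-≤
  (ℚᵘ.≤-respˡ-≃ (ℚᵘ.≃-sym lhs) (ℚᵘ.≤-respʳ-≃ (ℚᵘ.≃-sym (toℚᵘ-/ (+ r) s)) (*≤* (subst₂ ℤ._≤_ (ℤ.pos-* ℤ.∣ i ℤ.* + suc m ℤ.+ (ℤ.- j) ℤ.* + suc n ∣ (suc s)) (ℤ.pos-* r (suc n ℕ.* suc m)) (ℤ.+≤+ h′)))))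
  where
  lhs : toℚᵘ (ℚ.∣ i ℚ./ suc n ℚ.- j ℚ./ suc m ∣) ℚᵘ.≃ ℚᵘ.∣ mkℚᵘ i n ℚᵘ.- mkℚᵘ j m ∣
  lhs = ℚᵘ.≃-trans (ℚ.toℚᵘ-homo-∣-∣ (i ℚ./ suc n ℚ.- j ℚ./ suc m)) (ℚᵘ.∣-∣-cong
    (ℚᵘ.≃-trans (ℚ.toℚᵘ-homo-+ (i ℚ./ suc n) (ℚ.- (j ℚ./ suc m)))
      (ℚᵘ.+-cong (toℚᵘ-/ i n) (ℚᵘ.≃-trans (ℚ.toℚᵘ-homo‿- (j ℚ./ suc m)) (ℚᵘ.-‿cong (toℚᵘ-/ j m))))))
  h′ : ℤ.∣ i ℤ.* + suc m ℤ.+ (ℤ.- j) ℤ.* + suc n ∣ ℕ.* suc s ℕ.≤ r ℕ.* (suc n ℕ.* suc m)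
  h′ = subst (λ x → ℤ.∣ i ℤ.* + suc m ℤ.+ x ∣ ℕ.* suc s ℕ.≤ r ℕ.* (suc n ℕ.* suc m)) (ℤ.neg-distribˡ-* j (+ suc n)) h

/-scale : ∀ i j m .{{_ : NonZero m}} → (i ℚ./ 1) ℚ.* (j ℚ./ m) ≡ (i ℤ.* j) ℚ./ m
/-scale i j (suc m) = ℚ.toℚᵘ-injective (ℚᵘ.≃-trans (ℚ.toℚᵘ-homo-* (i ℚ./ 1) (j ℚ./ suc m))
  (ℚᵘ.≃-trans (ℚᵘ.*-cong (toℚᵘ-/ i 0) (toℚᵘ-/ j m)) (ℚᵘ.≃-trans (*≡* (cong (λ k → i ℤ.* j ℤ.* + k) (sym (cong suc (ℕ.+-identityʳ m))))) (ℚᵘ.≃-sym (toℚᵘ-/ (i ℤ.* j) m)))))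

/-combine : ∀ i n j m .{{_ : NonZero n}} .{{_ : NonZero m}} .{{_ : NonZero (n ℕ.* m)}} → (i ℚ./ n) ℚ.* (j ℚ./ m) ≡ (i ℤ.* j) ℚ./ (n ℕ.* m)
/-combine i (suc n) j (suc m) = ℚ.toℚᵘ-injective (ℚᵘ.≃-trans (ℚ.toℚᵘ-homo-* (i ℚ./ suc n) (j ℚ./ suc m))
  (ℚᵘ.≃-trans (ℚᵘ.*-cong (toℚᵘ-/ i n) (toℚᵘ-/ j m)) (ℚᵘ.≃-sym (toℚᵘ-/ (i ℤ.* j) _))))

∣+-+∣≤ : ∀ u v c → u ℕ.≤ v ℕ.+ c → v ℕ.≤ u ℕ.+ c → ℤ.∣ + u ℤ.- + v ∣ ℕ.≤ c
∣+-+∣≤ u v c u≤ v≤ = subst (λ x → ℤ.∣ x ∣ ℕ.≤ c) (sym (ℤ.m-n≡m⊖n u v)) (cases (ℕ.≤-total u v))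
  where
  cases : u ℕ.≤ v ⊎ v ℕ.≤ u → ℤ.∣ u ℤ.⊖ v ∣ ℕ.≤ c
  cases (inj₁ p) = subst (ℕ._≤ c) (sym (ℤ.∣⊖∣-≤ p)) (ℕ.m≤n+o⇒m∸n≤o v u v≤)
  cases (inj₂ p) = subst (ℕ._≤ c) (sym (trans (ℤ.∣m⊖n∣≡∣n⊖m∣ u v) (ℤ.∣⊖∣-≤ p))) (ℕ.m≤n+o⇒m∸n≤o u v u≤)

-- Both numbers carry the same sign, so only the magnitudes count; the two hypotheses are the two
-- halves of the absolute value.
signed-distance : ∀ s a b m n c → a ℕ.* m ℕ.≤ b ℕ.* n ℕ.+ c → b ℕ.* n ℕ.≤ a ℕ.* m ℕ.+ c →
  ℤ.∣ signed s a ℤ.* + m ℤ.- signed s b ℤ.* + n ∣ ℕ.≤ c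
signed-distance false a b m n c p q = subst (λ x → ℤ.∣ x ∣ ℕ.≤ c) (cong₂ ℤ._-_ (ℤ.pos-* a m) (ℤ.pos-* b n)) (∣+-+∣≤ (a ℕ.* m) (b ℕ.* n) c p q)
signed-distance true  a b m n c p q = subst (ℕ._≤ c) (trans (sym (ℤ.∣-i∣≡∣i∣ (+ a ℤ.* + m ℤ.- + b ℤ.* + n))) (cong ℤ.∣_∣
    (trans (ℤ.neg-distrib-+ (+ a ℤ.* + m) (ℤ.- (+ b ℤ.* + n))) (cong₂ (λ x y → x ℤ.+ ℤ.- y) (ℤ.neg-distribˡ-* (+ a) (+ m)) (ℤ.neg-distribˡ-* (+ b) (+ n))))))
  (signed-distance false a b m n c p q)

signed-abs : ∀ z → signed (negative z) ℤ.∣ z ∣ ≡ z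
signed-abs (+ n)    = refl
signed-abs -[1+ n ] = refl

-- For sequences representing reals x and y, the field is definitionally the statement ∣ x - y ∣ ≤ fromℚ q.
record Close (x y : ℕ → ℚ) (q : ℚ) : Set where
  constructor near
  field
    estimate : ∀ ε .{{_ : Positive ε}} → ∃[ N ] (∀ n → N ℕ.≤ n → ℚ.∣ x n ℚ.- y n ∣ ℚ.≤ q ℚ.+ ε)

open Close public

close-sym : ∀ {x y q} → Close x y q → Close y x q
close-sym {x} {y} {q} (near c) = near λ ε → proj₁ (c ε) , λ n le → subst (ℚ._≤ q ℚ.+ ε) (∣p-q∣≡∣q-p∣ (x n) (y n)) (proj₂ (c ε) n le)

close-trans : ∀ {x y z p q} → Close x y p → Close y z q → Close x z (p ℚ.+ q)
close-trans {x} {y} {z} {p} {q} (near c) (near d) = near est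
  where
  open ℚ-Solver
  lem : ∀ p q e → (p ℚ.+ e) ℚ.+ (q ℚ.+ e) ≡ (p ℚ.+ q) ℚ.+ (e ℚ.+ e)
  lem = solve 3 (λ p q e → (p :+ e) :+ (q :+ e) := (p :+ q) :+ (e :+ e)) refl
  est : ∀ ε .{{_ : Positive ε}} → ∃[ N ] (∀ n → N ℕ.≤ n → ℚ.∣ x n ℚ.- z n ∣ ℚ.≤ (p ℚ.+ q) ℚ.+ ε)
  est ε with c (ε ℚ.* ½) {{½-pos ε}} | d (ε ℚ.* ½) {{½-pos ε}}
  ... | N₁ , h₁ | N₂ , h₂ = N₁ ℕ.⊔ N₂ , λ n le →
    subst (ℚ.∣ x n ℚ.- z n ∣ ℚ.≤_) (trans (lem p q (ε ℚ.* ½)) (cong (p ℚ.+ q ℚ.+_) (halves ε)))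
      (triangle (x n) (y n) (z n) (h₁ n (ℕ.≤-trans (ℕ.m≤m⊔n N₁ N₂) le)) (h₂ n (ℕ.≤-trans (ℕ.m≤n⊔m N₁ N₂) le)))

close-≤ : ∀ {x y p q} → Close x y p → p ℚ.≤ q → Close x y q
close-≤ (near c) p≤q = near λ ε → proj₁ (c ε) , λ n le → ℚ.≤-trans (proj₂ (c ε) n le) (ℚ.+-monoˡ-≤ ε p≤q)

close-const : ∀ p q {r} → ℚ.∣ p ℚ.- q ∣ ℚ.≤ r → Close (λ _ → p) (λ _ → q) r
close-const p q {r} h = near λ ε → 0 , λ _ _ → ℚ.≤-trans h (ℚ.≤-trans (ℚ.≤-reflexive (sym (ℚ.+-identityʳ r))) (ℚ.+-monoʳ-≤ r (ℚ.<⇒≤ (ℚ.positive⁻¹ ε))))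

close-scale : ∀ s .{{_ : Positive s}} {x y q} → Close x y q → Close (λ n → s ℚ.* x n) (λ n → s ℚ.* y n) (s ℚ.* q)
close-scale s {x} {y} {q} (near c) = near est
  where
  s⁻¹ = (ℚ.1/ s) {{ℚ.pos⇒nonZero s}}
  open ℚ-Solver
  dist : ∀ s a b → s ℚ.* (a ℚ.- b) ≡ s ℚ.* a ℚ.- s ℚ.* b
  dist = solve 3 (λ s a b → s :* (a :+ (:- b)) := s :* a :+ (:- (s :* b))) refl
  est : ∀ ε .{{_ : Positive ε}} → ∃[ N ] (∀ n → N ℕ.≤ n → ℚ.∣ s ℚ.* x n ℚ.- s ℚ.* y n ∣ ℚ.≤ s ℚ.* q ℚ.+ ε)
  est ε with c (s⁻¹ ℚ.* ε) {{ℚ.pos*pos⇒pos s⁻¹ {{ℚ.1/pos⇒pos s}} ε}}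
  ... | N , h = N , λ n le → subst₂ ℚ._≤_
    (trans (cong (ℚ._* ℚ.∣ x n ℚ.- y n ∣) (sym (ℚ.0≤p⇒∣p∣≡p (ℚ.<⇒≤ (ℚ.positive⁻¹ s))))) (trans (sym (ℚ.∣p*q∣≡∣p∣*∣q∣ s (x n ℚ.- y n))) (cong ℚ.∣_∣ (dist s (x n) (y n)))))
    (trans (ℚ.*-distribˡ-+ s q (s⁻¹ ℚ.* ε)) (cong (s ℚ.* q ℚ.+_) (trans (sym (ℚ.*-assoc s s⁻¹ ε)) (trans (cong (ℚ._* ε) (ℚ.*-inverseʳ s {{ℚ.pos⇒nonZero s}})) (ℚ.*-identityˡ ε)))))
    (ℚ.*-monoˡ-≤-nonNeg s {{ℚ.pos⇒nonNeg s}} (h n le))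

close-cong : ∀ {x x′ y y′ q} → (∀ n → x n ≡ x′ n) → (∀ n → y n ≡ y′ n) → Close x y q → Close x′ y′ q
close-cong {q = q} hx hy (near c) = near λ ε → proj₁ (c ε) , λ n le → subst₂ (λ a b → ℚ.∣ a ℚ.- b ∣ ℚ.≤ q ℚ.+ ε) (hx n) (hy n) (proj₂ (c ε) n le)

p≤∣p∣ : ∀ p → p ℚ.≤ ℚ.∣ p ∣
p≤∣p∣ p with ℚ.≤-total 0ℚ p
... | inj₁ 0≤p = ℚ.≤-reflexive (sym (ℚ.0≤p⇒∣p∣≡p 0≤p))
... | inj₂ p≤0 = ℚ.≤-trans p≤0 (ℚ.0≤∣p∣ p)

-- The Lipschitz constant is a real number. An eventual rational bound of its sequence takes its
-- place, so that the error estimates remain rational.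
lipschitz-close : ∀ f (L : Lipschitz f) {x y q} → Close (seq x) (seq y) q →
  Close (seq (apply f x)) (seq (apply f y)) (EventualBound.bound (eventualBound (proj₁ L)) ℚ.* q)
lipschitz-close f (K , _ , lip) {x} {y} {q} (near c) = near est
  where
  open EventualBound (eventualBound K) renaming (bound to b)
  d : ℕ → ℚ
  d n = ℚ.∣ seq x n ℚ.- seq y n ∣
  b⁻¹ = (ℚ.1/ b) {{ℚ.pos⇒nonZero b {{bound-pos}}}}
  est : ∀ ε .{{_ : Positive ε}} → ∃[ N ] (∀ n → N ℕ.≤ n → ℚ.∣ seq (apply f x) n ℚ.- seq (apply f y) n ∣ ℚ.≤ b ℚ.* q ℚ.+ ε)
  est ε = N , λ n le → ℚ.≤-trans (proj₂ l n (ℕ.≤-trans N₁≤N le))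
    (ℚ.≤-trans (ℚ.+-monoˡ-≤ (ε ℚ.* ½) (ℚ.≤-trans (p≤∣p∣ (seq K n ℚ.* d n))
      (*-mono-≤-∣∣ (seq K n) (d n) {{ℚ.pos⇒nonNeg b {{bound-pos}}}} (bounded n (ℕ.≤-trans N₃≤N le)) (ℚ.≤-trans (ℚ.≤-reflexive (ℚ.∣∣p∣∣≡∣p∣ (seq x n ℚ.- seq y n))) (proj₂ k n (ℕ.≤-trans N₂≤N le))))))
      (ℚ.≤-reflexive (trans (cong (ℚ._+ ε ℚ.* ½) (trans (ℚ.*-distribˡ-+ b q δ) (cong (b ℚ.* q ℚ.+_) bδ))) (trans (ℚ.+-assoc (b ℚ.* q) (ε ℚ.* ½) (ε ℚ.* ½)) (cong (b ℚ.* q ℚ.+_) (halves ε))))))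
    where
    -- Half of `ε` pays for the slack of the Lipschitz inequality; the other half is divided by `b`,
    -- which multiplies the slack of the distance.
    δ = b⁻¹ ℚ.* (ε ℚ.* ½)
    δ-pos : Positive δ
    δ-pos = ℚ.pos*pos⇒pos b⁻¹ {{ℚ.1/pos⇒pos b {{bound-pos}}}} (ε ℚ.* ½) {{½-pos ε}}
    bδ : b ℚ.* δ ≡ ε ℚ.* ½
    bδ = trans (sym (ℚ.*-assoc b b⁻¹ (ε ℚ.* ½))) (trans (cong (ℚ._* (ε ℚ.* ½)) (ℚ.*-inverseʳ b {{ℚ.pos⇒nonZero b {{bound-pos}}}})) (ℚ.*-identityˡ (ε ℚ.* ½)))
    l = lip x y (ε ℚ.* ½) {{½-pos ε}}
    k = c δ {{δ-pos}}
    N = proj₁ l ℕ.⊔ (proj₁ k ℕ.⊔ from)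
    N₁≤N = ℕ.m≤m⊔n (proj₁ l) (proj₁ k ℕ.⊔ from)
    N₂≤N = ℕ.≤-trans (ℕ.m≤m⊔n (proj₁ k) from) (ℕ.m≤n⊔m (proj₁ l) (proj₁ k ℕ.⊔ from))
    N₃≤N = ℕ.≤-trans (ℕ.m≤n⊔m (proj₁ k) from) (ℕ.m≤n⊔m (proj₁ l) (proj₁ k ℕ.⊔ from))

-- Rounding errors

private
  -- If `A` is the integer quotient of `P` by `y`, a further binary digit 1 gives the midpoint
  -- `A + 1/2`, at distance at most 1/2 from `P / y`; everything is multiplied by `2 y`.
  midpoint : ∀ A R y P → A ℕ.* y ℕ.+ R ≡ P → R ℕ.≤ y →
    P ℕ.* 2 ℕ.≤ (1 ℕ.+ 2 ℕ.* A) ℕ.* y ℕ.+ y × (1 ℕ.+ 2 ℕ.* A) ℕ.* y ℕ.≤ P ℕ.* 2 ℕ.+ y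
  midpoint A R y P refl R≤y =
    ℕ.≤-trans (ℕ.≤-reflexive (solve 3 (λ A R y → (A :* y :+ R) :* con 2 := con 2 :* (A :* y) :+ (R :+ R)) refl A R y))
      (ℕ.≤-trans (ℕ.+-monoʳ-≤ (2 ℕ.* (A ℕ.* y)) (ℕ.+-mono-≤ R≤y R≤y))
        (ℕ.≤-reflexive (solve 2 (λ A y → con 2 :* (A :* y) :+ (y :+ y) := (con 1 :+ con 2 :* A) :* y :+ y) refl A y))) ,
    ℕ.≤-trans (ℕ.m≤m+n ((1 ℕ.+ 2 ℕ.* A) ℕ.* y) (R ℕ.* 2))
      (ℕ.≤-reflexive (solve 3 (λ A R y → (con 1 :+ con 2 :* A) :* y :+ R :* con 2 := (A :* y :+ R) :* con 2 :+ y) refl A R y))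
    where open +-*-Solver

  half-step : ∀ y m → y ℕ.* 2 ℕ.^ m ℕ.≤ 1 ℕ.* (y ℕ.* 2 ℕ.^ suc m)
  half-step y m = ℕ.≤-trans (ℕ.*-monoʳ-≤ y (ℕ.m≤m+n (2 ℕ.^ m) _)) (ℕ.≤-reflexive (sym (ℕ.*-identityˡ _)))

  double : ∀ a m → (a ℕ.* 2 ℕ.^ m) ℕ.* 2 ≡ a ℕ.* 2 ℕ.^ suc m
  double a m = solve 2 (λ a p → (a :* p) :* con 2 := a :* (con 2 :* p)) refl a (2 ℕ.^ m)
    where open +-*-Solver

-- The divisions for the integer and the fractional digits form one division of `a 2 ^ m` by
-- `suc y`, to which `midpoint` applies. The error is in fact at most half of the bound.
quotient-error : ∀ x y m →
  ℚ.∣ x ℚ./ suc y ℚ.- 𝔻→ℚ (quotient (negative x) (low (width ℤ.∣ x ∣) ℤ.∣ x ∣) (low (width (suc y)) (suc y)) m) ∣ ℚ.≤ 2^- m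
quotient-error x y m = subst (λ x′ → ℚ.∣ x′ ℚ./ suc y ℚ.- 𝔻→ℚ (quotient (negative x) X Y m) ∣ ℚ.≤ 2^- m) (signed-abs x)
  (/-distance (signed (negative x) a) (suc y) (signed (negative x) (1 ℕ.+ 2 ℕ.* A)) (2 ℕ.^ suc m) 1 (2 ℕ.^ m) {{_}} {{ℕ.m^n≢0 2 (suc m)}} {{ℕ.m^n≢0 2 m}}
    (ℕ.≤-trans (ℕ.*-monoˡ-≤ (2 ℕ.^ m) (signed-distance (negative x) a (1 ℕ.+ 2 ℕ.* A) (2 ℕ.^ suc m) (suc y) (suc y)
      (subst (ℕ._≤ (1 ℕ.+ 2 ℕ.* A) ℕ.* suc y ℕ.+ suc y) (double a m) (proj₁ mid)) (subst (λ v → (1 ℕ.+ 2 ℕ.* A) ℕ.* suc y ℕ.≤ v ℕ.+ suc y) (double a m) (proj₂ mid)))) (half-step (suc y) m)))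
  where
  a = ℤ.∣ x ∣
  X = low (width a) a
  Y = low (width (suc y)) (suc y)
  valY : val Y ≡ suc y
  valY = val-low (width (suc y)) (suc y) (<2^-log₂ (suc y))
  valX : val X ≡ a
  valX = val-low (width a) a (<2^-log₂ a)
  Y-pos : 0 ℕ.< val Y
  Y-pos = subst (0 ℕ.<_) (sym valY) (s≤s z≤n)
  I = integerPart X Y
  R₁ = fractionPart X Y
  F = fractionDigits X Y m
  A = val (F ++ I)
  R₂ = proj₁ (divide Y (replicate m false) R₁ [])
  first : val I ℕ.* val Y ℕ.+ val R₁ ≡ a
  first = trans (proj₁ (divide-val Y (reverse X) [] [] Y-pos)) (trans (cong val (List.reverse-involutive X)) valX)
  zeros : val (reverse (replicate m false)) ≡ 0
  zeros = trans (cong val (replicate-ʳ++ m false [])) (trans (val-zeros m []) (ℕ.*-zeroʳ (2 ℕ.^ m)))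
  second : A ℕ.* val Y ℕ.+ val R₂ ≡ a ℕ.* 2 ℕ.^ m
  second = trans (cong (λ p → val (proj₂ p) ℕ.* val Y ℕ.+ val (proj₁ p)) (sym (divide-++ Y (replicate m false) R₁ [] I)))
    (trans (proj₁ (divide-val Y (replicate m false) R₁ I (proj₂ (divide-val Y (reverse X) [] [] Y-pos))))
      (trans (cong₂ ℕ._+_ (cong₂ (λ v l → v ℕ.* 2 ℕ.^ l) first (List.length-replicate m)) zeros) (ℕ.+-identityʳ _)))
  R₂< : val R₂ ℕ.≤ val Y
  R₂< = ℕ.<⇒≤ (proj₂ (divide-val Y (replicate m false) R₁ [] (proj₂ (divide-val Y (reverse X) [] [] Y-pos))))
  mid : (a ℕ.* 2 ℕ.^ m) ℕ.* 2 ℕ.≤ (1 ℕ.+ 2 ℕ.* A) ℕ.* suc y ℕ.+ suc y × (1 ℕ.+ 2 ℕ.* A) ℕ.* suc y ℕ.≤ (a ℕ.* 2 ℕ.^ m) ℕ.* 2 ℕ.+ suc y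
  mid = midpoint A (val R₂) (suc y) (a ℕ.* 2 ℕ.^ m) (subst (λ v → A ℕ.* v ℕ.+ val R₂ ≡ a ℕ.* 2 ℕ.^ m) valY second) (subst (val R₂ ℕ.≤_) valY R₂<)

-- The kept digits are the floor of `a 2 ^ N / 2 ^ b`, so the difference `R` plays the part of the
-- remainder in `midpoint`.
truncation-error : ∀ z b N → ℚ.∣ 𝔻→ℚ (z /2^ b) ℚ.- 𝔻→ℚ (oddNumerator z b N /2^ suc N) ∣ ℚ.≤ 2^- N
truncation-error z b N = subst (λ z′ → ℚ.∣ 𝔻→ℚ (z′ /2^ b) ℚ.- 𝔻→ℚ (oddNumerator z b N /2^ suc N) ∣ ℚ.≤ 2^- N) (signed-abs z)
  (/-distance (signed (negative z) a) (2 ℕ.^ b) (signed (negative z) (1 ℕ.+ 2 ℕ.* A)) (2 ℕ.^ suc N) 1 (2 ℕ.^ N) {{ℕ.m^n≢0 2 b}} {{ℕ.m^n≢0 2 (suc N)}} {{ℕ.m^n≢0 2 N}}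
    (ℕ.≤-trans (ℕ.*-monoˡ-≤ (2 ℕ.^ N) (signed-distance (negative z) a (1 ℕ.+ 2 ℕ.* A) (2 ℕ.^ suc N) p p
      (subst (ℕ._≤ (1 ℕ.+ 2 ℕ.* A) ℕ.* p ℕ.+ p) (double a N) (proj₁ mid)) (subst (λ v → (1 ℕ.+ 2 ℕ.* A) ℕ.* p ℕ.≤ v ℕ.+ p) (double a N) (proj₂ mid)))) (half-step p N)))
  where
  a = ℤ.∣ z ∣
  p = 2 ℕ.^ b
  G = msb b a
  I = low (width (whole z b)) (whole z b)
  A = val (takePad N G ʳ++ I)
  lenG : length G ≡ b
  lenG = trans (List.length-reverse (low b a)) (length-low b a)
  a≡ : a ≡ val I ℕ.* 2 ℕ.^ length G ℕ.+ val (reverse G)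
  a≡ = trans (sym (val-split b a)) (trans (val-++ (low b a) I) (trans (ℕ.+-comm (val (low b a)) _)
    (cong₂ ℕ._+_ (trans (cong (λ l → 2 ℕ.^ l ℕ.* val I) (trans (length-low b a) (sym lenG))) (ℕ.*-comm (2 ℕ.^ length G) (val I))) (cong val (sym (List.reverse-involutive (low b a)))))))
  bounds = takePad-bounds N G I a a≡
  lo : A ℕ.* p ℕ.≤ a ℕ.* 2 ℕ.^ N
  lo = subst (λ l → A ℕ.* 2 ℕ.^ l ℕ.≤ a ℕ.* 2 ℕ.^ N) lenG (proj₁ bounds)
  hi : a ℕ.* 2 ℕ.^ N ℕ.< suc A ℕ.* p
  hi = subst (λ l → a ℕ.* 2 ℕ.^ N ℕ.< suc A ℕ.* 2 ℕ.^ l) lenG (proj₂ bounds)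
  R = a ℕ.* 2 ℕ.^ N ℕ.∸ A ℕ.* p
  mid = midpoint A R p (a ℕ.* 2 ℕ.^ N) (ℕ.m+[n∸m]≡n lo)
    (ℕ.m≤n+o⇒m∸n≤o (a ℕ.* 2 ℕ.^ N) (A ℕ.* p) (ℕ.≤-trans (ℕ.<⇒≤ hi) (ℕ.≤-reflexive (ℕ.+-comm p (A ℕ.* p)))))

scale-signed : ∀ y z → + y ℤ.* z ≡ signed (negative z) (ℤ.∣ z ∣ ℕ.* y)
scale-signed y (+ n)    = trans (sym (ℤ.pos-* y n)) (cong +_ (ℕ.*-comm y n))
scale-signed y -[1+ n ] = trans (sym (ℤ.neg-distribʳ-* (+ y) (+ suc n))) (cong ℤ.-_ (trans (sym (ℤ.pos-* y (suc n))) (cong +_ (ℕ.*-comm y (suc n)))))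

-- Rounding discards a remainder smaller than `2 ^ b`, hence less than 1 after division.
product-error : ∀ z b Y y → val Y ≡ y →
  ℚ.∣ signed (negative z) (product z b Y) ℚ./ 1 ℚ.- (+ y ℚ./ 1) ℚ.* 𝔻→ℚ (z /2^ b) ∣ ℚ.≤ + 1 ℚ./ 1
product-error z b Y y refl = subst (λ q → ℚ.∣ signed s H ℚ./ 1 ℚ.- q ∣ ℚ.≤ + 1 ℚ./ 1)
  (sym (trans (/-scale (+ val Y) z p {{nz}}) (cong (λ i → (i ℚ./ p) {{nz}}) (scale-signed (val Y) z))))
  (/-distance (signed s H) 1 (signed s m) p 1 1 {{_}} {{nz}}
    (subst₂ ℕ._≤_ (sym (ℕ.*-identityʳ _)) (sym (trans (ℕ.*-identityˡ (1 ℕ.* p)) (ℕ.*-identityˡ p)))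
      (signed-distance s H m p 1 p
        (ℕ.≤-trans (ℕ.m/n*n≤m m p {{nz}}) (ℕ.≤-trans (ℕ.≤-reflexive (sym (ℕ.*-identityʳ m))) (ℕ.m≤m+n (m ℕ.* 1) p)))
        (ℕ.≤-trans (ℕ.≤-reflexive (trans (ℕ.*-identityʳ m) (trans (ℕ.m≡m%n+[m/n]*n m p {{nz}}) (ℕ.+-comm _ (H ℕ.* p)))))
          (ℕ.+-monoʳ-≤ (H ℕ.* p) (ℕ.<⇒≤ (ℕ.m%n<n m p {{nz}})))))))
  where
  s = negative z
  p = 2 ℕ.^ b
  nz = ℕ.m^n≢0 2 b
  m = ℤ.∣ z ∣ ℕ.* val Y
  H = product z b Y

𝔻-shift : ∀ z k b → (2^- k) ℚ.* 𝔻→ℚ (z /2^ b) ≡ 𝔻→ℚ (z /2^ (k ℕ.+ b))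
𝔻-shift z k b = trans (/-combine 1ℤ (2 ℕ.^ k) z (2 ℕ.^ b) {{ℕ.m^n≢0 2 k}} {{ℕ.m^n≢0 2 b}} {{nz}})
  (ℚ./-cong {{nz}} {{ℕ.m^n≢0 2 (k ℕ.+ b)}} (ℤ.*-identityˡ z) (sym (ℕ.^-distribˡ-+-* 2 k b)))
  where nz = ℕ.m*n≢0 (2 ℕ.^ k) (2 ℕ.^ b) {{ℕ.m^n≢0 2 k}} {{ℕ.m^n≢0 2 b}}

-- Polynomials

-- Coefficients are natural numbers, so upper bounds may be substituted for the arguments.
⟦⟧-mono : ∀ {m} (p : Polynomial m) (ρ ρ′ : Vec ℕ m) → (∀ i → lookup ρ i ℕ.≤ lookup ρ′ i) → ⟦ p ⟧ ρ ℕ.≤ ⟦ p ⟧ ρ′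
⟦⟧-mono (con c) ρ ρ′ h = ℕ.≤-refl
⟦⟧-mono (var i) ρ ρ′ h = h i
⟦⟧-mono (p ⊕ q) ρ ρ′ h = ℕ.+-mono-≤ (⟦⟧-mono p ρ ρ′ h) (⟦⟧-mono q ρ ρ′ h)
⟦⟧-mono (p ⊗ q) ρ ρ′ h = ℕ.*-mono-≤ (⟦⟧-mono p ρ ρ′ h) (⟦⟧-mono q ρ ρ′ h)

infixl 6 _⊞_
infixl 7 _⊠_

_⊞_ _⊠_ : ∀ {m} → Polynomial m → Polynomial m → Polynomial m
_⊞_ = _⊕_
_⊠_ = _⊗_

substitute : ∀ {m k} → Polynomial m → Vec (Polynomial k) m → Polynomial k
substitute (con c) σ = con c
substitute (var i) σ = lookup σ i
substitute (p ⊕ q) σ = substitute p σ ⊕ substitute q σ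
substitute (p ⊗ q) σ = substitute p σ ⊗ substitute q σ

⟦substitute⟧ : ∀ {m k} (p : Polynomial m) (σ : Vec (Polynomial k) m) ρ → ⟦ substitute p σ ⟧ ρ ≡ ⟦ p ⟧ (Vec.map (λ q → ⟦ q ⟧ ρ) σ)
⟦substitute⟧ (con c) σ ρ = refl
⟦substitute⟧ (var i) σ ρ = sym (Vec.lookup-map i (λ q → ⟦ q ⟧ ρ) σ)
⟦substitute⟧ (p ⊕ q) σ ρ = cong₂ ℕ._+_ (⟦substitute⟧ p σ ρ) (⟦substitute⟧ q σ ρ)
⟦substitute⟧ (p ⊗ q) σ ρ = cong₂ ℕ._*_ (⟦substitute⟧ p σ ρ) (⟦substitute⟧ q σ ρ)

-- Boxes

-∣p∣≤p : ∀ p → ℚ.- ℚ.∣ p ∣ ℚ.≤ p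
-∣p∣≤p p = subst (ℚ.- ℚ.∣ p ∣ ℚ.≤_) (lem p) (ℚ.neg-antimono-≤ (subst (ℚ.- p ℚ.≤_) (ℚ.∣-p∣≡∣p∣ p) (p≤∣p∣ (ℚ.- p))))
  where
  open ℚ-Solver
  lem : ∀ p → ℚ.- (ℚ.- p) ≡ p
  lem = solve 1 (λ p → :- (:- p) := p) refl

∣p∣≤ : ∀ p r → ℚ.- r ℚ.≤ p → p ℚ.≤ r → ℚ.∣ p ∣ ℚ.≤ r
∣p∣≤ p r lo hi with ℚ.∣p∣≡p∨∣p∣≡-p p
... | inj₁ eq = subst (ℚ._≤ r) (sym eq) hi
... | inj₂ eq = subst (ℚ._≤ r) (sym eq) (subst (ℚ.- p ℚ.≤_) (lem r) (ℚ.neg-antimono-≤ lo))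
  where
  open ℚ-Solver
  lem : ∀ p → ℚ.- (ℚ.- p) ≡ p
  lem = solve 1 (λ p → :- (:- p) := p) refl

p≤p+ε : ∀ p ε .{{_ : Positive ε}} → p ℚ.≤ p ℚ.+ ε
p≤p+ε p ε = ℚ.≤-trans (ℚ.≤-reflexive (sym (ℚ.+-identityʳ p))) (ℚ.+-monoʳ-≤ p (ℚ.<⇒≤ (ℚ.positive⁻¹ ε)))

-- Otherwise half of the excess `p - q` would be an `ε` for which the hypothesis fails. This reduces
-- the order of constant reals to that of rationals.
≤-archimedean : ∀ p q → (∀ ε .{{_ : Positive ε}} → p ℚ.≤ q ℚ.+ ε) → p ℚ.≤ q
≤-archimedean p q h with p ℚ.≤? q
... | yes p≤q = p≤q
... | no p≰q = ⊥-elim (ℚ.<-irrefl refl (ℚ.<-≤-trans lt (h δ {{δ-pos}})))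
  where
  d = p ℚ.- q
  d-pos : Positive d
  d-pos = ℚ.positive (subst (ℚ._< d) (ℚ.+-inverseʳ q) (ℚ.+-monoˡ-< (ℚ.- q) (ℚ.≰⇒> p≰q)))
  δ = d ℚ.* ½
  δ-pos : Positive δ
  δ-pos = ½-pos d {{d-pos}}
  split : (q ℚ.+ δ) ℚ.+ δ ≡ p
  split = trans (ℚ.+-assoc q δ δ) (trans (cong (q ℚ.+_) (halves d)) (lem p q))
    where
    open ℚ-Solver
    lem : ∀ p q → q ℚ.+ (p ℚ.- q) ≡ p
    lem = solve 2 (λ p q → q :+ (p :+ (:- q)) := p) refl
  lt : q ℚ.+ δ ℚ.< p
  lt = subst₂ ℚ._<_ (ℚ.+-identityʳ (q ℚ.+ δ)) split (ℚ.+-monoʳ-< (q ℚ.+ δ) (ℚ.positive⁻¹ δ {{δ-pos}}))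

least-below : ∀ {P : ℕ → Set} → (∀ j → Dec (P j)) → ∀ n → (∀ j → j ℕ.< n → ¬ P j) ⊎ ∃[ k ] (k ℕ.< n × IsLeast P k)
least-below P? zero = inj₁ λ _ ()
least-below P? (suc n) with least-below P? n
... | inj₂ (k , k<n , lst) = inj₂ (k , ℕ.m<n⇒m<1+n k<n , lst)
... | inj₁ none with P? n
...   | yes p = inj₂ (n , ℕ.≤-refl , p , λ j pj → ℕ.≮⇒≥ (λ j<n → none j j<n pj))
...   | no ¬p = inj₁ λ j j<1+n pj → none j (ℕ.≤∧≢⇒< (ℕ.s≤s⁻¹ j<1+n) (λ { refl → ¬p pj })) pj

least≤ : ∀ {P : ℕ → Set} → (∀ j → Dec (P j)) → ∀ n → P n → ∃[ k ] (k ℕ.≤ n × IsLeast P k)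
least≤ P? n p with least-below P? (suc n)
... | inj₁ none = ⊥-elim (none n ℕ.≤-refl p)
... | inj₂ (k , k<1+n , lst) = k , ℕ.s≤s⁻¹ k<1+n , lst

-- For constant sequences, membership in a box reduces to comparisons of rationals and is thus
-- decidable, which a search for the least box requires.
module _ {d : ℕ} (x : Vector ℝ d) (v : Fin d → ℚ) (x≡v : ∀ i → x i ≡ fromℚ (v i)) where

  Box : ℕ → Set
  Box j = ∀ i → ℚ.∣ v i ∣ ℚ.≤ 2^ j

  box⇒inBox : ∀ j → Box j → InBox x j
  box⇒inBox j h i rewrite x≡v i =
    (λ ε → 0 , λ _ _ → ℚ.≤-trans (ℚ.≤-trans (ℚ.neg-antimono-≤ (h i)) (-∣p∣≤p (v i))) (p≤p+ε (v i) ε)) ,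
    (λ ε → 0 , λ _ _ → ℚ.≤-trans (ℚ.≤-trans (p≤∣p∣ (v i)) (h i)) (p≤p+ε (2^ j) ε))

  inBox⇒box : ∀ j → InBox x j → Box j
  inBox⇒box j h i with h i
  ... | lo , hi rewrite x≡v i = ∣p∣≤ (v i) (2^ j)
    (≤-archimedean _ _ λ ε → proj₂ (lo ε) (proj₁ (lo ε)) ℕ.≤-refl)
    (≤-archimedean _ _ λ ε → proj₂ (hi ε) (proj₁ (hi ε)) ℕ.≤-refl)

  -- `RunsInTime` bounds the time at the least box only; its index is found below that of any known
  -- box.
  leastBox : ∀ k → Box k → ∃[ k′ ] (k′ ℕ.≤ k × IsLeast (InBox x) k′)
  leastBox k h = least≤ inBox? k (box⇒inBox k h)
    where
    inBox? : ∀ j → Dec (InBox x j)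
    inBox? j with Fin.all? (λ i → ℚ.∣ v i ∣ ℚ.≤? 2^ j)
    ... | yes b = yes (box⇒inBox j b)
    ... | no ¬b = no λ b → ¬b (inBox⇒box j b)

/-abs≤ : ∀ i n r .{{_ : NonZero n}} → ℤ.∣ i ∣ ℕ.≤ r ℕ.* n → ℚ.∣ i ℚ./ n ∣ ℚ.≤ + r ℚ./ 1
/-abs≤ i n r h = subst (λ q → ℚ.∣ q ∣ ℚ.≤ + r ℚ./ 1) (ℚ.+-identityʳ (i ℚ./ n))
  (/-distance i n (+ 0) 1 r 1 (subst₂ ℕ._≤_ (sym (trans (ℕ.*-identityʳ _) (cong ℤ.∣_∣ (trans (ℤ.+-identityʳ (i ℤ.* + 1)) (ℤ.*-identityʳ i))))) (cong (r ℕ.*_) (sym (ℕ.*-identityʳ n))) h))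

-- Two functions on the empty type need not be definitionally equal, but a machine without oracles
-- has no query to put to them.
oracle-irrelevant : ∀ {M : OTM 0} {φ ψ w t v} → Outputs M φ w t v → Outputs M ψ w t v
oracle-irrelevant {M} {φ} {ψ} (c , h , eq) = c , transfer h , eq
  where
  act≡ : ∀ c A → act M φ c A ≡ act M ψ c A
  act≡ c halt          = refl
  act≡ c (step _ _ _)  = refl
  act≡ c (query () _)
  transfer : ∀ {c t c′} → HaltsFrom M φ c t c′ → HaltsFrom M ψ c t c′
  transfer (halted eq)  = halted (trans (sym (act≡ _ _)) eq)
  transfer (steps eq h) = steps (trans (sym (act≡ _ _)) eq) (transfer h)

solid-encodeℤ : ∀ {a} z → Solid (encodeℤ {a} z)
solid-encodeℤ (+ n)    = encodeℕ-solid n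
solid-encodeℤ -[1+ n ] = refl ∷ encodeℕ-solid (suc n)

width≤∣∣₂ : ∀ z → width ℤ.∣ z ∣ ℕ.≤ ∣ z ∣₂
width≤∣∣₂ z = ℕ.≤-trans (ℕ.m≤n+m (width ℤ.∣ z ∣) (length (encodeSign {0} z)))
  (ℕ.≤-reflexive (sym (trans (List.length-++ (encodeSign {0} z)) (cong (length (encodeSign {0} z) ℕ.+_) (length-encodeℕ {0} ℤ.∣ z ∣)))))

length-encodeℤ : ∀ {a} z → length (encodeℤ {a} z) ≡ ∣ z ∣₂
length-encodeℤ {a} z = trans (List.length-++ (encodeSign {a} z)) (trans (cong₂ ℕ._+_ (sign z) (trans (length-encodeℕ {a} ℤ.∣ z ∣) (sym (length-encodeℕ {0} ℤ.∣ z ∣)))) (sym (List.length-++ (encodeSign {0} z))))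
  where
  sign : ∀ z → length (encodeSign {a} z) ≡ length (encodeSign {0} z)
  sign (+ _)    = refl
  sign -[1+ _ ] = refl

2^-pos : ∀ n → Positive (2^- n)
2^-pos n = ℚ.normalize-pos 1 (2 ℕ.^ n) {{ℕ.m^n≢0 2 n}}

-- Polynomial-time computable functions are definable

module ForwardDirection (f : ℝ⟶ℝ) (M : OTM 1) (computes : Computes M (unary f)) (p : Polynomial 2) (inTime : RunsInTime M p) where
  open Forward M using (machine; parseTime; ψ)
  module F = Forward M

  module At (x : ℤ) (y : ℕ) where

    point′ : Vector ℝ 1
    point′ _ = fromℚ (x ℚ./ suc y)

    X Y : List Bool
    X = low (width ℤ.∣ x ∣) ℤ.∣ x ∣
    Y = low (width (suc y)) (suc y)

    φ : Oracles 1
    φ _ = quotient (negative x) X Y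

    φ-CF : ∀ i → CF (point′ i) (φ i)
    φ-CF _ m = estimate (close-const (x ℚ./ suc y) (𝔻→ℚ (quotient (negative x) X Y m)) (quotient-error x y m))

    computed = computes point′ φ φ-CF (width (suc y))

    time : ℕ
    time = proj₁ computed

    z : ℤ
    z = 𝔻.numerator (proj₁ (proj₂ computed))

    b : ℕ
    b = 𝔻.exponent (proj₁ (proj₂ computed))

    rounded : ℤ
    rounded = signed (negative z) (product z b Y)

    -- Division by `suc y` does not increase the absolute value, so the digits of `x` alone
    -- determine a box.
    box : Box point′ (λ _ → x ℚ./ suc y) (λ _ → refl) (width ℤ.∣ x ∣)
    box _ = /-abs≤ x (suc y) (2 ℕ.^ width ℤ.∣ x ∣) (ℕ.≤-trans (ℕ.<⇒≤ (<2^-log₂ ℤ.∣ x ∣)) (ℕ.m≤m*n (2 ℕ.^ width ℤ.∣ x ∣) (suc y)))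

    time≤ : time ℕ.≤ ⟦ p ⟧ (∣ x ∣₂ ∷ ∣ + suc y ∣₂ ∷ [])
    time≤ = go (leastBox point′ (λ _ → x ℚ./ suc y) (λ _ → refl) (width ℤ.∣ x ∣) box)
      where
      lookup≤ : ∀ {k} → k ℕ.≤ width ℤ.∣ x ∣ → ∀ i → lookup (k ∷ width (suc y) ∷ []) i ℕ.≤ lookup (∣ x ∣₂ ∷ ∣ + suc y ∣₂ ∷ []) i
      lookup≤ k≤ 0F = ℕ.≤-trans k≤ (width≤∣∣₂ x)
      lookup≤ k≤ 1F = width≤∣∣₂ (+ suc y)
      go : ∃[ k ] (k ℕ.≤ width ℤ.∣ x ∣ × IsLeast (InBox point′) k) → time ℕ.≤ ⟦ p ⟧ (∣ x ∣₂ ∷ ∣ + suc y ∣₂ ∷ [])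
      go (k , k≤ , least) = ℕ.≤-trans
        (inTime point′ φ φ-CF (width (suc y)) k least time (encode𝔻 (proj₁ (proj₂ computed))) (proj₁ (proj₂ (proj₂ computed))))
        (⟦⟧-mono p (k ∷ width (suc y) ∷ []) (∣ x ∣₂ ∷ ∣ + suc y ∣₂ ∷ []) (lookup≤ k≤))

    output : ∃[ T ] (T ℕ.≤ F.runTime x y time × Outputs machine ψ (encodeℤ x ++ sep ∷ encodeℤ (+ suc y)) T (encodeℤ rounded))
    output = go (proj₁ (proj₂ (proj₂ computed)))
      where
      go : Outputs M φ (encodeUnary (width (suc y))) time (encode𝔻 (z /2^ b)) →
        ∃[ T ] (T ℕ.≤ F.runTime x y time × Outputs machine ψ (encodeℤ x ++ sep ∷ encodeℤ (+ suc y)) T (encodeℤ rounded))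
      go (c , h , eq) = F.outputs x y {z = z} {b} h eq (solid-encodeℤ rounded)

    -- One unit is due to rounding the product, the other to M: its error `2^- width (suc y)` is
    -- multiplied by `suc y`, which is smaller than `2 ^ width (suc y)`.
    close : Close (λ _ → rounded ℚ./ 1) (λ n → (+ suc y ℚ./ 1) ℚ.* seq (apply f (fromℚ (x ℚ./ suc y))) n) (+ 1 ℚ./ 1 ℚ.+ + 1 ℚ./ 1)
    close = close-trans
      (close-const (rounded ℚ./ 1) ((+ suc y ℚ./ 1) ℚ.* 𝔻→ℚ (z /2^ b)) (product-error z b Y (suc y) (val-low (width (suc y)) (suc y) (<2^-log₂ (suc y)))))
      (close-≤ {q = + 1 ℚ./ 1} (close-scale (+ suc y ℚ./ 1) {{ℚ.normalize-pos (suc y) 1}} (near {y = seq (apply f (fromℚ (x ℚ./ suc y)))} (proj₂ (proj₂ (proj₂ computed))))) small)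
      where
      small : (+ suc y ℚ./ 1) ℚ.* (2^- width (suc y)) ℚ.≤ + 1 ℚ./ 1
      small = subst (ℚ._≤ + 1 ℚ./ 1) (sym (/-scale (+ suc y) 1ℤ (2 ℕ.^ width (suc y)) {{ℕ.m^n≢0 2 (width (suc y))}}))
        (/-≤ (+ suc y ℤ.* 1ℤ) (2 ℕ.^ width (suc y)) (+ 1) 1 {{ℕ.m^n≢0 2 (width (suc y))}}
          (subst₂ ℤ._≤_ (sym (trans (ℤ.*-identityʳ (+ suc y ℤ.* 1ℤ)) (ℤ.*-identityʳ (+ suc y)))) (sym (ℤ.*-identityˡ (+ (2 ℕ.^ width (suc y))))) (ℤ.+≤+ (ℕ.<⇒≤ (<2^-log₂ (suc y))))))

  -- Definability concerns `y ≥ 1`; the value 0 elsewhere makes the function total and easy to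
  -- compute.
  g : ℤ → ℤ → ℤ
  g x (+ suc y)  = At.rounded x y
  g x (+ zero)   = + 0
  g x -[1+ _ ]   = + 0

  g-close : ∀ x y → Close (λ _ → g x (+ suc y) ℚ./ 1) (λ n → (+ suc y ℚ./ 1) ℚ.* seq (apply f (fromℚ (x ℚ./ suc y))) n) (+ 1 ℚ./ 1 ℚ.+ + 1 ℚ./ 1)
  g-close x y = At.close x y

  polytime : PolytimeComputableℤ g
  polytime = machine , bound , λ x y → transfer x y (result′ x y)
    where
    respondP : Polynomial 3 → Polynomial 3
    respondP s = s ⊠ (s ⊠ con 24 ⊞ con 12) ⊞ s ⊠ (s ⊠ con 24 ⊞ con 12) ⊞ s ⊠ con 38 ⊞ con 50

    finishP : Polynomial 3 → Polynomial 3 → Polynomial 3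
    finishP y u = u ⊠ ((y ⊞ u ⊠ con 2) ⊠ con 24 ⊞ con 17) ⊞ u ⊠ con 15 ⊞ (y ⊞ u ⊠ con 2) ⊠ con 8 ⊞ con 20

    -- In the widths of x and y and the running time of M.
    timeP : Polynomial 3
    timeP = (con 3 ⊞ (px ⊠ con 5 ⊞ con 1)) ⊞ ((py ⊠ con 7 ⊞ (py ⊠ con 7 ⊞ con 3)) ⊞
      (t ⊠ (con 2 ⊞ (con 8 ⊞ respondP (px ⊞ py ⊞ (con 1 ⊞ u)))) ⊞ finishP py u))
      where
      px = var 0F
      py = var 1F
      t  = var 2F
      u  = py ⊞ t ⊠ (con 5 ⊞ px)

    time : ℕ → ℕ → ℕ → ℕ → ℕ → ℕ
    time lx ly px py t = (3 ℕ.+ (px ℕ.* 5 ℕ.+ 1)) ℕ.+ ((py ℕ.* 7 ℕ.+ (py ℕ.* 7 ℕ.+ 3)) ℕ.+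
      (t ℕ.* (2 ℕ.+ (8 ℕ.+ respondTime (lx ℕ.+ ly ℕ.+ suc (py ℕ.+ t ℕ.* (5 ℕ.+ lx))))) ℕ.+ finishTime ly (py ℕ.+ t ℕ.* (5 ℕ.+ lx))))

    runTime≡ : ∀ x y t → F.runTime x y t ≡ ⟦ timeP ⟧ (width ℤ.∣ x ∣ ∷ width (suc y) ∷ t ∷ [])
    runTime≡ x y t = cong₂ (λ lx ly → time lx ly (width ℤ.∣ x ∣) (width (suc y)) t) (length-low (width ℤ.∣ x ∣) ℤ.∣ x ∣) (length-low (width (suc y)) (suc y))

    bound₁ bound₂ bound : Polynomial 2
    -- The running time of M is eliminated in favour of its bound `p`, taken at the lengths of `x`
    -- and `y`. The sum with `bound₂` then covers positive and nonpositive `y` alike.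
    bound₁ = substitute timeP (var 0F ∷ var 1F ∷ p ∷ [])
    bound₂ = (con 3 ⊞ (var 0F ⊠ con 5 ⊞ con 1)) ⊞ (var 1F ⊠ con 3 ⊞ con 2)
    bound  = bound₁ ⊞ bound₂

    Result′ : ℤ → ℤ → Set
    Result′ x y = ∃[ t ] (Outputs machine ψ (encodeℤ x ++ sep ∷ encodeℤ y) t (encodeℤ (g x y)) × t ℕ.≤ ⟦ bound ⟧ (∣ x ∣₂ ∷ ∣ y ∣₂ ∷ []))

    positive : ∀ x y → ∃[ T ] (T ℕ.≤ F.runTime x y (At.time x y) × Outputs machine ψ (encodeℤ x ++ sep ∷ encodeℤ (+ suc y)) T (encodeℤ (At.rounded x y))) → Result′ x (+ suc y)
    positive x y (T , T≤ , out) = T , out , ℕ.≤-trans T≤ (ℕ.≤-trans (ℕ.≤-reflexive (runTime≡ x y (At.time x y)))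
      (ℕ.≤-trans (⟦⟧-mono timeP (width ℤ.∣ x ∣ ∷ width (suc y) ∷ At.time x y ∷ []) (∣ x ∣₂ ∷ ∣ + suc y ∣₂ ∷ ⟦ p ⟧ (∣ x ∣₂ ∷ ∣ + suc y ∣₂ ∷ []) ∷ []) λ { 0F → width≤∣∣₂ x ; 1F → width≤∣∣₂ (+ suc y) ; 2F → At.time≤ x y })
        (ℕ.≤-trans (ℕ.≤-reflexive (sym (⟦substitute⟧ timeP (var 0F ∷ var 1F ∷ p ∷ []) (∣ x ∣₂ ∷ ∣ + suc y ∣₂ ∷ [])))) (ℕ.m≤m+n _ (⟦ bound₂ ⟧ (∣ x ∣₂ ∷ ∣ + suc y ∣₂ ∷ []))))))

    trivial : ∀ x y → g x y ≡ + 0 →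
      ∃[ T ] (T ℕ.≤ parseTime x ℕ.+ (length (encodeℤ {OTM.auxSymbols M} y) ℕ.* 3 ℕ.+ 2) × Outputs machine ψ (encodeℤ x ++ sep ∷ encodeℤ y) T (encodeℤ (+ 0))) → Result′ x y
    trivial x y g≡0 (T , T≤ , out) = T , subst (λ v → Outputs machine ψ (encodeℤ x ++ sep ∷ encodeℤ y) T (encodeℤ v)) (sym g≡0) out ,
      ℕ.≤-trans T≤ (ℕ.≤-trans (ℕ.+-mono-≤ (ℕ.+-monoʳ-≤ 3 (ℕ.+-monoˡ-≤ 1 (ℕ.*-monoˡ-≤ 5 (width≤∣∣₂ x)))) (ℕ.≤-reflexive (cong (λ l → l ℕ.* 3 ℕ.+ 2) (length-encodeℤ y))))
        (ℕ.m≤n+m _ (⟦ bound₁ ⟧ (∣ x ∣₂ ∷ ∣ y ∣₂ ∷ []))))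

    result′ : ∀ x y → Result′ x y
    result′ x (+ suc y) = positive x y (At.output x y)
    result′ x (+ zero)  = trivial x (+ zero) refl (F.outputs-nil x (+ zero) refl (solid-encodeℤ (+ zero)))
    result′ x -[1+ y ]  = trivial x -[1+ y ] refl (F.outputs-nil x -[1+ y ] refl (solid-encodeℤ -[1+ y ]))

    transfer : ∀ {φ : ℕ → Oracles 0} x y → Result′ x y → ∃[ t ] (Outputs machine (φ t) (encodeℤ x ++ sep ∷ encodeℤ y) t (encodeℤ (g x y)) × t ℕ.≤ ⟦ bound ⟧ (∣ x ∣₂ ∷ ∣ y ∣₂ ∷ []))
    transfer x y (t , out , t≤) = t , oracle-irrelevant {M = machine} out , t≤

polytime⇒definable : ∀ {ℓ} (C : ℝ^ 2 ⟶ℝ → Set ℓ) → Approximates C PolytimeComputableℤ → ∀ f → PolytimeComputable (unary f) → Definable C f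
polytime⇒definable C approx f (M , computes , p , inTime) = proj₁ g̃ , proj₁ (proj₂ g̃) , close
  where
  open ForwardDirection f M computes p inTime
  g̃ = approx g polytime
  close : ∀ (x : ℤ) (y : ℕ) .{{_ : NonZero y}} → ∣ apply₂ (proj₁ g̃) (fromℤ x) (fromℤ (+ y)) - fromℤ (+ y) * apply f (fromℚ (x ℚ./ y)) ∣ ≤ fromℤ (+ 3)
  -- 1/4 from the approximation of `g` by `g̃` and 2 from `g` itself, which is below 3.
  close x (suc y) = estimate (close-≤ (close-trans (near {x = seq (apply₂ (proj₁ g̃) (fromℤ x) (fromℤ (+ suc y)))} (proj₂ (proj₂ g̃) x (+ suc y))) (g-close x y)) (from-yes (1ℤ ℚ./ 4 ℚ.+ (+ 1 ℚ./ 1 ℚ.+ + 1 ℚ./ 1) ℚ.≤? + 3 ℚ./ 1)))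

-- Definable Lipschitz functions are polynomial-time computable

/-+₁ : ∀ i j → (i ℚ./ 1) ℚ.+ (j ℚ./ 1) ≡ (i ℤ.+ j) ℚ./ 1
/-+₁ i j = ℚ.toℚᵘ-injective (ℚᵘ.≃-trans (ℚ.toℚᵘ-homo-+ (i ℚ./ 1) (j ℚ./ 1))
  (ℚᵘ.≃-trans (ℚᵘ.+-cong (toℚᵘ-/ i 0) (toℚᵘ-/ j 0)) (ℚᵘ.≃-trans (*≡* (cong (ℤ._* + 1) (cong₂ ℤ._+_ (ℤ.*-identityʳ i) (ℤ.*-identityʳ j)))) (ℚᵘ.≃-sym (toℚᵘ-/ (i ℤ.+ j) 0)))))

/-abs : ∀ i n .{{_ : NonZero n}} → ℚ.∣ i ℚ./ n ∣ ≡ (+ ℤ.∣ i ∣) ℚ./ n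
/-abs i (suc n) = ℚ.toℚᵘ-injective (ℚᵘ.≃-trans (ℚ.toℚᵘ-homo-∣-∣ (i ℚ./ suc n)) (ℚᵘ.≃-trans (ℚᵘ.∣-∣-cong (toℚᵘ-/ i n)) (ℚᵘ.≃-sym (toℚᵘ-/ (+ ℤ.∣ i ∣) n))))

2^-≤1 : ∀ n → (2^- n) ℚ.≤ 1ℚ
2^-≤1 n = /-≤ 1ℤ (2 ℕ.^ n) (+ 1) 1 {{ℕ.m^n≢0 2 n}} (subst (1ℤ ℤ.≤_) (sym (ℤ.*-identityˡ (+ (2 ℕ.^ n)))) (ℤ.+≤+ (ℕ.m^n>0 2 n)))

2^-double : ∀ n → (2^- suc n) ℚ.+ (2^- suc n) ≡ 2^- n
2^-double n = trans (cong₂ ℚ._+_ half half) (halves (2^- n))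
  where
  half : 2^- suc n ≡ (2^- n) ℚ.* ½
  half = trans (sym (𝔻-shift 1ℤ 1 n)) (ℚ.*-comm (2^- 1) (2^- n))

n<2^n : ∀ n → n ℕ.< 2 ℕ.^ n
n<2^n zero    = s≤s z≤n
n<2^n (suc n) = ℕ.≤-trans (ℕ.+-mono-≤ (ℕ.m^n>0 2 n) (n<2^n n)) (ℕ.≤-reflexive (cong (2 ℕ.^ n ℕ.+_) (sym (ℕ.+-identityʳ (2 ℕ.^ n)))))

ceiling : ∀ q → ∃[ m ] (q ℚ.≤ + m ℚ./ 1)
ceiling q = ℤ.∣ ℚ.↥ q ∣ , ℚ.≤-trans (p≤∣p∣ q) (subst (λ p → ℚ.∣ p ∣ ℚ.≤ + ℤ.∣ ℚ.↥ q ∣ ℚ./ 1) (ℚ.↥p/↧p≡p q)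
  (/-abs≤ (ℚ.↥ q) (ℚ.↧ₙ q) ℤ.∣ ℚ.↥ q ∣ (ℕ.m≤m*n ℤ.∣ ℚ.↥ q ∣ (ℚ.↧ₙ q))))

-- The answer differs from `x` by at most 1, and the two inequalities between reals contribute a
-- slack of 1/2 each, so its size is at most `2 ^ k + 2`. Its integer part is then below
-- `2 ^ (k + 2)`, a bound that does not involve the number of fractional digits.
whole-bound : ∀ (x : ℝ) k z b N → InBox {1} (λ _ → x) k → ∣ x - 𝔻→ℝ (z /2^ b) ∣ ≤ fromℚ (2^- N) → width (whole z b) ℕ.≤ k ℕ.+ 3
whole-bound x k z b N box close = ℕ.≤-trans (subst (λ m → width m ℕ.≤ suc (length (low (k ℕ.+ 2) (whole z b)))) (val-low (k ℕ.+ 2) (whole z b) small) (width-val (low (k ℕ.+ 2) (whole z b))))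
    (ℕ.≤-reflexive (trans (cong suc (length-low (k ℕ.+ 2) (whole z b))) (sym (ℕ.+-suc k 2))))
  where
  c = close ½
  lo = proj₁ (box zero) ½
  hi = proj₂ (box zero) ½
  n = proj₁ c ℕ.⊔ (proj₁ lo ℕ.⊔ proj₁ hi)
  d = 𝔻→ℚ (z /2^ b)
  xₙ = seq x n
  c≤ : ℚ.∣ xₙ ℚ.- d ∣ ℚ.≤ (2^- N) ℚ.+ ½
  c≤ = proj₂ c n (ℕ.m≤m⊔n (proj₁ c) _)
  x≤ : ℚ.∣ xₙ ∣ ℚ.≤ (2^ k) ℚ.+ ½
  x≤ = ∣p∣≤ xₙ ((2^ k) ℚ.+ ½)
    (ℚ.≤-trans (ℚ.≤-reflexive (ℚ.neg-distrib-+ (2^ k) ½)) (ℚ.≤-trans (ℚ.+-monoˡ-≤ (ℚ.- ½) (proj₂ lo n (ℕ.≤-trans (ℕ.m≤m⊔n (proj₁ lo) (proj₁ hi)) (ℕ.m≤n⊔m (proj₁ c) _)))) (ℚ.≤-reflexive (cancel xₙ ½))))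
    (proj₂ hi n (ℕ.≤-trans (ℕ.m≤n⊔m (proj₁ lo) (proj₁ hi)) (ℕ.m≤n⊔m (proj₁ c) _)))
    where
    open ℚ-Solver
    cancel : ∀ a h → (a ℚ.+ h) ℚ.+ (ℚ.- h) ≡ a
    cancel = solve 2 (λ a h → (a :+ h) :+ (:- h) := a) refl
  d≤ : ℚ.∣ d ∣ ℚ.≤ (+ (2 ℕ.^ k ℕ.+ 2)) ℚ./ 1
  d≤ = ℚ.≤-trans (∣p∣-≤ d xₙ) (ℚ.≤-trans (ℚ.+-mono-≤ (subst (ℚ._≤ (2^- N) ℚ.+ ½) (∣p-q∣≡∣q-p∣ xₙ d) c≤) x≤)
    (ℚ.≤-trans (ℚ.+-monoˡ-≤ ((2^ k) ℚ.+ ½) (ℚ.+-monoˡ-≤ ½ (2^-≤1 N))) (ℚ.≤-reflexive (trans (shuffle (2^ k) 1ℚ ½) (/-+₁ (+ (2 ℕ.^ k)) (+ 2))))))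
    where
    open ℚ-Solver
    shuffle : ∀ p o h → (o ℚ.+ h) ℚ.+ (p ℚ.+ h) ≡ p ℚ.+ (o ℚ.+ (h ℚ.+ h))
    shuffle = solve 3 (λ p o h → (o :+ h) :+ (p :+ h) := p :+ (o :+ (h :+ h))) refl
  z≤ : ℤ.∣ z ∣ ℕ.≤ (2 ℕ.^ k ℕ.+ 2) ℕ.* 2 ℕ.^ b
  z≤ = ℤ.drop‿+≤+ (subst₂ ℤ._≤_ (ℤ.*-identityʳ (+ ℤ.∣ z ∣)) (sym (ℤ.pos-* (2 ℕ.^ k ℕ.+ 2) (2 ℕ.^ b)))
    (/-≤⁻¹ (+ ℤ.∣ z ∣) (2 ℕ.^ b) (+ (2 ℕ.^ k ℕ.+ 2)) 1 {{ℕ.m^n≢0 2 b}} (subst (ℚ._≤ (+ (2 ℕ.^ k ℕ.+ 2)) ℚ./ 1) (/-abs z (2 ℕ.^ b) {{ℕ.m^n≢0 2 b}}) d≤)))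
  small : whole z b ℕ.< 2 ℕ.^ (k ℕ.+ 2)
  small = ℕ.≤-trans (s≤s (ℕ.≤-trans (ℕ./-monoˡ-≤ (2 ℕ.^ b) {{ℕ.m^n≢0 2 b}} z≤) (ℕ.≤-reflexive (ℕ.m*n/n≡m (2 ℕ.^ k ℕ.+ 2) (2 ℕ.^ b) {{ℕ.m^n≢0 2 b}}))))
    (ℕ.≤-trans (ℕ.≤-reflexive (sym (ℕ.+-suc (2 ℕ.^ k) 2))) (ℕ.≤-trans (ℕ.+-monoʳ-≤ (2 ℕ.^ k) (ℕ.*-monoˡ-≤ 3 (ℕ.m^n>0 2 k)))
      (ℕ.≤-reflexive (trans (solve 1 (λ p → p :+ p :* con 3 := p :* con 4) refl (2 ℕ.^ k)) (sym (ℕ.^-distribˡ-+-* 2 k 2))))))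
    where open +-*-Solver

module BackwardDirection (f : ℝ⟶ℝ) (L : Lipschitz f) (g̃ : ℝ^ 2 ⟶ℝ)
  (defines : ∀ (x : ℤ) (y : ℕ) .{{_ : NonZero y}} → ∣ apply₂ g̃ (fromℤ x) (fromℤ (+ y)) - fromℤ (+ y) * apply f (fromℚ (x ℚ./ y)) ∣ ≤ fromℤ (+ 3))
  (M : OTM 2) (computes : Computes M g̃) (p : Polynomial 2) (inTime : RunsInTime M p) where

  K : ℚ
  K = EventualBound.bound (eventualBound (proj₁ L))

  -- The total error is `2 (1 + K) 2^-N`. With `N = suc c′ + n` this is `(1 + K) 2^-(c′ + n)`, which
  -- is at most `2^-n` because `1 + K ≤ c′ < 2 ^ c′`.
  c′ c : ℕ
  c′ = proj₁ (ceiling (1ℚ ℚ.+ K))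
  c  = suc c′

  module B = Backward M c

  module At (x : Vector ℝ 1) (φ : Oracles 1) (φ-CF : ∀ i → CF (x i) (φ i)) (n : ℕ) where

    N : ℕ
    N = c ℕ.+ n

    z : ℤ
    z = 𝔻.numerator (φ 0F N)

    b : ℕ
    b = 𝔻.exponent (φ 0F N)

    numerators : Fin 2 → ℤ
    numerators = B.numerators n φ z b refl

    ψ : Oracles 2
    ψ = B.ψ n φ z b refl

    X : ℤ
    X = oddNumerator z b N

    point′ : Vector ℝ 2
    point′ = fromℤ X Vector.∷ fromℤ (+ (2 ℕ.^ suc N)) Vector.∷ Vector.[]

    point≡ : ∀ i → point′ i ≡ fromℚ (numerators i ℚ./ 1)
    point≡ 0F = refl
    point≡ 1F = refl

    ψ-CF : ∀ i → CF (point′ i) (ψ i)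
    ψ-CF i m = subst (λ r → ∣ r - 𝔻→ℝ (numerators i /2^ 0) ∣ ≤ fromℚ (2^- m)) (sym (point≡ i))
      (estimate (close-const (numerators i ℚ./ 1) (numerators i ℚ./ 1) (∣p-p∣≤ε (numerators i ℚ./ 1) (2^- m) {{2^-pos m}})))

    -- Precision 0 allows an error of `2^- 0`, that is 1; the unary input is the empty word.
    computed = computes point′ ψ ψ-CF 0

    time : ℕ
    time = proj₁ computed

    z′ : ℤ
    z′ = 𝔻.numerator (proj₁ (proj₂ computed))

    b′ : ℕ
    b′ = 𝔻.exponent (proj₁ (proj₂ computed))

    output : ∃[ T ] (T ℕ.≤ B.runTime n φ z b refl time × Outputs B.machine φ (encodeUnary n) T (encode𝔻 (z′ /2^ (suc N ℕ.+ b′))))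
    output = go (proj₁ (proj₂ (proj₂ computed)))
      where
      go : Outputs M ψ [] time (encode𝔻 (z′ /2^ b′)) →
        ∃[ T ] (T ℕ.≤ B.runTime n φ z b refl time × Outputs B.machine φ (encodeUnary n) T (encode𝔻 (z′ /2^ (suc N ℕ.+ b′))))
      go (cM , h , eq) = B.outputs n φ z b refl {z′ = z′} {b′} h eq

    approximation : ℚ
    approximation = 𝔻→ℚ (X /2^ suc N)

    F : ℕ → ℚ
    F = seq (apply f (fromℚ approximation))

    s y : ℚ
    s = 2^- suc N
    y = + (2 ℕ.^ suc N) ℚ./ 1

    sy≡1 : s ℚ.* y ≡ 1ℚ
    sy≡1 = trans (ℚ.*-comm s y) (trans (/-scale (+ (2 ℕ.^ suc N)) 1ℤ (2 ℕ.^ suc N) {{ℕ.m^n≢0 2 (suc N)}})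
      (trans (cong (λ i → (i ℚ./ 2 ℕ.^ suc N) {{ℕ.m^n≢0 2 (suc N)}}) (ℤ.*-identityʳ (+ (2 ℕ.^ suc N)))) (self (2 ℕ.^ suc N) {{ℕ.m^n≢0 2 (suc N)}})))
      where
      self : ∀ m .{{_ : NonZero m}} → + m ℚ./ m ≡ 1ℚ
      self m = ℚ.≤-antisym (/-≤ (+ m) m (+ 1) 1 (ℤ.≤-reflexive (ℤ.*-comm (+ m) (+ 1)))) (/-≤ (+ 1) 1 (+ m) m (ℤ.≤-reflexive (ℤ.*-comm (+ 1) (+ m))))

    close₁ : Close (λ _ → 𝔻→ℚ (z′ /2^ b′)) (λ n → y ℚ.* F n) ((2^- 0) ℚ.+ + 3 ℚ./ 1)
    close₁ = close-trans (near {y = seq (apply₂ g̃ (fromℤ X) (fromℤ (+ (2 ℕ.^ suc N))))} {q = 2^- 0} (proj₂ (proj₂ (proj₂ computed)))) (near {q = + 3 ℚ./ 1} (defines X (2 ℕ.^ suc N) {{ℕ.m^n≢0 2 (suc N)}}))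

    close₂ : Close (λ _ → 𝔻→ℚ (z′ /2^ (suc N ℕ.+ b′))) F ((2^- N) ℚ.+ (2^- N))
    close₂ = close-≤ (close-cong (λ _ → 𝔻-shift z′ (suc N) b′) (λ n → trans (sym (ℚ.*-assoc s y (F n))) (trans (cong (ℚ._* F n) sy≡1) (ℚ.*-identityˡ (F n))))
        (close-scale s {{2^-pos (suc N)}} close₁))
      -- The bound `1 + 3` is four units, each scaled to `s`, the inverse of `y`; two halvings
      -- combine them into `2 · 2^-N`.
      (ℚ.≤-reflexive (trans (four s 1ℚ) (trans (cong (λ q → (q ℚ.+ q) ℚ.+ (q ℚ.+ q)) (ℚ.*-identityʳ s)) (cong₂ ℚ._+_ (2^-double N) (2^-double N)))))
      where
      open ℚ-Solver
      four : ∀ s o → s ℚ.* ((o ℚ.+ o) ℚ.+ (o ℚ.+ o)) ≡ ((s ℚ.* o) ℚ.+ (s ℚ.* o)) ℚ.+ ((s ℚ.* o) ℚ.+ (s ℚ.* o))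
      four = solve 2 (λ s o → s :* ((o :+ o) :+ (o :+ o)) := ((s :* o) :+ (s :* o)) :+ ((s :* o) :+ (s :* o))) refl

    -- One `2^- N` is the precision of the oracle answer, the other the error of truncation.
    close₃ : Close (λ _ → approximation) (seq (x 0F)) ((2^- N) ℚ.+ (2^- N))
    close₃ = close-sym (close-trans (near {x = seq (x 0F)} {y = λ _ → 𝔻→ℚ (z /2^ b)} {q = 2^- N} (φ-CF 0F N)) (close-const (𝔻→ℚ (z /2^ b)) approximation (truncation-error z b N)))

    close : Close (λ _ → 𝔻→ℚ (z′ /2^ (suc N ℕ.+ b′))) (seq (apply f (x 0F))) (2^- n)
    close = close-≤ (close-trans close₂ (lipschitz-close f L {fromℚ approximation} {x 0F} close₃)) small
      where
      E : ℚ
      E = 2^- (c′ ℕ.+ n)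
      open ℚ-Solver
      factor : ∀ e k → e ℚ.+ k ℚ.* e ≡ (1ℚ ℚ.+ k) ℚ.* e
      factor e k = trans (cong (ℚ._+ k ℚ.* e) (sym (ℚ.*-identityˡ e))) (sym (ℚ.*-distribʳ-+ e 1ℚ k))
      small : ((2^- N) ℚ.+ (2^- N)) ℚ.+ K ℚ.* ((2^- N) ℚ.+ (2^- N)) ℚ.≤ 2^- n
      small = subst (λ e → e ℚ.+ K ℚ.* e ℚ.≤ 2^- n) (sym (2^-double (c′ ℕ.+ n)))
        (ℚ.≤-trans (ℚ.≤-reflexive (factor E K)) (ℚ.≤-trans (ℚ.*-monoʳ-≤-nonNeg E {{ℚ.pos⇒nonNeg E {{2^-pos (c′ ℕ.+ n)}}}} (proj₂ (ceiling (1ℚ ℚ.+ K))))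
          (ℚ.≤-trans (ℚ.≤-reflexive (/-scale (+ c′) 1ℤ (2 ℕ.^ (c′ ℕ.+ n)) {{ℕ.m^n≢0 2 (c′ ℕ.+ n)}}))
            (/-≤ (+ c′ ℤ.* 1ℤ) (2 ℕ.^ (c′ ℕ.+ n)) 1ℤ (2 ℕ.^ n) {{ℕ.m^n≢0 2 (c′ ℕ.+ n)}} {{ℕ.m^n≢0 2 n}}
              (subst₂ ℤ._≤_ (trans (ℤ.pos-* c′ (2 ℕ.^ n)) (cong (ℤ._* + (2 ℕ.^ n)) (sym (ℤ.*-identityʳ (+ c′))))) (sym (ℤ.*-identityˡ (+ (2 ℕ.^ (c′ ℕ.+ n)))))
                (ℤ.+≤+ (ℕ.≤-trans (ℕ.*-monoˡ-≤ (2 ℕ.^ n) (ℕ.<⇒≤ (n<2^n c′))) (ℕ.≤-reflexive (sym (ℕ.^-distribˡ-+-* 2 c′ n))))))))))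

    -- The index of the box is logarithmic in the size of the two integers, so M runs in time
    -- polynomial in `N` and the width of the integer part.
    box : Box point′ (λ i → numerators i ℚ./ 1) point≡ (suc (N ℕ.+ width (whole z b)))
    box 0F = /-abs≤ X 1 (2 ℕ.^ suc (N ℕ.+ width (whole z b))) (ℕ.≤-trans (ℕ.≤-reflexive (∣signed∣ (negative z) (val (truncation z b N))))
      (ℕ.≤-trans (ℕ.<⇒≤ (val<2^ (truncation z b N))) (ℕ.≤-reflexive (trans (cong (2 ℕ.^_) (length-truncation z b N)) (sym (ℕ.*-identityʳ _))))))
    box 1F = /-abs≤ (+ (2 ℕ.^ suc N)) 1 (2 ℕ.^ suc (N ℕ.+ width (whole z b))) (ℕ.≤-trans (ℕ.^-monoʳ-≤ 2 (s≤s (ℕ.m≤m+n N (width (whole z b))))) (ℕ.≤-reflexive (sym (ℕ.*-identityʳ _))))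

    time≤ : time ℕ.≤ ⟦ p ⟧ (suc (N ℕ.+ width (whole z b)) ∷ 0 ∷ [])
    time≤ = go (leastBox point′ (λ i → numerators i ℚ./ 1) point≡ (suc (N ℕ.+ width (whole z b))) box)
      where
      lookup≤ : ∀ {k k′} → k ℕ.≤ k′ → ∀ i → lookup (k ∷ 0 ∷ []) i ℕ.≤ lookup (k′ ∷ 0 ∷ []) i
      lookup≤ k≤ 0F = k≤
      lookup≤ k≤ 1F = z≤n
      go : ∃[ k ] (k ℕ.≤ suc (N ℕ.+ width (whole z b)) × IsLeast (InBox point′) k) → time ℕ.≤ ⟦ p ⟧ (suc (N ℕ.+ width (whole z b)) ∷ 0 ∷ [])
      go (k , k≤ , least) = ℕ.≤-trans
        (inTime point′ ψ ψ-CF 0 k least time (encode𝔻 (proj₁ (proj₂ computed))) (proj₁ (proj₂ (proj₂ computed))))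
        (⟦⟧-mono p (k ∷ 0 ∷ []) (suc (N ℕ.+ width (whole z b)) ∷ 0 ∷ []) (lookup≤ k≤))

  -- In n, the width of the integer part of the oracle answer, and the running time of M.
  timeP : Polynomial 3
  timeP = prepareP ⊞ (t ⊠ (con 2 ⊞ BP (t ⊠ D)) ⊞ (con 19 ⊞ (t ⊠ D) ⊠ con 11 ⊞ (con 1 ⊞ N) ⊠ con 6))
    where
    n = var 0F
    ℓ = var 1F
    t = var 2F
    N = con c ⊞ n
    Q = con 3 ⊞ (N ⊞ ℓ)
    D = con 3 ⊞ (Q ⊞ Q)
    U = con 1 ⊞ (N ⊞ ℓ)
    BP : Polynomial 3 → Polynomial 3
    BP s = con 8 ⊞ ((Q ⊠ con 19 ⊞ s ⊠ con 4 ⊞ con 8) ⊞ (Q ⊠ con 19 ⊞ s ⊠ con 4 ⊞ con 8))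
    prepareP : Polynomial 3
    prepareP = n ⊠ con 7 ⊞ (con c ⊠ con 4 ⊞ (con 1 ⊞ (con 3 ⊞ (ℓ ⊠ con 5 ⊞ (con 1 ⊞ (con 2 ⊞ (N ⊠ con 10 ⊞ (con 2 ⊞ (con 2 ⊞ (con 2 ⊞ (con 2 ⊞
      (U ⊠ con 5 ⊞ (U ⊠ con 3 ⊞ (U ⊠ con 5 ⊞ con 2))))))))))))))

  bound : Polynomial 2
  -- With `var 0F` for `k` and `var 1F` for `n`: the width of the integer part is at most `k + 3`,
  -- and M runs at precision 0 in a box of index at most `1 + (c + n) + (k + 3)`.
  bound = substitute timeP (var 1F ∷ var 0F ⊞ con 3 ∷ substitute p ((con 1 ⊞ ((con c ⊞ var 1F) ⊞ (var 0F ⊞ con 3))) ∷ con 0 ∷ []) ∷ [])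

  bound-ok : ∀ x φ φ-CF n k → InBox x k → B.runTime n φ (At.z x φ φ-CF n) (At.b x φ φ-CF n) refl (At.time x φ φ-CF n) ℕ.≤ ⟦ bound ⟧ (k ∷ n ∷ [])
  bound-ok x φ φ-CF n k inBox = ℕ.≤-trans (⟦⟧-mono timeP (n ∷ ℓ ∷ time ∷ []) (n ∷ k ℕ.+ 3 ∷ t′ ∷ []) args)
    (ℕ.≤-reflexive (sym (⟦substitute⟧ timeP (var 1F ∷ var 0F ⊞ con 3 ∷ substitute p ((con 1 ⊞ ((con c ⊞ var 1F) ⊞ (var 0F ⊞ con 3))) ∷ con 0 ∷ []) ∷ []) (k ∷ n ∷ []))))
    where
    open At x φ φ-CF n
    ℓ = width (whole z b)
    t′ = ⟦ substitute p ((con 1 ⊞ ((con c ⊞ var 1F) ⊞ (var 0F ⊞ con 3))) ∷ con 0 ∷ []) ⟧ (k ∷ n ∷ [])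
    ℓ≤ : ℓ ℕ.≤ k ℕ.+ 3
    ℓ≤ = whole-bound (x 0F) k z b N (λ _ → inBox 0F) (φ-CF 0F N)
    box≤ : ∀ i → lookup (suc (N ℕ.+ ℓ) ∷ 0 ∷ []) i ℕ.≤ lookup (suc (N ℕ.+ (k ℕ.+ 3)) ∷ 0 ∷ []) i
    box≤ 0F = s≤s (ℕ.+-monoʳ-≤ N ℓ≤)
    box≤ 1F = z≤n
    t≤ : time ℕ.≤ t′
    t≤ = ℕ.≤-trans time≤ (ℕ.≤-trans (⟦⟧-mono p (suc (N ℕ.+ ℓ) ∷ 0 ∷ []) (suc (N ℕ.+ (k ℕ.+ 3)) ∷ 0 ∷ []) box≤)
      (ℕ.≤-reflexive (sym (⟦substitute⟧ p ((con 1 ⊞ ((con c ⊞ var 1F) ⊞ (var 0F ⊞ con 3))) ∷ con 0 ∷ []) (k ∷ n ∷ [])))))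
    args : ∀ i → lookup (n ∷ ℓ ∷ time ∷ []) i ℕ.≤ lookup (n ∷ k ℕ.+ 3 ∷ t′ ∷ []) i
    args 0F = ℕ.≤-refl
    args 1F = ℓ≤
    args 2F = t≤

  polytime : PolytimeComputable (unary f)
  polytime = B.machine , correct , bound , timely
    where
    correct : Computes B.machine (unary f)
    correct x φ φ-CF n = go (At.output x φ φ-CF n)
      where
      open At x φ φ-CF n
      go : ∃[ T ] (T ℕ.≤ B.runTime n φ z b refl time × Outputs B.machine φ (encodeUnary n) T (encode𝔻 (z′ /2^ (suc N ℕ.+ b′)))) →
        ∃[ t ] ∃[ r ] (Outputs B.machine φ (encodeUnary n) t (encode𝔻 r) × ∣ 𝔻→ℝ r - apply f (x 0F) ∣ ≤ fromℚ (2^- n))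
      go (T , _ , out) = T , (z′ /2^ (suc N ℕ.+ b′)) , out , estimate close
    timely : RunsInTime B.machine bound
    timely x φ φ-CF n k (inBox , _) t v (_ , h , _) = go (At.output x φ φ-CF n)
      where
      open At x φ φ-CF n using (z; b; z′; b′; N; time)
      go : ∃[ T ] (T ℕ.≤ B.runTime n φ z b refl time × Outputs B.machine φ (encodeUnary n) T (encode𝔻 (z′ /2^ (suc N ℕ.+ b′)))) → t ℕ.≤ ⟦ bound ⟧ (k ∷ n ∷ [])
      go (T , T≤ , (_ , h′ , _)) = ℕ.≤-trans (ℕ.≤-reflexive (HaltsFrom-deterministic h h′)) (ℕ.≤-trans T≤ (bound-ok x φ φ-CF n k inBox))

definable⇒polytime : ∀ {ℓ} (C : ℝ^ 2 ⟶ℝ → Set ℓ) → (∀ g → C g → PolytimeComputable g) → ∀ f → Lipschitz f → Definable C f → PolytimeComputable (unary f)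
definable⇒polytime C C-polytime f L (g̃ , Cg̃ , defines) = go (C-polytime g̃ Cg̃)
  where
  go : PolytimeComputable g̃ → PolytimeComputable (unary f)
  go (M , computes , p , inTime) = BackwardDirection.polytime f L g̃ defines M computes p inTime

theorem12 : {ℓ : Level} (C : ℝ^ 2 ⟶ℝ → Set ℓ) →
    (∀ g → C g → PolytimeComputable g) →
    Approximates C PolytimeComputableℤ →
    (f : ℝ⟶ℝ) → Lipschitz f →
    PolytimeComputable (unary f) ⇔ Definable C f
theorem12 C C-polytime approx f L = mk⇔ (polytime⇒definable C approx f) (definable⇒polytime C C-polytime f L)
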